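{- Let $d\geq 1$, $n\geq d+1$ and $k$ be integers with $0\leq k<\left\lfloor\frac{n}{d+1}\right\rfloor$. Then every set $S$ of $n$ points in general position in $\mathbb{R}^d$ satisfies $$E_k(S)\geq (d+1)\binom{k+d}{d}.$$ Furthermore, this bound is tight in the given range of $k$: there exists a set $S$ of $n$ points in general position in $\mathbb{R}^d$ with $E_k(S)=(d+1)\binom{k+d}{d}$.
   Context: A finite set $S\subset\mathbb{R}^d$ is in general position if every subset of at most $d+1$ of its points is affinely independent. A $j$-facet of $S$ is an oriented $(d-1)$-simplex with vertices in $S$, i.e. a $d$-element subset $\sigma\subset S$ together with a choice of one of the two open half-spaces bounded by the hyperplane spanned by $\sigma$ (called its positive side), such that the positive side contains exactly $j$ points of $S$. The number of $j$-facets of $S$ is denoted $e_j(S)$, and $E_k(S)=\sum_{j=0}^{k}e_j(S)$ is the number of $(\leq k)$-facets of $S$. -}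

module Defs where

open import Data.Fin using (Fin)
open import Data.Fin.Subset using (Subset; _∈_; ∣_∣)
open import Data.List using (applyUpTo)
open import Data.Nat as ℕ using (ℕ; suc; _⊔_)
import Data.Nat.ListAction as ListAction
import Data.Nat.Properties as ℕ
open import Data.Product using (Σ; ∃; _×_; _,_)
open import Data.Rational as ℚ using (ℚ; 0ℚ; 1ℚ; ½)
import Data.Rational.Properties as ℚ
import Data.Rational.Solver as ℚ-Solver
open import Data.Sum using (_⊎_)
open import Data.Vec.Functional using (Vector; foldr)
open import Function using (_∘_; Injective)
open import Function.Bundles using (_⇔_; Bijection; mk⇔; module Equivalence)
open import Level using (0ℓ)
open import Relation.Binary.Bundles using (Setoid)
open import Relation.Binary.PropositionalEquality
  using (_≡_; _≢_; refl; sym; trans; cong; subst; setoid)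

open ℚ-Solver.+-*-Solver using (solve; _:=_; _:+_; _:*_; _:-_)

-- The real numbers are Cauchy sequences of rationals. They are used up to the
-- equivalence relation _≈_, and inequality is the apartness relation _#_,
-- which is classically the negation of _≈_.

IsCauchy : (ℕ → ℚ) → Set
IsCauchy x = ∀ ε → 0ℚ ℚ.< ε → ∃ λ N → ∀ m n → N ℕ.≤ m → N ℕ.≤ n →
  ℚ.∣ x m ℚ.- x n ∣ ℚ.< ε

record ℝ : Set where
  constructor mkℝ
  field
    seq      : ℕ → ℚ
    isCauchy : IsCauchy seq

open ℝ public

infix 4 _≈_ _<_ _#_

_≈_ : ℝ → ℝ → Set
x ≈ y = ∀ ε → 0ℚ ℚ.< ε → ∃ λ N → ∀ m → N ℕ.≤ m →
  ℚ.∣ seq x m ℚ.- seq y m ∣ ℚ.< ε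

_<_ : ℝ → ℝ → Set
x < y = ∃ λ ε → 0ℚ ℚ.< ε × ∃ λ N → ∀ m → N ℕ.≤ m → seq x m ℚ.+ ε ℚ.< seq y m

_#_ : ℝ → ℝ → Set
x # y = x < y ⊎ y < x

private
  cancel : ∀ p q → p ≡ (p ℚ.- q) ℚ.+ q
  cancel = solve 2 (λ p q → p := (p :- q) :+ q) refl

  +-difference : ∀ p q r s → (p ℚ.+ q) ℚ.- (r ℚ.+ s) ≡ (p ℚ.- r) ℚ.+ (q ℚ.- s)
  +-difference = solve 4 (λ p q r s → (p :+ q) :- (r :+ s) := (p :- r) :+ (q :- s)) refl

  *-difference : ∀ p q r s → p ℚ.* q ℚ.- r ℚ.* s ≡ p ℚ.* (q ℚ.- s) ℚ.+ s ℚ.* (p ℚ.- r)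
  *-difference = solve 4 (λ p q r s → p :* q :- r :* s := p :* (q :- s) :+ s :* (p :- r)) refl

  halve : ∀ ε → 0ℚ ℚ.< ε → 0ℚ ℚ.< ½ ℚ.* ε
  halve ε 0<ε = subst (ℚ._< ½ ℚ.* ε) (ℚ.*-zeroʳ ½) (ℚ.*-monoʳ-<-pos ½ 0<ε)

  halves : ∀ ε → ½ ℚ.* ε ℚ.+ ½ ℚ.* ε ≡ ε
  halves ε = trans (sym (ℚ.*-distribʳ-+ ε ½ ½)) (ℚ.*-identityˡ ε)

  unscale : ∀ b → 0ℚ ℚ.< b → ∀ ε → 0ℚ ℚ.< ε → ∃ λ δ → 0ℚ ℚ.< δ × b ℚ.* δ ≡ ε
  unscale b 0<b ε 0<ε = δ , 0<δ , eq
    where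
    instance
      b⁺ : ℚ.Positive b
      b⁺ = ℚ.positive 0<b
      b≢0 : ℚ.NonZero b
      b≢0 = ℚ.pos⇒nonZero b
      b⁻¹⁺ : ℚ.Positive (ℚ.1/ b)
      b⁻¹⁺ = ℚ.1/pos⇒pos b
    δ : ℚ
    δ = ℚ.1/ b ℚ.* ε
    0<δ : 0ℚ ℚ.< δ
    0<δ = subst (ℚ._< δ) (ℚ.*-zeroʳ (ℚ.1/ b)) (ℚ.*-monoʳ-<-pos (ℚ.1/ b) 0<ε)
    eq : b ℚ.* δ ≡ ε
    eq = trans (sym (ℚ.*-assoc b (ℚ.1/ b) ε))
        (trans (cong (ℚ._* ε) (ℚ.*-inverseʳ b)) (ℚ.*-identityˡ ε))

  eventuallyBounded : ∀ x → IsCauchy x →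
    ∃ λ b → 0ℚ ℚ.< b × ∃ λ N → ∀ m → N ℕ.≤ m → ℚ.∣ x m ∣ ℚ.≤ b
  eventuallyBounded x cx with cx 1ℚ (ℚ.positive⁻¹ 1ℚ)
  ... | N , close = b , 0<b , N , bound
    where
    b : ℚ
    b = 1ℚ ℚ.+ ℚ.∣ x N ∣
    0<b : 0ℚ ℚ.< b
    0<b = ℚ.+-mono-<-≤ (ℚ.positive⁻¹ 1ℚ) (ℚ.0≤∣p∣ (x N))
    bound : ∀ m → N ℕ.≤ m → ℚ.∣ x m ∣ ℚ.≤ b
    bound m N≤m = begin
      ℚ.∣ x m ∣                          ≡⟨ cong ℚ.∣_∣ (cancel (x m) (x N)) ⟩
      ℚ.∣ (x m ℚ.- x N) ℚ.+ x N ∣        ≤⟨ ℚ.∣p+q∣≤∣p∣+∣q∣ (x m ℚ.- x N) (x N) ⟩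
      ℚ.∣ x m ℚ.- x N ∣ ℚ.+ ℚ.∣ x N ∣    ≤⟨ ℚ.+-monoˡ-≤ ℚ.∣ x N ∣ (ℚ.<⇒≤ (close m N N≤m ℕ.≤-refl)) ⟩
      1ℚ ℚ.+ ℚ.∣ x N ∣                   ∎
      where open ℚ.≤-Reasoning

  ∣p*q∣≤ : ∀ {b} p q → ℚ.∣ p ∣ ℚ.≤ b → ℚ.∣ p ℚ.* q ∣ ℚ.≤ b ℚ.* ℚ.∣ q ∣
  ∣p*q∣≤ {b} p q p≤b = subst (ℚ._≤ b ℚ.* ℚ.∣ q ∣) (sym (ℚ.∣p*q∣≡∣p∣*∣q∣ p q))
    (ℚ.*-monoʳ-≤-nonNeg ℚ.∣ q ∣ {{ℚ.nonNegative (ℚ.0≤∣p∣ q)}} p≤b)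

  scale< : ∀ {b δ ε q} → 0ℚ ℚ.< b → b ℚ.* δ ≡ ε → q ℚ.< δ → b ℚ.* q ℚ.< ε
  scale< {b} {q = q} 0<b eq q<δ =
    subst (b ℚ.* q ℚ.<_) eq (ℚ.*-monoʳ-<-pos b {{ℚ.positive 0<b}} q<δ)

  abstract
    const-isCauchy : ∀ p → IsCauchy (λ _ → p)
    const-isCauchy p ε 0<ε = 0 , λ _ _ _ _ →
      subst (λ z → ℚ.∣ z ∣ ℚ.< ε) (sym (ℚ.+-inverseʳ p)) 0<ε

    +-isCauchy : ∀ x y → IsCauchy x → IsCauchy y → IsCauchy (λ m → x m ℚ.+ y m)
    +-isCauchy x y cx cy ε 0<ε with cx (½ ℚ.* ε) (halve ε 0<ε) | cy (½ ℚ.* ε) (halve ε 0<ε)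
    ... | N , x-close | M , y-close = N ⊔ M , λ m n N⊔M≤m N⊔M≤n → begin-strict
      ℚ.∣ (x m ℚ.+ y m) ℚ.- (x n ℚ.+ y n) ∣
        ≡⟨ cong ℚ.∣_∣ (+-difference (x m) (y m) (x n) (y n)) ⟩
      ℚ.∣ (x m ℚ.- x n) ℚ.+ (y m ℚ.- y n) ∣
        ≤⟨ ℚ.∣p+q∣≤∣p∣+∣q∣ (x m ℚ.- x n) (y m ℚ.- y n) ⟩
      ℚ.∣ x m ℚ.- x n ∣ ℚ.+ ℚ.∣ y m ℚ.- y n ∣
        <⟨ ℚ.+-mono-< (x-close m n (ℕ.m⊔n≤o⇒m≤o N M N⊔M≤m) (ℕ.m⊔n≤o⇒m≤o N M N⊔M≤n))
                      (y-close m n (ℕ.m⊔n≤o⇒n≤o N M N⊔M≤m) (ℕ.m⊔n≤o⇒n≤o N M N⊔M≤n)) ⟩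
      ½ ℚ.* ε ℚ.+ ½ ℚ.* ε
        ≡⟨ halves ε ⟩
      ε ∎
      where open ℚ.≤-Reasoning

    *-close : ∀ b c δ γ ε p q r s → 0ℚ ℚ.< b → 0ℚ ℚ.< c →
      b ℚ.* δ ≡ ½ ℚ.* ε → c ℚ.* γ ≡ ½ ℚ.* ε → ℚ.∣ p ∣ ℚ.≤ b → ℚ.∣ s ∣ ℚ.≤ c →
      ℚ.∣ q ℚ.- s ∣ ℚ.< δ → ℚ.∣ p ℚ.- r ∣ ℚ.< γ → ℚ.∣ p ℚ.* q ℚ.- r ℚ.* s ∣ ℚ.< ε
    *-close b c δ γ ε p q r s 0<b 0<c bδ≡½ε cγ≡½ε p≤b s≤c q-close p-close = begin-strict
      ℚ.∣ p ℚ.* q ℚ.- r ℚ.* s ∣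
        ≡⟨ cong ℚ.∣_∣ (*-difference p q r s) ⟩
      ℚ.∣ p ℚ.* (q ℚ.- s) ℚ.+ s ℚ.* (p ℚ.- r) ∣
        ≤⟨ ℚ.∣p+q∣≤∣p∣+∣q∣ (p ℚ.* (q ℚ.- s)) (s ℚ.* (p ℚ.- r)) ⟩
      ℚ.∣ p ℚ.* (q ℚ.- s) ∣ ℚ.+ ℚ.∣ s ℚ.* (p ℚ.- r) ∣
        ≤⟨ ℚ.+-mono-≤ (∣p*q∣≤ p (q ℚ.- s) p≤b) (∣p*q∣≤ s (p ℚ.- r) s≤c) ⟩
      b ℚ.* ℚ.∣ q ℚ.- s ∣ ℚ.+ c ℚ.* ℚ.∣ p ℚ.- r ∣
        <⟨ ℚ.+-mono-< (scale< {b} {δ} {½ ℚ.* ε} {ℚ.∣ q ℚ.- s ∣} 0<b bδ≡½ε q-close)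
                      (scale< {c} {γ} {½ ℚ.* ε} {ℚ.∣ p ℚ.- r ∣} 0<c cγ≡½ε p-close) ⟩
      ½ ℚ.* ε ℚ.+ ½ ℚ.* ε
        ≡⟨ halves ε ⟩
      ε ∎
      where open ℚ.≤-Reasoning

    *-isCauchy : ∀ x y → IsCauchy x → IsCauchy y → IsCauchy (λ m → x m ℚ.* y m)
    *-isCauchy x y cx cy ε 0<ε =
      let b , 0<b , N₁ , x≤b = eventuallyBounded x cx
          c , 0<c , N₂ , y≤c = eventuallyBounded y cy
          δ , 0<δ , bδ≡½ε    = unscale b 0<b (½ ℚ.* ε) (halve ε 0<ε)
          γ , 0<γ , cγ≡½ε    = unscale c 0<c (½ ℚ.* ε) (halve ε 0<ε)
          N₃ , y-close       = cy δ 0<δ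
          N₄ , x-close       = cx γ 0<γ
          N₁₂ = N₁ ⊔ N₂
          N₃₄ = N₃ ⊔ N₄
      in N₁₂ ⊔ N₃₄ , λ m n N≤m N≤n →
        let N₁₂≤m = ℕ.m⊔n≤o⇒m≤o N₁₂ N₃₄ N≤m
            N₁₂≤n = ℕ.m⊔n≤o⇒m≤o N₁₂ N₃₄ N≤n
            N₃₄≤m = ℕ.m⊔n≤o⇒n≤o N₁₂ N₃₄ N≤m
            N₃₄≤n = ℕ.m⊔n≤o⇒n≤o N₁₂ N₃₄ N≤n
        in *-close b c δ γ ε (x m) (y m) (x n) (y n) 0<b 0<c bδ≡½ε cγ≡½ε
             (x≤b m (ℕ.m⊔n≤o⇒m≤o N₁ N₂ N₁₂≤m)) (y≤c n (ℕ.m⊔n≤o⇒n≤o N₁ N₂ N₁₂≤n))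
             (y-close m n (ℕ.m⊔n≤o⇒m≤o N₃ N₄ N₃₄≤m) (ℕ.m⊔n≤o⇒m≤o N₃ N₄ N₃₄≤n))
             (x-close m n (ℕ.m⊔n≤o⇒n≤o N₃ N₄ N₃₄≤m) (ℕ.m⊔n≤o⇒n≤o N₃ N₄ N₃₄≤n))

0ℝ : ℝ
0ℝ = mkℝ (λ _ → 0ℚ) (const-isCauchy 0ℚ)

infixl 6 _+_
infixl 7 _*_

_+_ : ℝ → ℝ → ℝ
x + y = mkℝ (λ m → seq x m ℚ.+ seq y m) (+-isCauchy (seq x) (seq y) (isCauchy x) (isCauchy y))

_*_ : ℝ → ℝ → ℝ
x * y = mkℝ (λ m → seq x m ℚ.* seq y m) (*-isCauchy (seq x) (seq y) (isCauchy x) (isCauchy y))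

sum : ∀ {n} → Vector ℝ n → ℝ
sum = foldr _+_ 0ℝ

Point : ℕ → Set
Point d = Vector ℝ d

_#ₚ_ : ∀ {d} → Point d → Point d → Set
p #ₚ q = ∃ λ c → p c # q c

origin : ∀ {d} → Point d
origin _ = 0ℝ

infix 8 _·_

_·_ : ∀ {d} → Point d → Point d → ℝ
p · q = sum λ c → p c * q c

combination : ∀ {m d} → Vector ℝ m → Vector (Point d) m → Point d
combination w q c = sum λ i → w i * q i c

-- Affine independence is stated in the positive form appropriate to apartness:
-- a nonzero weight vector of total weight zero has a nonzero combination.

AffinelyIndependent : ∀ {m d} → Vector (Point d) m → Set
AffinelyIndependent {m} q = (w : Vector ℝ m) → sum w ≈ 0ℝ → w #ₚ origin →
  combination w q #ₚ origin

record PointSet (n d : ℕ) : Set where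
  field
    point    : Fin n → Point d
    distinct : ∀ {i j} → i ≢ j → point i #ₚ point j

open PointSet public

GeneralPosition : ∀ {n d} → PointSet n d → Set
GeneralPosition {n} {d} S = ∀ {m} → m ℕ.≤ suc d →
  (ι : Fin m → Fin n) → Injective _≡_ _≡_ ι → AffinelyIndependent (point S ∘ ι)

-- The open half-space { x | offset < normal · x }. The opposite half-space is
-- obtained by negating both the normal and the offset.

record HalfSpace (d : ℕ) : Set where
  field
    normal  : Point d
    offset  : ℝ
    nonzero : normal #ₚ origin

open HalfSpace public

_∈ₕ_ : ∀ {d} → Point d → HalfSpace d → Set
x ∈ₕ H = offset H < normal H · x

_∈∂_ : ∀ {d} → Point d → HalfSpace d → Set
x ∈∂ H = normal H · x ≈ offset H

-- Many pairs (normal , offset) describe the same half-space.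
_≐_ : ∀ {d} → HalfSpace d → HalfSpace d → Set
H ≐ H′ = ∀ x → x ∈ₕ H ⇔ x ∈ₕ H′

ContainsExactly : ∀ {n d} → HalfSpace d → PointSet n d → ℕ → Set
ContainsExactly {n} H S j =
  Σ (Subset n) λ τ → ∣ τ ∣ ≡ j × (∀ i → i ∈ τ ⇔ point S i ∈ₕ H)

record Facet {n d : ℕ} (S : PointSet n d) (j : ℕ) : Set where
  field
    vertices     : Subset n
    size         : ∣ vertices ∣ ≡ d
    positiveSide : HalfSpace d
    spanning     : ∀ i → i ∈ vertices → point S i ∈∂ positiveSide
    count        : ContainsExactly positiveSide S j

open Facet public

facetSetoid : ∀ {n d} → PointSet n d → ℕ → Setoid 0ℓ 0ℓ
facetSetoid S j = record
  { Carrier       = Facet S j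
  ; _≈_           = λ F G → vertices F ≡ vertices G × positiveSide F ≐ positiveSide G
  ; isEquivalence = record
    { refl  = refl , λ _ → mk⇔ (λ h → h) (λ h → h)
    ; sym   = λ (v , s) → sym v , λ x → mk⇔ (from (s x)) (to (s x))
    ; trans = λ (v , s) (v′ , s′) → trans v v′ ,
        λ x → mk⇔ (to (s′ x) ∘ to (s x)) (from (s x) ∘ from (s′ x))
    }
  }
  where open Equivalence using (to; from)

HasCardinality : Setoid 0ℓ 0ℓ → ℕ → Set
HasCardinality A m = Bijection (setoid (Fin m)) A

-- "E_k(S) = N", where e j is the number e_j(S) of j-facets for each j ≤ k.
NumberOf≤Facets : ∀ {n d} → PointSet n d → ℕ → ℕ → Set
NumberOf≤Facets S k N = ∃ λ (e : ℕ → ℕ) →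
  (∀ j → j ℕ.≤ k → HasCardinality (facetSetoid S j) (e j)) ×
  N ≡ ListAction.sum (applyUpTo e (suc k))

{-# OPTIONS --safe #-}
-- The bound is proved by induction on the dimension and on the number of points. At a vertex p
-- of the convex hull, E_k(S) is the sum of E_k(S / p), where S / p is the projection of S from p,
-- of E_{k-1}(S ∖ p), and of the number N of k-facets of S ∖ p with p on the negative side; so
-- N ≥ C(k+d-1,d-1) is what is needed. By Helly's theorem there is a generic direction u at p that
-- is interior to the cone of S ∖ D from p for every D of at most k points. For each such D exactly
-- one hull facet of S ∖ (D ∪ p) is crossed by the line p + tu on leaving the hull. Hence, counting
-- the pairs of a crossed d-set and a removed point in two ways, exactly C(k+d-1,d-1) of the
-- crossed d-sets have k points beyond them.
--
-- For tightness, place the points near d + 1 rays from the barycentre of a simplex: the hull of S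
-- minus any k points is then a simplex, and the same double count, starting from d + 1 hull
-- facets instead of one, gives e_j(S) = (d+1) C(j+d-1,d-1) for all j ≤ k.
--
-- All of this takes place over ℚ. The functional spanned by d points in general position is a
-- polynomial in their coordinates, so a real point set and its m-th rational approximation have
-- the same facets for large m.

module Submission where

open import Algebra.Bundles using (CommutativeRing)
open import Data.Bool using (Bool; true; false; T; _∧_; not; if_then_else_)
import Data.Bool.Properties as Bool
open import Data.Fin as Fin using (Fin; zero; suc; punchIn)
import Data.Fin.Properties as Fin
open import Data.Fin.Subset using (Subset)
import Data.Integer as ℤ
open import Data.List using (List; _++_)
import Data.List as List
open import Data.List.Membership.Propositional using (_∈_)
import Data.List.Membership.Propositional.Properties as List
open import Data.List.Relation.Unary.Any as Any using (here; there)
import Data.List.Relation.Unary.Any.Properties as Any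
open import Data.Nat as ℕ using (ℕ; zero; suc)
open import Data.Nat.DivMod using (_%_; m%n<n; m/n*n≤m; [m+kn]%n≡m%n; m<n⇒m%n≡m)
import Data.Nat.ListAction as ListAction
import Data.Nat.Properties as ℕ
import Data.Nat.Solver as ℕ-Solver
open import Data.Product using (∃; Σ; _×_; _,_; proj₁; proj₂)
open import Data.Sum as Sum using (_⊎_; inj₁; inj₂; [_,_]′)
open import Data.Unit using (⊤; tt)
import Data.Vec as Vec
open Vec using (lookup; tabulate)
import Data.Vec.Functional as Vector
import Data.Vec.Functional.Properties as Vector
import Data.Vec.Properties as Vec
open import Function using (_∘_)
open import Function.Bundles using (mk⇔; module Equivalence)
open import Relation.Binary using (tri<; tri≈; tri>)
open import Relation.Binary.PropositionalEquality
open import Relation.Nullary using (Dec; yes; no; does; ¬_; contradiction)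
open import Relation.Nullary.Decidable using (dec-true; dec-false; _→-dec_; ¬?)
open import Relation.Unary using (Decidable)

-- After projection from p the points are rays without a distinguished hyperplane at infinity, so
-- the induction cannot stay with affine point sets. `Config` keeps only the space W of value
-- vectors of functionals; projecting restricts W to those vanishing at p, and the positive
-- functional `h`, at first the constant 1, becomes one that supports the hull at p. Points enter as
-- linear forms on W. Helly is what asks for large n: the cones live in dimension d, where any d
-- sets that miss at most k of the n - 1 other points each must share d points, so d (k + 1) ≤ n -
-- 1. The double count is an equality of Clarkson-Shor type: as level 0 has the same count for all
-- sets missing at most k points, averaging over the removal of one point determines every level up
-- to k. The binomial coefficient solves the resulting recursion; the starting count is a mere
-- factor. ℚ is there for its decidable order: pivoting, minimising and counting compare numbers
-- that, as Cauchy sequences, could be compared only after a proof that they are apart.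

module Counting where
  open import Data.Vec using ([]; _∷_)
  open import Data.Fin.Subset using (∣_∣)
  open import Data.Nat.Combinatorics using (_C_; nCn≡1; nCk+nC[k+1]≡[n+1]C[k+1])
  open import Data.Nat using (_+_; _*_; _≤_; _<_; z≤n; s≤s; _≡ᵇ_)
  open import Data.Nat.Properties hiding (_≟_)
  open import Algebra.Properties.Semiring.Sum ℕ.+-*-semiring public
  open ℕ-Solver.+-*-Solver using (solve; _:=_; _:+_; _:*_; con)

  -- Counting elements and subsets.

  ⟦_⟧ : Bool → ℕ
  ⟦ true ⟧ = 1
  ⟦ false ⟧ = 0

  cnt : ∀ {n} → (Fin n → Bool) → ℕ
  cnt b = sum (λ i → ⟦ b i ⟧)

  ∣∣≡cnt : ∀ {n} (σ : Subset n) → ∣ σ ∣ ≡ cnt (lookup σ)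
  ∣∣≡cnt [] = refl
  ∣∣≡cnt (true ∷ σ) = cong suc (∣∣≡cnt σ)
  ∣∣≡cnt (false ∷ σ) = ∣∣≡cnt σ

  cnt-cong : ∀ {n} {b c : Fin n → Bool} → (∀ i → b i ≡ c i) → cnt b ≡ cnt c
  cnt-cong eq = sum-cong-≗ (cong ⟦_⟧ ∘ eq)

  sum-mono-≤ : ∀ {n} {f g : Fin n → ℕ} → (∀ i → f i ≤ g i) → sum f ≤ sum g
  sum-mono-≤ {zero} le = z≤n
  sum-mono-≤ {suc n} le = +-mono-≤ (le zero) (sum-mono-≤ (le ∘ suc))

  sum-zero : ∀ {n} {f : Fin n → ℕ} → (∀ i → f i ≡ 0) → sum f ≡ 0
  sum-zero {zero} eq = refl
  sum-zero {suc n} eq = cong₂ _+_ (eq zero) (sum-zero (eq ∘ suc))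

  sum-one : ∀ {n} {f : Fin n → ℕ} → (∀ i → f i ≡ 1) → sum f ≡ n
  sum-one {zero} eq = refl
  sum-one {suc n} eq = cong₂ _+_ (eq zero) (sum-one (eq ∘ suc))

  cnt-none : ∀ {n} {b : Fin n → Bool} → (∀ i → b i ≡ false) → cnt b ≡ 0
  cnt-none eq = sum-zero (cong ⟦_⟧ ∘ eq)

  cnt-all : ∀ {n} {b : Fin n → Bool} → (∀ i → b i ≡ true) → cnt b ≡ n
  cnt-all eq = sum-one (cong ⟦_⟧ ∘ eq)

  ⟦⟧-mono : ∀ {b c} → (b ≡ true → c ≡ true) → ⟦ b ⟧ ≤ ⟦ c ⟧
  ⟦⟧-mono {false} imp = z≤n
  ⟦⟧-mono {true} imp rewrite imp refl = ≤-refl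

  cnt-mono : ∀ {n} {b c : Fin n → Bool} → (∀ i → b i ≡ true → c i ≡ true) → cnt b ≤ cnt c
  cnt-mono imp = sum-mono-≤ (⟦⟧-mono ∘ imp)

  cnt≡0 : ∀ {n} {b : Fin n → Bool} → cnt b ≡ 0 → ∀ i → b i ≡ false
  cnt≡0 {suc n} {b} eq i with b zero in eq₀
  cnt≡0 {suc n} {b} eq zero    | false = eq₀
  cnt≡0 {suc n} {b} eq (suc i) | false = cnt≡0 eq i

  cnt>0 : ∀ {n} {b : Fin n → Bool} → 0 < cnt b → ∃ λ i → b i ≡ true
  cnt>0 {suc n} {b} lt with b zero in eq₀
  ... | true = zero , eq₀
  ... | false = let i , eq = cnt>0 lt in suc i , eq

  cnt<⇒∃ : ∀ {n} {b c : Fin n → Bool} → cnt b < cnt c → ∃ λ i → b i ≡ false × c i ≡ true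
  cnt<⇒∃ {zero} ()
  cnt<⇒∃ {suc n} {b} {c} lt with b zero in b₀ | c zero in c₀
  ... | false | true = zero , b₀ , c₀
  ... | true | true = let i , p = cnt<⇒∃ (≤-pred lt) in suc i , p
  ... | false | false = let i , p = cnt<⇒∃ lt in suc i , p
  ... | true | false = let i , p = cnt<⇒∃ (≤-trans (n≤1+n _) lt) in suc i , p

  cnt-⊆-≡ : ∀ {n} {b c : Fin n → Bool} → (∀ i → b i ≡ true → c i ≡ true) → cnt b ≡ cnt c →
    ∀ i → b i ≡ c i
  cnt-⊆-≡ {suc n} {b} {c} sub eq i with b zero in b₀ | c zero in c₀
  cnt-⊆-≡ sub eq zero | true | true = trans b₀ (sym c₀)
  cnt-⊆-≡ sub eq (suc i) | true | true = cnt-⊆-≡ (sub ∘ suc) (suc-injective eq) i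
  cnt-⊆-≡ sub eq zero | false | false = trans b₀ (sym c₀)
  cnt-⊆-≡ sub eq (suc i) | false | false = cnt-⊆-≡ (sub ∘ suc) eq i
  cnt-⊆-≡ sub eq i | true | false = contradiction (trans (sym c₀) (sub zero b₀)) λ ()
  cnt-⊆-≡ sub eq i | false | true = contradiction (cnt-mono (sub ∘ suc)) (<⇒≱ (≤-reflexive (sym eq)))

  -- The bits at r stand on opposite sides so that no subtraction occurs.
  cnt-change : ∀ {n} {b c : Fin n → Bool} r → (∀ i → i ≢ r → b i ≡ c i) →
    cnt b + ⟦ c r ⟧ ≡ cnt c + ⟦ b r ⟧
  cnt-change {suc n} {b} {c} r agree = begin
    cnt b + ⟦ c r ⟧                                 ≡⟨ cong (_+ ⟦ c r ⟧) (sum-remove {i = r} (⟦_⟧ ∘ b)) ⟩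
    ⟦ b r ⟧ + cnt (b ∘ punchIn r) + ⟦ c r ⟧         ≡⟨ cong (λ z → ⟦ b r ⟧ + z + ⟦ c r ⟧)
                                                        (cnt-cong λ i → agree _ (Fin.punchInᵢ≢i r i)) ⟩
    ⟦ b r ⟧ + cnt (c ∘ punchIn r) + ⟦ c r ⟧         ≡⟨ solve 3 (λ x y z → x :+ y :+ z := z :+ y :+ x) refl ⟦ b r ⟧ _ ⟦ c r ⟧ ⟩
    ⟦ c r ⟧ + cnt (c ∘ punchIn r) + ⟦ b r ⟧         ≡⟨ cong (_+ ⟦ b r ⟧) (sum-remove {i = r} (⟦_⟧ ∘ c)) ⟨
    cnt c + ⟦ b r ⟧                                 ∎
    where open ≡-Reasoning

  cnt-≟ : ∀ {n} (r : Fin n) → cnt (λ i → does (i Fin.≟ r)) ≡ 1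
  cnt-≟ {n} r = begin
    cnt b                ≡⟨ +-identityʳ _ ⟨
    cnt b + 0            ≡⟨ cnt-change {b = b} {c = λ _ → false} r (λ i i≢r → dec-false (i Fin.≟ r) i≢r) ⟩
    cnt {n} (λ _ → false) + ⟦ b r ⟧ ≡⟨ cong₂ _+_ (cnt-none {n} λ _ → refl) (cong ⟦_⟧ (dec-true (r Fin.≟ r) refl)) ⟩
    1                    ∎
    where
    open ≡-Reasoning
    b = λ i → does (i Fin.≟ r)

  cnt-not : ∀ {n} (b : Fin n → Bool) → cnt (not ∘ b) + cnt b ≡ n
  cnt-not b = trans (sym (∑-distrib-+ (⟦_⟧ ∘ not ∘ b) (⟦_⟧ ∘ b))) (sum-one λ i → one (b i))
    where
    one : ∀ x → ⟦ not x ⟧ + ⟦ x ⟧ ≡ 1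
    one true = refl
    one false = refl

  cnt-between : ∀ {n} m {b c : Fin n → Bool} → (∀ i → b i ≡ true → c i ≡ true) → cnt b ≤ m → m ≤ cnt c →
    ∃ λ a → (∀ i → b i ≡ true → a i ≡ true) × (∀ i → a i ≡ true → c i ≡ true) × cnt a ≡ m
  cnt-between {zero} zero sub lo hi = (λ ()) , (λ ()) , (λ ()) , refl
  cnt-between {suc n} m {b} {c} sub lo hi with b zero in b₀ | c zero in c₀
  cnt-between {suc n} m sub lo hi | true | false = contradiction (trans (sym c₀) (sub zero b₀)) λ ()
  cnt-between {suc n} m {b} sub lo hi | false | false =
    let a , b⊆a , a⊆c , eq = cnt-between m (sub ∘ suc) lo hi
    in (λ { zero → false ; (suc i) → a i })
     , (λ { zero b₁ → trans (sym b₀) b₁ ; (suc i) → b⊆a i }) , (λ { zero () ; (suc i) → a⊆c i }) , eq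
  cnt-between {suc n} (suc m) {b} sub lo hi | true | true =
    let a , b⊆a , a⊆c , eq = cnt-between m (sub ∘ suc) (≤-pred lo) (≤-pred hi)
    in (λ { zero → true ; (suc i) → a i })
     , (λ { zero _ → refl ; (suc i) → b⊆a i }) , (λ { zero _ → c₀ ; (suc i) → a⊆c i }) , cong suc eq
  cnt-between {suc n} m {b} {c} sub lo hi | false | true with m ℕ.≤? cnt (c ∘ suc)
  ... | yes hi′ =
    let a , b⊆a , a⊆c , eq = cnt-between m (sub ∘ suc) lo hi′
    in (λ { zero → false ; (suc i) → a i })
     , (λ { zero b₁ → trans (sym b₀) b₁ ; (suc i) → b⊆a i }) , (λ { zero () ; (suc i) → a⊆c i }) , eq
  ... | no hi′ =
    -- Without index zero `c` has fewer than m elements, with it at least m; hence exactly m.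
    c , sub , (λ _ h → h) ,
    trans (cong (λ x → ⟦ x ⟧ + cnt (c ∘ suc)) c₀) (≤-antisym (≰⇒> hi′) hi)

  -- Branching on the first bit makes it a structural identity that a sum over all subsets splits at
  -- any chosen element, see `∑ₛ-insert`.
  ∑ₛ : ∀ {n} → (Subset n → ℕ) → ℕ
  ∑ₛ {zero} g = g []
  ∑ₛ {suc n} g = ∑ₛ (g ∘ (false ∷_)) + ∑ₛ (g ∘ (true ∷_))

  ∑ₛ-cong : ∀ {n} {g h : Subset n → ℕ} → (∀ σ → g σ ≡ h σ) → ∑ₛ g ≡ ∑ₛ h
  ∑ₛ-cong {zero} eq = eq []
  ∑ₛ-cong {suc n} eq = cong₂ _+_ (∑ₛ-cong (eq ∘ (false ∷_))) (∑ₛ-cong (eq ∘ (true ∷_)))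

  ∑ₛ-mono : ∀ {n} {g h : Subset n → ℕ} → (∀ σ → g σ ≤ h σ) → ∑ₛ g ≤ ∑ₛ h
  ∑ₛ-mono {zero} le = le []
  ∑ₛ-mono {suc n} le = +-mono-≤ (∑ₛ-mono (le ∘ (false ∷_))) (∑ₛ-mono (le ∘ (true ∷_)))

  ∑ₛ-+ : ∀ {n} (g h : Subset n → ℕ) → ∑ₛ (λ σ → g σ + h σ) ≡ ∑ₛ g + ∑ₛ h
  ∑ₛ-+ {zero} g h = refl
  ∑ₛ-+ {suc n} g h = trans
    (cong₂ _+_ (∑ₛ-+ (g ∘ (false ∷_)) (h ∘ (false ∷_))) (∑ₛ-+ (g ∘ (true ∷_)) (h ∘ (true ∷_))))
    (solve 4 (λ a b c d → a :+ b :+ (c :+ d) := a :+ c :+ (b :+ d)) refl (∑ₛ (g ∘ (false ∷_))) _ (∑ₛ (g ∘ (true ∷_))) _)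

  ∑ₛ-zero : ∀ n → ∑ₛ {n} (λ _ → 0) ≡ 0
  ∑ₛ-zero zero = refl
  ∑ₛ-zero (suc n) = cong₂ _+_ (∑ₛ-zero n) (∑ₛ-zero n)

  ∑ₛ-* : ∀ {n} a (g : Subset n → ℕ) → ∑ₛ (λ σ → a * g σ) ≡ a * ∑ₛ g
  ∑ₛ-* {zero} a g = refl
  ∑ₛ-* {suc n} a g = trans (cong₂ _+_ (∑ₛ-* a (g ∘ (false ∷_))) (∑ₛ-* a (g ∘ (true ∷_))))
    (sym (*-distribˡ-+ a (∑ₛ (g ∘ (false ∷_))) _))

  ∑ₛ-swap : ∀ {m n} (g : Fin m → Subset n → ℕ) → sum (λ i → ∑ₛ (g i)) ≡ ∑ₛ (λ σ → sum (λ i → g i σ))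
  ∑ₛ-swap {zero} {n} g = sym (∑ₛ-zero n)
  ∑ₛ-swap {suc m} g = trans (cong (∑ₛ (g zero) +_) (∑ₛ-swap (g ∘ suc))) (sym (∑ₛ-+ (g zero) _))

  ∑ₛ-insert : ∀ {n} (p : Fin (suc n)) (g : Subset (suc n) → ℕ) →
    ∑ₛ g ≡ ∑ₛ (λ σ → g (Vec.insertAt σ p false)) + ∑ₛ (λ σ → g (Vec.insertAt σ p true))
  ∑ₛ-insert zero g = refl
  ∑ₛ-insert {suc n} (suc p) g = trans
    (cong₂ _+_ (∑ₛ-insert p (g ∘ (false ∷_))) (∑ₛ-insert p (g ∘ (true ∷_))))
    (solve 4 (λ a b c d → a :+ b :+ (c :+ d) := a :+ c :+ (b :+ d)) refl
      (∑ₛ (λ σ → g (false ∷ Vec.insertAt σ p false))) _ (∑ₛ (λ σ → g (true ∷ Vec.insertAt σ p false))) _)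

  _≟ₛ_ : ∀ {n} (σ τ : Subset n) → Dec (σ ≡ τ)
  _≟ₛ_ = Vec.≡-dec Bool._≟_

  ∑ₛ-δ : ∀ {n} (τ : Subset n) → ∑ₛ (λ σ → ⟦ does (σ ≟ₛ τ) ⟧) ≡ 1
  ∑ₛ-δ [] = refl
  ∑ₛ-δ {suc n} (false ∷ τ) = cong₂ _+_ (∑ₛ-δ τ) (∑ₛ-zero n)
  ∑ₛ-δ {suc n} (true ∷ τ) = cong₂ _+_ (∑ₛ-zero n) (∑ₛ-δ τ)

  -- The indicator of P is the sum of the delta functions at the `x i`, and each of these sums to 1.
  ∑ₛ-enum : ∀ {n c} (P : Subset n → Bool) (x : Fin c → Subset n) → (∀ {i j} → x i ≡ x j → i ≡ j) →
    (∀ i → P (x i) ≡ true) → (∀ σ → P σ ≡ true → ∃ λ i → σ ≡ x i) → ∑ₛ (⟦_⟧ ∘ P) ≡ c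
  ∑ₛ-enum {n} {c} P x inj sound complete = begin
    ∑ₛ (⟦_⟧ ∘ P)                                          ≡⟨ ∑ₛ-cong at ⟩
    ∑ₛ (λ σ → sum (λ i → ⟦ does (σ ≟ₛ x i) ⟧))            ≡⟨ ∑ₛ-swap (λ i σ → ⟦ does (σ ≟ₛ x i) ⟧) ⟨
    sum (λ i → ∑ₛ (λ σ → ⟦ does (σ ≟ₛ x i) ⟧))            ≡⟨ sum-one (∑ₛ-δ ∘ x) ⟩
    c                                                     ∎
    where
    open ≡-Reasoning
    at : ∀ σ → ⟦ P σ ⟧ ≡ sum (λ i → ⟦ does (σ ≟ₛ x i) ⟧)
    at σ with P σ in eq
    ... | false = sym (sum-zero λ i → cong ⟦_⟧ (dec-false (σ ≟ₛ x i)
                    λ { refl → contradiction (trans (sym eq) (sound i)) λ () }))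
    ... | true with complete σ eq
    ...   | i , refl = sym (trans (cnt-cong (λ j → same j)) (cnt-≟ i))
      where
      same : ∀ j → does (x i ≟ₛ x j) ≡ does (j Fin.≟ i)
      same j with j Fin.≟ i
      ... | yes refl = dec-true (x i ≟ₛ x i) refl
      ... | no j≢i = dec-false (x i ≟ₛ x j) (λ e → j≢i (sym (inj e)))

  -- Binomial coefficients.

  binom : ℕ → ℕ → ℕ
  binom zero e = 1
  binom (suc j) zero = 1
  binom (suc j) (suc e) = binom (suc j) e + binom j (suc e)

  binom≡C : ∀ j e → (j + e) C e ≡ binom j e
  binom≡C zero e = nCn≡1 e
  binom≡C (suc j) zero = refl
  binom≡C (suc j) (suc e) = begin
    suc (j + suc e) C suc e                       ≡⟨ nCk+nC[k+1]≡[n+1]C[k+1] (j + suc e) e ⟨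
    (j + suc e) C e + (j + suc e) C suc e         ≡⟨ cong (λ z → z C e + (j + suc e) C suc e) (+-suc j e) ⟩
    (suc j + e) C e + (j + suc e) C suc e         ≡⟨ cong₂ _+_ (binom≡C (suc j) e) (binom≡C j (suc e)) ⟩
    binom (suc j) e + binom j (suc e)             ∎
    where open ≡-Reasoning

  binom-zero : ∀ j → binom j 0 ≡ 1
  binom-zero zero = refl
  binom-zero (suc j) = refl

  -- Ratios of neighbours in Pascal's triangle. The two are proved together: since their right-hand
  -- sides agree, they trade one summand of Pascal's rule for the other.
  binom-absorbˡ : ∀ j e → suc j * binom (suc j) e ≡ suc (j + e) * binom j e
  binom-absorbʳ : ∀ j e → suc e * binom j (suc e) ≡ suc (j + e) * binom j e

  binom-absorbˡ j zero rewrite +-identityʳ j | binom-zero j = refl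
  binom-absorbˡ j (suc e) = begin
    suc j * (x + y)                    ≡⟨ *-distribˡ-+ (suc j) x y ⟩
    suc j * x + suc j * y              ≡⟨ cong (_+ suc j * y) (trans (binom-absorbˡ j e) (sym (binom-absorbʳ j e))) ⟩
    suc e * y + suc j * y              ≡⟨ solve 3 (λ e j y → (con 1 :+ e) :* y :+ (con 1 :+ j) :* y := (con 1 :+ (j :+ (con 1 :+ e))) :* y) refl e j y ⟩
    suc (j + suc e) * y                ∎
    where
    open ≡-Reasoning
    x = binom (suc j) e
    y = binom j (suc e)
  binom-absorbʳ zero e = refl
  binom-absorbʳ (suc j) e = begin
    suc e * (x + y)                    ≡⟨ *-distribˡ-+ (suc e) x y ⟩
    suc e * x + suc e * y              ≡⟨ cong (suc e * x +_) (trans (binom-absorbʳ j e) (sym (binom-absorbˡ j e))) ⟩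
    suc e * x + suc j * x              ≡⟨ solve 3 (λ e j x → (con 1 :+ e) :* x :+ (con 1 :+ j) :* x := (con 1 :+ (con 1 :+ j :+ e)) :* x) refl e j x ⟩
    suc (suc j + e) * x                ∎
    where
    open ≡-Reasoning
    x = binom (suc j) e
    y = binom j (suc e)

  -- Removing one element at a time.

  infixl 6 _∖_

  _∖_ : ∀ {n} → (Fin n → Bool) → Fin n → Fin n → Bool
  (R ∖ r) i = R i ∧ not (does (i Fin.≟ r))

  ∖-self : ∀ {n} (R : Fin n → Bool) r → (R ∖ r) r ≡ false
  ∖-self R r rewrite dec-true (r Fin.≟ r) refl = Bool.∧-zeroʳ (R r)

  ∖-other : ∀ {n} (R : Fin n → Bool) r i → i ≢ r → (R ∖ r) i ≡ R i
  ∖-other R r i i≢r rewrite dec-false (i Fin.≟ r) i≢r = Bool.∧-identityʳ (R i)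

  ∖-⊆ : ∀ {n} (R : Fin n → Bool) r i → (R ∖ r) i ≡ true → R i ≡ true
  ∖-⊆ R r i h with R i
  ... | true = refl

  cnt-∖ : ∀ {n} (R : Fin n → Bool) r → cnt (R ∖ r) + ⟦ R r ⟧ ≡ cnt R
  cnt-∖ R r = begin
    cnt (R ∖ r) + ⟦ R r ⟧     ≡⟨ cnt-change r (∖-other R r) ⟩
    cnt R + ⟦ (R ∖ r) r ⟧     ≡⟨ cong (λ z → cnt R + ⟦ z ⟧) (∖-self R r) ⟩
    cnt R + 0                 ≡⟨ +-identityʳ _ ⟩
    cnt R                     ∎
    where open ≡-Reasoning

  -- The Clarkson-Shor setting: a label ι has a defining set `B ι` and a disjoint conflict set
  -- `V ι`, and `level R j` counts the labels that are defined inside R and in conflict with exactly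
  -- j members of R. Labels are subsets of `Fin M` for an M independent of n, so that an extra bit
  -- can carry an orientation.
  module Thinning {M n : ℕ} (e : ℕ) (Q : Subset M → Bool) (B V : Subset M → Fin n → Bool)
    (size-B : ∀ ι → Q ι ≡ true → cnt (B ι) ≡ suc e)
    (disjoint : ∀ ι → Q ι ≡ true → ∀ i → B ι i ≡ true → V ι i ≡ false) where

    missing violated : (Fin n → Bool) → Subset M → ℕ
    missing R ι = cnt (λ i → B ι i ∧ not (R i))
    violated R ι = cnt (λ i → V ι i ∧ R i)

    at : (Fin n → Bool) → ℕ → Subset M → Bool
    at R j ι = Q ι ∧ (missing R ι ≡ᵇ 0) ∧ (violated R ι ≡ᵇ j)

    level : (Fin n → Bool) → ℕ → ℕ
    level R j = ∑ₛ (⟦_⟧ ∘ at R j)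

    private
      ≡ᵇ-refl : ∀ m → (m ≡ᵇ m) ≡ true
      ≡ᵇ-refl m = dec-true (m ℕ.≟ m) refl

      ≢⇒≡ᵇ : ∀ {m k} → m ≢ k → (m ≡ᵇ k) ≡ false
      ≢⇒≡ᵇ {m} {k} m≢k = dec-false (m ℕ.≟ k) m≢k

      violated-∖ : ∀ R r ι → R r ≡ true → violated (R ∖ r) ι + ⟦ V ι r ⟧ ≡ violated R ι
      violated-∖ R r ι Rr = begin
        violated (R ∖ r) ι + ⟦ V ι r ⟧           ≡⟨ cong (λ z → violated (R ∖ r) ι + ⟦ z ⟧)
                                                      (trans (sym (Bool.∧-identityʳ _)) (cong (V ι r ∧_) (sym Rr))) ⟩
        violated (R ∖ r) ι + ⟦ V ι r ∧ R r ⟧     ≡⟨ cnt-change r (λ i i≢r → cong (V ι i ∧_) (∖-other R r i i≢r)) ⟩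
        violated R ι + ⟦ V ι r ∧ (R ∖ r) r ⟧     ≡⟨ cong (λ z → violated R ι + ⟦ V ι r ∧ z ⟧) (∖-self R r) ⟩
        violated R ι + ⟦ V ι r ∧ false ⟧         ≡⟨ cong (λ z → violated R ι + ⟦ z ⟧) (Bool.∧-zeroʳ (V ι r)) ⟩
        violated R ι + 0                         ≡⟨ +-identityʳ _ ⟩
        violated R ι                             ∎
        where open ≡-Reasoning

      missing-∖ : ∀ R r ι → R r ≡ true → missing (R ∖ r) ι ≡ missing R ι + ⟦ B ι r ⟧
      missing-∖ R r ι Rr = begin
        missing (R ∖ r) ι                               ≡⟨ +-identityʳ _ ⟨
        missing (R ∖ r) ι + 0                           ≡⟨ cong (λ z → missing (R ∖ r) ι + ⟦ z ⟧) (Bool.∧-zeroʳ (B ι r)) ⟨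
        missing (R ∖ r) ι + ⟦ B ι r ∧ false ⟧           ≡⟨ cong (λ z → missing (R ∖ r) ι + ⟦ B ι r ∧ not z ⟧) Rr ⟨
        missing (R ∖ r) ι + ⟦ B ι r ∧ not (R r) ⟧       ≡⟨ cnt-change r (λ i i≢r → cong (λ z → B ι i ∧ not z) (∖-other R r i i≢r)) ⟩
        missing R ι + ⟦ B ι r ∧ not ((R ∖ r) r) ⟧       ≡⟨ cong (λ z → missing R ι + ⟦ B ι r ∧ not z ⟧) (∖-self R r) ⟩
        missing R ι + ⟦ B ι r ∧ true ⟧                  ≡⟨ cong (λ z → missing R ι + ⟦ z ⟧) (Bool.∧-identityʳ (B ι r)) ⟩
        missing R ι + ⟦ B ι r ⟧                         ∎
        where open ≡-Reasoning

      -- If ι violates j members of R then removing r keeps it at level j unless r ∈ B ι ∪ V ι;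
      -- if it violates j + 1 of them, it reaches level j by the removal of one of these. The
      -- term with suc e + j is on the left so that no subtraction occurs.
      removals : ∀ R j ι → sum (λ r → ⟦ R r ⟧ * ⟦ at (R ∖ r) j ι ⟧) + (suc e + j) * ⟦ at R j ι ⟧
                         ≡ cnt R * ⟦ at R j ι ⟧ + suc j * ⟦ at R (suc j) ι ⟧
      removals R j ι with Q ι in Qι
      ... | false = begin
        sum (λ r → ⟦ R r ⟧ * 0) + (suc e + j) * 0    ≡⟨ cong₂ _+_ (sum-zero (λ r → *-zeroʳ ⟦ R r ⟧)) (*-zeroʳ (suc e + j)) ⟩
        0                                            ≡⟨ cong₂ _+_ (*-zeroʳ (cnt R)) (*-zeroʳ (suc j)) ⟨
        cnt R * 0 + suc j * 0                        ∎
        where open ≡-Reasoning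
      ... | true with missing R ι in miss
      ... | suc m = begin
        sum (λ r → ⟦ R r ⟧ * ⟦ (missing (R ∖ r) ι ≡ᵇ 0) ∧ (violated (R ∖ r) ι ≡ᵇ j) ⟧) + (suc e + j) * 0
          ≡⟨ cong₂ _+_ (sum-zero term) (*-zeroʳ (suc e + j)) ⟩
        0
          ≡⟨ cong₂ _+_ (*-zeroʳ (cnt R)) (*-zeroʳ (suc j)) ⟨
        cnt R * 0 + suc j * 0  ∎
        where
        open ≡-Reasoning
        term : ∀ r → ⟦ R r ⟧ * ⟦ (missing (R ∖ r) ι ≡ᵇ 0) ∧ (violated (R ∖ r) ι ≡ᵇ j) ⟧ ≡ 0
        term r with R r in Rr
        ... | false = refl
        ... | true rewrite missing-∖ R r ι Rr | miss = refl
      ... | zero = main (violated R ι ℕ.≟ j) (violated R ι ℕ.≟ suc j)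
        where
        B⊆R : ∀ i → B ι i ≡ true → R i ≡ true
        B⊆R i Bi with R i in Ri
        ... | true = refl
        ... | false = contradiction
          (trans (sym (cnt≡0 miss i)) (cong₂ (λ x y → x ∧ not y) Bi Ri)) λ ()
        term : ℕ → Fin n → ℕ
        term v r = ⟦ R r ⟧ * ⟦ (missing (R ∖ r) ι ≡ᵇ 0) ∧ (violated (R ∖ r) ι ≡ᵇ v) ⟧
        goal : Set
        goal = sum (term j) + (suc e + j) * ⟦ violated R ι ≡ᵇ j ⟧
             ≡ cnt R * ⟦ violated R ι ≡ᵇ j ⟧ + suc j * ⟦ violated R ι ≡ᵇ suc j ⟧
        open ≡-Reasoning
        term-eq : ∀ r → R r ≡ true →
          1 * ⟦ (missing (R ∖ r) ι ≡ᵇ 0) ∧ (violated (R ∖ r) ι ≡ᵇ j) ⟧ ≡ ⟦ (⟦ B ι r ⟧ ≡ᵇ 0) ∧ (violated (R ∖ r) ι ≡ᵇ j) ⟧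
        term-eq r Rr rewrite missing-∖ R r ι Rr | miss = +-identityʳ _
        main : _ → _ → goal
        main (yes vj) (yes vj′) = contradiction (trans (sym vj′) vj) (1+n≢n)
        main (yes vj) (no vj′) rewrite vj | ≡ᵇ-refl j | ≢⇒≡ᵇ {j} {suc j} (1+n≢n ∘ sym) = begin
          sum (term j) + (suc e + j) * 1
            ≡⟨ cong₂ _+_ (sum-cong-≗ value) (trans (*-identityʳ _) (cong₂ _+_ (sym (size-B ι Qι)) (sym vj))) ⟩
          cnt free + (cnt (B ι) + violated R ι)
            ≡⟨ cong (cnt free +_) (∑-distrib-+ (⟦_⟧ ∘ B ι) (λ i → ⟦ V ι i ∧ R i ⟧)) ⟨
          cnt free + sum (λ i → ⟦ B ι i ⟧ + ⟦ V ι i ∧ R i ⟧)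
            ≡⟨ ∑-distrib-+ (⟦_⟧ ∘ free) (λ i → ⟦ B ι i ⟧ + ⟦ V ι i ∧ R i ⟧) ⟨
          sum (λ i → ⟦ free i ⟧ + (⟦ B ι i ⟧ + ⟦ V ι i ∧ R i ⟧))
            ≡⟨ sum-cong-≗ partition ⟩
          cnt R
            ≡⟨ trans (sym (*-identityʳ (cnt R))) (sym (trans (cong (cnt R * 1 +_) (*-zeroʳ (suc j))) (+-identityʳ _))) ⟩
          cnt R * 1 + suc j * 0 ∎
          where
          free : Fin n → Bool
          free i = R i ∧ not (B ι i) ∧ not (V ι i)
          value : ∀ r → term j r ≡ ⟦ free r ⟧
          value r with R r in Rr
          ... | false = refl
          ... | true = trans (term-eq r Rr) (cong ⟦_⟧ bool)
            where
            bool : (⟦ B ι r ⟧ ≡ᵇ 0) ∧ (violated (R ∖ r) ι ≡ᵇ j) ≡ not (B ι r) ∧ not (V ι r)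
            bool with violated-∖ R r ι Rr
            ... | veq with B ι r | V ι r
            ... | true | _ = refl
            ... | false | true = ≢⇒≡ᵇ λ vr → 1+n≢n (trans (trans (sym (+-comm _ 1)) (trans veq vj)) (sym vr))
            ... | false | false = trans (cong (_≡ᵇ j) (trans (sym (+-identityʳ _)) (trans veq vj))) (≡ᵇ-refl j)
          partition : ∀ i → ⟦ free i ⟧ + (⟦ B ι i ⟧ + ⟦ V ι i ∧ R i ⟧) ≡ ⟦ R i ⟧
          partition i with B ι i in Bi
          ... | true rewrite disjoint ι Qι i Bi | B⊆R i Bi = refl
          ... | false with R i | V ι i
          ... | true | true = refl
          ... | true | false = refl
          ... | false | true = refl
          ... | false | false = refl
        main (no v≢j) (yes vj′) rewrite vj′ | ≡ᵇ-refl j | ≢⇒≡ᵇ {suc j} {j} 1+n≢n = begin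
          sum (term j) + (suc e + j) * 0    ≡⟨ cong₂ _+_ (sum-cong-≗ value) (*-zeroʳ (suc e + j)) ⟩
          violated R ι + 0                  ≡⟨ trans (+-identityʳ _) vj′ ⟩
          suc j                             ≡⟨ *-identityʳ (suc j) ⟨
          suc j * 1                         ≡⟨ cong (_+ suc j * 1) (*-zeroʳ (cnt R)) ⟨
          cnt R * 0 + suc j * 1             ∎
          where
          value : ∀ r → term j r ≡ ⟦ V ι r ∧ R r ⟧
          value r with R r in Rr
          ... | false = cong ⟦_⟧ (sym (Bool.∧-zeroʳ (V ι r)))
          ... | true = trans (term-eq r Rr) (cong ⟦_⟧ (trans bool (sym (Bool.∧-identityʳ (V ι r)))))
            where
            bool : (⟦ B ι r ⟧ ≡ᵇ 0) ∧ (violated (R ∖ r) ι ≡ᵇ j) ≡ V ι r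
            bool with violated-∖ R r ι Rr | disjoint ι Qι r
            ... | veq | dis with B ι r | V ι r
            ... | true | true = contradiction (dis refl) λ ()
            ... | true | false = refl
            ... | false | true = trans (cong (_≡ᵇ j) (suc-injective (trans (sym (+-comm _ 1)) (trans veq vj′)))) (≡ᵇ-refl j)
            ... | false | false = trans (cong (_≡ᵇ j) (trans (sym (+-identityʳ _)) (trans veq vj′))) (≢⇒≡ᵇ {suc j} {j} 1+n≢n)
        main (no v≢j) (no v≢j′) rewrite ≢⇒≡ᵇ v≢j | ≢⇒≡ᵇ v≢j′ = begin
          sum (term j) + (suc e + j) * 0    ≡⟨ cong₂ _+_ (sum-zero value) (*-zeroʳ (suc e + j)) ⟩
          0                                 ≡⟨ cong₂ _+_ (*-zeroʳ (cnt R)) (*-zeroʳ (suc j)) ⟨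
          cnt R * 0 + suc j * 0             ∎
          where
          value : ∀ r → term j r ≡ 0
          value r with R r in Rr
          ... | false = refl
          ... | true = trans (term-eq r Rr) (cong ⟦_⟧ (trans (cong ((⟦ B ι r ⟧ ≡ᵇ 0) ∧_) (≢⇒≡ᵇ off)) (Bool.∧-zeroʳ _)))
            where
            off : violated (R ∖ r) ι ≢ j
            off eq with violated-∖ R r ι Rr
            ... | veq with V ι r
            ... | true = v≢j′ (trans (sym veq) (trans (+-comm _ 1) (cong suc eq)))
            ... | false = v≢j (trans (sym veq) (trans (+-identityʳ _) eq))

      -- The sum of `removals` over all labels. With subtraction it would read: the levels j of the
      -- sets R without r add up to (|R| - e - 1 - j) times level j of R plus j + 1 times level j +
      -- 1 of R.
      level-step : ∀ R j → sum (λ r → ⟦ R r ⟧ * level (R ∖ r) j) + (suc e + j) * level R j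
                         ≡ cnt R * level R j + suc j * level R (suc j)
      level-step R j = begin
        sum (λ r → ⟦ R r ⟧ * level (R ∖ r) j) + (suc e + j) * level R j
          ≡⟨ cong₂ _+_ (trans (sum-cong-≗ (λ r → sym (∑ₛ-* ⟦ R r ⟧ (⟦_⟧ ∘ at (R ∖ r) j))))
                              (∑ₛ-swap (λ r ι → ⟦ R r ⟧ * ⟦ at (R ∖ r) j ι ⟧)))
                       (sym (∑ₛ-* (suc e + j) (⟦_⟧ ∘ at R j))) ⟩
        ∑ₛ (λ ι → sum (λ r → ⟦ R r ⟧ * ⟦ at (R ∖ r) j ι ⟧)) + ∑ₛ (λ ι → (suc e + j) * ⟦ at R j ι ⟧)
          ≡⟨ ∑ₛ-+ (λ ι → sum (λ r → ⟦ R r ⟧ * ⟦ at (R ∖ r) j ι ⟧)) (λ ι → (suc e + j) * ⟦ at R j ι ⟧) ⟨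
        ∑ₛ (λ ι → sum (λ r → ⟦ R r ⟧ * ⟦ at (R ∖ r) j ι ⟧) + (suc e + j) * ⟦ at R j ι ⟧)
          ≡⟨ ∑ₛ-cong (removals R j) ⟩
        ∑ₛ (λ ι → cnt R * ⟦ at R j ι ⟧ + suc j * ⟦ at R (suc j) ι ⟧)
          ≡⟨ ∑ₛ-+ (λ ι → cnt R * ⟦ at R j ι ⟧) (λ ι → suc j * ⟦ at R (suc j) ι ⟧) ⟩
        ∑ₛ (λ ι → cnt R * ⟦ at R j ι ⟧) + ∑ₛ (λ ι → suc j * ⟦ at R (suc j) ι ⟧)
          ≡⟨ cong₂ _+_ (∑ₛ-* (cnt R) (⟦_⟧ ∘ at R j)) (∑ₛ-* (suc j) (⟦_⟧ ∘ at R (suc j))) ⟩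
        cnt R * level R j + suc j * level R (suc j) ∎
        where open ≡-Reasoning

    -- When level j does not depend on the set, `level-step` becomes the recursion (j + 1) level (j
    -- + 1) = (e + 1 + j) level j, which `binom j e` satisfies. Each step refers to R with one
    -- element less, so at level j only k - j elements may be missing.
    level-value : ∀ c k → (∀ R → n ≤ cnt R + k → level R 0 ≡ c) →
      ∀ j R → n + j ≤ cnt R + k → level R j ≡ c * binom j e
    level-value c k base zero R le = trans (base R (subst (_≤ cnt R + k) (+-identityʳ n) le)) (sym (*-identityʳ c))
    level-value c k base (suc j) R le = *-cancelˡ-≡ _ _ (suc j) (+-cancelˡ-≡ (cnt R * x) _ _ (begin
      cnt R * x + suc j * level R (suc j)
        ≡⟨ cong (λ z → cnt R * z + suc j * level R (suc j)) (level-value c k base j R le′) ⟨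
      cnt R * level R j + suc j * level R (suc j)
        ≡⟨ level-step R j ⟨
      sum (λ r → ⟦ R r ⟧ * level (R ∖ r) j) + (suc e + j) * level R j
        ≡⟨ cong₂ _+_ (trans (sum-cong-≗ below) (sym (*-distribʳ-sum x (⟦_⟧ ∘ R))))
                     (cong ((suc e + j) *_) (level-value c k base j R le′)) ⟩
      cnt R * x + (suc e + j) * (c * binom j e)
        ≡⟨ cong (cnt R * x +_) (solve 4 (λ e j c b → (con 1 :+ e :+ j) :* (c :* b) := c :* ((con 1 :+ (j :+ e)) :* b)) refl e j c (binom j e)) ⟩
      cnt R * x + c * (suc (j + e) * binom j e)
        ≡⟨ cong (λ z → cnt R * x + c * z) (binom-absorbˡ j e) ⟨
      cnt R * x + c * (suc j * binom (suc j) e)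
        ≡⟨ cong (cnt R * x +_) (solve 3 (λ j c b → c :* ((con 1 :+ j) :* b) := (con 1 :+ j) :* (c :* b)) refl j c (binom (suc j) e)) ⟩
      cnt R * x + suc j * (c * binom (suc j) e) ∎))
      where
      open ≡-Reasoning
      x = c * binom j e
      le′ : n + j ≤ cnt R + k
      le′ = ≤-trans (+-monoʳ-≤ n (n≤1+n j)) le
      below : ∀ r → ⟦ R r ⟧ * level (R ∖ r) j ≡ ⟦ R r ⟧ * x
      below r with R r in Rr
      ... | false = refl
      ... | true = cong (_+ 0) (level-value c k base j (R ∖ r) (≤-pred (subst₂ _≤_ (+-suc n j) (cong (_+ k) card) le)))
        where
        card : cnt R ≡ suc (cnt (R ∖ r))
        card = trans (sym (cnt-∖ R r)) (trans (cong (λ z → cnt (R ∖ r) + ⟦ z ⟧) Rr) (+-comm _ 1))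

module Geometry where
  open import Data.List using ([]; _∷_)
  open import Data.Rational as ℚ
  open import Data.Rational.Properties as ℚ using
    (*-zeroˡ; *-zeroʳ; +-identityˡ; +-identityʳ; *-identityˡ; *-identityʳ; *-comm; *-assoc; +-inverseʳ;
     ≤-refl; ≤-trans; <-trans; <⇒≤; ≤-<-trans; <-≤-trans; <-irrefl; ≤-reflexive; +-mono-≤; +-mono-<; +-mono-<-≤; +-mono-≤-<)
  import Data.Rational.Solver as ℚ-Solver
  open import Algebra.Properties.Semiring.Sum (CommutativeRing.semiring ℚ.+-*-commutativeRing)
    using () renaming (sum to ∑; sum-cong-≗ to ∑-cong; ∑-distrib-+ to ∑-+; ∑-comm to ∑-swap;
      sum-remove to ∑-remove; *-distribˡ-sum to *-∑; *-distribʳ-sum to ∑-*)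
  open import Defs using (IsCauchy; ℝ; mkℝ; seq; isCauchy; PointSet; Point; point; GeneralPosition; AffinelyIndependent;
    HalfSpace; _∈ₕ_; _≐_; Facet; facetSetoid; HasCardinality; NumberOf≤Facets)
  import Defs as ℝ
  open Counting
  open ℚ-Solver.+-*-Solver using (solve; _:=_; _:+_; _:*_; _:-_; :-_; con)
  open ℕ-Solver.+-*-Solver using () renaming (solve to ℕ-solve; _:+_ to _⊕_; _:=_ to _⊜_; _:*_ to _⊛_; con to num)

  -- Order, inverses and finite sums over the rationals.

  0<* : ∀ {a b} → 0ℚ < a → 0ℚ < b → 0ℚ < a * b
  0<* {a} {b} 0<a 0<b = ℚ.positive⁻¹ (a * b) {{ℚ.pos*pos⇒pos a {{ℚ.positive 0<a}} b {{ℚ.positive 0<b}}}}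

  0≤* : ∀ {a b} → 0ℚ ≤ a → 0ℚ ≤ b → 0ℚ ≤ a * b
  0≤* {a} {b} 0≤a 0≤b =
    ℚ.nonNegative⁻¹ (a * b) {{ℚ.nonNeg*nonNeg⇒nonNeg a {{ℚ.nonNegative 0≤a}} b {{ℚ.nonNegative 0≤b}}}}

  0<1 : 0ℚ < 1ℚ
  0<1 = ℚ.positive⁻¹ 1ℚ

  ≤⇒0≤- : ∀ {a b} → a ≤ b → 0ℚ ≤ b - a
  ≤⇒0≤- {a} {b} a≤b = subst (_≤ b - a) (+-inverseʳ a) (ℚ.+-monoˡ-≤ (- a) a≤b)

  <⇒0<- : ∀ {a b} → a < b → 0ℚ < b - a
  <⇒0<- {a} {b} a<b = subst (_< b - a) (+-inverseʳ a) (ℚ.+-monoˡ-< (- a) a<b)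

  0≤-⇒≤ : ∀ {a b} → 0ℚ ≤ b - a → a ≤ b
  0≤-⇒≤ {a} {b} h = subst₂ _≤_ (+-identityˡ a) (solve 2 (λ a b → b :- a :+ a := b) refl a b) (ℚ.+-monoˡ-≤ a h)

  0<-⇒< : ∀ {a b} → 0ℚ < b - a → a < b
  0<-⇒< {a} {b} h = subst₂ _<_ (+-identityˡ a) (solve 2 (λ a b → b :- a :+ a := b) refl a b) (ℚ.+-monoˡ-< a h)

  <0⇒0<- : ∀ {a} → a < 0ℚ → 0ℚ < - a
  <0⇒0<- = ℚ.neg-antimono-<

  0<-⇒<0 : ∀ {a} → 0ℚ < - a → a < 0ℚ
  0<-⇒<0 {a} h = subst (_< 0ℚ) (solve 1 (λ a → :- (:- a) := a) refl a) (ℚ.neg-antimono-< h)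

  0<⇒≢0 : ∀ {a} → 0ℚ < a → a ≢ 0ℚ
  0<⇒≢0 0<a refl = <-irrefl refl 0<a

  ≮0∧≢0⇒0< : ∀ {a} → ¬ (a < 0ℚ) → a ≢ 0ℚ → 0ℚ < a
  ≮0∧≢0⇒0< {a} a≮0 a≢0 with ℚ.<-cmp a 0ℚ
  ... | tri< a<0 _ _ = contradiction a<0 a≮0
  ... | tri≈ _ a≡0 _ = contradiction a≡0 a≢0
  ... | tri> _ _ 0<a = 0<a

  ≢0⇒sign : ∀ {a} → a ≢ 0ℚ → a < 0ℚ ⊎ 0ℚ < a
  ≢0⇒sign {a} a≢0 with ℚ.<-cmp a 0ℚ
  ... | tri< a<0 _ _ = inj₁ a<0
  ... | tri≈ _ a≡0 _ = contradiction a≡0 a≢0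
  ... | tri> _ _ 0<a = inj₂ 0<a

  *-cancel-≡0 : ∀ {a b} → a ≢ 0ℚ → a * b ≡ 0ℚ → b ≡ 0ℚ
  *-cancel-≡0 {a} {b} a≢0 ab≡0 = begin
    b                    ≡⟨ *-identityˡ b ⟨
    1ℚ * b               ≡⟨ cong (_* b) (ℚ.*-inverseˡ a) ⟨
    (1/ a * a) * b       ≡⟨ *-assoc (1/ a) a b ⟩
    1/ a * (a * b)       ≡⟨ cong (1/ a *_) ab≡0 ⟩
    1/ a * 0ℚ            ≡⟨ *-zeroʳ (1/ a) ⟩
    0ℚ                   ∎
    where
    open ≡-Reasoning
    instance _ = ≢-nonZero a≢0

  *≢0 : ∀ {a b} → a ≢ 0ℚ → b ≢ 0ℚ → a * b ≢ 0ℚ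
  *≢0 a≢0 b≢0 = b≢0 ∘ *-cancel-≡0 a≢0

  square-pos : ∀ {a} → a ≢ 0ℚ → 0ℚ < a * a
  square-pos {a} a≢0 with ≢0⇒sign a≢0
  ... | inj₂ 0<a = 0<* 0<a 0<a
  ... | inj₁ a<0 = subst (0ℚ <_) (solve 1 (λ a → :- a :* :- a := a :* a) refl a) (0<* (<0⇒0<- a<0) (<0⇒0<- a<0))

  square-nonneg : ∀ a → 0ℚ ≤ a * a
  square-nonneg a with a ≟ 0ℚ
  ... | yes refl = ≤-refl
  ... | no a≢0 = <⇒≤ (square-pos a≢0)

  abstract
    -- inv 0ℚ = 0ℚ.
    inv : ℚ → ℚ
    inv a with a ≟ 0ℚ
    ... | yes _ = 0ℚ
    ... | no a≢0 = 1/_ a {{≢-nonZero a≢0}}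

    inv-inverse : ∀ {a} → a ≢ 0ℚ → a * inv a ≡ 1ℚ
    inv-inverse {a} a≢0 with a ≟ 0ℚ
    ... | yes a≡0 = contradiction a≡0 a≢0
    ... | no a≢0′ = ℚ.*-inverseʳ a {{≢-nonZero a≢0′}}

    0<inv : ∀ {a} → 0ℚ < a → 0ℚ < inv a
    0<inv {a} 0<a with a ≟ 0ℚ
    ... | yes refl = 0<a
    ... | no a≢0 = ℚ.positive⁻¹ (1/_ a {{≢-nonZero a≢0}}) {{ℚ.1/pos⇒pos a {{ℚ.positive 0<a}}}}

  abstract
    positive? : ℚ → Bool
    positive? a = does (0ℚ <? a)

    positive⇒0< : ∀ {a} → positive? a ≡ true → 0ℚ < a
    positive⇒0< {a} = go (0ℚ <? a)
      where
      go : (p : Dec (0ℚ < a)) → does p ≡ true → 0ℚ < a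
      go (yes 0<a) _ = 0<a

    0<⇒positive : ∀ {a} → 0ℚ < a → positive? a ≡ true
    0<⇒positive {a} = dec-true (0ℚ <? a)

    ≤0⇒nonpositive : ∀ {a} → a ≤ 0ℚ → positive? a ≡ false
    ≤0⇒nonpositive {a} a≤0 = dec-false (0ℚ <? a) λ 0<a → <-irrefl refl (<-≤-trans 0<a a≤0)

  nonpositive⇒≤0 : ∀ {a} → positive? a ≡ false → a ≤ 0ℚ
  nonpositive⇒≤0 eq = ℚ.≮⇒≥ λ 0<a → contradiction (trans (sym (0<⇒positive 0<a)) eq) λ ()

  part : ℚ → ℚ
  part a = if positive? a then a else 0ℚ

  0≤part : ∀ a → 0ℚ ≤ part a
  0≤part a with positive? a in eq
  ... | true = <⇒≤ (positive⇒0< eq)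
  ... | false = ≤-refl

  part-pos : ∀ {a} → 0ℚ < a → part a ≡ a
  part-pos {a} 0<a rewrite 0<⇒positive 0<a = refl

  part-neg : ∀ {a} → a ≤ 0ℚ → part a ≡ 0ℚ
  part-neg {a} a≤0 rewrite ≤0⇒nonpositive a≤0 = refl

  0≤⇒-≤0 : ∀ {a} → 0ℚ ≤ a → - a ≤ 0ℚ
  0≤⇒-≤0 = ℚ.neg-antimono-≤

  part-disjoint : ∀ a → part a ≡ 0ℚ ⊎ part (- a) ≡ 0ℚ
  part-disjoint a with ℚ.≤-total a 0ℚ
  ... | inj₁ a≤0 = inj₁ (part-neg a≤0)
  ... | inj₂ 0≤a = inj₂ (part-neg (0≤⇒-≤0 0≤a))

  part-nonzero : ∀ {a} → a ≢ 0ℚ → 0ℚ < part a ⊎ 0ℚ < part (- a)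
  part-nonzero a≢0 with ≢0⇒sign a≢0
  ... | inj₁ a<0 = inj₂ (subst (0ℚ <_) (sym (part-pos (<0⇒0<- a<0))) (<0⇒0<- a<0))
  ... | inj₂ 0<a = inj₁ (subst (0ℚ <_) (sym (part-pos 0<a)) 0<a)

  part-difference : ∀ a → part a - part (- a) ≡ a
  part-difference a with ℚ.<-cmp a 0ℚ
  ... | tri< a<0 _ _ rewrite part-neg (<⇒≤ a<0) | part-pos (<0⇒0<- a<0) = solve 1 (λ a → con 0ℚ :- (:- a) := a) refl a
  ... | tri≈ _ refl _ rewrite part-neg (≤-refl {0ℚ}) = refl
  ... | tri> _ _ 0<a rewrite part-pos 0<a | part-neg (0≤⇒-≤0 (<⇒≤ 0<a)) = +-identityʳ a

  ∑-zero : ∀ {n} {f : Fin n → ℚ} → (∀ i → f i ≡ 0ℚ) → ∑ f ≡ 0ℚ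
  ∑-zero {zero} eq = refl
  ∑-zero {suc n} eq = cong₂ _+_ (eq zero) (∑-zero (eq ∘ suc))

  ∑-single : ∀ {n} {f : Fin n → ℚ} t → (∀ i → i ≢ t → f i ≡ 0ℚ) → ∑ f ≡ f t
  ∑-single {suc n} {f} t eq = trans (∑-remove {i = t} f)
    (trans (cong (f t +_) (∑-zero λ i → eq _ (Fin.punchInᵢ≢i t i))) (+-identityʳ (f t)))

  ∑-nonneg : ∀ {n} {f : Fin n → ℚ} → (∀ i → 0ℚ ≤ f i) → 0ℚ ≤ ∑ f
  ∑-nonneg {zero} le = ≤-refl
  ∑-nonneg {suc n} le = +-mono-≤ (le zero) (∑-nonneg (le ∘ suc))

  ∑-pos : ∀ {n} {f : Fin n → ℚ} → (∀ i → 0ℚ ≤ f i) → ∀ t → 0ℚ < f t → 0ℚ < ∑ f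
  ∑-pos {suc n} {f} le t lt = subst (0ℚ <_) (sym (∑-remove {i = t} f))
    (+-mono-<-≤ lt (∑-nonneg λ i → le (punchIn t i)))

  ∑-neg : ∀ {n} (f : Fin n → ℚ) → ∑ (λ i → - f i) ≡ - ∑ f
  ∑-neg {zero} f = refl
  ∑-neg {suc n} f = trans (cong (- f zero +_) (∑-neg (f ∘ suc))) (sym (ℚ.neg-distrib-+ (f zero) _))

  ∃-pos : ∀ {n} {f : Fin n → ℚ} → 0ℚ < ∑ f → ∃ λ i → 0ℚ < f i
  ∃-pos {zero} lt = contradiction lt (<-irrefl refl)
  ∃-pos {suc n} {f} lt with 0ℚ <? f zero
  ... | yes p = zero , p
  ... | no p with ∃-pos {f = f ∘ suc} (≮⇒ (0ℚ <? ∑ (f ∘ suc)))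
    where
    ≮⇒ : Dec (0ℚ < ∑ (f ∘ suc)) → 0ℚ < ∑ (f ∘ suc)
    ≮⇒ (yes q) = q
    ≮⇒ (no q) = contradiction (<-≤-trans lt (+-mono-≤ (ℚ.≮⇒≥ p) (ℚ.≮⇒≥ q))) (<-irrefl refl)
  ... | i , q = suc i , q

  argmin : ∀ {A : Set} {P : A → Set} → Decidable P → (κ : A → ℚ) → ∀ xs → (∃ λ x → x ∈ xs × P x) →
    ∃ λ x → P x × ∀ y → y ∈ xs → P y → κ x ≤ κ y
  argmin {A} {P} P? κ (x ∷ xs) some with P? x | any xs
    where
    any : ∀ ys → Dec (∃ λ y → y ∈ ys × P y)
    any [] = no λ ()
    any (y ∷ ys) with P? y | any ys
    ... | yes py | _ = yes (y , here refl , py)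
    ... | no _ | yes (z , z∈ , pz) = yes (z , there z∈ , pz)
    ... | no ¬py | no ¬pz = no λ { (_ , here refl , py) → ¬py py ; (z , there z∈ , pz) → ¬pz (z , z∈ , pz) }
  argmin P? κ (x ∷ xs) (y , here refl , py) | no ¬px | no _ = contradiction py ¬px
  argmin P? κ (x ∷ xs) (y , there y∈ , py) | no ¬px | no ¬any = contradiction (y , y∈ , py) ¬any
  argmin P? κ (x ∷ xs) some | yes px | no ¬any = x , px ,
    λ { _ (here refl) _ → ≤-refl ; y (there y∈) py → contradiction (y , y∈ , py) ¬any }
  argmin P? κ (x ∷ xs) some | no ¬px | yes any = let z , pz , min = argmin P? κ xs any in z , pz ,
    λ { _ (here refl) py → contradiction py ¬px ; y (there y∈) py → min y y∈ py }
  argmin P? κ (x ∷ xs) some | yes px | yes any with argmin P? κ xs any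
  ... | z , pz , min with κ x ≤? κ z
  ...   | yes le = x , px , λ { _ (here refl) _ → ≤-refl ; y (there y∈) py → ≤-trans le (min y y∈ py) }
  ...   | no nle = z , pz , λ { _ (here refl) _ → <⇒≤ (ℚ.≰⇒> nle) ; y (there y∈) py → min y y∈ py }

  -- Weights, values and configurations.

  infix 8 ⟨_,_⟩

  ⟨_,_⟩ : ∀ {n} → (Fin n → ℚ) → (Fin n → ℚ) → ℚ
  ⟨ u , v ⟩ = ∑ (λ i → u i * v i)

  ⟨⟩-comb : ∀ {n} a b (u u′ v : Fin n → ℚ) →
    ⟨ (λ i → a * u i + b * u′ i) , v ⟩ ≡ a * ⟨ u , v ⟩ + b * ⟨ u′ , v ⟩
  ⟨⟩-comb a b u u′ v = begin
    ∑ (λ i → (a * u i + b * u′ i) * v i)                           ≡⟨ ∑-cong (λ i → lemma a b (u i) (u′ i) (v i)) ⟩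
    ∑ (λ i → a * (u i * v i) + b * (u′ i * v i))                   ≡⟨ ∑-+ (λ i → a * (u i * v i)) (λ i → b * (u′ i * v i)) ⟩
    ∑ (λ i → a * (u i * v i)) + ∑ (λ i → b * (u′ i * v i))         ≡⟨ cong₂ _+_ (*-∑ a (λ i → u i * v i)) (*-∑ b (λ i → u′ i * v i)) ⟨
    a * ⟨ u , v ⟩ + b * ⟨ u′ , v ⟩                                 ∎
    where
    open ≡-Reasoning
    lemma : ∀ a b u u′ v → (a * u + b * u′) * v ≡ a * (u * v) + b * (u′ * v)
    lemma = solve 5 (λ a b u u′ v → (a :* u :+ b :* u′) :* v := a :* (u :* v) :+ b :* (u′ :* v)) refl

  ⟨⟩-comm : ∀ {n} (u v : Fin n → ℚ) → ⟨ u , v ⟩ ≡ ⟨ v , u ⟩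
  ⟨⟩-comm u v = ∑-cong λ i → *-comm (u i) (v i)

  ⟨⟩-combʳ : ∀ {n} a b (u v v′ : Fin n → ℚ) →
    ⟨ u , (λ i → a * v i + b * v′ i) ⟩ ≡ a * ⟨ u , v ⟩ + b * ⟨ u , v′ ⟩
  ⟨⟩-combʳ a b u v v′ = trans (⟨⟩-comm u _) (trans (⟨⟩-comb a b v v′ u)
    (cong₂ (λ x y → a * x + b * y) (⟨⟩-comm v u) (⟨⟩-comm v′ u)))

  ⟨⟩-congʳ : ∀ {n} (u : Fin n → ℚ) {v v′ : Fin n → ℚ} → (∀ i → v i ≡ v′ i) → ⟨ u , v ⟩ ≡ ⟨ u , v′ ⟩
  ⟨⟩-congʳ u eq = ∑-cong λ i → cong (u i *_) (eq i)

  ⟨⟩-congˡ : ∀ {n} {u u′ : Fin n → ℚ} (v : Fin n → ℚ) → (∀ i → u i ≡ u′ i) → ⟨ u , v ⟩ ≡ ⟨ u′ , v ⟩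
  ⟨⟩-congˡ v eq = ∑-cong λ i → cong (_* v i) (eq i)

  unit : ∀ {n} → Fin n → Fin n → ℚ
  unit x i = if does (i Fin.≟ x) then 1ℚ else 0ℚ

  unit-self : ∀ {n} (x : Fin n) → unit x x ≡ 1ℚ
  unit-self x rewrite dec-true (x Fin.≟ x) refl = refl

  unit-other : ∀ {n} {x i : Fin n} → i ≢ x → unit x i ≡ 0ℚ
  unit-other {x = x} {i} i≢x rewrite dec-false (i Fin.≟ x) i≢x = refl

  0≤unit : ∀ {n} (x i : Fin n) → 0ℚ ≤ unit x i
  0≤unit x i with does (i Fin.≟ x)
  ... | true = <⇒≤ 0<1
  ... | false = ≤-refl

  ⟨unit,⟩ : ∀ {n} (x : Fin n) v → ⟨ unit x , v ⟩ ≡ v x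
  ⟨unit,⟩ x v = trans (∑-single x λ i i≢x → trans (cong (_* v i) (unit-other i≢x)) (*-zeroˡ (v i)))
    (trans (cong (_* v x) (unit-self x)) (*-identityˡ (v x)))

  -- An affine configuration of n points in general position in dimension d, seen
  -- through the space W of value vectors of the affine functionals. The functional
  -- f σ spans the line of those vanishing on the d-element set σ.

  record Config (d n : ℕ) : Set₁ where
    field
      W      : (Fin n → ℚ) → Set
      W-ext  : ∀ {v w} → (∀ i → v i ≡ w i) → W v → W w
      W-comb : ∀ a b {v w} → W v → W w → W (λ i → a * v i + b * w i)
      f      : Subset n → Fin n → ℚ
      f∈W    : ∀ {σ} → cnt (lookup σ) ≡ d → W (f σ)
      f-on   : ∀ {σ} → cnt (lookup σ) ≡ d → ∀ i → lookup σ i ≡ true → f σ i ≡ 0ℚ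
      f-off  : ∀ {σ} → cnt (lookup σ) ≡ d → ∀ i → lookup σ i ≡ false → f σ i ≢ 0ℚ
      unique : ∀ {w} → W w → ∀ τ → cnt τ ≡ suc d → (∀ i → τ i ≡ true → w i ≡ 0ℚ) → ∀ i → w i ≡ 0ℚ
      h      : Fin n → ℚ
      h∈W    : W h
      0<h    : ∀ i → 0ℚ < h i

  module ConfigProperties {d n : ℕ} (C : Config d n) where
    open Config C public

    face : (Fin n → Bool) → Fin n → ℚ
    face σ = f (tabulate σ)

    private
      size : ∀ {σ : Fin n → Bool} {m} → cnt σ ≡ m → cnt (lookup (tabulate σ)) ≡ m
      size {σ} eq = trans (cnt-cong (Vec.lookup∘tabulate σ)) eq

    face∈W : ∀ {σ} → cnt σ ≡ d → W (face σ)
    face∈W eq = f∈W (size eq)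

    face-on : ∀ {σ} → cnt σ ≡ d → ∀ i → σ i ≡ true → face σ i ≡ 0ℚ
    face-on {σ} eq i i∈σ = f-on (size eq) i (trans (Vec.lookup∘tabulate σ i) i∈σ)

    face-off : ∀ {σ} → cnt σ ≡ d → ∀ i → σ i ≡ false → face σ i ≢ 0ℚ
    face-off {σ} eq i i∉σ = f-off (size eq) i (trans (Vec.lookup∘tabulate σ i) i∉σ)

    W-zero : W (λ _ → 0ℚ)
    W-zero = W-ext (λ i → solve 1 (λ x → con 0ℚ :* x :+ con 0ℚ :* x := con 0ℚ) refl (h i)) (W-comb 0ℚ 0ℚ h∈W h∈W)

    W-sum : ∀ {m} (c : Fin m → ℚ) (g : Fin m → Fin n → ℚ) → (∀ s → W (g s)) → W (λ i → ∑ (λ s → c s * g s i))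
    W-sum {zero} c g g∈W = W-zero
    W-sum {suc m} c g g∈W = W-ext (λ i → cong (c zero * g zero i +_) (*-identityˡ _))
      (W-comb (c zero) 1ℚ (g∈W zero) (W-sum (c ∘ suc) (g ∘ suc) (g∈W ∘ suc)))

    -- In general position d + 1 points are a basis of the dual of W, and `dual s` is the Lagrange
    -- functional of s: 1 at s and 0 on the rest of σ. It is 0 for s outside σ so that sums can run
    -- over all of `Fin n`.
    module Basis (σ : Fin n → Bool) (size-σ : cnt σ ≡ suc d) where

      size-∖ : ∀ {s} → σ s ≡ true → cnt (σ ∖ s) ≡ d
      size-∖ {s} s∈σ = ℕ.suc-injective (trans (sym (ℕ.+-comm _ 1))
        (trans (sym (cong (λ z → cnt (σ ∖ s) ℕ.+ ⟦ z ⟧) s∈σ)) (trans (cnt-∖ σ s) size-σ)))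

      dual : Fin n → Fin n → ℚ
      dual s i = if σ s then inv (face (σ ∖ s) s) * face (σ ∖ s) i else 0ℚ

      dual-outside : ∀ {s} → σ s ≡ false → ∀ i → dual s i ≡ 0ℚ
      dual-outside s∉σ i rewrite s∉σ = refl

      dual-self : ∀ {s} → σ s ≡ true → dual s s ≡ 1ℚ
      dual-self {s} s∈σ rewrite s∈σ =
        trans (*-comm (inv (face (σ ∖ s) s)) (face (σ ∖ s) s)) (inv-inverse (face-off (size-∖ s∈σ) s (∖-self σ s)))

      dual-other : ∀ {s i} → σ i ≡ true → i ≢ s → dual s i ≡ 0ℚ
      dual-other {s} {i} i∈σ i≢s with σ s in s∈σ
      ... | false = refl
      ... | true = trans (cong (inv (face (σ ∖ s) s) *_) (face-on (size-∖ s∈σ) i (trans (∖-other σ s i i≢s) i∈σ)))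
          (*-zeroʳ (inv (face (σ ∖ s) s)))

      dual∈W : ∀ s → W (dual s)
      dual∈W s with σ s in s∈σ
      ... | false = W-zero
      ... | true = W-ext (λ i → solve 2 (λ a x → a :* x :+ con 0ℚ :* x := a :* x) refl (inv (face (σ ∖ s) s)) (face (σ ∖ s) i))
        (W-comb (inv (face (σ ∖ s) s)) 0ℚ (face∈W (size-∖ s∈σ)) (face∈W (size-∖ s∈σ)))

      -- Lagrange interpolation: both sides agree on the d + 1 points of σ, hence everywhere by
      -- `unique`.
      expansion : ∀ {v} → W v → ∀ i → v i ≡ ⟨ (λ s → dual s i) , v ⟩
      expansion {v} v∈W i = trans (sym (cancel (v i) _)) (trans (cong (_+ S i) zero-everywhere) (+-identityˡ _))
        where
        S : Fin n → ℚ
        S i = ⟨ (λ s → dual s i) , v ⟩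
        cancel : ∀ a b → 1ℚ * a + - 1ℚ * b + b ≡ a
        cancel = solve 2 (λ a b → con 1ℚ :* a :+ con (- 1ℚ) :* b :+ b := a) refl
        S∈W : W S
        S∈W = W-ext (λ i → ⟨⟩-comm v (λ s → dual s i)) (W-sum v dual dual∈W)
        agrees : ∀ i → σ i ≡ true → S i ≡ v i
        agrees i i∈σ = trans (∑-single i λ s s≢i → trans (cong (_* v s) (dual-other i∈σ (s≢i ∘ sym))) (*-zeroˡ (v s)))
          (trans (cong (_* v i) (dual-self i∈σ)) (*-identityˡ (v i)))
        zero-everywhere : 1ℚ * v i + - 1ℚ * S i ≡ 0ℚ
        zero-everywhere = unique (W-comb 1ℚ (- 1ℚ) v∈W S∈W) σ size-σ
          (λ i i∈σ → trans (cong (λ z → 1ℚ * v i + - 1ℚ * z) (agrees i i∈σ))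
            (solve 1 (λ a → con 1ℚ :* a :+ con (- 1ℚ) :* a := con 0ℚ) refl (v i))) i

    -- A weight vector c stands for the linear form `⟨ c , v ⟩` in v on W, that is, for the sum of
    -- the points with weights c in homogeneous coordinates. Two weight vectors are the same vector
    -- when these forms agree on W.
    record Represents (c a : Fin n → ℚ) : Set where
      constructor representing
      field on : ∀ {v} → W v → ⟨ c , v ⟩ ≡ ⟨ a , v ⟩

    open Represents public

  -- Simplicial cones and pivoting.

  RatioTest : ∀ {n} → (a b : Fin n → ℚ) → Set
  RatioTest a b = ∃ λ t → ∃ λ s → 0ℚ < b s × t * b s ≡ a s × 0ℚ ≤ t × ∀ i → 0ℚ ≤ a i - t * b i

  abstract
    -- The step t is the least quotient `a i` / `b i` over the i with `b i` positive, and s attains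
    -- it.
    ratio-test : ∀ {n} (a b : Fin n → ℚ) → (∀ i → 0ℚ ≤ a i) → (∃ λ i → 0ℚ < b i) → RatioTest a b
    ratio-test {n} a b 0≤a (j , 0<bj)
      with argmin (λ i → 0ℚ <? b i) (λ i → a i * inv (b i)) (List.allFin n) (j , List.∈-allFin j , 0<bj)
    ... | s , 0<bs , min = κ s , s , 0<bs , cancels s 0<bs , 0≤t , rest
      where
      κ : Fin n → ℚ
      κ i = a i * inv (b i)
      0≤t : 0ℚ ≤ κ s
      0≤t = 0≤* (0≤a s) (<⇒≤ (0<inv 0<bs))
      cancels : ∀ i → 0ℚ < b i → κ i * b i ≡ a i
      cancels i 0<bi = trans (*-assoc (a i) (inv (b i)) (b i))
        (trans (cong (a i *_) (trans (*-comm (inv (b i)) (b i)) (inv-inverse (0<⇒≢0 0<bi)))) (*-identityʳ (a i)))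
      flip-sign : ∀ a t b → a + t * (- b) ≡ a - t * b
      flip-sign = solve 3 (λ a t b → a :+ t :* (:- b) := a :- t :* b) refl
      rest : ∀ i → 0ℚ ≤ a i - κ s * b i
      rest i with 0ℚ <? b i
      ... | yes 0<bi = ≤⇒0≤- (subst (κ s * b i ≤_) (cancels i 0<bi)
        (ℚ.*-monoʳ-≤-nonNeg (b i) {{ℚ.nonNegative (<⇒≤ 0<bi)}} (min i (List.∈-allFin i) 0<bi)))
      ... | no 0≮bi = subst (0ℚ ≤_) (flip-sign (a i) (κ s) (b i))
        (+-mono-≤ (0≤a i) (0≤* 0≤t (ℚ.neg-antimono-≤ (ℚ.≮⇒≥ 0≮bi))))

  module Cones {e n : ℕ} (C : Config e n) where
    open ConfigProperties C

    module Coefficients (c : Fin n → ℚ) (σ : Fin n → Bool) (size-σ : cnt σ ≡ suc e) where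
      open Basis σ size-σ

      coefficient : Fin n → ℚ
      coefficient s = ⟨ c , dual s ⟩

      coefficient-outside : ∀ s → σ s ≡ false → coefficient s ≡ 0ℚ
      coefficient-outside s s∉σ = ∑-zero λ i → trans (cong (c i *_) (dual-outside s∉σ i)) (*-zeroʳ (c i))

      represents : Represents c coefficient
      represents = representing λ {v} v∈W → begin
        ∑ (λ i → c i * v i)
          ≡⟨ ∑-cong (λ i → trans (cong (c i *_) (expansion v∈W i)) (*-∑ (c i) (λ s → dual s i * v s))) ⟩
        ∑ (λ i → ∑ (λ s → c i * (dual s i * v s)))
          ≡⟨ ∑-swap (λ i s → c i * (dual s i * v s)) ⟩
        ∑ (λ s → ∑ (λ i → c i * (dual s i * v s)))
          ≡⟨ ∑-cong (λ s → trans (∑-cong λ i → sym (*-assoc (c i) (dual s i) (v s))) (sym (∑-* (v s) (λ i → c i * dual s i)))) ⟩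
        ∑ (λ s → coefficient s * v s) ∎
        where open ≡-Reasoning

      coefficient-unique : ∀ {a} → (∀ i → σ i ≡ false → a i ≡ 0ℚ) → Represents c a → ∀ s → σ s ≡ true → coefficient s ≡ a s
      coefficient-unique {a} off rep s s∈σ = trans (on rep (dual∈W s)) (trans (∑-single s other)
        (trans (cong (a s *_) (dual-self s∈σ)) (*-identityʳ (a s))))
        where
        other : ∀ i → i ≢ s → a i * dual s i ≡ 0ℚ
        other i i≢s with σ i in i∈σ
        ... | true = trans (cong (a i *_) (dual-other i∈σ i≢s)) (*-zeroʳ (a i))
        ... | false = trans (cong (_* dual s i) (off i i∈σ)) (*-zeroˡ (dual s i))

    record InCone (c : Fin n → ℚ) (σ : Fin n → Bool) : Set where
      field
        a          : Fin n → ℚ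
        inside     : ∀ i → σ i ≡ true → 0ℚ < a i
        outside    : ∀ i → σ i ≡ false → a i ≡ 0ℚ
        represents : Represents c a

    -- Coefficients with respect to a basis are unique, so it is enough to test the signs of these.
    inCone? : ∀ c σ → cnt σ ≡ suc e → Dec (InCone c σ)
    inCone? c σ size-σ with Fin.all? (λ i → (σ i Bool.≟ true) →-dec (0ℚ <? Coefficients.coefficient c σ size-σ i))
    ... | yes pos = yes record
      { a = coefficient ; inside = pos ; outside = coefficient-outside ; represents = represents }
      where open Coefficients c σ size-σ
    ... | no ¬pos = no λ ic → ¬pos λ i i∈σ → subst (0ℚ <_)
      (sym (Coefficients.coefficient-unique c σ size-σ (InCone.outside ic) (InCone.represents ic) i i∈σ)) (InCone.inside ic i i∈σ)

    -- The ratio test of the simplex method: x enters the representation a of c, and an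
    -- element of the basis σ leaves it.
    record Pivot (c a : Fin n → ℚ) (σ : Fin n → Bool) (x : Fin n) : Set where
      field
        a′         : Fin n → ℚ
        s          : Fin n
        s∈σ        : σ s ≡ true
        0≤a′       : ∀ i → 0ℚ ≤ a′ i
        a′-s       : a′ s ≡ 0ℚ
        a′-outside : ∀ i → a i ≡ 0ℚ → σ i ≡ false → i ≢ x → a′ i ≡ 0ℚ
        represents : Represents c a′

    -- With b the coordinates of x in the basis σ, c is unchanged when t times x comes in and t
    -- times b goes out. As `h` is positive at every point and `h x` is the sum of the `b s * h s`,
    -- some `b s` is positive; this is what bounds the step.
    pivot-exists : ∀ {c a} → Represents c a → (∀ i → 0ℚ ≤ a i) → ∀ σ → cnt σ ≡ suc e → ∀ x → σ x ≡ false → Pivot c a σ x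
    pivot-exists {c} {a} rep 0≤a σ size-σ x x∉σ = leaving (ratio-test a b 0≤a entering)
      where
      open ≡-Reasoning
      open Basis σ size-σ
      b : Fin n → ℚ
      b s = dual s x
      entering : ∃ λ i → 0ℚ < b i
      entering with ∃-pos (subst (0ℚ <_) (expansion h∈W x) (0<h x))
      ... | i , 0<bh = i , ℚ.*-cancelʳ-<-nonNeg (h i) {{ℚ.nonNegative (<⇒≤ (0<h i))}} (subst (_< b i * h i) (sym (*-zeroˡ (h i))) 0<bh)
      leaving : RatioTest a b → Pivot c a σ x
      leaving (t , s , 0<bs , tb , 0≤t , rest) = record
        { a′ = a′ ; s = s ; s∈σ = s∈σ
        ; 0≤a′ = λ i → +-mono-≤ (rest i) (0≤* {t} {unit x i} 0≤t (0≤unit x i))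
        ; a′-s = trans (cong₂ (λ y z → (a s - y) + t * z) tb (unit-other s≢x))
            (trans (cong (λ z → (a s - a s) + z) (*-zeroʳ t)) (trans (+-identityʳ (a s - a s)) (+-inverseʳ (a s))))
        ; a′-outside = λ i ai≡0 i∉σ i≢x → trans
            (cong₂ (λ y z → (y - t * z) + t * unit x i) ai≡0 (dual-outside i∉σ x))
            (trans (cong (λ z → (0ℚ - t * 0ℚ) + t * z) (unit-other i≢x)) (vanishing t))
        ; represents = a′-represents
        }
        where
        s∈σ : σ s ≡ true
        s∈σ = Bool.¬-not λ s∉σ → 0<⇒≢0 0<bs (dual-outside s∉σ x)
        s≢x : s ≢ x
        s≢x s≡x = contradiction (trans (sym (subst (λ z → σ z ≡ true) s≡x s∈σ)) x∉σ) λ ()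
        a′ : Fin n → ℚ
        a′ i = (a i - t * b i) + t * unit x i
        vanishing : ∀ t → (0ℚ - t * 0ℚ) + t * 0ℚ ≡ 0ℚ
        vanishing = solve 1 (λ t → (con 0ℚ :- t :* con 0ℚ) :+ t :* con 0ℚ := con 0ℚ) refl
        lemma₁ : ∀ y t z → y ≡ 1ℚ * (1ℚ * y + (- t) * z) + t * z
        lemma₁ = solve 3 (λ y t z → y := con 1ℚ :* (con 1ℚ :* y :+ (:- t) :* z) :+ t :* z) refl
        lemma₂ : ∀ a t b u → 1ℚ * (1ℚ * a + (- t) * b) + t * u ≡ (a - t * b) + t * u
        lemma₂ = solve 4 (λ a t b u → con 1ℚ :* (con 1ℚ :* a :+ (:- t) :* b) :+ t :* u := (a :- t :* b) :+ t :* u) refl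
        a′-represents : Represents c a′
        a′-represents = representing λ {v} v∈W → begin
          ⟨ c , v ⟩
            ≡⟨ on rep v∈W ⟩
          ⟨ a , v ⟩
            ≡⟨ lemma₁ ⟨ a , v ⟩ t (v x) ⟩
          1ℚ * (1ℚ * ⟨ a , v ⟩ + (- t) * v x) + t * v x
            ≡⟨ cong₂ (λ y z → 1ℚ * (1ℚ * ⟨ a , v ⟩ + (- t) * y) + t * z) (expansion v∈W x) (sym (⟨unit,⟩ x v)) ⟩
          1ℚ * (1ℚ * ⟨ a , v ⟩ + (- t) * ⟨ b , v ⟩) + t * ⟨ unit x , v ⟩
            ≡⟨ cong (λ y → 1ℚ * y + t * ⟨ unit x , v ⟩) (⟨⟩-comb 1ℚ (- t) a b v) ⟨
          1ℚ * ⟨ (λ i → 1ℚ * a i + (- t) * b i) , v ⟩ + t * ⟨ unit x , v ⟩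
            ≡⟨ ⟨⟩-comb 1ℚ t (λ i → 1ℚ * a i + (- t) * b i) (unit x) v ⟨
          ⟨ (λ i → 1ℚ * (1ℚ * a i + (- t) * b i) + t * unit x i) , v ⟩
            ≡⟨ ⟨⟩-congˡ v (λ i → lemma₂ (a i) t (b i) (unit x i)) ⟩
          ⟨ a′ , v ⟩ ∎

    abstract
      pivot : ∀ {c a} → Represents c a → (∀ i → 0ℚ ≤ a i) → ∀ σ → cnt σ ≡ suc e → ∀ x → σ x ≡ false → Pivot c a σ x
      pivot = pivot-exists

    Generic : (Fin n → ℚ) → Set
    Generic c = ∀ ρ → cnt ρ ≡ e → ⟨ c , face ρ ⟩ ≢ 0ℚ

    ⟨⟩-disjoint : ∀ {a v : Fin n → ℚ} {σ : Fin n → Bool} → (∀ i → σ i ≡ false → a i ≡ 0ℚ) → (∀ i → σ i ≡ true → v i ≡ 0ℚ) → ⟨ a , v ⟩ ≡ 0ℚ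
    ⟨⟩-disjoint {a} {v} {σ} a-off v-on = ∑-zero zero-at
      where
      zero-at : ∀ i → a i * v i ≡ 0ℚ
      zero-at i with σ i in eq
      ... | true = trans (cong (a i *_) (v-on i eq)) (*-zeroʳ (a i))
      ... | false = trans (cong (_* v i) (a-off i eq)) (*-zeroˡ (v i))

    supp : (Fin n → ℚ) → Fin n → Bool
    supp a i = positive? (a i)

    supp-zero : ∀ {a} → (∀ i → 0ℚ ≤ a i) → ∀ i → supp a i ≡ false → a i ≡ 0ℚ
    supp-zero 0≤a i eq = ℚ.≤-antisym (nonpositive⇒≤0 eq) (0≤a i)

    -- A nonnegative representation by at most e points would put c on a hyperplane spanned by e
    -- points.
    supp-large : suc e ℕ.≤ n → ∀ {c a} → Generic c → Represents c a → (∀ i → 0ℚ ≤ a i) → suc e ℕ.≤ cnt (supp a)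
    supp-large e<n {c} {a} generic rep 0≤a with suc e ℕ.≤? cnt (supp a)
    ... | yes p = p
    ... | no p =
      let ρ , supp⊆ρ , _ , size-ρ = cnt-between e {b = supp a} {c = λ _ → true} (λ _ _ → refl) (ℕ.≤-pred (ℕ.≰⇒> p))
                                (subst (e ℕ.≤_) (sym (cnt-all {n} λ _ → refl)) (ℕ.<⇒≤ e<n))
      in contradiction (trans (on rep (face∈W size-ρ)) (⟨⟩-disjoint {σ = ρ}
           (λ i i∉ρ → supp-zero 0≤a i (off supp⊆ρ i i∉ρ)) (face-on size-ρ))) (generic ρ size-ρ)
      where
      off : ∀ {ρ : Fin n → Bool} → (∀ i → supp a i ≡ true → ρ i ≡ true) → ∀ i → ρ i ≡ false → supp a i ≡ false
      off sub i i∉ρ = Bool.¬-not λ i∈ → contradiction (trans (sym (sub i i∈)) i∉ρ) λ ()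

    carathéodory : suc e ℕ.≤ n → ∀ {c} (R : Fin n → Bool) → Generic c → ∀ m (a : Fin n → ℚ) → Represents c a → (∀ i → 0ℚ ≤ a i) →
      (∀ i → R i ≡ false → a i ≡ 0ℚ) → cnt (supp a) ℕ.≤ m ℕ.+ suc e →
      ∃ λ σ → cnt σ ≡ suc e × (∀ i → σ i ≡ true → R i ≡ true) × InCone c σ
    carathéodory e<n {c} R generic m a rep 0≤a off-R le with cnt (supp a) ℕ.≟ suc e
    ... | yes size = supp a , size , inR , record
      { a = a ; inside = λ _ → positive⇒0< ; outside = supp-zero 0≤a ; represents = rep }
      where
      inR : ∀ i → supp a i ≡ true → R i ≡ true
      inR i i∈ = Bool.¬-not λ i∉R → 0<⇒≢0 (positive⇒0< i∈) (off-R i i∉R)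
    carathéodory e<n {c} R generic zero a rep 0≤a off-R le | no size =
      contradiction (ℕ.≤-antisym le (supp-large e<n {c} generic rep 0≤a)) size
    carathéodory e<n {c} R generic (suc m) a rep 0≤a off-R le | no size =
      carathéodory e<n {c} R generic m a′ represents 0≤a′ off-R′ (ℕ.≤-pred (ℕ.≤-trans fewer le))
      where
      large : suc (suc e) ℕ.≤ cnt (supp a)
      large = ℕ.≤∧≢⇒< (supp-large e<n {c} generic rep 0≤a) (size ∘ sym)
      σ-exists = cnt-between (suc e) {b = λ _ → false} {c = supp a} (λ _ ()) (subst (ℕ._≤ suc e) (sym (cnt-none {n} λ _ → refl)) ℕ.z≤n) (ℕ.<⇒≤ large)
      σ = proj₁ σ-exists
      σ⊆supp = proj₁ (proj₂ (proj₂ σ-exists))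
      size-σ = proj₂ (proj₂ (proj₂ σ-exists))
      x-exists = cnt<⇒∃ {b = σ} {c = supp a} (subst (ℕ._< cnt (supp a)) (sym size-σ) large)
      x = proj₁ x-exists
      open Pivot (pivot {c} {a} rep 0≤a σ size-σ x (proj₁ (proj₂ x-exists)))
      vanish : ∀ i → supp a i ≡ false → a′ i ≡ 0ℚ
      vanish i i∉ = a′-outside i (supp-zero 0≤a i i∉) i∉σ i≢x
        where
        i∉σ : σ i ≡ false
        i∉σ = Bool.¬-not λ i∈σ → contradiction (trans (sym (σ⊆supp i i∈σ)) i∉) λ ()
        i≢x : i ≢ x
        i≢x refl = contradiction (trans (sym (proj₂ (proj₂ x-exists))) i∉) λ ()
      off-R′ : ∀ i → R i ≡ false → a′ i ≡ 0ℚ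
      off-R′ i i∉R = vanish i i∉
        where
        i∉ : supp a i ≡ false
        i∉ = Bool.¬-not λ i∈ → 0<⇒≢0 (positive⇒0< i∈) (off-R i i∉R)
      sub : ∀ i → supp a′ i ≡ true → (supp a ∖ s) i ≡ true
      sub i i∈ = trans (∖-other (supp a) s i λ { refl → 0<⇒≢0 (positive⇒0< i∈) a′-s })
        (Bool.¬-not λ i∉ → 0<⇒≢0 (positive⇒0< i∈) (vanish i i∉))
      fewer : suc (cnt (supp a′)) ℕ.≤ cnt (supp a)
      fewer = subst (suc (cnt (supp a′)) ℕ.≤_)
        (trans (sym (ℕ.+-comm _ 1)) (trans (cong (λ z → cnt (supp a ∖ s) ℕ.+ ⟦ z ⟧) (sym (σ⊆supp s s∈σ))) (cnt-∖ (supp a) s)))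
        (ℕ.s≤s (cnt-mono sub))

  -- Linear systems and perturbation.

  kernel : ∀ {n m} (σ : Fin n → Bool) (A : Fin n → Fin m → ℚ) → cnt σ ℕ.< m →
    ∃ λ b → (∃ λ j → b j ≢ 0ℚ) × ∀ i → σ i ≡ true → ⟨ A i , b ⟩ ≡ 0ℚ
  kernel {zero} {suc m} σ A lt = unit zero , (zero , λ ()) , λ ()
  kernel {suc n} {m} σ A lt with σ zero in σ₀
  ... | false = let b , nz , sol = kernel (σ ∘ suc) (A ∘ suc) lt
                in b , nz , λ { zero eq → contradiction (trans (sym σ₀) eq) λ () ; (suc i) eq → sol i eq }
  ... | true with Fin.any? (λ c → ¬? (A zero c ≟ 0ℚ))
  ...   | no none = let b , nz , sol = kernel (σ ∘ suc) (A ∘ suc) (ℕ.<-trans (ℕ.n<1+n _) lt)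
                    in b , nz , λ { zero _ → ∑-zero (λ c → trans (cong (_* b c) (zero-row c)) (*-zeroˡ (b c)))
                                  ; (suc i) eq → sol i eq }
    where
    zero-row : ∀ c → A zero c ≡ 0ℚ
    zero-row c with A zero c ≟ 0ℚ
    ... | yes p = p
    ... | no p = contradiction (c , p) none
  kernel {suc n} {suc m} σ A lt | true | yes (c , Ac≢0) = b , nz , solution
    where
    -- The unknown c is eliminated by cross-multiplication with the first equation, whose
    -- coefficient at c is nonzero.
    A′ : Fin n → Fin m → ℚ
    A′ i j = A zero c * A (suc i) (punchIn c j) - A (suc i) c * A zero (punchIn c j)
    rec = kernel (σ ∘ suc) A′ (ℕ.≤-pred lt)
    b′ = proj₁ rec
    j = proj₁ (proj₁ (proj₂ rec))
    r : (Fin (suc m) → ℚ) → ℚ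
    r a = ∑ (λ j → a (punchIn c j) * b′ j)
    b : Fin (suc m) → ℚ
    b = Vector.insertAt (λ j → A zero c * b′ j) c (- r (A zero))
    nz : ∃ λ j → b j ≢ 0ℚ
    nz = punchIn c j , subst (_≢ 0ℚ) (sym (Vector.insertAt-punchIn _ c _ j)) (*≢0 Ac≢0 (proj₂ (proj₁ (proj₂ rec))))
    split : ∀ a → ⟨ a , b ⟩ ≡ A zero c * r a - a c * r (A zero)
    split a = begin
      ⟨ a , b ⟩
        ≡⟨ ∑-remove {i = c} (λ i → a i * b i) ⟩
      a c * b c + ∑ (λ j → a (punchIn c j) * b (punchIn c j))
        ≡⟨ cong₂ (λ x y → a c * x + y) (Vector.insertAt-lookup _ c _)
             (∑-cong λ j → trans (cong (a (punchIn c j) *_) (Vector.insertAt-punchIn _ c _ j)) (swap (a (punchIn c j)) (A zero c) (b′ j))) ⟩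
      a c * - r (A zero) + ∑ (λ j → A zero c * (a (punchIn c j) * b′ j))
        ≡⟨ cong (a c * - r (A zero) +_) (*-∑ (A zero c) (λ j → a (punchIn c j) * b′ j)) ⟨
      a c * - r (A zero) + A zero c * r a
        ≡⟨ solve 4 (λ x y z w → x :* (:- y) :+ z :* w := z :* w :- x :* y) refl (a c) (r (A zero)) (A zero c) (r a) ⟩
      A zero c * r a - a c * r (A zero) ∎
      where
      open ≡-Reasoning
      swap : ∀ x y z → x * (y * z) ≡ y * (x * z)
      swap = solve 3 (λ x y z → x :* (y :* z) := y :* (x :* z)) refl
    solution : ∀ i → σ i ≡ true → ⟨ A i , b ⟩ ≡ 0ℚ
    solution zero _ = trans (split (A zero)) (+-inverseʳ (A zero c * r (A zero)))
    solution (suc i) i∈σ = trans (split (A (suc i))) (trans (sym expand) (proj₂ (proj₂ rec) i i∈σ))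
      where
      open ≡-Reasoning
      expand : ⟨ A′ i , b′ ⟩ ≡ A zero c * r (A (suc i)) - A (suc i) c * r (A zero)
      expand = begin
        ⟨ A′ i , b′ ⟩
          ≡⟨ ⟨⟩-congˡ b′ (λ j → solve 4 (λ x y z w → x :* y :- z :* w := x :* y :+ (:- z) :* w) refl (A zero c) (A (suc i) (punchIn c j)) (A (suc i) c) (A zero (punchIn c j))) ⟩
        ⟨ (λ j → A zero c * A (suc i) (punchIn c j) + (- A (suc i) c) * A zero (punchIn c j)) , b′ ⟩
          ≡⟨ ⟨⟩-comb (A zero c) (- A (suc i) c) (A (suc i) ∘ punchIn c) (A zero ∘ punchIn c) b′ ⟩
        A zero c * r (A (suc i)) + (- A (suc i) c) * r (A zero)
          ≡⟨ solve 4 (λ x y z w → x :* y :+ (:- z) :* w := x :* y :- z :* w) refl (A zero c) (r (A (suc i))) (A (suc i) c) (r (A zero)) ⟩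
        A zero c * r (A (suc i)) - A (suc i) c * r (A zero) ∎

  -- Openness is needed only in the directions of the axes.
  Open : ∀ {n} → ((Fin n → ℚ) → Set) → Set
  Open {n} P = ∀ c → P c → ∀ x → ∃ λ ε₀ → 0ℚ < ε₀ × ∀ ε → 0ℚ < ε → ε ≤ ε₀ → P (λ i → c i + ε * unit x i)

  private
    min : ∀ {a b} → 0ℚ < a → 0ℚ < b → ∃ λ c → 0ℚ < c × c ≤ a × c ≤ b
    min {a} {b} 0<a 0<b with a ≤? b
    ... | yes a≤b = a , 0<a , ≤-refl , a≤b
    ... | no a≰b = b , 0<b , <⇒≤ (ℚ.≰⇒> a≰b) , ≤-refl

    0<½ : 0ℚ < ½
    0<½ = ℚ.positive⁻¹ ½

    half< : ∀ {a} → 0ℚ < a → ½ * a < a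
    half< {a} 0<a = 0<-⇒< (subst (0ℚ <_) (solve 1 (λ a → con ½ :* a := a :- con ½ :* a) refl a) (0<* 0<½ 0<a))

  Open-× : ∀ {n} {P Q : (Fin n → ℚ) → Set} → Open P → Open Q → Open (λ c → P c × Q c)
  Open-× P-open Q-open c (p , q) x with P-open c p x | Q-open c q x
  ... | a , 0<a , P-step | b , 0<b , Q-step with min 0<a 0<b
  ... | m , 0<m , m≤a , m≤b = m , 0<m , λ ε 0<ε ε≤m → P-step ε 0<ε (≤-trans ε≤m m≤a) , Q-step ε 0<ε (≤-trans ε≤m m≤b)

  Open-∀ : ∀ {n} {A : Set} {P : A → (Fin n → ℚ) → Set} → (∀ a → Open (P a)) → ∀ xs → Open (λ c → ∀ a → a ∈ xs → P a c)
  Open-∀ opens [] c p x = 1ℚ , 0<1 , λ _ _ _ _ ()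
  Open-∀ opens (a ∷ xs) c p x with opens a c (p a (here refl)) x | Open-∀ opens xs c (λ b b∈ → p b (there b∈)) x
  ... | r , 0<r , step | s , 0<s , steps with min 0<r 0<s
  ... | m , 0<m , m≤r , m≤s = m , 0<m , λ { ε 0<ε ε≤m _ (here refl) → step ε 0<ε (≤-trans ε≤m m≤r)
                                          ; ε 0<ε ε≤m b (there b∈) → steps ε 0<ε (≤-trans ε≤m m≤s) b b∈ }

  ⟨⟩-step : ∀ {n} (c : Fin n → ℚ) ε x g → ⟨ (λ i → c i + ε * unit x i) , g ⟩ ≡ ⟨ c , g ⟩ + ε * g x
  ⟨⟩-step c ε x g = begin
    ⟨ (λ i → c i + ε * unit x i) , g ⟩              ≡⟨ ⟨⟩-congˡ g (λ i → cong (_+ ε * unit x i) (sym (*-identityˡ (c i)))) ⟩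
    ⟨ (λ i → 1ℚ * c i + ε * unit x i) , g ⟩         ≡⟨ ⟨⟩-comb 1ℚ ε c (unit x) g ⟩
    1ℚ * ⟨ c , g ⟩ + ε * ⟨ unit x , g ⟩             ≡⟨ cong₂ (λ y z → y + ε * z) (*-identityˡ ⟨ c , g ⟩) (⟨unit,⟩ x g) ⟩
    ⟨ c , g ⟩ + ε * g x                             ∎
    where open ≡-Reasoning

  private
    nonzero-step : ∀ {a} b → a ≢ 0ℚ → ∃ λ ε₀ → 0ℚ < ε₀ × ∀ ε → 0ℚ < ε → ε ≤ ε₀ → a + ε * b ≢ 0ℚ
    nonzero-step {a} b a≢0 with b ≟ 0ℚ
    ... | yes refl = 1ℚ , 0<1 , λ ε _ _ → subst (_≢ 0ℚ) (sym (trans (cong (a +_) (*-zeroʳ ε)) (+-identityʳ a))) a≢0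
    ... | no b≢0 = by-root (0ℚ <? root)
      where
      -- The only zero of `a + ε * b` as a function of ε; if it is positive, half of it is a safe
      -- bound.
      root : ℚ
      root = - a * inv b
      is-root : ∀ {ε} → a + ε * b ≡ 0ℚ → ε ≡ root
      is-root {ε} eq = begin
        ε                          ≡⟨ *-identityʳ ε ⟨
        ε * 1ℚ                     ≡⟨ cong (ε *_) (inv-inverse b≢0) ⟨
        ε * (b * inv b)            ≡⟨ solve 4 (λ a ε b i → ε :* (b :* i) := (a :+ ε :* b) :* i :+ :- a :* i) refl a ε b (inv b) ⟩
        (a + ε * b) * inv b + root ≡⟨ cong (λ z → z * inv b + root) eq ⟩
        0ℚ * inv b + root          ≡⟨ cong (_+ root) (*-zeroˡ (inv b)) ⟩
        0ℚ + root                  ≡⟨ +-identityˡ root ⟩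
        root                       ∎
        where open ≡-Reasoning
      by-root : Dec (0ℚ < root) → ∃ λ ε₀ → 0ℚ < ε₀ × ∀ ε → 0ℚ < ε → ε ≤ ε₀ → a + ε * b ≢ 0ℚ
      by-root (yes 0<r) = ½ * root , 0<* 0<½ 0<r , λ ε 0<ε ε≤ eq →
        <-irrefl refl (≤-<-trans (subst (_≤ ½ * root) (is-root eq) ε≤) (half< 0<r))
      by-root (no 0≮r) = 1ℚ , 0<1 , λ ε 0<ε _ eq → 0≮r (subst (0ℚ <_) (is-root eq) 0<ε)

  Open-nonzero : ∀ {n} κ (g : Fin n → ℚ) → Open (λ c → κ + ⟨ c , g ⟩ ≢ 0ℚ)
  Open-nonzero κ g c nz x with nonzero-step (g x) nz
  ... | ε₀ , 0<ε₀ , step = ε₀ , 0<ε₀ , λ ε 0<ε ε≤ → subst (_≢ 0ℚ)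
    (trans (ℚ.+-assoc κ ⟨ c , g ⟩ (ε * g x)) (cong (κ +_) (sym (⟨⟩-step c ε x g)))) (step ε 0<ε ε≤)

  -- One hyperplane at a time: if c lies on it, a small step along an axis on which it is not
  -- constant leaves it, and having left it is an open condition that joins P for the hyperplanes
  -- still to come.
  perturb : ∀ {n} {A : Set} {P : (Fin n → ℚ) → Set} → Open P → ∀ (κ : A → ℚ) (g : A → Fin n → ℚ) →
    (∀ a c → κ a + ⟨ c , g a ⟩ ≡ 0ℚ → ∃ λ x → g a x ≢ 0ℚ) →
    ∀ xs c → P c → ∃ λ c′ → P c′ × ∀ a → a ∈ xs → κ a + ⟨ c′ , g a ⟩ ≢ 0ℚ
  perturb P-open κ g nz [] c p = c , p , λ _ ()
  perturb {P = P} P-open κ g nz (a ∷ xs) c p =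
    let c₁ , p₁ , nz₁ = first (κ a + ⟨ c , g a ⟩ ≟ 0ℚ)
        c₂ , (p₂ , nz₂) , rest = perturb (Open-× P-open (Open-nonzero (κ a) (g a))) κ g nz xs c₁ (p₁ , nz₁)
    in c₂ , p₂ , λ { _ (here refl) → nz₂ ; b (there b∈) → rest b b∈ }
    where
    first : Dec (κ a + ⟨ c , g a ⟩ ≡ 0ℚ) → ∃ λ c′ → P c′ × κ a + ⟨ c′ , g a ⟩ ≢ 0ℚ
    first (no nonzero) = c , p , nonzero
    first (yes eq) =
      let x , gx≢0 = nz a c eq
          ε₀ , 0<ε₀ , step = P-open c p x
      in _ , step ε₀ 0<ε₀ ≤-refl , λ eq′ → *≢0 (0<⇒≢0 0<ε₀) gx≢0
           (trans (sym (+-identityˡ (ε₀ * g a x))) (trans (cong (_+ ε₀ * g a x) (sym eq))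
             (trans (ℚ.+-assoc (κ a) ⟨ c , g a ⟩ (ε₀ * g a x)) (trans (cong (κ a +_) (sym (⟨⟩-step c ε₀ x (g a)))) eq′))))

  pos-step : ∀ {a} b → 0ℚ < a → ∃ λ ε₀ → 0ℚ < ε₀ × ∀ ε → 0ℚ < ε → ε ≤ ε₀ → 0ℚ < a + ε * b
  pos-step {a} b 0<a with ℚ.<-cmp b 0ℚ
  ... | tri≈ _ refl _ = 1ℚ , 0<1 , λ ε _ _ → subst (0ℚ <_) (sym (trans (cong (a +_) (*-zeroʳ ε)) (+-identityʳ a))) 0<a
  ... | tri> _ _ 0<b = 1ℚ , 0<1 , λ ε 0<ε _ → +-mono-< 0<a (0<* 0<ε 0<b)
  ... | tri< b<0 _ _ = ε₀ , 0<* 0<½ (0<* 0<a (0<inv 0<-b)) , λ ε 0<ε ε≤ → <-≤-trans (0<* 0<½ 0<a) (bound ε ε≤)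
    where
    0<-b = <0⇒0<- b<0
    -- At this step `a + ε * b` has dropped to half of a.
    ε₀ = ½ * (a * inv (- b))
    bound : ∀ ε → ε ≤ ε₀ → ½ * a ≤ a + ε * b
    bound ε ε≤ = 0≤-⇒≤ (subst (0ℚ ≤_) eq (0≤* (≤⇒0≤- ε≤) (<⇒≤ 0<-b)))
      where
      eq : (ε₀ - ε) * - b ≡ a + ε * b - ½ * a
      eq = trans (solve 4 (λ ε a b i → (con ½ :* (a :* i) :- ε) :* (:- b) := con ½ :* a :* ((:- b) :* i) :+ ε :* b) refl ε a b (inv (- b)))
        (trans (cong (λ z → ½ * a * z + ε * b) (inv-inverse (0<⇒≢0 0<-b)))
          (solve 3 (λ ε a b → con ½ :* a :* con 1ℚ :+ ε :* b := a :+ ε :* b :- con ½ :* a) refl ε a b))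

  Open-affine : ∀ {n} κ (g : Fin n → ℚ) → Open (λ c → 0ℚ < κ + ⟨ c , g ⟩)
  Open-affine κ g c p x with pos-step (g x) p
  ... | ε₀ , 0<ε₀ , step = ε₀ , 0<ε₀ , λ ε 0<ε ε≤ → subst (0ℚ <_)
    (trans (ℚ.+-assoc κ ⟨ c , g ⟩ (ε * g x)) (cong (κ +_) (sym (⟨⟩-step c ε x g)))) (step ε 0<ε ε≤)

  pos-steps : ∀ {n} (τ : Fin n → Bool) (a b : Fin n → ℚ) → (∀ i → τ i ≡ true → 0ℚ < a i) →
    ∃ λ ε₀ → 0ℚ < ε₀ × ∀ ε → 0ℚ < ε → ε ≤ ε₀ → ∀ i → τ i ≡ true → 0ℚ < a i + ε * b i
  pos-steps {zero} τ a b 0<a = 1ℚ , 0<1 , λ _ _ _ ()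
  pos-steps {suc n} τ a b 0<a with τ zero in τ₀ | pos-steps (τ ∘ suc) (a ∘ suc) (b ∘ suc) (0<a ∘ suc)
  ... | false | ε₀ , 0<ε₀ , step = ε₀ , 0<ε₀ ,
    λ { ε 0<ε ε≤ zero eq → contradiction (trans (sym τ₀) eq) λ () ; ε 0<ε ε≤ (suc i) → step ε 0<ε ε≤ i }
  ... | true | ε₀ , 0<ε₀ , step with pos-step (b zero) (0<a zero τ₀)
  ...   | ε₁ , 0<ε₁ , step₁ with min 0<ε₀ 0<ε₁
  ...     | m , 0<m , m≤ε₀ , m≤ε₁ = m , 0<m ,
    λ { ε 0<ε ε≤ zero _ → step₁ ε 0<ε (≤-trans ε≤ m≤ε₁) ; ε 0<ε ε≤ (suc i) → step ε 0<ε (≤-trans ε≤ m≤ε₀) i }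

  subsets : ∀ n → List (Subset n)
  subsets zero = Vec.[] ∷ []
  subsets (suc n) = List.map (false Vec.∷_) (subsets n) ++ List.map (true Vec.∷_) (subsets n)

  ∈-subsets : ∀ {n} (σ : Subset n) → σ ∈ subsets n
  ∈-subsets Vec.[] = here refl
  ∈-subsets (false Vec.∷ σ) = List.∈-++⁺ˡ (List.∈-map⁺ (false Vec.∷_) (∈-subsets σ))
  ∈-subsets {suc n} (true Vec.∷ σ) = List.∈-++⁺ʳ (List.map (false Vec.∷_) (subsets n)) (List.∈-map⁺ (true Vec.∷_) (∈-subsets σ))

  -- Helly's theorem for cones and a deep direction.

  ⋂ᵇ : ∀ {M n} → (Fin M → Fin n → Bool) → Fin n → Bool
  ⋂ᵇ {zero} R i = true
  ⋂ᵇ {suc M} R i = R zero i ∧ ⋂ᵇ (R ∘ suc) i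

  ⋂ᵇ-⊆ : ∀ {M n} (R : Fin M → Fin n → Bool) i → ⋂ᵇ R i ≡ true → ∀ j → R j i ≡ true
  ⋂ᵇ-⊆ R i h zero with R zero i
  ... | true = refl
  ⋂ᵇ-⊆ R i h (suc j) with R zero i
  ... | true = ⋂ᵇ-⊆ (R ∘ suc) i h j

  -- In terms of the complements this is the union bound.
  cnt-⋂ᵇ : ∀ {M n} k (R : Fin M → Fin n → Bool) → (∀ j → n ℕ.≤ cnt (R j) ℕ.+ k) → n ℕ.≤ cnt (⋂ᵇ R) ℕ.+ M ℕ.* k
  cnt-⋂ᵇ {zero} {n} k R le = ℕ.≤-reflexive (sym (trans (ℕ.+-identityʳ _) (cnt-all {n} λ _ → refl)))
  cnt-⋂ᵇ {suc M} {n} k R le = ℕ.+-cancelʳ-≤ n n _ (begin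
    n ℕ.+ n                                                      ≤⟨ ℕ.+-mono-≤ (le zero) (cnt-⋂ᵇ k (R ∘ suc) (le ∘ suc)) ⟩
    (cnt (R zero) ℕ.+ k) ℕ.+ (cnt (⋂ᵇ (R ∘ suc)) ℕ.+ M ℕ.* k)    ≡⟨ regroup (cnt (R zero)) k (cnt (⋂ᵇ (R ∘ suc))) (M ℕ.* k) ⟩
    (cnt (R zero) ℕ.+ cnt (⋂ᵇ (R ∘ suc))) ℕ.+ (k ℕ.+ M ℕ.* k)    ≤⟨ ℕ.+-monoˡ-≤ (k ℕ.+ M ℕ.* k) shared ⟩
    (cnt (⋂ᵇ R) ℕ.+ n) ℕ.+ (k ℕ.+ M ℕ.* k)                       ≡⟨ regroup′ (cnt (⋂ᵇ R)) n (k ℕ.+ M ℕ.* k) ⟩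
    (cnt (⋂ᵇ R) ℕ.+ (k ℕ.+ M ℕ.* k)) ℕ.+ n                       ∎)
    where
    open ℕ.≤-Reasoning
    regroup : ∀ a b c d → (a ℕ.+ b) ℕ.+ (c ℕ.+ d) ≡ (a ℕ.+ c) ℕ.+ (b ℕ.+ d)
    regroup = ℕ-solve 4 (λ a b c d → (a ⊕ b) ⊕ (c ⊕ d) ⊜ (a ⊕ c) ⊕ (b ⊕ d)) refl
    regroup′ : ∀ a b c → (a ℕ.+ b) ℕ.+ c ≡ (a ℕ.+ c) ℕ.+ b
    regroup′ = ℕ-solve 3 (λ a b c → (a ⊕ b) ⊕ c ⊜ (a ⊕ c) ⊕ b) refl
    both : ∀ a b → ⟦ a ⟧ ℕ.+ ⟦ b ⟧ ℕ.≤ ⟦ a ∧ b ⟧ ℕ.+ 1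
    both true true = ℕ.≤-refl
    both true false = ℕ.≤-refl
    both false true = ℕ.≤-refl
    both false false = ℕ.z≤n
    shared : cnt (R zero) ℕ.+ cnt (⋂ᵇ (R ∘ suc)) ℕ.≤ cnt (⋂ᵇ R) ℕ.+ n
    shared = begin
      cnt (R zero) ℕ.+ cnt (⋂ᵇ (R ∘ suc))                 ≡⟨ ∑-distrib-+ (⟦_⟧ ∘ R zero) (⟦_⟧ ∘ ⋂ᵇ (R ∘ suc)) ⟨
      sum (λ i → ⟦ R zero i ⟧ ℕ.+ ⟦ ⋂ᵇ (R ∘ suc) i ⟧)     ≤⟨ sum-mono-≤ (λ i → both (R zero i) (⋂ᵇ (R ∘ suc) i)) ⟩
      sum (λ i → ⟦ ⋂ᵇ R i ⟧ ℕ.+ 1)                        ≡⟨ ∑-distrib-+ (⟦_⟧ ∘ ⋂ᵇ R) (λ _ → 1) ⟩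
      cnt (⋂ᵇ R) ℕ.+ sum {n} (λ _ → 1)                    ≡⟨ cong (cnt (⋂ᵇ R) ℕ.+_) (sum-one {n} λ _ → refl) ⟩
      cnt (⋂ᵇ R) ℕ.+ n                                    ∎

  module Center {e n : ℕ} (C : Config e n) where
    open ConfigProperties C
    open Cones C using (Generic)

    -- Positivity on one basis τ already places c in the interior of the cone over R. Unlike
    -- positivity on all of R, it survives unchanged when R grows.
    record Interior (c : Fin n → ℚ) (R : Fin n → Bool) : Set where
      field
        a          : Fin n → ℚ
        0≤a        : ∀ i → 0ℚ ≤ a i
        outside    : ∀ i → R i ≡ false → a i ≡ 0ℚ
        τ          : Fin n → Bool
        size-τ     : cnt τ ≡ suc e
        on-τ       : ∀ i → τ i ≡ true → 0ℚ < a i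
        represents : Represents c a

    Interior-resp : ∀ {c c′ R} → Represents c′ c → Interior c R → Interior c′ R
    Interior-resp eq I = record
      { Interior I ; represents = representing λ v∈W → trans (on eq v∈W) (on (Interior.represents I) v∈W) }

    Interior-⊆ : ∀ {c R R′} → (∀ i → R′ i ≡ false → R i ≡ false) → Interior c R → Interior c R′
    Interior-⊆ sub I = record { Interior I ; outside = λ i i∉R′ → Interior.outside I i (sub i i∉R′) }

    Interior-h : ∀ {c R} → Interior c R → 0ℚ < ⟨ c , h ⟩
    Interior-h I = subst (0ℚ <_) (sym (on represents h∈W))
      (∑-pos (λ i → 0≤* (0≤a i) (<⇒≤ (0<h i))) (proj₁ t) (0<* (on-τ (proj₁ t) (proj₂ t)) (0<h (proj₁ t))))
      where
      open Interior I
      t : ∃ λ i → τ i ≡ true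
      t = cnt>0 (subst (0 ℕ.<_) (sym size-τ) ℕ.z<s)

    Interior-scale : ∀ {c R} l → 0ℚ < l → Interior c R → Interior (λ i → l * c i) R
    Interior-scale {c} l 0<l I = record
      { a = λ i → l * a i ; 0≤a = λ i → 0≤* (<⇒≤ 0<l) (0≤a i)
      ; outside = λ i i∉R → trans (cong (l *_) (outside i i∉R)) (*-zeroʳ l)
      ; τ = τ ; size-τ = size-τ ; on-τ = λ i i∈τ → 0<* 0<l (on-τ i i∈τ)
      ; represents = representing λ {v} v∈W → trans (scale c v) (trans (cong (l *_) (on represents v∈W)) (sym (scale a v)))
      }
      where
      open Interior I
      scale : ∀ u v → ⟨ (λ i → l * u i) , v ⟩ ≡ l * ⟨ u , v ⟩
      scale u v = trans (∑-cong λ i → *-assoc l (u i) (v i)) (sym (*-∑ l λ i → u i * v i))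

    Interior-+ : ∀ {c c′ R} → Interior c R → Interior c′ R → Interior (λ i → c i + c′ i) R
    Interior-+ {c} {c′} I J = record
      { a = λ i → I.a i + J.a i ; 0≤a = λ i → +-mono-≤ (I.0≤a i) (J.0≤a i)
      ; outside = λ i i∉R → cong₂ _+_ (I.outside i i∉R) (J.outside i i∉R)
      ; τ = I.τ ; size-τ = I.size-τ ; on-τ = λ i i∈τ → +-mono-<-≤ (I.on-τ i i∈τ) (J.0≤a i)
      ; represents = representing λ {v} v∈W → trans (add c c′ v)
          (trans (cong₂ _+_ (on I.represents v∈W) (on J.represents v∈W)) (sym (add I.a J.a v)))
      }
      where
      module I = Interior I
      module J = Interior J
      add : ∀ u u′ v → ⟨ (λ i → u i + u′ i) , v ⟩ ≡ ⟨ u , v ⟩ + ⟨ u′ , v ⟩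
      add u u′ v = trans (∑-cong λ i → ℚ.*-distribʳ-+ (v i) (u i) (u′ i)) (∑-+ (λ i → u i * v i) (λ i → u′ i * v i))

    -- Nothing is assumed about a `u j` of weight zero; this lets a side of a Radon partition ignore
    -- the one vector it does not involve.
    Interior-sum : ∀ {M R} (l : Fin M → ℚ) (u : Fin M → Fin n → ℚ) → (∀ j → 0ℚ ≤ l j) → (∀ j → 0ℚ < l j → Interior (u j) R) →
      (∀ j → l j ≡ 0ℚ) ⊎ Interior (λ i → ∑ (λ j → l j * u j i)) R
    Interior-sum {zero} l u 0≤l I = inj₁ λ ()
    Interior-sum {suc M} l u 0≤l I with 0ℚ <? l zero | Interior-sum (l ∘ suc) (u ∘ suc) (0≤l ∘ suc) (I ∘ suc)
    ... | yes 0<l₀ | inj₂ J = inj₂ (Interior-+ (Interior-scale (l zero) 0<l₀ (I zero 0<l₀)) J)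
    ... | yes 0<l₀ | inj₁ l≡0 = inj₂ (Interior-resp
      (representing λ {v} _ → ⟨⟩-congˡ v λ i → trans (cong (l zero * u zero i +_) (∑-zero λ j → trans (cong (_* u (suc j) i) (l≡0 j)) (*-zeroˡ (u (suc j) i)))) (+-identityʳ (l zero * u zero i)))
      (Interior-scale (l zero) 0<l₀ (I zero 0<l₀)))
    ... | no 0≮l₀ | inj₁ l≡0 = inj₁ λ { zero → ℚ.≤-antisym (ℚ.≮⇒≥ 0≮l₀) (0≤l zero) ; (suc j) → l≡0 j }
    ... | no 0≮l₀ | inj₂ J = inj₂ (Interior-resp
      (representing λ {v} _ → ⟨⟩-congˡ v λ i → trans (cong (λ z → z * u zero i + ∑ (λ j → l (suc j) * u (suc j) i)) (ℚ.≤-antisym (ℚ.≮⇒≥ 0≮l₀) (0≤l zero)))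
         (trans (cong (_+ ∑ (λ j → l (suc j) * u (suc j) i)) (*-zeroˡ (u zero i))) (+-identityˡ (∑ (λ j → l (suc j) * u (suc j) i))))) J)

    -- The step along x is rewritten in the basis τ, where every coefficient of c is positive and
    -- has room to move.
    Interior-open : ∀ R → Open (λ c → Interior c R)
    Interior-open R c I x with pos-steps (Interior.τ I) (Interior.a I) (λ s → ConfigProperties.Basis.dual C (Interior.τ I) (Interior.size-τ I) s x) (Interior.on-τ I)
    ... | ε₀ , 0<ε₀ , step = ε₀ , 0<ε₀ , stepped
      where
      open Interior I
      open Basis τ size-τ
      b : Fin n → ℚ
      b s = dual s x
      stepped : ∀ ε → 0ℚ < ε → ε ≤ ε₀ → Interior (λ i → c i + ε * unit x i) R
      stepped ε 0<ε ε≤ = record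
        { a = a′ ; 0≤a = 0≤a′ ; outside = λ i i∉R → trans (off-τ i (i∉τ i i∉R)) (outside i i∉R)
        ; τ = τ ; size-τ = size-τ ; on-τ = step ε 0<ε ε≤
        ; represents = representing λ {v} v∈W → trans (⟨⟩-step c ε x v) (trans (cong₂ (λ y z → y + ε * z) (on represents v∈W) (expansion v∈W x))
            (trans (cong (_+ ε * ⟨ b , v ⟩) (sym (*-identityˡ ⟨ a , v ⟩))) (trans (sym (⟨⟩-comb 1ℚ ε a b v))
              (⟨⟩-congˡ v λ i → cong (_+ ε * b i) (*-identityˡ (a i))))))
        }
        where
        a′ : Fin n → ℚ
        a′ i = a i + ε * b i
        off-τ : ∀ i → τ i ≡ false → a′ i ≡ a i
        off-τ i i∉τ = trans (cong (λ z → a i + ε * z) (dual-outside i∉τ x)) (trans (cong (a i +_) (*-zeroʳ ε)) (+-identityʳ (a i)))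
        0≤a′ : ∀ i → 0ℚ ≤ a′ i
        0≤a′ i = by-τ (τ i) refl
          where
          by-τ : ∀ z → τ i ≡ z → 0ℚ ≤ a′ i
          by-τ true eq = <⇒≤ (step ε 0<ε ε≤ i eq)
          by-τ false eq = subst (0ℚ ≤_) (sym (off-τ i eq)) (0≤a i)
        i∉τ : ∀ i → R i ≡ false → τ i ≡ false
        i∉τ i i∉R = Bool.¬-not λ i∈τ → 0<⇒≢0 (on-τ i i∈τ) (outside i i∉R)

    indicator : (Fin n → Bool) → Fin n → ℚ
    indicator τ i = if τ i then 1ℚ else 0ℚ

    -- The `R j` have e + 1 points in common, and the sum of these points is interior to every cone.
    few-interiors : ∀ {M} k (R : Fin M → Fin n → Bool) → (∀ j → n ℕ.≤ cnt (R j) ℕ.+ k) →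
      M ℕ.* k ℕ.+ suc e ℕ.≤ n → ∃ λ c → ∀ j → Interior c (R j)
    few-interiors {M} k R large le = indicator τ , λ j → record
      { a = indicator τ ; 0≤a = 0≤indicator
      ; outside = λ i i∉R → cong (λ z → if z then 1ℚ else 0ℚ)
          (Bool.¬-not λ i∈τ → contradiction (trans (sym (⋂ᵇ-⊆ R i (τ⊆ i i∈τ) j)) i∉R) λ ())
      ; τ = τ ; size-τ = size-τ ; on-τ = λ i i∈τ → subst (λ z → 0ℚ < (if z then 1ℚ else 0ℚ)) (sym i∈τ) 0<1
      ; represents = representing λ _ → refl }
      where
      τ-exists = cnt-between (suc e) {b = λ _ → false} {c = ⋂ᵇ R} (λ _ ()) (subst (ℕ._≤ suc e) (sym (cnt-none {n} λ _ → refl)) ℕ.z≤n)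
        (ℕ.+-cancelˡ-≤ (M ℕ.* k) _ _ (ℕ.≤-trans le (subst (n ℕ.≤_) (ℕ.+-comm (cnt (⋂ᵇ R)) (M ℕ.* k)) (cnt-⋂ᵇ k R large))))
      τ = proj₁ τ-exists
      τ⊆ = proj₁ (proj₂ (proj₂ τ-exists))
      size-τ = proj₂ (proj₂ (proj₂ τ-exists))
      0≤indicator : ∀ i → 0ℚ ≤ indicator τ i
      0≤indicator i with τ i
      ... | true = <⇒≤ 0<1
      ... | false = ≤-refl

    basis-exists : suc e ℕ.≤ n → ∃ λ τ → cnt τ ≡ suc e
    basis-exists le with cnt-between (suc e) {b = λ _ → false} {c = λ (_ : Fin n) → true} (λ _ ())
      (subst (ℕ._≤ suc e) (sym (cnt-none {n} λ _ → refl)) ℕ.z≤n) (subst (suc e ℕ.≤_) (sym (cnt-all {n} λ _ → refl)) le)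
    ... | τ , _ , _ , eq = τ , eq

    -- A Radon partition of the u j.
    record Balanced {M} (u : Fin M → Fin n → ℚ) : Set where
      field
        p q      : Fin M → ℚ
        0≤p      : ∀ j → 0ℚ ≤ p j
        0≤q      : ∀ j → 0ℚ ≤ q j
        disjoint : ∀ j → p j ≡ 0ℚ ⊎ q j ≡ 0ℚ
        nonzero  : ∃ λ j → 0ℚ < p j ⊎ 0ℚ < q j
        same     : Represents (λ i → ∑ (λ j → p j * u j i)) (λ i → ∑ (λ j → q j * u j i))

    ⟨∑,⟩ : ∀ {M} (l : Fin M → ℚ) (u : Fin M → Fin n → ℚ) v → ⟨ (λ i → ∑ (λ j → l j * u j i)) , v ⟩ ≡ ∑ (λ j → l j * ⟨ u j , v ⟩)
    ⟨∑,⟩ l u v = begin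
      ∑ (λ i → ∑ (λ j → l j * u j i) * v i)     ≡⟨ ∑-cong (λ i → trans (∑-* (v i) (λ j → l j * u j i)) (∑-cong λ j → *-assoc (l j) (u j i) (v i))) ⟩
      ∑ (λ i → ∑ (λ j → l j * (u j i * v i)))   ≡⟨ ∑-swap (λ i j → l j * (u j i * v i)) ⟩
      ∑ (λ j → ∑ (λ i → l j * (u j i * v i)))   ≡⟨ ∑-cong (λ j → *-∑ (l j) (λ i → u j i * v i)) ⟨
      ∑ (λ j → l j * ⟨ u j , v ⟩)               ∎
      where open ≡-Reasoning

    -- More than e + 1 vectors in a space of dimension e + 1 satisfy a linear relation b; its
    -- positive and negative parts are the two sides of the partition.
    balance : ∀ {M} (u : Fin M → Fin n → ℚ) → suc e ℕ.≤ n → suc e ℕ.< M → Balanced u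
    balance {M} u e<n lt with basis-exists e<n
    ... | σ , size-σ with kernel σ (λ s j → ⟨ u j , ConfigProperties.Basis.dual C σ size-σ s ⟩) (subst (ℕ._< M) (sym size-σ) lt)
    ... | b , (j₀ , b≢0) , solves = record
      { p = λ j → part (b j) ; q = λ j → part (- b j)
      ; 0≤p = λ j → 0≤part (b j) ; 0≤q = λ j → 0≤part (- b j)
      ; disjoint = λ j → part-disjoint (b j) ; nonzero = j₀ , part-nonzero b≢0
      ; same = representing λ {v} v∈W → trans (⟨∑,⟩ (part ∘ b) u v) (trans (0≡-⇒≡ (difference v∈W)) (sym (⟨∑,⟩ (λ j → part (- b j)) u v))) }
      where
      open Basis σ size-σ
      0≡-⇒≡ : ∀ {x y} → x - y ≡ 0ℚ → x ≡ y
      0≡-⇒≡ {x} {y} eq = trans (solve 2 (λ x y → x := x :- y :+ y) refl x y) (trans (cong (_+ y) eq) (+-identityˡ y))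
      vanishing : ∀ {v} → W v → ∑ (λ j → b j * ⟨ u j , v ⟩) ≡ 0ℚ
      vanishing {v} v∈W = begin
        ∑ (λ j → b j * ⟨ u j , v ⟩)
          ≡⟨ ∑-cong (λ j → cong (b j *_) (on (Coefficients.represents (u j) σ size-σ) v∈W)) ⟩
        ∑ (λ j → b j * ∑ (λ s → ⟨ u j , dual s ⟩ * v s))
          ≡⟨ ∑-cong (λ j → trans (*-∑ (b j) (λ s → ⟨ u j , dual s ⟩ * v s)) (∑-cong λ s → rotate (b j) ⟨ u j , dual s ⟩ (v s))) ⟩
        ∑ (λ j → ∑ (λ s → v s * (⟨ u j , dual s ⟩ * b j)))
          ≡⟨ ∑-swap (λ j s → v s * (⟨ u j , dual s ⟩ * b j)) ⟩
        ∑ (λ s → ∑ (λ j → v s * (⟨ u j , dual s ⟩ * b j)))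
          ≡⟨ ∑-cong (λ s → sym (*-∑ (v s) (λ j → ⟨ u j , dual s ⟩ * b j))) ⟩
        ∑ (λ s → v s * ∑ (λ j → ⟨ u j , dual s ⟩ * b j))
          ≡⟨ ∑-zero (λ s → trans (cong (v s *_) (row s)) (*-zeroʳ (v s))) ⟩
        0ℚ ∎
        where
        open ≡-Reasoning
        open Cones C using (module Coefficients)
        rotate : ∀ x y z → x * (y * z) ≡ z * (y * x)
        rotate = solve 3 (λ x y z → x :* (y :* z) := z :* (y :* x)) refl
        row : ∀ s → ∑ (λ j → ⟨ u j , dual s ⟩ * b j) ≡ 0ℚ
        row s = by-σ (σ s) refl
          where
          by-σ : ∀ z → σ s ≡ z → ∑ (λ j → ⟨ u j , dual s ⟩ * b j) ≡ 0ℚ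
          by-σ true eq = solves s eq
          by-σ false eq = ∑-zero λ j → trans (cong (_* b j) (∑-zero λ i → trans (cong (u j i *_) (dual-outside eq i)) (*-zeroʳ (u j i)))) (*-zeroˡ (b j))
      difference : ∀ {v} → W v → ∑ (λ j → part (b j) * ⟨ u j , v ⟩) - ∑ (λ j → part (- b j) * ⟨ u j , v ⟩) ≡ 0ℚ
      difference {v} v∈W = begin
        P - N                                                                     ≡⟨ cong (P +_) (∑-neg (λ j → part (- b j) * ⟨ u j , v ⟩)) ⟨
        P + ∑ (λ j → - (part (- b j) * ⟨ u j , v ⟩))                              ≡⟨ ∑-+ (λ j → part (b j) * ⟨ u j , v ⟩) (λ j → - (part (- b j) * ⟨ u j , v ⟩)) ⟨
        ∑ (λ j → part (b j) * ⟨ u j , v ⟩ + - (part (- b j) * ⟨ u j , v ⟩))       ≡⟨ ∑-cong (λ j → trans (factor (part (b j)) (part (- b j)) ⟨ u j , v ⟩) (cong (_* ⟨ u j , v ⟩) (part-difference (b j)))) ⟩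
        ∑ (λ j → b j * ⟨ u j , v ⟩)                                               ≡⟨ vanishing v∈W ⟩
        0ℚ                                                                        ∎
        where
        open ≡-Reasoning
        P = ∑ (λ j → part (b j) * ⟨ u j , v ⟩)
        N = ∑ (λ j → part (- b j) * ⟨ u j , v ⟩)
        factor : ∀ x y z → x * z + - (y * z) ≡ (x - y) * z
        factor = solve 3 (λ x y z → x :* z :+ (:- (y :* z)) := (x :- y) :* z) refl

    -- For each i, one of the two sides of a Radon partition of the u j does not involve u i,
    -- the only one of these vectors which may fail to be interior to R i.
    helly-step : ∀ {M} (R : Fin (suc M) → Fin n → Bool) → suc e ℕ.≤ n → suc e ℕ.≤ M →
      (∀ j → ∃ λ c → ∀ i → Interior c (R (punchIn j i))) → ∃ λ c → ∀ j → Interior c (R j)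
    helly-step {suc M} R e<n e<M rec = c , interior
      where
      u : Fin (suc (suc M)) → Fin n → ℚ
      u j = proj₁ (rec j)
      u-interior : ∀ i j → j ≢ i → Interior (u j) (R i)
      u-interior i j j≢i = subst (λ z → Interior (u j) (R z)) (Fin.punchIn-punchOut j≢i) (proj₂ (rec j) (Fin.punchOut j≢i))
      open Balanced (balance u e<n (ℕ.s≤s e<M))
      c c′ : Fin n → ℚ
      c i = ∑ (λ j → p j * u j i)
      c′ i = ∑ (λ j → q j * u j i)
      0<uh : ∀ j → 0ℚ < ⟨ u j , h ⟩
      0<uh j = Interior-h (proj₂ (rec j) zero)
      vanishes : ∀ l → (∀ j → l j ≡ 0ℚ) → ⟨ (λ i → ∑ (λ j → l j * u j i)) , h ⟩ ≡ 0ℚ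
      vanishes l l≡0 = trans (⟨∑,⟩ l u h) (∑-zero λ j → trans (cong (_* ⟨ u j , h ⟩) (l≡0 j)) (*-zeroˡ ⟨ u j , h ⟩))
      positive-at : ∀ l → (∀ j → 0ℚ ≤ l j) → ∀ j → 0ℚ < l j → 0ℚ < ⟨ (λ i → ∑ (λ j → l j * u j i)) , h ⟩
      positive-at l 0≤l j 0<lj = subst (0ℚ <_) (sym (⟨∑,⟩ l u h)) (∑-pos (λ i → 0≤* (0≤l i) (<⇒≤ (0<uh i))) j (0<* 0<lj (0<uh j)))
      balanced-h : ⟨ c , h ⟩ ≡ ⟨ c′ , h ⟩
      balanced-h = on same h∈W
      -- A conic Radon partition could have an empty side. This is excluded since `h` is positive on
      -- all `u j` and takes the same value on both sides, so that one side is zero only if the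
      -- other is.
      p≢0 : ¬ (∀ j → p j ≡ 0ℚ)
      p≢0 p≡0 with nonzero
      ... | j , inj₁ 0<p = 0<⇒≢0 0<p (p≡0 j)
      ... | j , inj₂ 0<q = 0<⇒≢0 (positive-at q 0≤q j 0<q) (trans (sym balanced-h) (vanishes p p≡0))
      q≢0 : ¬ (∀ j → q j ≡ 0ℚ)
      q≢0 q≡0 with nonzero
      ... | j , inj₂ 0<q = 0<⇒≢0 0<q (q≡0 j)
      ... | j , inj₁ 0<p = 0<⇒≢0 (positive-at p 0≤p j 0<p) (trans balanced-h (vanishes q q≡0))
      interior : ∀ i → Interior c (R i)
      interior i with disjoint i
      ... | inj₁ pi≡0 with Interior-sum {R = R i} p u 0≤p (λ j 0<p → u-interior i j λ { refl → 0<⇒≢0 0<p pi≡0 })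
      ...   | inj₁ p≡0 = contradiction p≡0 p≢0
      ...   | inj₂ I = I
      interior i | inj₂ qi≡0 with Interior-sum {R = R i} q u 0≤q (λ j 0<q → u-interior i j λ { refl → 0<⇒≢0 0<q qi≡0 })
      ...   | inj₁ q≡0 = contradiction q≡0 q≢0
      ...   | inj₂ I = Interior-resp same I

    -- Families of at most e + 1 sets have a common interior vector by counting; larger ones get it
    -- by induction on their size.
    helly : ∀ M k (R : Fin M → Fin n → Bool) → (∀ j → n ℕ.≤ cnt (R j) ℕ.+ k) →
      suc e ℕ.* k ℕ.+ suc e ℕ.≤ n → ∃ λ c → ∀ j → Interior c (R j)
    helly zero k R large le = few-interiors k R large (ℕ.≤-trans (ℕ.m≤n+m (suc e) (suc e ℕ.* k)) le)
    helly (suc M) k R large le with M ℕ.≤? e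
    ... | yes M≤ = few-interiors k R large (ℕ.≤-trans (ℕ.+-monoˡ-≤ (suc e) (ℕ.*-monoˡ-≤ k (ℕ.s≤s M≤))) le)
    ... | no M≰ = helly-step R (ℕ.≤-trans (ℕ.m≤n+m (suc e) (suc e ℕ.* k)) le) (ℕ.≰⇒> M≰)
      (λ j → helly M k (R ∘ punchIn j) (large ∘ punchIn j) le)

    -- The conic analogue of a centerpoint: c stays interior whichever k points are removed. Helly's
    -- theorem supplies such a c, and since interiority is open it can be perturbed off the finitely
    -- many spanned hyperplanes.
    center-exists : ∀ k → suc e ℕ.* k ℕ.+ suc e ℕ.≤ n →
      ∃ λ c → Generic c × ∀ R → n ℕ.≤ cnt R ℕ.+ k → Interior c R
    center-exists k le = c , generic , interior
      where
      large? : ∀ (s : Subset n) → Dec (n ℕ.≤ cnt (lookup s) ℕ.+ k)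
      large? s = n ℕ.≤? cnt (lookup s) ℕ.+ k
      -- Subsets that are too small are replaced by the full set, so that the family can be indexed
      -- by all subsets.
      R : Subset n → Fin n → Bool
      R s with large? s
      ... | yes _ = lookup s
      ... | no _ = λ _ → true
      large : ∀ s → n ℕ.≤ cnt (R s) ℕ.+ k
      large s with large? s
      ... | yes le = le
      ... | no _ = subst (λ z → n ℕ.≤ z ℕ.+ k) (sym (cnt-all {n} λ _ → refl)) (ℕ.m≤m+n n k)
      R-large : ∀ s → n ℕ.≤ cnt (lookup s) ℕ.+ k → R s ≡ lookup s
      R-large s le with large? s
      ... | yes _ = refl
      ... | no ¬le = contradiction le ¬le
      H = helly (List.length (subsets n)) k (λ j → R (List.lookup (subsets n) j)) (λ j → large (List.lookup (subsets n) j)) le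
      AllInterior : (Fin n → ℚ) → Set
      AllInterior c = ∀ s → s ∈ subsets n → Interior c (R s)
      start : AllInterior (proj₁ H)
      start s s∈ = subst (λ z → Interior (proj₁ H) (R z)) (sym (Any.lookup-index s∈)) (proj₂ H (Any.index s∈))
      e≤n : e ℕ.< n
      e≤n = ℕ.≤-trans (ℕ.m≤n+m (suc e) (suc e ℕ.* k)) le
      -- For a subset of the wrong size `h` serves as a harmless functional to avoid, being nowhere
      -- zero.
      g : Subset n → Fin n → ℚ
      g s = if cnt (lookup s) ℕ.≡ᵇ e then f s else h
      g-nonzero : ∀ s → ∃ λ x → g s x ≢ 0ℚ
      g-nonzero s with cnt (lookup s) ℕ.≟ e
      ... | yes size rewrite dec-true (cnt (lookup s) ℕ.≟ e) size =
        let x , x∉ , _ = cnt<⇒∃ {b = lookup s} {c = λ _ → true} (subst₂ ℕ._<_ (sym size) (sym (cnt-all {n} λ _ → refl)) e≤n)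
        in x , f-off size x x∉
      ... | no ¬size rewrite dec-false (cnt (lookup s) ℕ.≟ e) ¬size = x , 0<⇒≢0 (0<h x)
        where
        x : Fin n
        x = Fin.fromℕ< (ℕ.≤-trans (ℕ.s≤s ℕ.z≤n) e≤n)
      perturbed = perturb (Open-∀ (λ s → Interior-open (R s)) (subsets n)) (λ _ → 0ℚ) g (λ s _ _ → g-nonzero s) (subsets n) (proj₁ H) start
      c = proj₁ perturbed
      generic : Generic c
      generic ρ size-ρ = subst (λ v → ⟨ c , v ⟩ ≢ 0ℚ)
        (cong (λ z → if z then face ρ else h) (dec-true (cnt (lookup (tabulate ρ)) ℕ.≟ e) (trans (cnt-cong (Vec.lookup∘tabulate ρ)) size-ρ)))
        (λ eq → proj₂ (proj₂ perturbed) (tabulate ρ) (∈-subsets (tabulate ρ)) (trans (+-identityˡ ⟨ c , g (tabulate ρ) ⟩) eq))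
      interior : ∀ Q → n ℕ.≤ cnt Q ℕ.+ k → Interior c Q
      interior Q large-Q = Interior-⊆ (λ i i∉Q → trans (Vec.lookup∘tabulate Q i) i∉Q)
        (subst (Interior c) (R-large (tabulate Q) (subst (λ z → n ℕ.≤ z ℕ.+ k) (sym (cnt-cong (Vec.lookup∘tabulate Q))) large-Q))
          (proj₁ (proj₂ perturbed) (tabulate Q) (∈-subsets (tabulate Q))))

    abstract
      center : ∀ k → suc e ℕ.* k ℕ.+ suc e ℕ.≤ n →
        ∃ λ c → Generic c × ∀ R → n ℕ.≤ cnt R ℕ.+ k → Interior c R
      center = center-exists

  -- Facets crossed by a line through a vertex.

  ≡ᵇ-refl : ∀ m → (m ℕ.≡ᵇ m) ≡ true
  ≡ᵇ-refl m = dec-true (m ℕ.≟ m) refl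

  ≡ᵇ⇒≡ : ∀ {m k} → (m ℕ.≡ᵇ k) ≡ true → m ≡ k
  ≡ᵇ⇒≡ {m} {k} eq = ℕ.≡ᵇ⇒≡ m k (subst T (sym eq) _)

  ≡⇒≡ᵇ : ∀ {m k} → m ≡ k → (m ℕ.≡ᵇ k) ≡ true
  ≡⇒≡ᵇ {m} refl = ≡ᵇ-refl m

  ∧-true : ∀ {a b} → a ≡ true → b ≡ true → a ∧ b ≡ true
  ∧-true refl refl = refl

  ∧-trueˡ : ∀ {a b} → a ∧ b ≡ true → a ≡ true
  ∧-trueˡ {true} _ = refl

  ∧-trueʳ : ∀ {a b} → a ∧ b ≡ true → b ≡ true
  ∧-trueʳ {true} eq = eq

  lookup-injective : ∀ {n} {σ τ : Subset n} → (∀ i → lookup σ i ≡ lookup τ i) → σ ≡ τ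
  lookup-injective {σ = σ} {τ} eq = trans (sym (Vec.tabulate∘lookup σ)) (trans (Vec.tabulate-cong eq) (Vec.tabulate∘lookup τ))

  does-true : ∀ {A : Set} (p : Dec A) → does p ≡ true → A
  does-true (yes a) _ = a

  -- g σ vanishes on σ and takes the value −1 at an extra point p, whose quotient
  -- configuration is C; w₀ is a functional with value 1 at p.
  module Lifting {e n : ℕ} (C : Config e n) (w₀ : Fin n → ℚ) (g : Subset n → Fin n → ℚ)
    (g-lifted : ∀ {σ} → cnt (lookup σ) ≡ suc e → Config.W C (λ i → g σ i + w₀ i))
    (g-on : ∀ {σ} → cnt (lookup σ) ≡ suc e → ∀ i → lookup σ i ≡ true → g σ i ≡ 0ℚ)
    (g-off : ∀ {σ} → cnt (lookup σ) ≡ suc e → ∀ i → lookup σ i ≡ false → g σ i ≢ 0ℚ) where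

    open ConfigProperties C
    open Cones C

    above : Subset n → Fin n → Bool
    above σ i = positive? (g σ i)

    private
      module Fixed (k : ℕ) (le : suc e ℕ.* k ℕ.+ suc e ℕ.≤ n) where
        open Center C using (center; Interior)

        e<n : suc e ℕ.≤ n
        e<n = ℕ.≤-trans (ℕ.m≤n+m (suc e) (suc e ℕ.* k)) le

        c : Fin n → ℚ
        c = proj₁ (center k le)
        c-generic : Generic c
        c-generic = proj₁ (proj₂ (center k le))
        c-interior : ∀ R → n ℕ.≤ cnt R ℕ.+ k → Interior c R
        c-interior = proj₂ (proj₂ (center k le))

        -- Seen from p, the direction c passes through the relative interior of the simplex σ.
        Meets : Subset n → Set
        Meets σ = Σ (cnt (lookup σ) ≡ suc e) λ _ → InCone c (lookup σ)

        meets? : ∀ σ → Dec (Meets σ)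
        meets? σ with cnt (lookup σ) ℕ.≟ suc e
        ... | no ¬size = no (¬size ∘ proj₁)
        ... | yes size with inCone? c (lookup σ) size
        ...   | yes ic = yes (size , ic)
        ...   | no ¬ic = no (¬ic ∘ proj₂)

        abstract
          Q : Subset n → Bool
          Q σ = does (meets? σ)

          Q⇒Meets : ∀ {σ} → Q σ ≡ true → Meets σ
          Q⇒Meets {σ} = does-true (meets? σ)

          Meets⇒Q : ∀ {σ} → Meets σ → Q σ ≡ true
          Meets⇒Q {σ} = dec-true (meets? σ)

        -- The height at which the line through p in direction c crosses the hyperplane of σ.
        height : Subset n → ℚ
        height σ = ⟨ c , g σ ⟩

        -- The difference of `g τ` and `g σ` vanishes at p and so belongs to the quotient, where c
        -- may be replaced by its coefficients a; these live on σ, where `g σ` is zero.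
        height-difference : ∀ {σ τ} ((size-σ , ic) : Meets σ) → cnt (lookup τ) ≡ suc e →
          ⟨ InCone.a ic , g τ ⟩ ≡ height τ - height σ
        height-difference {σ} {τ} (size-σ , ic) size-τ = begin
          ⟨ a , g τ ⟩                                ≡⟨ isolate ⟨ a , g τ ⟩ ⟨ a , g σ ⟩ ⟩
          1ℚ * ⟨ a , g τ ⟩ + - 1ℚ * ⟨ a , g σ ⟩ + ⟨ a , g σ ⟩
                                                     ≡⟨ cong₂ _+_ (sym (⟨⟩-combʳ 1ℚ (- 1ℚ) a (g τ) (g σ))) (⟨⟩-disjoint {σ = lookup σ} outside (g-on size-σ)) ⟩
          ⟨ a , (λ i → 1ℚ * g τ i + - 1ℚ * g σ i) ⟩ + 0ℚ
                                                     ≡⟨ +-identityʳ ⟨ a , (λ i → 1ℚ * g τ i + - 1ℚ * g σ i) ⟩ ⟩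
          ⟨ a , (λ i → 1ℚ * g τ i + - 1ℚ * g σ i) ⟩  ≡⟨ on represents (W-ext (λ i → drop (g τ i) (g σ i) (w₀ i)) (W-comb 1ℚ (- 1ℚ) (g-lifted size-τ) (g-lifted size-σ))) ⟨
          ⟨ c , (λ i → 1ℚ * g τ i + - 1ℚ * g σ i) ⟩  ≡⟨ ⟨⟩-combʳ 1ℚ (- 1ℚ) c (g τ) (g σ) ⟩
          1ℚ * height τ + - 1ℚ * height σ            ≡⟨ solve 2 (λ x y → con 1ℚ :* x :+ con (- 1ℚ) :* y := x :- y) refl (height τ) (height σ) ⟩
          height τ - height σ                        ∎
          where
          open ≡-Reasoning
          open InCone ic
          isolate : ∀ x y → x ≡ 1ℚ * x + - 1ℚ * y + y
          isolate = solve 2 (λ x y → x := con 1ℚ :* x :+ con (- 1ℚ) :* y :+ y) refl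
          drop : ∀ x y w → 1ℚ * (x + w) + - 1ℚ * (y + w) ≡ 1ℚ * x + - 1ℚ * y
          drop = solve 3 (λ x y w → con 1ℚ :* (x :+ w) :+ con (- 1ℚ) :* (y :+ w) := con 1ℚ :* x :+ con (- 1ℚ) :* y) refl

        module Within (R : Fin n → Bool) (large : n ℕ.≤ cnt R ℕ.+ k) where

          Inside : Subset n → Set
          Inside σ = ∀ i → lookup σ i ≡ true → R i ≡ true

          Candidate : Subset n → Set
          Candidate σ = Meets σ × Inside σ

          candidate? : ∀ σ → Dec (Candidate σ)
          candidate? σ with meets? σ | Fin.all? (λ i → (lookup σ i Bool.≟ true) →-dec (R i Bool.≟ true))
          ... | yes m | yes s = yes (m , s)
          ... | yes _ | no ¬s = no (¬s ∘ proj₂)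
          ... | no ¬m | _ = no (¬m ∘ proj₁)

          transport-cone : ∀ {σ τ : Fin n → Bool} → (∀ i → τ i ≡ σ i) → InCone c σ → InCone c τ
          transport-cone eq ic = record
            { a = a ; inside = λ i i∈ → inside i (trans (sym (eq i)) i∈) ; outside = λ i i∉ → outside i (trans (sym (eq i)) i∉)
            ; represents = represents }
            where open InCone ic

          candidate : ∀ {σ} → cnt σ ≡ suc e → InCone c σ → (∀ i → σ i ≡ true → R i ≡ true) → Candidate (tabulate σ)
          candidate {σ} size ic sub = (trans (cnt-cong (Vec.lookup∘tabulate σ)) size , transport-cone (Vec.lookup∘tabulate σ) ic)
            , λ i i∈ → sub i (trans (sym (Vec.lookup∘tabulate σ i)) i∈)

          some-candidate : ∃ λ σ → σ ∈ subsets n × Candidate σ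
          some-candidate with c-interior R large
          ... | I with carathéodory e<n {c} R c-generic (cnt (supp (Interior.a I))) (Interior.a I) (Interior.represents I)
                         (Interior.0≤a I) (Interior.outside I) (ℕ.m≤m+n _ _)
          ... | σ , size , sub , ic = tabulate σ , ∈-subsets (tabulate σ) , candidate size ic sub

          Optimal : Subset n → Set
          Optimal σ = ∀ i → R i ≡ true → above σ i ≡ false

          -- If x lies beyond σ, pivoting x into σ gives another candidate, of which x is the only
          -- point off the hyperplane of σ. In homogeneous coordinates the crossing point is the sum
          -- of the points with weights c plus `height σ` times p, so less height means farther from
          -- p.
          lower : ∀ {σ} → Candidate σ → ∀ x → R x ≡ true → 0ℚ < g σ x → ∃ λ τ → Candidate τ × height τ < height σ
          lower {σ} ((size , ic) , sub) x x∈R 0<gx = tabulate σ′ , candidate size′ ic′ sub′ , decrease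
            where
            open InCone ic using (a; inside; outside)
            x∉σ : lookup σ x ≡ false
            x∉σ = Bool.¬-not λ x∈σ → 0<⇒≢0 0<gx (g-on size x x∈σ)
            0≤a : ∀ i → 0ℚ ≤ a i
            0≤a i = by (lookup σ i) refl
              where
              by : ∀ z → lookup σ i ≡ z → 0ℚ ≤ a i
              by true eq = <⇒≤ (inside i eq)
              by false eq = ≤-reflexive (sym (outside i eq))
            open Pivot (pivot {c} {a} (InCone.represents ic) 0≤a (lookup σ) size x x∉σ)
            s≢x : s ≢ x
            s≢x s≡x = contradiction (trans (sym (trans (cong (lookup σ) (sym s≡x)) s∈σ)) x∉σ) λ ()
            σ′ : Fin n → Bool
            σ′ i = if does (i Fin.≟ x) then true else (lookup σ ∖ s) i
            σ′-x : σ′ x ≡ true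
            σ′-x rewrite dec-true (x Fin.≟ x) refl = refl
            σ′-other : ∀ i → i ≢ x → σ′ i ≡ (lookup σ ∖ s) i
            σ′-other i i≢x rewrite dec-false (i Fin.≟ x) i≢x = refl
            size′ : cnt σ′ ≡ suc e
            size′ = begin
              cnt σ′                                          ≡⟨ ℕ.+-identityʳ _ ⟨
              cnt σ′ ℕ.+ 0                                    ≡⟨ cong (λ z → cnt σ′ ℕ.+ ⟦ z ⟧) (trans (∖-other (lookup σ) s x (s≢x ∘ sym)) x∉σ) ⟨
              cnt σ′ ℕ.+ ⟦ (lookup σ ∖ s) x ⟧                 ≡⟨ cnt-change {b = σ′} {c = lookup σ ∖ s} x σ′-other ⟩
              cnt (lookup σ ∖ s) ℕ.+ ⟦ σ′ x ⟧                 ≡⟨ cong (λ z → cnt (lookup σ ∖ s) ℕ.+ ⟦ z ⟧) (trans σ′-x (sym s∈σ)) ⟩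
              cnt (lookup σ ∖ s) ℕ.+ ⟦ lookup σ s ⟧           ≡⟨ cnt-∖ (lookup σ) s ⟩
              cnt (lookup σ)                                  ≡⟨ size ⟩
              suc e                                           ∎
              where open ≡-Reasoning
            sub′ : ∀ i → σ′ i ≡ true → R i ≡ true
            sub′ i i∈ with i Fin.≟ x
            ... | yes refl = x∈R
            ... | no i≢x = sub i (∖-⊆ (lookup σ) s i i∈)
            outside′ : ∀ i → σ′ i ≡ false → a′ i ≡ 0ℚ
            outside′ i i∉ = by (i Fin.≟ s)
              where
              i≢x : i ≢ x
              i≢x i≡x = contradiction (trans (sym (trans (cong σ′ i≡x) σ′-x)) i∉) λ ()
              by : Dec (i ≡ s) → a′ i ≡ 0ℚ
              by (yes i≡s) = trans (cong a′ i≡s) a′-s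
              by (no i≢s) = a′-outside i (outside i i∉σ) i∉σ i≢x
                where
                i∉σ : lookup σ i ≡ false
                i∉σ = trans (sym (∖-other (lookup σ) s i i≢s)) (trans (sym (σ′-other i i≢x)) i∉)
            -- No degenerate pivots: a zero coefficient would put c on the hyperplane of the other e
            -- points of σ′.
            inside′ : ∀ i → σ′ i ≡ true → 0ℚ < a′ i
            inside′ i i∈ = ≮0∧≢0⇒0< (λ a′<0 → <-irrefl refl (<-≤-trans a′<0 (0≤a′ i))) λ a′i≡0 →
              c-generic (σ′ ∖ i) size-ρ (trans (on represents (face∈W size-ρ))
                (⟨⟩-disjoint {σ = σ′ ∖ i} (off a′i≡0) (face-on size-ρ)))
              where
              size-ρ : cnt (σ′ ∖ i) ≡ e
              size-ρ = ℕ.suc-injective (trans (sym (ℕ.+-comm _ 1)) (trans (cong (λ z → cnt (σ′ ∖ i) ℕ.+ ⟦ z ⟧) (sym i∈)) (trans (cnt-∖ σ′ i) size′)))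
              off : a′ i ≡ 0ℚ → ∀ j → (σ′ ∖ i) j ≡ false → a′ j ≡ 0ℚ
              off eq j j∉ with j Fin.≟ i
              ... | yes refl = eq
              ... | no j≢i = outside′ j (trans (sym (Bool.∧-identityʳ (σ′ j))) j∉)
            ic′ : InCone c σ′
            ic′ = record { a = a′ ; inside = inside′ ; outside = outside′ ; represents = represents }
            meets′ : Meets (tabulate σ′)
            meets′ = proj₁ (candidate size′ ic′ sub′)
            only-x : ∀ i → i ≢ x → a′ i * g σ i ≡ 0ℚ
            only-x i i≢x = by (lookup σ i) refl
              where
              by : ∀ z → lookup σ i ≡ z → a′ i * g σ i ≡ 0ℚ
              by true eq = trans (cong (a′ i *_) (g-on size i eq)) (*-zeroʳ (a′ i))
              by false eq = trans (cong (_* g σ i) (a′-outside i (outside i eq) eq i≢x)) (*-zeroˡ (g σ i))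
            decrease : height (tabulate σ′) < height σ
            decrease = 0<-⇒< (subst (0ℚ <_) (trans (sym (∑-single x only-x)) (height-difference {tabulate σ′} {σ} meets′ size))
              (0<* (inside′ x σ′-x) 0<gx))

          -- At a candidate of least height `lower` cannot apply.
          optimum : ∃ λ σ → Candidate σ × Optimal σ
          optimum with argmin candidate? height (subsets n) some-candidate
          ... | σ , cand , least = σ , cand , λ i i∈R → Bool.¬-not λ i-above →
            let τ , cand-τ , lt = lower cand i i∈R (positive⇒0< i-above)
            in <-irrefl refl (<-≤-trans lt (least τ (∈-subsets τ) cand-τ))

          optimal-terms : ∀ {σ τ} (cand-σ : Candidate σ) → Candidate τ → Optimal τ → ∀ i → InCone.a (proj₂ (proj₁ cand-σ)) i * g τ i ≤ 0ℚ
          optimal-terms {σ} {τ} ((_ , ic) , sub) _ opt i = by (lookup σ i) refl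
            where
            open InCone ic
            by : ∀ z → lookup σ i ≡ z → a i * g τ i ≤ 0ℚ
            by false eq = ≤-reflexive (trans (cong (_* g τ i) (outside i eq)) (*-zeroˡ (g τ i)))
            by true eq = subst (a i * g τ i ≤_) (*-zeroʳ (a i))
              (ℚ.*-monoˡ-≤-nonNeg (a i) {{ℚ.nonNegative (<⇒≤ (inside i eq))}} (nonpositive⇒≤0 (opt i (sub i eq))))

          ∑-nonpos : ∀ {m} {v : Fin m → ℚ} → (∀ i → v i ≤ 0ℚ) → ∑ v ≤ 0ℚ
          ∑-nonpos {zero} le = ≤-refl
          ∑-nonpos {suc m} le = +-mono-≤ (le zero) (∑-nonpos (le ∘ suc))

          -- Weak duality: `g τ` is nonpositive on R, and the coefficients of c on σ are nonnegative
          -- and supported in R.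
          optimal-lower : ∀ {σ τ} → Candidate σ → Candidate τ → Optimal τ → height τ ≤ height σ
          optimal-lower {σ} {τ} cand-σ cand-τ opt = 0≤-⇒≤ (subst (0ℚ ≤_) (solve 2 (λ x y → :- (x :- y) := y :- x) refl (height τ) (height σ))
            (ℚ.neg-antimono-≤ (subst (_≤ 0ℚ) (height-difference {σ} {τ} (proj₁ cand-σ) (proj₁ (proj₁ cand-τ)))
              (∑-nonpos (optimal-terms {σ} {τ} cand-σ cand-τ opt)))))

          -- Complementary slackness: equal heights make `⟨ a , g τ ⟩` a sum of nonpositive terms
          -- with value 0. As a is positive on σ, `g τ` vanishes on σ, and in general position it
          -- does so on τ only.
          optimal-unique : ∀ {σ τ} → Candidate σ → Optimal σ → Candidate τ → Optimal τ → σ ≡ τ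
          optimal-unique {σ} {τ} cand-σ opt-σ cand-τ opt-τ = lookup-injective
            (cnt-⊆-≡ sub (trans (proj₁ (proj₁ cand-σ)) (sym (proj₁ (proj₁ cand-τ)))))
            where
            open InCone (proj₂ (proj₁ cand-σ))
            total : ⟨ a , g τ ⟩ ≡ 0ℚ
            total = trans (height-difference {σ} {τ} (proj₁ cand-σ) (proj₁ (proj₁ cand-τ)))
              (trans (cong (_- height σ) (ℚ.≤-antisym (optimal-lower {σ} {τ} cand-σ cand-τ opt-τ) (optimal-lower {τ} {σ} cand-τ cand-σ opt-σ))) (+-inverseʳ (height σ)))
            each : ∀ i → a i * g τ i ≡ 0ℚ
            each i with ℚ.<-cmp (a i * g τ i) 0ℚ
            ... | tri≈ _ eq _ = eq
            ... | tri> _ _ gt = contradiction (<-≤-trans gt (optimal-terms {σ} {τ} cand-σ cand-τ opt-τ i)) (<-irrefl refl)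
            ... | tri< lt _ _ = contradiction (subst (0ℚ <_) (trans (∑-neg (λ j → a j * g τ j)) (cong -_ total))
              (∑-pos (λ j → ℚ.neg-antimono-≤ (optimal-terms {σ} {τ} cand-σ cand-τ opt-τ j)) i (<0⇒0<- lt))) (<-irrefl refl)
            sub : ∀ i → lookup σ i ≡ true → lookup τ i ≡ true
            sub i i∈σ = Bool.¬-not λ i∉τ → g-off (proj₁ (proj₁ cand-τ)) i i∉τ (*-cancel-≡0 (0<⇒≢0 (inside i i∈σ)) (each i))

        open Thinning e Q lookup above
          (λ σ Qσ → proj₁ (Q⇒Meets Qσ))
          (λ σ Qσ i i∈σ → ≤0⇒nonpositive (≤-reflexive (g-on (proj₁ (Q⇒Meets Qσ)) i i∈σ)))

        one-optimum : ∀ {R large} → (∃ λ σ → Within.Candidate R large σ × Within.Optimal R large σ) → level R 0 ≡ 1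
        one-optimum {R} {large} (σ , cand , opt) = ∑ₛ-enum (at R 0) (λ (_ : Fin 1) → σ) (λ { {zero} {zero} _ → refl })
          (λ _ → sound) (λ τ eq → zero , complete τ eq)
          where
          open Within R large
          sound : at R 0 σ ≡ true
          sound = ∧-true (Meets⇒Q (proj₁ cand)) (∧-true
            (≡⇒≡ᵇ (cnt-none λ i → Bool.¬-not λ eq → contradiction
              (trans (sym (proj₂ cand i (∧-trueˡ eq))) (not-true (∧-trueʳ {lookup σ i} eq))) λ ()))
            (≡⇒≡ᵇ (cnt-none λ i → Bool.¬-not λ eq → contradiction
              (trans (sym (∧-trueˡ eq)) (opt i (∧-trueʳ {above σ i} eq))) λ ())))
            where
            not-true : ∀ {b} → not b ≡ true → b ≡ false
            not-true {false} _ = refl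
          complete : ∀ τ → at R 0 τ ≡ true → τ ≡ σ
          complete τ eq = optimal-unique {τ} {σ} (Q⇒Meets Qτ , inR) optimal cand opt
            where
            Qτ : Q τ ≡ true
            Qτ = ∧-trueˡ eq
            miss : missing R τ ≡ 0
            miss = ≡ᵇ⇒≡ (∧-trueˡ {missing R τ ℕ.≡ᵇ 0} (∧-trueʳ {Q τ} eq))
            viol : violated R τ ≡ 0
            viol = ≡ᵇ⇒≡ (∧-trueʳ {missing R τ ℕ.≡ᵇ 0} (∧-trueʳ {Q τ} eq))
            inR : Inside τ
            inR i i∈τ = Bool.¬-not λ i∉R → contradiction (trans (sym (cnt≡0 miss i)) (cong₂ (λ x y → x ∧ not y) i∈τ i∉R)) λ ()
            optimal : Optimal τ
            optimal i i∈R = Bool.¬-not λ up → contradiction (trans (sym (cnt≡0 viol i)) (cong₂ _∧_ up i∈R)) λ ()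

        base : ∀ R → n ℕ.≤ cnt R ℕ.+ k → level R 0 ≡ 1
        base R large = one-optimum {R} {large} (optimum R large)
          where
          open Within using (optimum)

        full : Fin n → Bool
        full _ = true

        counted : level full k ≡ binom k e
        counted = trans (level-value 1 k base k full (ℕ.≤-reflexive (cong (ℕ._+ k) (sym (cnt-all {n} λ _ → refl))))) (ℕ.+-identityʳ (binom k e))

        -- Dropping the condition that the line crosses σ only enlarges the count.
        bound : level full k ℕ.≤ ∑ₛ (λ σ → ⟦ (cnt (lookup σ) ℕ.≡ᵇ suc e) ∧ (cnt (above σ) ℕ.≡ᵇ k) ⟧)
        bound = ∑ₛ-mono λ σ → ⟦⟧-mono λ eq → ∧-true (≡⇒≡ᵇ (proj₁ (Q⇒Meets (∧-trueˡ eq))))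
          (trans (cong (ℕ._≡ᵇ k) (cnt-cong λ i → sym (Bool.∧-identityʳ (above σ i))))
            (∧-trueʳ {missing full σ ℕ.≡ᵇ 0} (∧-trueʳ {Q σ} eq)))

    lifting : ∀ k → suc e ℕ.* k ℕ.+ suc e ℕ.≤ n →
      binom k e ℕ.≤ ∑ₛ (λ σ → ⟦ (cnt (lookup σ) ℕ.≡ᵇ suc e) ∧ (cnt (above σ) ℕ.≡ᵇ k) ⟧)
    lifting k le = subst (ℕ._≤ _) counted bound
      where open Fixed k le

  -- Facet counts under deletion and contraction of a point.

  signed : Bool → ℚ → ℚ
  signed true x = x
  signed false x = - x

  signed-zero : ∀ b {x} → x ≡ 0ℚ → signed b x ≡ 0ℚ
  signed-zero true refl = refl
  signed-zero false refl = refl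

  -- A facet candidate is b ∷ σ, where the bit b orients the hyperplane spanned by σ.
  side : ∀ {n} → (Subset n → Fin n → ℚ) → Subset (suc n) → Fin n → Bool
  side f (b Vec.∷ σ) i = positive? (signed b (f σ i))

  isFacet : ∀ {n} → ℕ → (Subset n → Fin n → ℚ) → ℕ → Subset (suc n) → Bool
  isFacet d f j ι = (cnt (lookup (Vec.tail ι)) ℕ.≡ᵇ d) ∧ (cnt (side f ι) ℕ.≡ᵇ j)

  facetCount : ∀ {n} → ℕ → (Subset n → Fin n → ℚ) → ℕ → ℕ
  facetCount d f j = ∑ₛ (⟦_⟧ ∘ isFacet d f j)

  cumulative : (ℕ → ℕ) → ℕ → ℕ
  cumulative c zero = c 0
  cumulative c (suc k) = cumulative c k ℕ.+ c (suc k)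

  size-insertAt : ∀ {n} (σ : Subset n) p b → cnt (lookup (Vec.insertAt σ p b)) ≡ ⟦ b ⟧ ℕ.+ cnt (lookup σ)
  size-insertAt σ p b = trans (sum-remove {i = p} (⟦_⟧ ∘ lookup (Vec.insertAt σ p b)))
    (cong₂ ℕ._+_ (cong ⟦_⟧ (Vec.insertAt-lookup σ p b)) (cnt-cong λ i → Vec.insertAt-punchIn σ p b i))

  module _ {n : ℕ} (p : Fin (suc n)) where

    deleted contracted : (Subset (suc n) → Fin (suc n) → ℚ) → Subset n → Fin n → ℚ
    deleted f σ i = f (Vec.insertAt σ p false) (punchIn p i)
    contracted f σ i = f (Vec.insertAt σ p true) (punchIn p i)

    insertAt-elim : ∀ {b} {P : Fin (suc n) → Set} (τ : Fin n → Bool) → (b ≡ true → P p) → (∀ j → τ j ≡ true → P (punchIn p j)) →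
      ∀ i → Vector.insertAt τ p b i ≡ true → P i
    insertAt-elim {b} {P} τ at-p at i i∈ with p Fin.≟ i
    ... | yes refl = at-p (trans (sym (Vector.insertAt-lookup τ p b)) i∈)
    ... | no p≢i = subst P (Fin.punchIn-punchOut p≢i) (at (Fin.punchOut p≢i)
      (trans (sym (Vector.insertAt-punchIn τ p b (Fin.punchOut p≢i))) (trans (cong (Vector.insertAt τ p b) (Fin.punchIn-punchOut p≢i)) i∈)))

    deletion : ∀ {d} → Config d (suc n) → Config d n
    deletion {d} C = record
      { W = λ v → ∃ λ w → W w × ∀ i → v i ≡ w (punchIn p i)
      ; W-ext = λ eq (w , w∈W , v≡w) → w , w∈W , λ i → trans (sym (eq i)) (v≡w i)
      ; W-comb = λ a b (w , w∈W , eq) (w′ , w′∈W , eq′) → _ , W-comb a b w∈W w′∈W , λ i → cong₂ (λ x y → a * x + b * y) (eq i) (eq′ i)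
      ; f = deleted f
      ; f∈W = λ {σ} size → f (Vec.insertAt σ p false) , f∈W (trans (size-insertAt σ p false) size) , λ _ → refl
      ; f-on = λ {σ} size i i∈σ → f-on (trans (size-insertAt σ p false) size) (punchIn p i) (trans (Vec.insertAt-punchIn σ p false i) i∈σ)
      ; f-off = λ {σ} size i i∉σ → f-off (trans (size-insertAt σ p false) size) (punchIn p i) (trans (Vec.insertAt-punchIn σ p false i) i∉σ)
      ; unique = λ (w , w∈W , eq) τ size vanish i → trans (eq i) (unique w∈W (Vector.insertAt τ p false)
          (trans (sum-remove {i = p} (⟦_⟧ ∘ Vector.insertAt τ p false)) (trans (cong₂ ℕ._+_ (cong ⟦_⟧ (Vector.insertAt-lookup τ p false)) (cnt-cong (Vector.insertAt-punchIn τ p false))) size))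
          (insertAt-elim τ (λ h → contradiction h λ ()) (λ j j∈ → trans (sym (eq j)) (vanish j j∈))) (punchIn p i))
      ; h = h ∘ punchIn p
      ; h∈W = h , h∈W , λ _ → refl
      ; 0<h = 0<h ∘ punchIn p
      }
      where
      open Config C

    -- A functional that supports the hull at p and touches it nowhere else.
    Extreme : ∀ {d} → Config d (suc n) → Set
    Extreme C = ∃ λ l → Config.W C l × l p ≡ 0ℚ × ∀ i → 0ℚ < l (punchIn p i)

    -- Projection from p. The old `h` is positive at p and hence not in the new space, so the
    -- supporting functional l takes its place; this is why p must be a vertex.
    contraction : ∀ {d} (C : Config (suc d) (suc n)) → Extreme C → Config d n
    contraction {d} C (l , l∈W , lp≡0 , 0<l) = record
      { W = λ v → ∃ λ w → W w × w p ≡ 0ℚ × ∀ i → v i ≡ w (punchIn p i)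
      ; W-ext = λ eq (w , w∈W , wp≡0 , v≡w) → w , w∈W , wp≡0 , λ i → trans (sym (eq i)) (v≡w i)
      ; W-comb = λ a b (w , w∈W , wp≡0 , eq) (w′ , w′∈W , w′p≡0 , eq′) → _ , W-comb a b w∈W w′∈W
          , trans (cong₂ (λ x y → a * x + b * y) wp≡0 w′p≡0) (solve 2 (λ a b → a :* con 0ℚ :+ b :* con 0ℚ := con 0ℚ) refl a b)
          , λ i → cong₂ (λ x y → a * x + b * y) (eq i) (eq′ i)
      ; f = contracted f
      ; f∈W = λ {σ} size → f (Vec.insertAt σ p true) , f∈W (size′ σ size)
          , f-on (size′ σ size) p (Vec.insertAt-lookup σ p true) , λ _ → refl
      ; f-on = λ {σ} size i i∈σ → f-on (size′ σ size) (punchIn p i) (trans (Vec.insertAt-punchIn σ p true i) i∈σ)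
      ; f-off = λ {σ} size i i∉σ → f-off (size′ σ size) (punchIn p i) (trans (Vec.insertAt-punchIn σ p true i) i∉σ)
      ; unique = λ (w , w∈W , wp≡0 , eq) τ size vanish i → trans (eq i) (unique w∈W (Vector.insertAt τ p true)
          (trans (sum-remove {i = p} (⟦_⟧ ∘ Vector.insertAt τ p true)) (trans (cong₂ ℕ._+_ (cong ⟦_⟧ (Vector.insertAt-lookup τ p true)) (cnt-cong (Vector.insertAt-punchIn τ p true))) (cong suc size)))
          (insertAt-elim τ (λ _ → wp≡0) (λ j j∈ → trans (sym (eq j)) (vanish j j∈))) (punchIn p i))
      ; h = l ∘ punchIn p
      ; h∈W = l , l∈W , lp≡0 , λ _ → refl
      ; 0<h = 0<l
      }
      where
      open Config C
      size′ : ∀ (σ : Subset n) → cnt (lookup σ) ≡ d → cnt (lookup (Vec.insertAt σ p true)) ≡ suc d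
      size′ σ size = trans (size-insertAt σ p true) (cong suc size)

    away toward : ℕ → (Subset (suc n) → Fin (suc n) → ℚ) → ℕ → Subset (suc n) → Bool
    away d f j (b Vec.∷ σ) = (cnt (lookup σ) ℕ.≡ᵇ d) ∧ not (side f (b Vec.∷ Vec.insertAt σ p false) p)
      ∧ (cnt (side (deleted f) (b Vec.∷ σ)) ℕ.≡ᵇ j)
    toward d f j (b Vec.∷ σ) = (cnt (lookup σ) ℕ.≡ᵇ d) ∧ side f (b Vec.∷ Vec.insertAt σ p false) p
      ∧ (cnt (side (deleted f) (b Vec.∷ σ)) ℕ.≡ᵇ j)

    awayCount towardCount : ℕ → (Subset (suc n) → Fin (suc n) → ℚ) → ℕ → ℕ
    awayCount d f j = ∑ₛ (⟦_⟧ ∘ away d f j)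
    towardCount d f j = ∑ₛ (⟦_⟧ ∘ toward d f j)

    facetCount-deleted : ∀ d f j → facetCount d (deleted f) j ≡ awayCount d f j ℕ.+ towardCount d f j
    facetCount-deleted d f j = trans (∑ₛ-cong each) (∑ₛ-+ (⟦_⟧ ∘ away d f j) (⟦_⟧ ∘ toward d f j))
      where
      bits : ∀ z s m → ⟦ z ∧ m ⟧ ≡ ⟦ z ∧ not s ∧ m ⟧ ℕ.+ ⟦ z ∧ s ∧ m ⟧
      bits false s m = refl
      bits true true m = refl
      bits true false m = sym (ℕ.+-identityʳ ⟦ m ⟧)
      each : ∀ ι → ⟦ isFacet d (deleted f) j ι ⟧ ≡ ⟦ away d f j ι ⟧ ℕ.+ ⟦ toward d f j ι ⟧
      each (b Vec.∷ σ) = bits (cnt (lookup σ) ℕ.≡ᵇ d) (side f (b Vec.∷ Vec.insertAt σ p false) p) _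

    private
      throughFacets missingFacets : ℕ → (Subset (suc n) → Fin (suc n) → ℚ) → ℕ → Subset (suc n) → ℕ
      throughFacets d f j ι = ⟦ isFacet d f j (Vec.insertAt ι (suc p) true) ⟧
      missingFacets d f j ι = ⟦ isFacet d f j (Vec.insertAt ι (suc p) false) ⟧

      split-side : ∀ f b σ x → cnt (side f (b Vec.∷ Vec.insertAt σ p x))
        ≡ ⟦ side f (b Vec.∷ Vec.insertAt σ p x) p ⟧ ℕ.+ cnt (λ i → side f (b Vec.∷ Vec.insertAt σ p x) (punchIn p i))
      split-side f b σ x = sum-remove {i = p} (⟦_⟧ ∘ side f (b Vec.∷ Vec.insertAt σ p x))

    facetCount-throughFacets : ∀ {d} (C : Config (suc d) (suc n)) j → ∑ₛ (throughFacets (suc d) (Config.f C) j) ≡ facetCount d (contracted (Config.f C)) j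
    facetCount-throughFacets {d} C j = ∑ₛ-cong each
      where
      open Config C
      each : ∀ ι → throughFacets (suc d) f j ι ≡ ⟦ isFacet d (contracted f) j ι ⟧
      each (b Vec.∷ σ) = by (cnt (lookup σ) ℕ.≟ d)
        where
        open ≡-Reasoning
        by : Dec (cnt (lookup σ) ≡ d) → throughFacets (suc d) f j (b Vec.∷ σ) ≡ ⟦ isFacet d (contracted f) j (b Vec.∷ σ) ⟧
        by (no ¬size) = cong ⟦_⟧ (trans
          (cong (_∧ (cnt (side f (b Vec.∷ Vec.insertAt σ p true)) ℕ.≡ᵇ j)) (trans (cong (ℕ._≡ᵇ suc d) (size-insertAt σ p true)) (dec-false (cnt (lookup σ) ℕ.≟ d) ¬size)))
          (sym (cong (_∧ (cnt (side (contracted f) (b Vec.∷ σ)) ℕ.≡ᵇ j)) (dec-false (cnt (lookup σ) ℕ.≟ d) ¬size))))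
        by (yes size) = cong₂ (λ x y → ⟦ (x ℕ.≡ᵇ suc d) ∧ (y ℕ.≡ᵇ j) ⟧) (size-insertAt σ p true)
          (trans (split-side f b σ true) (cong (λ z → ⟦ z ⟧ ℕ.+ cnt (side (contracted f) (b Vec.∷ σ)))
            (≤0⇒nonpositive (≤-reflexive (signed-zero b (f-on (trans (size-insertAt σ p true) (cong suc size)) p (Vec.insertAt-lookup σ p true)))))))

    missing-zero : ∀ d f → ∑ₛ (missingFacets d f 0) ≡ awayCount d f 0
    missing-zero d f = ∑ₛ-cong each
      where
      bits : ∀ s m → (⟦ s ⟧ ℕ.+ m ℕ.≡ᵇ 0) ≡ not s ∧ (m ℕ.≡ᵇ 0)
      bits true m = refl
      bits false m = refl
      each : ∀ ι → missingFacets d f 0 ι ≡ ⟦ away d f 0 ι ⟧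
      each (b Vec.∷ σ) = trans
        (cong₂ (λ x y → ⟦ (x ℕ.≡ᵇ d) ∧ (y ℕ.≡ᵇ 0) ⟧) (size-insertAt σ p false) (split-side f b σ false))
        (cong (λ z → ⟦ (cnt (lookup σ) ℕ.≡ᵇ d) ∧ z ⟧) (bits (side f (b Vec.∷ Vec.insertAt σ p false) p) _))

    -- Restoring p raises the level by one exactly for the hyperplanes that have p on their positive
    -- side.
    missing-suc : ∀ d f j → ∑ₛ (missingFacets d f (suc j)) ≡ awayCount d f (suc j) ℕ.+ towardCount d f j
    missing-suc d f j = trans (∑ₛ-cong each) (∑ₛ-+ (⟦_⟧ ∘ away d f (suc j)) (⟦_⟧ ∘ toward d f j))
      where
      bits : ∀ z s m → ⟦ z ∧ (⟦ s ⟧ ℕ.+ m ℕ.≡ᵇ suc j) ⟧ ≡ ⟦ z ∧ not s ∧ (m ℕ.≡ᵇ suc j) ⟧ ℕ.+ ⟦ z ∧ s ∧ (m ℕ.≡ᵇ j) ⟧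
      bits false s m = refl
      bits true true m = refl
      bits true false m = sym (ℕ.+-identityʳ _)
      each : ∀ ι → missingFacets d f (suc j) ι ≡ ⟦ away d f (suc j) ι ⟧ ℕ.+ ⟦ toward d f j ι ⟧
      each (b Vec.∷ σ) = trans
        (cong₂ (λ x y → ⟦ (x ℕ.≡ᵇ d) ∧ (y ℕ.≡ᵇ suc j) ⟧) (size-insertAt σ p false) (split-side f b σ false))
        (bits (cnt (lookup σ) ℕ.≡ᵇ d) (side f (b Vec.∷ Vec.insertAt σ p false) p) _)

    module _ {d : ℕ} (C : Config (suc d) (suc n)) where
      open Config C using (f)

      private
        count count/p : ℕ → ℕ
        count = facetCount (suc d) f
        count/p = facetCount d (contracted f)

      cumulative-zero : cumulative count 0 ≡ count/p 0 ℕ.+ awayCount (suc d) f 0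
      cumulative-zero = trans (∑ₛ-insert (suc p) (⟦_⟧ ∘ isFacet (suc d) f 0))
        (trans (ℕ.+-comm (∑ₛ (missingFacets (suc d) f 0)) _) (cong₂ ℕ._+_ (facetCount-throughFacets C 0) (missing-zero (suc d) f)))

      -- The facets through p, those with p on their negative side at level suc k, and all the
      -- others, whose level in the deletion of p is at most k.
      cumulative-suc : ∀ k → cumulative count (suc k) ≡
        cumulative count/p (suc k) ℕ.+ awayCount (suc d) f (suc k) ℕ.+ cumulative (facetCount (suc d) (deleted f)) k
      cumulative-suc zero = begin
        cumulative count 0 ℕ.+ count 1
          ≡⟨ cong₂ ℕ._+_ cumulative-zero (trans (∑ₛ-insert (suc p) (⟦_⟧ ∘ isFacet (suc d) f 1)) (cong₂ ℕ._+_ (missing-suc (suc d) f 0) (facetCount-throughFacets C 1))) ⟩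
        (count/p 0 ℕ.+ A 0) ℕ.+ ((A 1 ℕ.+ B 0) ℕ.+ count/p 1)
          ≡⟨ regroup (count/p 0) (A 0) (A 1) (B 0) (count/p 1) ⟩
        ((count/p 0 ℕ.+ count/p 1) ℕ.+ A 1) ℕ.+ (A 0 ℕ.+ B 0)
          ≡⟨ cong (((count/p 0 ℕ.+ count/p 1) ℕ.+ A 1) ℕ.+_) (facetCount-deleted (suc d) f 0) ⟨
        ((count/p 0 ℕ.+ count/p 1) ℕ.+ A 1) ℕ.+ facetCount (suc d) (deleted f) 0 ∎
        where
        open ≡-Reasoning
        A = awayCount (suc d) f
        B = towardCount (suc d) f
        regroup : ∀ a b c d e → (a ℕ.+ b) ℕ.+ ((c ℕ.+ d) ℕ.+ e) ≡ ((a ℕ.+ e) ℕ.+ c) ℕ.+ (b ℕ.+ d)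
        regroup = ℕ-solve 5 (λ a b c d e → (a ⊕ b) ⊕ ((c ⊕ d) ⊕ e) ⊜ ((a ⊕ e) ⊕ c) ⊕ (b ⊕ d)) refl
      cumulative-suc (suc k) = begin
        cumulative count (suc k) ℕ.+ count (2 ℕ.+ k)
          ≡⟨ cong₂ ℕ._+_ (cumulative-suc k) (trans (∑ₛ-insert (suc p) (⟦_⟧ ∘ isFacet (suc d) f (2 ℕ.+ k))) (cong₂ ℕ._+_ (missing-suc (suc d) f (suc k)) (facetCount-throughFacets C (2 ℕ.+ k)))) ⟩
        ((X ℕ.+ A (suc k)) ℕ.+ Y) ℕ.+ ((A (2 ℕ.+ k) ℕ.+ B (suc k)) ℕ.+ count/p (2 ℕ.+ k))
          ≡⟨ regroup X (A (suc k)) Y (A (2 ℕ.+ k)) (B (suc k)) (count/p (2 ℕ.+ k)) ⟩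
        ((X ℕ.+ count/p (2 ℕ.+ k)) ℕ.+ A (2 ℕ.+ k)) ℕ.+ (Y ℕ.+ (A (suc k) ℕ.+ B (suc k)))
          ≡⟨ cong (λ z → ((X ℕ.+ count/p (2 ℕ.+ k)) ℕ.+ A (2 ℕ.+ k)) ℕ.+ (Y ℕ.+ z)) (facetCount-deleted (suc d) f (suc k)) ⟨
        ((X ℕ.+ count/p (2 ℕ.+ k)) ℕ.+ A (2 ℕ.+ k)) ℕ.+ (Y ℕ.+ facetCount (suc d) (deleted f) (suc k)) ∎
        where
        open ≡-Reasoning
        A = awayCount (suc d) f
        B = towardCount (suc d) f
        X = cumulative count/p (suc k)
        Y = cumulative (facetCount (suc d) (deleted f)) k
        regroup : ∀ a b c d e g → ((a ℕ.+ b) ℕ.+ c) ℕ.+ ((d ℕ.+ e) ℕ.+ g) ≡ ((a ℕ.+ g) ℕ.+ d) ℕ.+ (c ℕ.+ (b ℕ.+ e))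
        regroup = ℕ-solve 6 (λ a b c d e g → ((a ⊕ b) ⊕ c) ⊕ ((d ⊕ e) ⊕ g) ⊜ ((a ⊕ g) ⊕ d) ⊕ (c ⊕ (b ⊕ e))) refl

      positive-scale : ∀ {a x} → 0ℚ < a → positive? (a * x) ≡ positive? x
      positive-scale {a} {x} 0<a = by (0ℚ <? x)
        where
        by : Dec (0ℚ < x) → positive? (a * x) ≡ positive? x
        by (yes 0<x) = trans (0<⇒positive (0<* 0<a 0<x)) (sym (0<⇒positive 0<x))
        by (no 0≮x) = trans (≤0⇒nonpositive (subst (a * x ≤_) (*-zeroʳ a) (ℚ.*-monoˡ-≤-nonNeg a {{ℚ.nonNegative (<⇒≤ 0<a)}} (ℚ.≮⇒≥ 0≮x))))
          (sym (≤0⇒nonpositive (ℚ.≮⇒≥ 0≮x)))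

      inv-neg : ∀ {a} → a < 0ℚ → 0ℚ < - inv a
      inv-neg {a} a<0 = ℚ.*-cancelˡ-<-nonNeg (- a) {{ℚ.nonNegative (<⇒≤ (<0⇒0<- a<0))}}
        (subst₂ _<_ (sym (*-zeroʳ (- a))) (sym (trans (solve 2 (λ a i → (:- a) :* (:- i) := a :* i) refl a (inv a)) (inv-inverse {a} λ { refl → <-irrefl refl a<0 }))) 0<1)

      -- The spanning functionals are scaled to the value -1 at p and `h` to the value 1, so that
      -- their sum vanishes at p as `Lifting` requires. Each σ is then counted in the orientation
      -- with p on the negative side, in which the positive side is `above σ`.
      awayCount-bound : Extreme C → ∀ k → suc d ℕ.* k ℕ.+ suc d ℕ.≤ n → binom k d ℕ.≤ awayCount (suc d) f k
      awayCount-bound ext k le = ℕ.≤-trans (lifting k le) (ℕ.≤-trans (∑ₛ-mono each)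
        (ℕ.≤-reflexive (∑ₛ-+ (⟦_⟧ ∘ away (suc d) f k ∘ (false Vec.∷_)) (⟦_⟧ ∘ away (suc d) f k ∘ (true Vec.∷_)))))
        where
        open Config C hiding (f)
        F : Subset n → Fin (suc n) → ℚ
        F σ = f (Vec.insertAt σ p false)
        w₀ : Fin n → ℚ
        w₀ i = inv (h p) * h (punchIn p i)
        g : Subset n → Fin n → ℚ
        g σ i = - inv (F σ p) * F σ (punchIn p i)
        size′ : ∀ (σ : Subset n) → cnt (lookup σ) ≡ suc d → cnt (lookup (Vec.insertAt σ p false)) ≡ suc d
        size′ σ size = trans (size-insertAt σ p false) size
        Fp≢0 : ∀ {σ} → cnt (lookup σ) ≡ suc d → F σ p ≢ 0ℚ
        Fp≢0 {σ} size = f-off (size′ σ size) p (Vec.insertAt-lookup σ p false)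
        g-lifted : ∀ {σ} → cnt (lookup σ) ≡ suc d → Config.W (contraction C ext) (λ i → g σ i + w₀ i)
        g-lifted {σ} size = (λ i → - inv (F σ p) * F σ i + inv (h p) * h i) , W-comb (- inv (F σ p)) (inv (h p)) (f∈W (size′ σ size)) h∈W
          , trans (solve 4 (λ i x j y → (:- i) :* x :+ j :* y := y :* j :- x :* i) refl (inv (F σ p)) (F σ p) (inv (h p)) (h p))
              (trans (cong₂ _-_ (inv-inverse {h p} (0<⇒≢0 (0<h p))) (inv-inverse {F σ p} (Fp≢0 {σ} size))) (+-inverseʳ 1ℚ))
          , λ _ → refl
        g-on : ∀ {σ} → cnt (lookup σ) ≡ suc d → ∀ i → lookup σ i ≡ true → g σ i ≡ 0ℚ
        g-on {σ} size i i∈σ = trans (cong (- inv (F σ p) *_) (f-on (size′ σ size) (punchIn p i) (trans (Vec.insertAt-punchIn σ p false i) i∈σ))) (*-zeroʳ (- inv (F σ p)))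
        -inv≢0 : ∀ {x} → x ≢ 0ℚ → - inv x ≢ 0ℚ
        -inv≢0 {x} x≢0 eq = ℚ.1≢0 (trans (sym (inv-inverse x≢0)) (trans (cong (x *_) (trans (solve 1 (λ i → i := :- (:- i)) refl (inv x)) (cong -_ eq))) (*-zeroʳ x)))
        g-off : ∀ {σ} → cnt (lookup σ) ≡ suc d → ∀ i → lookup σ i ≡ false → g σ i ≢ 0ℚ
        g-off {σ} size i i∉σ = *≢0 { - inv (F σ p)} (-inv≢0 {F σ p} (Fp≢0 {σ} size)) (f-off (size′ σ size) (punchIn p i) (trans (Vec.insertAt-punchIn σ p false i) i∉σ))
        open Lifting (contraction C ext) w₀ g (λ {σ} → g-lifted {σ}) (λ {σ} → g-on {σ}) (λ {σ} → g-off {σ})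
        each : ∀ σ → ⟦ (cnt (lookup σ) ℕ.≡ᵇ suc d) ∧ (cnt (above σ) ℕ.≡ᵇ k) ⟧ ℕ.≤ ⟦ away (suc d) f k (false Vec.∷ σ) ⟧ ℕ.+ ⟦ away (suc d) f k (true Vec.∷ σ) ⟧
        each σ = by (cnt (lookup σ) ℕ.≟ suc d)
          where
          ind : ℕ
          ind = ⟦ (cnt (lookup σ) ℕ.≡ᵇ suc d) ∧ (cnt (above σ) ℕ.≡ᵇ k) ⟧
          ori : Bool → ℕ
          ori b = ⟦ away (suc d) f k (b Vec.∷ σ) ⟧
          orient : ∀ b → positive? (signed b (F σ p)) ≡ false → (∀ i → above σ i ≡ side (deleted f) (b Vec.∷ σ) i) → ind ℕ.≤ ori b
          orient b off same = ⟦⟧-mono λ eq → ∧-true {cnt (lookup σ) ℕ.≡ᵇ suc d} (∧-trueˡ {cnt (lookup σ) ℕ.≡ᵇ suc d} {cnt (above σ) ℕ.≡ᵇ k} eq)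
            (∧-true {not (positive? (signed b (F σ p)))} (cong not off)
              (trans (cong (ℕ._≡ᵇ k) (sym (cnt-cong same))) (∧-trueʳ {cnt (lookup σ) ℕ.≡ᵇ suc d} eq)))
          by : Dec (cnt (lookup σ) ≡ suc d) → ind ℕ.≤ ori false ℕ.+ ori true
          by (no ¬size) = subst (ℕ._≤ ori false ℕ.+ ori true) (sym (cong (λ z → ⟦ z ∧ (cnt (above σ) ℕ.≡ᵇ k) ⟧) (dec-false (cnt (lookup σ) ℕ.≟ suc d) ¬size))) ℕ.z≤n
          by (yes size) with ≢0⇒sign (Fp≢0 {σ} size)
          ... | inj₁ Fp<0 = ℕ.≤-trans (orient true (≤0⇒nonpositive (<⇒≤ Fp<0)) (λ i → positive-scale { - inv (F σ p)} {F σ (punchIn p i)} (inv-neg Fp<0))) (ℕ.m≤n+m (ori true) (ori false))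
          ... | inj₂ 0<Fp = ℕ.≤-trans (orient false (≤0⇒nonpositive (ℚ.neg-antimono-≤ (<⇒≤ 0<Fp)))
              (λ i → trans (cong positive? (solve 2 (λ i x → (:- i) :* x := i :* (:- x)) refl (inv (F σ p)) (F σ (punchIn p i)))) (positive-scale {inv (F σ p)} { - F σ (punchIn p i)} (0<inv 0<Fp)))) (ℕ.m≤m+n (ori false) (ori true))

  -- Existence of a vertex of the hull.

  module _ {d n : ℕ} (C : Config (suc d) (suc n)) (d<n : suc d ℕ.≤ n) where
    open ConfigProperties C

    separating : ∀ {p x} → x ≢ p → ∃ λ σ → cnt σ ≡ suc d × σ p ≡ true × σ x ≡ false
    separating {p} {x} x≢p with cnt-between (suc d) {b = λ i → does (i Fin.≟ p)} {c = λ i → not (does (i Fin.≟ x))}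
      p⊆ (subst (ℕ._≤ suc d) (sym (cnt-≟ p)) (ℕ.s≤s ℕ.z≤n)) (subst (suc d ℕ.≤_) (sym size) d<n)
      where
      p⊆ : ∀ i → does (i Fin.≟ p) ≡ true → not (does (i Fin.≟ x)) ≡ true
      p⊆ i eq with i Fin.≟ p
      ... | yes refl = cong not (dec-false (p Fin.≟ x) (x≢p ∘ sym))
      size : cnt (λ i → not (does (i Fin.≟ x))) ≡ n
      size = ℕ.suc-injective (trans (ℕ.+-comm 1 _) (trans (cong (cnt (λ i → not (does (i Fin.≟ x))) ℕ.+_) (sym (cnt-≟ x))) (cnt-not (λ i → does (i Fin.≟ x)))))
    ... | σ , p⊆σ , σ⊆ , size = σ , size , p⊆σ p (dec-true (p Fin.≟ p) refl)
        , Bool.¬-not λ x∈σ → contradiction (trans (sym (σ⊆ x x∈σ)) (cong not (dec-true (x Fin.≟ x) refl))) λ ()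

    private
      testCount : ℕ
      testCount = List.length (subsets (suc n))

      sizedTest : ∀ (σ : Subset (suc n)) → Dec (cnt (lookup σ) ≡ suc d) → Fin (suc n) → ℚ
      sizedTest σ (yes _) = f σ
      sizedTest σ (no _) = h

      test : Fin testCount → Fin (suc n) → ℚ
      test m = sizedTest (List.lookup (subsets (suc n)) m) (cnt (lookup (List.lookup (subsets (suc n)) m)) ℕ.≟ suc d)

      test∈W : ∀ m → W (test m)
      test∈W m with cnt (lookup (List.lookup (subsets (suc n)) m)) ℕ.≟ suc d
      ... | yes size = f∈W size
      ... | no _ = h∈W

      -- Dividing by `h` turns values into affine coordinates. All spanning functionals are used at
      -- once: they are far from independent, but together they separate the points, which is all
      -- that the norm argument asks.
      chart : Fin (suc n) → Fin testCount → ℚ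
      chart i m = test m i * inv (h i)

      chart-h : ∀ i m → chart i m * h i ≡ test m i
      chart-h i m = trans (*-assoc (test m i) (inv (h i)) (h i))
        (trans (cong (test m i *_) (trans (*-comm (inv (h i)) (h i)) (inv-inverse (0<⇒≢0 (0<h i))))) (*-identityʳ (test m i)))

      chart-separates : ∀ {p x} → x ≢ p → ∃ λ m → chart p m - chart x m ≢ 0ℚ
      chart-separates {p} {x} x≢p with separating x≢p
      ... | σ , size , p∈σ , x∉σ = m , λ eq → face-off {σ} size x x∉σ (trans (sym (trans (chart-h x m) (cong (λ v → v x) at)))
          (trans (cong (_* h x) (trans (trans (solve 2 (λ a b → b := a :- (a :- b)) refl (chart p m) (chart x m)) (cong₂ _-_ chartp≡0 eq)) refl)) (*-zeroˡ (h x))))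
        where
        τ = tabulate σ
        m = Any.index (∈-subsets τ)
        sizedTest-yes : ∀ {τ} (dec : Dec (cnt (lookup τ) ≡ suc d)) → cnt (lookup τ) ≡ suc d → sizedTest τ dec ≡ f τ
        sizedTest-yes (yes _) _ = refl
        sizedTest-yes (no ¬size) size = contradiction size ¬size
        at : test m ≡ face σ
        at = trans (cong (λ t → sizedTest t (cnt (lookup t) ℕ.≟ suc d)) (sym (Any.lookup-index (∈-subsets τ))))
          (sizedTest-yes (cnt (lookup τ) ℕ.≟ suc d) (trans (cnt-cong (Vec.lookup∘tabulate σ)) size))
        chartp≡0 : chart p m ≡ 0ℚ
        chartp≡0 = trans (cong (λ v → v p * inv (h p)) at) (trans (cong (_* inv (h p)) (face-on {σ} size p p∈σ)) (*-zeroˡ (inv (h p))))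

      norm² : Fin (suc n) → ℚ
      norm² i = ∑ (λ m → chart i m * chart i m)

      -- Twice ⟨a, a - b⟩ equals |a - b|² + |a|² - |b|².
      farther : ∀ {testCount} (a b : Fin testCount → ℚ) → ∑ (λ m → b m * b m) ≤ ∑ (λ m → a m * a m) → (∃ λ m → a m - b m ≢ 0ℚ) → 0ℚ < ∑ (λ m → a m * (a m - b m))
      farther a b le (m , nz) = ℚ.≰⇒> λ S≤0 → <-irrefl {0ℚ} refl (<-≤-trans {0ℚ} {S + S} {0ℚ} double (+-mono-≤ {S} {0ℚ} {S} {0ℚ} S≤0 S≤0))
        where
        S = ∑ (λ m → a m * (a m - b m))
        A² = ∑ (λ m → a m * a m)
        B² = ∑ (λ m → b m * b m)
        expand : ∀ x y → (x - y) * (x - y) + x * x ≡ x * (x - y) + x * (x - y) + y * y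
        expand = solve 2 (λ x y → (x :- y) :* (x :- y) :+ x :* x := x :* (x :- y) :+ x :* (x :- y) :+ y :* y) refl
        total : ∑ (λ m → (a m - b m) * (a m - b m)) + A² ≡ S + S + B²
        total = trans (sym (∑-+ (λ m → (a m - b m) * (a m - b m)) (λ m → a m * a m)))
          (trans (∑-cong λ m → expand (a m) (b m))
          (trans (∑-+ (λ m → a m * (a m - b m) + a m * (a m - b m)) (λ m → b m * b m))
            (cong (_+ B²) (∑-+ (λ m → a m * (a m - b m)) (λ m → a m * (a m - b m))))))
        double : 0ℚ < S + S
        double = subst (0ℚ <_) (trans (solve 3 (λ x y z → x :+ (y :- z) := (x :+ y) :- z) refl (∑ (λ m → (a m - b m) * (a m - b m))) A² B²)
            (trans (cong (_- B²) total) (solve 2 (λ x y → x :+ y :- y := x) refl (S + S) B²)))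
          (+-mono-<-≤ (∑-pos (λ i → square-nonneg (a i - b i)) m (square-pos nz)) (≤⇒0≤- le))

    -- The point farthest from the origin of the chart is a vertex of the convex hull.
    extreme-point-exists : ∃ λ p → Extreme p C
    extreme-point-exists with argmin {P = λ _ → ⊤} (λ _ → yes tt) (λ i → - norm² i) (List.allFin (suc n)) (zero , List.∈-allFin zero , tt)
    ... | p , _ , least = p , l , l∈W , at-p , above
      where
      -- The tangent hyperplane at p of the sphere through p, multiplied by `h` to return from the
      -- chart to W.
      l : Fin (suc n) → ℚ
      l i = ∑ (λ m → chart p m * (chart p m * h i + - 1ℚ * test m i))
      l∈W : W l
      l∈W = W-sum (chart p) (λ m i → chart p m * h i + - 1ℚ * test m i) (λ m → W-comb (chart p m) (- 1ℚ) h∈W (test∈W m))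
      l-chart : ∀ i → l i ≡ h i * ∑ (λ m → chart p m * (chart p m - chart i m))
      l-chart i = trans (∑-cong λ m → trans (cong (λ z → chart p m * (chart p m * h i + - 1ℚ * z)) (sym (chart-h i m))) (factor (chart p m) (h i) (chart i m)))
        (sym (*-∑ (h i) (λ m → chart p m * (chart p m - chart i m))))
        where
        factor : ∀ a k b → a * (a * k + - 1ℚ * (b * k)) ≡ k * (a * (a - b))
        factor = solve 3 (λ a k b → a :* (a :* k :+ con (- 1ℚ) :* (b :* k)) := k :* (a :* (a :- b))) refl
      at-p : l p ≡ 0ℚ
      at-p = trans (l-chart p) (trans (cong (h p *_) (∑-zero λ m → trans (cong (chart p m *_) (+-inverseʳ (chart p m))) (*-zeroʳ (chart p m)))) (*-zeroʳ (h p)))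
      flip : ∀ {a b} → - a ≤ - b → b ≤ a
      flip {a} {b} le = subst₂ _≤_ (solve 1 (λ a → :- (:- a) := a) refl b) (solve 1 (λ a → :- (:- a) := a) refl a) (ℚ.neg-antimono-≤ le)
      above : ∀ i → 0ℚ < l (punchIn p i)
      above i = subst (0ℚ <_) (sym (l-chart (punchIn p i))) (0<* (0<h (punchIn p i))
        (farther (chart p) (chart (punchIn p i)) (flip (least (punchIn p i) (List.∈-allFin (punchIn p i)) tt)) (chart-separates (Fin.punchInᵢ≢i p i))))

    abstract
      extreme-point : ∃ λ p → Extreme p C
      extreme-point = extreme-point-exists

  -- The lower bound by induction.

  ∑ₛ-≥ : ∀ {n} (g : Subset n → ℕ) σ → g σ ℕ.≤ ∑ₛ g
  ∑ₛ-≥ g Vec.[] = ℕ.≤-refl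
  ∑ₛ-≥ g (false Vec.∷ σ) = ℕ.≤-trans (∑ₛ-≥ (g ∘ (false Vec.∷_)) σ) (ℕ.m≤m+n _ _)
  ∑ₛ-≥ g (true Vec.∷ σ) = ℕ.≤-trans (∑ₛ-≥ (g ∘ (true Vec.∷_)) σ) (ℕ.m≤n+m _ _)

  cumulative-≥ : ∀ c k → c 0 ℕ.≤ cumulative c k
  cumulative-≥ c zero = ℕ.≤-refl
  cumulative-≥ c (suc k) = ℕ.≤-trans (cumulative-≥ c k) (ℕ.m≤m+n _ _)

  -- In dimension 0 a functional that vanishes at one point is zero, so the functional of the empty
  -- set is a multiple of `h` and has one sign throughout; the opposite orientation has nothing on
  -- its positive side. The induction on the dimension thus starts one below the theorem.
  point-facet : ∀ {n} (C : Config 0 (suc n)) → 1 ℕ.≤ facetCount 0 (Config.f C) 0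
  point-facet {n} C = ℕ.≤-trans (ℕ.≤-reflexive (sym (cong ⟦_⟧ isFacet-ι))) (∑ₛ-≥ (⟦_⟧ ∘ isFacet 0 f 0) (b Vec.∷ ∅))
    where
    open Config C
    ∅ : Subset (suc n)
    ∅ = tabulate (λ _ → false)
    size : cnt (lookup ∅) ≡ 0
    size = cnt-none {b = lookup ∅} (Vec.lookup∘tabulate (λ _ → false))
    b : Bool
    b = not (positive? (f ∅ zero))
    ratio : ∀ i → f ∅ zero * h i ≡ h zero * f ∅ i
    ratio i = begin
      f ∅ zero * h i                                                  ≡⟨ solve 2 (λ x y → x := (x :+ :- y) :+ y) refl (f ∅ zero * h i) (h zero * f ∅ i) ⟩
      (f ∅ zero * h i + - (h zero * f ∅ i)) + h zero * f ∅ i          ≡⟨ cong (_+ h zero * f ∅ i) (trans (solve 4 (λ a x y z → a :* x :+ (:- (y :* z)) := a :* x :+ (:- y) :* z) refl (f ∅ zero) (h i) (h zero) (f ∅ i)) vanish) ⟩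
      0ℚ + h zero * f ∅ i                                             ≡⟨ +-identityˡ (h zero * f ∅ i) ⟩
      h zero * f ∅ i                                                  ∎
      where
      open ≡-Reasoning
      vanish : f ∅ zero * h i + (- h zero) * f ∅ i ≡ 0ℚ
      vanish = unique (W-comb (f ∅ zero) (- h zero) h∈W (f∈W size)) (λ j → does (j Fin.≟ zero)) (cnt-≟ {suc n} zero) at-zero i
        where
        at-zero : ∀ j → does (j Fin.≟ zero) ≡ true → f ∅ zero * h j + (- h zero) * f ∅ j ≡ 0ℚ
        at-zero zero _ = solve 2 (λ x y → x :* y :+ (:- y) :* x := con 0ℚ) refl (f ∅ zero) (h zero)
    cancel : ∀ {a x} → 0ℚ < a → 0ℚ < a * x → 0ℚ < x
    cancel {a} {x} 0<a 0<ax = ℚ.*-cancelˡ-<-nonNeg a {{ℚ.nonNegative (<⇒≤ 0<a)}} (subst (_< a * x) (sym (*-zeroʳ a)) 0<ax)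
    no-side : ∀ i → side f (b Vec.∷ ∅) i ≡ false
    no-side i = by (positive? (f ∅ zero)) refl
      where
      by : ∀ z → positive? (f ∅ zero) ≡ z → positive? (signed (not (positive? (f ∅ zero))) (f ∅ i)) ≡ false
      by true eq = trans (cong (λ z → positive? (signed (not z) (f ∅ i))) eq) (≤0⇒nonpositive (ℚ.neg-antimono-≤ (<⇒≤
        (cancel (0<h zero) (subst (0ℚ <_) (ratio i) (0<* (positive⇒0< eq) (0<h i)))))))
      by false eq = trans (cong (λ z → positive? (signed (not z) (f ∅ i))) eq) (≤0⇒nonpositive (ℚ.≮⇒≥ λ 0<fi →
        <-irrefl refl (<-≤-trans (cancel {h i} (0<h i) (subst (0ℚ <_) (trans (sym (ratio i)) (*-comm (f ∅ zero) (h i))) (0<* (0<h zero) 0<fi))) (nonpositive⇒≤0 eq))))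
    isFacet-ι : isFacet 0 f 0 (b Vec.∷ ∅) ≡ true
    isFacet-ι = ∧-true (≡⇒≡ᵇ size) (≡⇒≡ᵇ (cnt-none no-side))

  module _ {d n : ℕ} (p : Fin (suc n)) (C : Config (suc d) (suc n)) (ext : Extreme p C) where
    private
      values = Config.f C

      -- Projection costs one point and saves k + 1 of the required ones, so k are left to spare.
      fits : ∀ k → suc k ℕ.* suc (suc d) ℕ.≤ suc n → suc k ℕ.* suc d ℕ.≤ n
      fits k le = ℕ.≤-pred (ℕ.≤-trans (ℕ.≤-trans (ℕ.m≤m+n (suc (suc k ℕ.* suc d)) k)
        (ℕ.≤-reflexive (count k d))) le)
        where
        count : ∀ k d → suc (suc k ℕ.* suc d) ℕ.+ k ≡ suc k ℕ.* suc (suc d)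
        count = ℕ-solve 2 (λ k d → num 1 ⊕ ((num 1 ⊕ k) ⊛ (num 1 ⊕ d)) ⊕ k ⊜ (num 1 ⊕ k) ⊛ (num 2 ⊕ d)) refl

      away-bound : ∀ k → suc k ℕ.* suc (suc d) ℕ.≤ suc n → binom k d ℕ.≤ awayCount p (suc d) values k
      away-bound k le = awayCount-bound p C ext k (subst (ℕ._≤ n) (count k d) (fits k le))
        where
        count : ∀ k d → suc k ℕ.* suc d ≡ suc d ℕ.* k ℕ.+ suc d
        count = ℕ-solve 2 (λ k d → (num 1 ⊕ k) ⊛ (num 1 ⊕ d) ⊜ (num 1 ⊕ d) ⊛ k ⊕ (num 1 ⊕ d)) refl

    bound-zero : 1 ℕ.* suc (suc d) ℕ.≤ suc n →
      (1 ℕ.* suc d ℕ.≤ n → suc d ℕ.* 1 ℕ.≤ facetCount d (contracted p values) 0) →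
      suc (suc d) ℕ.* 1 ℕ.≤ cumulative (facetCount (suc d) values) 0
    bound-zero le contracted-bound = begin
      suc (suc d) ℕ.* 1                                                    ≡⟨ count d ⟩
      suc d ℕ.* 1 ℕ.+ 1                                                    ≤⟨ ℕ.+-mono-≤ (contracted-bound (fits 0 le)) (away-bound 0 le) ⟩
      facetCount d (contracted p values) 0 ℕ.+ awayCount p (suc d) values 0          ≡⟨ cumulative-zero p C ⟨
      cumulative (facetCount (suc d) values) 0                                  ∎
      where
      open ℕ.≤-Reasoning
      count : ∀ d → suc (suc d) ℕ.* 1 ≡ suc d ℕ.* 1 ℕ.+ 1
      count = ℕ-solve 1 (λ d → (num 2 ⊕ d) ⊛ num 1 ⊜ (num 1 ⊕ d) ⊛ num 1 ⊕ num 1) refl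

    -- Let x + y be Pascal's rule for the binomial coefficient. The three terms of `cumulative-suc`
    -- are at least (d + 1) x, x and (d + 2) y.
    bound-suc : ∀ k → suc (suc k) ℕ.* suc (suc d) ℕ.≤ suc n →
      (suc (suc k) ℕ.* suc d ℕ.≤ n → suc d ℕ.* binom (suc k) d ℕ.≤ cumulative (facetCount d (contracted p values)) (suc k)) →
      (suc k ℕ.* suc (suc d) ℕ.≤ n → suc (suc d) ℕ.* binom k (suc d) ℕ.≤ cumulative (facetCount (suc d) (deleted p values)) k) →
      suc (suc d) ℕ.* binom (suc k) (suc d) ℕ.≤ cumulative (facetCount (suc d) values) (suc k)
    bound-suc k le contracted-bound deleted-bound = begin
      suc (suc d) ℕ.* (binom (suc k) d ℕ.+ binom k (suc d))
        ≡⟨ count d (binom (suc k) d) (binom k (suc d)) ⟩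
      (suc d ℕ.* binom (suc k) d ℕ.+ binom (suc k) d) ℕ.+ suc (suc d) ℕ.* binom k (suc d)
        ≤⟨ ℕ.+-mono-≤ (ℕ.+-mono-≤ (contracted-bound (fits (suc k) le)) (away-bound (suc k) le))
                      (deleted-bound (ℕ.≤-pred (ℕ.≤-trans (ℕ.s≤s (ℕ.m≤n+m (suc k ℕ.* suc (suc d)) (suc d))) le))) ⟩
      (cumulative (facetCount d (contracted p values)) (suc k) ℕ.+ awayCount p (suc d) values (suc k)) ℕ.+ cumulative (facetCount (suc d) (deleted p values)) k
        ≡⟨ cumulative-suc p C k ⟨
      cumulative (facetCount (suc d) values) (suc k) ∎
      where
      open ℕ.≤-Reasoning
      count : ∀ d x y → suc (suc d) ℕ.* (x ℕ.+ y) ≡ (suc d ℕ.* x ℕ.+ x) ℕ.+ suc (suc d) ℕ.* y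
      count = ℕ-solve 3 (λ d x y → (num 2 ⊕ d) ⊛ (x ⊕ y) ⊜ ((num 1 ⊕ d) ⊛ x ⊕ x) ⊕ (num 2 ⊕ d) ⊛ y) refl

  lower-bound : ∀ d n k (C : Config d n) → suc k ℕ.* suc d ℕ.≤ n → suc d ℕ.* binom k d ℕ.≤ cumulative (facetCount d (Config.f C)) k
  lower-bound zero zero k C ()
  lower-bound zero (suc n) k C le = ℕ.≤-trans (ℕ.≤-reflexive (trans (ℕ.+-identityʳ (binom k 0)) (binom-zero k)))
    (ℕ.≤-trans (point-facet C) (cumulative-≥ (facetCount 0 (Config.f C)) k))
  lower-bound (suc d) zero k C ()
  lower-bound (suc d) (suc n) k C le with extreme-point C (ℕ.≤-pred (ℕ.≤-trans (ℕ.m≤m+n (suc (suc d)) (k ℕ.* suc (suc d))) le))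
  lower-bound (suc d) (suc n) zero C le | p , ext = bound-zero p C ext le (lower-bound d n zero (contraction p C ext))
  lower-bound (suc d) (suc n) (suc k) C le | p , ext =
    bound-suc p C ext k le (lower-bound d n (suc k) (contraction p C ext)) (lower-bound (suc d) n k (deletion p C))

  -- Signs of Cauchy sequences.

  Seq : Set
  Seq = ℕ → ℚ

  -- The limit is positive, zero, or apart from zero. Bare sequences are used so that rational
  -- expressions in the terms need not be packed into reals.
  Pos Null Apart : Seq → Set
  Pos s = ∃ λ ε → 0ℚ < ε × ∃ λ N → ∀ m → N ℕ.≤ m → ε < s m
  Null s = ∀ ε → 0ℚ < ε → ∃ λ N → ∀ m → N ℕ.≤ m → ∣ s m ∣ < ε
  Apart s = Pos s ⊎ Pos (λ m → - s m)

  p≤∣p∣ : ∀ p → p ≤ ∣ p ∣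
  p≤∣p∣ p with ℚ.≤-total 0ℚ p
  ... | inj₁ 0≤p = ≤-reflexive (sym (ℚ.0≤p⇒∣p∣≡p 0≤p))
  ... | inj₂ p≤0 = ≤-trans p≤0 (ℚ.0≤∣p∣ p)

  ∣∣<⇒< : ∀ {p ε} → ∣ p ∣ < ε → p < ε
  ∣∣<⇒< {p} = ≤-<-trans (p≤∣p∣ p)

  ∣∣<⇒-< : ∀ {p ε} → ∣ p ∣ < ε → - p < ε
  ∣∣<⇒-< {p} {ε} lt = ≤-<-trans (p≤∣p∣ (- p)) (subst (_< ε) (sym (ℚ.∣-p∣≡∣p∣ p)) lt)

  private
    half : ∀ {ε} → 0ℚ < ε → 0ℚ < ½ * ε
    half = 0<* 0<½

    half+half : ∀ ε → ½ * ε + ½ * ε ≡ ε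
    half+half = solve 1 (λ ε → con ½ :* ε :+ con ½ :* ε := ε) refl

    join₁ : ∀ N M {m} → N ℕ.⊔ M ℕ.≤ m → N ℕ.≤ m
    join₁ N M = ℕ.m⊔n≤o⇒m≤o N M
    join₂ : ∀ N M {m} → N ℕ.⊔ M ℕ.≤ m → M ℕ.≤ m
    join₂ N M = ℕ.m⊔n≤o⇒n≤o N M

    +-< : ∀ {a b c d} → a < b → c < d → a + c < b + d
    +-< = +-mono-<

  Pos-ext : ∀ {s t} → (∀ m → s m ≡ t m) → Pos s → Pos t
  Pos-ext eq (ε , 0<ε , N , ev) = ε , 0<ε , N , λ m N≤m → subst (ε <_) (eq m) (ev m N≤m)

  Apart-ext : ∀ {s t} → (∀ m → s m ≡ t m) → Apart s → Apart t
  Apart-ext eq (inj₁ p) = inj₁ (Pos-ext eq p)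
  Apart-ext eq (inj₂ p) = inj₂ (Pos-ext (λ m → cong -_ (eq m)) p)

  Null-ext : ∀ {s t} → (∀ m → s m ≡ t m) → Null s → Null t
  Null-ext eq ns ε 0<ε = let N , ev = ns ε 0<ε in N , λ m N≤m → subst (λ z → ∣ z ∣ < ε) (eq m) (ev m N≤m)

  Pos-* : ∀ {s t} → Pos s → Pos t → Pos (λ m → s m * t m)
  Pos-* {s} {t} (ε , 0<ε , N , ev) (δ , 0<δ , M , ev′) = ε * δ , 0<* 0<ε 0<δ , N ℕ.⊔ M , λ m le →
    <-trans (ℚ.*-monoʳ-<-pos ε {{ℚ.positive 0<ε}} (ev′ m (join₂ N M le)))
            (ℚ.*-monoˡ-<-pos (t m) {{ℚ.positive (<-trans 0<δ (ev′ m (join₂ N M le)))}} (ev m (join₁ N M le)))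

  Pos-eventually : ∀ {s} → Pos s → ∃ λ N → ∀ m → N ℕ.≤ m → 0ℚ < s m
  Pos-eventually (ε , 0<ε , N , ev) = N , λ m N≤m → <-trans 0<ε (ev m N≤m)

  Pos-asym : ∀ {s} → Pos s → ¬ Pos (λ m → - s m)
  Pos-asym {s} p q with Pos-eventually p | Pos-eventually q
  ... | N , ev | M , ev′ = <-irrefl refl (<-trans (ev (N ℕ.⊔ M) (ℕ.m≤m⊔n N M)) (0<-⇒<0 (ev′ (N ℕ.⊔ M) (ℕ.m≤n⊔m N M))))

  Pos⇒¬Null : ∀ {s} → Pos s → ¬ Null s
  Pos⇒¬Null {s} (ε , 0<ε , N , ev) ns with ns ε 0<ε
  ... | M , small = <-irrefl refl (<-trans (ev (N ℕ.⊔ M) (ℕ.m≤m⊔n N M)) (∣∣<⇒< (small (N ℕ.⊔ M) (ℕ.m≤n⊔m N M))))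

  Null-neg : ∀ {s} → Null s → Null (λ m → - s m)
  Null-neg {s} ns ε 0<ε = let N , ev = ns ε 0<ε in N , λ m N≤m → subst (_< ε) (sym (ℚ.∣-p∣≡∣p∣ (s m))) (ev m N≤m)

  Null-+ : ∀ {s t} → Null s → Null t → Null (λ m → s m + t m)
  Null-+ {s} {t} ns nt ε 0<ε with ns (½ * ε) (half 0<ε) | nt (½ * ε) (half 0<ε)
  ... | N , ev | M , ev′ = N ℕ.⊔ M , λ m le → ≤-<-trans (ℚ.∣p+q∣≤∣p∣+∣q∣ (s m) (t m))
    (subst (∣ s m ∣ + ∣ t m ∣ <_) (half+half ε) (+-< (ev m (join₁ N M le)) (ev′ m (join₂ N M le))))

  Null-zero : ∀ {s} → (∀ m → s m ≡ 0ℚ) → Null s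
  Null-zero eq ε 0<ε = 0 , λ m _ → subst (λ z → ∣ z ∣ < ε) (sym (eq m)) 0<ε

  Null-const : ∀ {q} → Null (λ _ → q) → q ≡ 0ℚ
  Null-const {q} nq with ℚ.<-cmp q 0ℚ
  ... | tri≈ _ eq _ = eq
  ... | tri> _ _ 0<q = let N , ev = nq q 0<q in contradiction (∣∣<⇒< (ev N ℕ.≤-refl)) (<-irrefl refl)
  ... | tri< q<0 _ _ = let N , ev = nq (- q) (<0⇒0<- q<0) in contradiction (∣∣<⇒-< {q} (ev N ℕ.≤-refl)) (<-irrefl refl)

  Pos-Null : ∀ {s t} → Null t → Pos s → Pos (λ m → s m + t m)
  Pos-Null {s} {t} nt (ε , 0<ε , N , ev) with nt (½ * ε) (half 0<ε)
  ... | M , small = ½ * ε , half 0<ε , N ℕ.⊔ M , λ m le →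
    0<-⇒< (subst (0ℚ <_) (trans (cong (λ z → (s m - z) + (½ * ε - - t m)) (sym (half+half ε))) (regroup (s m) (½ * ε) (t m)))
      (+-< (<⇒0<- (ev m (join₁ N M le))) (<⇒0<- (∣∣<⇒-< {t m} (small m (join₂ N M le))))))
    where
    regroup : ∀ s h t → (s - (h + h)) + (h - - t) ≡ (s + t) - h
    regroup = solve 3 (λ s h t → (s :- (h :+ h)) :+ (h :- (:- t)) := (s :+ t) :- h) refl

  Bounded : Seq → Set
  Bounded s = ∃ λ b → 0ℚ < b × ∃ λ N → ∀ m → N ℕ.≤ m → ∣ s m ∣ < b

  Cauchy⇒Bounded : ∀ {s} → IsCauchy s → Bounded s
  Cauchy⇒Bounded {s} cs with cs 1ℚ 0<1
  ... | N , close = 1ℚ + ∣ s N ∣ , +-mono-<-≤ 0<1 (ℚ.0≤∣p∣ (s N)) , N , λ m N≤m →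
    subst (λ z → ∣ z ∣ < 1ℚ + ∣ s N ∣) (solve 2 (λ p q → (p :- q) :+ q := p) refl (s m) (s N))
      (≤-<-trans (ℚ.∣p+q∣≤∣p∣+∣q∣ (s m - s N) (s N)) (ℚ.+-monoˡ-< ∣ s N ∣ (close m N N≤m ℕ.≤-refl)))

  Null-* : ∀ {s t} → Bounded s → Null t → Null (λ m → s m * t m)
  Null-* {s} {t} (b , 0<b , N , bound) nt ε 0<ε with nt (inv b * ε) (0<* (0<inv 0<b) 0<ε)
  ... | M , small = N ℕ.⊔ M , λ m le → subst (_< ε) (sym (ℚ.∣p*q∣≡∣p∣*∣q∣ (s m) (t m)))
    (≤-<-trans (ℚ.*-monoʳ-≤-nonNeg ∣ t m ∣ {{ℚ.nonNegative (ℚ.0≤∣p∣ (t m))}} (<⇒≤ (bound m (join₁ N M le))))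
      (subst (b * ∣ t m ∣ <_) cancel (ℚ.*-monoʳ-<-pos b {{ℚ.positive 0<b}} (small m (join₂ N M le)))))
    where
    cancel : b * (inv b * ε) ≡ ε
    cancel = trans (sym (*-assoc b (inv b) ε)) (trans (cong (_* ε) (inv-inverse (0<⇒≢0 0<b))) (*-identityˡ ε))

  -- Late terms differ by less than δ / 2, so one late term determines the sign of all that follow.
  away-from-zero : ∀ {s} → IsCauchy s → ∀ δ → 0ℚ < δ → ∀ N → (∀ m → N ℕ.≤ m → δ < s m ⊎ δ < - s m) → Apart s
  away-from-zero {s} cs δ 0<δ N clear with cs (½ * δ) (half 0<δ)
  ... | M , close with clear (N ℕ.⊔ M) (ℕ.m≤m⊔n N M)
  ...   | inj₁ δ<s = inj₁ (½ * δ , half 0<δ , N ℕ.⊔ M , λ m le → 0<-⇒< (subst (0ℚ <_)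
    (trans (cong (λ z → (s K - z) + (½ * δ - (s K - s m))) (sym (half+half δ))) (regroup (s K) (½ * δ) (s m)))
    (+-< (<⇒0<- δ<s) (<⇒0<- (∣∣<⇒< (close K m (ℕ.m≤n⊔m N M) (join₂ N M le)))))))
    where
    K = N ℕ.⊔ M
    regroup : ∀ k h m → (k - (h + h)) + (h - (k - m)) ≡ m - h
    regroup = solve 3 (λ k h m → (k :- (h :+ h)) :+ (h :- (k :- m)) := m :- h) refl
  ...   | inj₂ δ<-s = inj₂ (½ * δ , half 0<δ , N ℕ.⊔ M , λ m le → 0<-⇒< (subst (0ℚ <_)
    (trans (cong (λ z → (- s K - z) + (½ * δ - - (s K - s m))) (sym (half+half δ))) (regroup (s K) (½ * δ) (s m)))
    (+-< (<⇒0<- δ<-s) (<⇒0<- (∣∣<⇒-< {s K - s m} (close K m (ℕ.m≤n⊔m N M) (join₂ N M le)))))))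
    where
    K = N ℕ.⊔ M
    regroup : ∀ k h m → (- k - (h + h)) + (h - - (k - m)) ≡ - m - h
    regroup = solve 3 (λ k h m → (:- k :- (h :+ h)) :+ (h :- (:- (k :- m))) := :- m :- h) refl

  -- Where |s t| exceeds ε and |t| is below b, |s| exceeds ε / b; the Cauchy property then fixes the
  -- sign.
  Apart-factor : ∀ {s t} → IsCauchy s → Bounded t → Apart (λ m → s m * t m) → Apart s
  Apart-factor {s} {t} cs (b , 0<b , M , bound) st = go (large st)
    where
    ε<∣∣ : ∀ {ε} q → ε < q ⊎ ε < - q → ε < ∣ q ∣
    ε<∣∣ {ε} q (inj₁ lt) = <-≤-trans lt (p≤∣p∣ q)
    ε<∣∣ {ε} q (inj₂ lt) = <-≤-trans lt (subst (- q ≤_) (ℚ.∣-p∣≡∣p∣ q) (p≤∣p∣ (- q)))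
    Large : Set
    Large = ∃ λ ε → 0ℚ < ε × ∃ λ N → ∀ m → N ℕ.≤ m → ε < ∣ s m * t m ∣
    large : Apart (λ m → s m * t m) → Large
    large (inj₁ (ε , 0<ε , N , ev)) = ε , 0<ε , N , λ m le → ε<∣∣ (s m * t m) (inj₁ (ev m le))
    large (inj₂ (ε , 0<ε , N , ev)) = ε , 0<ε , N , λ m le → ε<∣∣ (s m * t m) (inj₂ (ev m le))
    go : Large → Apart s
    go (ε , 0<ε , N , ev) = away-from-zero cs δ (0<* 0<ε (0<inv 0<b)) (N ℕ.⊔ M) clear
      where
      δ = ε * inv b
      δb : δ * b ≡ ε
      δb = trans (*-assoc ε (inv b) b) (trans (cong (ε *_) (trans (*-comm (inv b) b) (inv-inverse (0<⇒≢0 0<b)))) (*-identityʳ ε))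
      δ<∣s∣ : ∀ m → N ℕ.⊔ M ℕ.≤ m → δ < ∣ s m ∣
      δ<∣s∣ m le = ℚ.*-cancelʳ-<-nonNeg b {{ℚ.nonNegative (<⇒≤ 0<b)}} (subst (_< ∣ s m ∣ * b) (sym δb)
        (<-≤-trans (subst (ε <_) (ℚ.∣p*q∣≡∣p∣*∣q∣ (s m) (t m)) (ev m (join₁ N M le)))
          (ℚ.*-monoˡ-≤-nonNeg ∣ s m ∣ {{ℚ.nonNegative (ℚ.0≤∣p∣ (s m))}} (<⇒≤ (bound m (join₂ N M le))))))
      clear : ∀ m → N ℕ.⊔ M ℕ.≤ m → δ < s m ⊎ δ < - s m
      clear m le with ℚ.∣p∣≡p∨∣p∣≡-p (s m)
      ... | inj₁ eq = inj₁ (subst (δ <_) eq (δ<∣s∣ m le))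
      ... | inj₂ eq = inj₂ (subst (δ <_) eq (δ<∣s∣ m le))

  -- The alternative has to be decided from rational data: a late term of s, accurate to ε / 4, is
  -- compared with ε / 2.
  Pos-split : ∀ {s t} → IsCauchy s → Pos (λ m → s m + t m) → Pos s ⊎ Pos t
  Pos-split {s} {t} cs (ε , 0<ε , N , ev) with cs (½ * (½ * ε)) (half (half 0<ε))
  ... | M , close with ½ * ε <? s (N ℕ.⊔ M)
  ...   | yes lt = inj₁ (½ * (½ * ε) , half (half 0<ε) , N ℕ.⊔ M , λ m le → 0<-⇒< (subst (0ℚ <_)
    (regroup (s K) ε (s m)) (+-< (<⇒0<- lt) (<⇒0<- (∣∣<⇒< (close K m (ℕ.m≤n⊔m N M) (join₂ N M le)))))))
    where
    K = N ℕ.⊔ M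
    regroup : ∀ k e m → (k - ½ * e) + (½ * (½ * e) - (k - m)) ≡ m - ½ * (½ * e)
    regroup = solve 3 (λ k e m → (k :- con ½ :* e) :+ (con ½ :* (con ½ :* e) :- (k :- m)) := m :- con ½ :* (con ½ :* e)) refl
  ...   | no ≮ = inj₂ (½ * (½ * ε) , half (half 0<ε) , N ℕ.⊔ M , λ m le → 0<-⇒< (subst (0ℚ <_)
    (regroup (s K) ε (s m) (t m)) (+-mono-≤-< (≤⇒0≤- (ℚ.≮⇒≥ ≮)) (+-< (<⇒0<- (∣∣<⇒-< {s K - s m} (close K m (ℕ.m≤n⊔m N M) (join₂ N M le)))) (<⇒0<- (ev m (join₁ N M le)))))))
    where
    K = N ℕ.⊔ M
    regroup : ∀ k e m t → (½ * e - k) + ((½ * (½ * e) - - (k - m)) + ((m + t) - e)) ≡ t - ½ * (½ * e)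
    regroup = solve 4 (λ k e m t → (con ½ :* e :- k) :+ ((con ½ :* (con ½ :* e) :- (:- (k :- m))) :+ ((m :+ t) :- e)) := t :- con ½ :* (con ½ :* e)) refl

  neg-Cauchy : ∀ {s} → IsCauchy s → IsCauchy (λ m → - s m)
  neg-Cauchy {s} cs ε 0<ε = let N , close = cs ε 0<ε in N , λ m k N≤m N≤k →
    subst (_< ε) (trans (sym (ℚ.∣-p∣≡∣p∣ (s m - s k))) (cong ∣_∣ (solve 2 (λ p q → :- (p :- q) := :- p :- (:- q)) refl (s m) (s k)))) (close m k N≤m N≤k)

  Apart-split : ∀ {s t} → IsCauchy s → Apart (λ m → s m + t m) → Apart s ⊎ Apart t
  Apart-split {s} {t} cs (inj₁ p) = Sum.map inj₁ inj₁ (Pos-split {s} {t} cs p)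
  Apart-split {s} {t} cs (inj₂ p) = Sum.map inj₂ inj₂ (Pos-split { λ m → - s m } { λ m → - t m } (neg-Cauchy {s} cs)
    (Pos-ext { λ m → - (s m + t m) } (λ m → ℚ.neg-distrib-+ (s m) (t m)) p))

  Apart-* : ∀ {s t} → Apart s → Apart t → Apart (λ m → s m * t m)
  Apart-* (inj₁ p) (inj₁ q) = inj₁ (Pos-* p q)
  Apart-* {s} {t} (inj₁ p) (inj₂ q) = inj₂ (Pos-ext (λ m → sym (ℚ.neg-distribʳ-* (s m) (t m))) (Pos-* p q))
  Apart-* {s} {t} (inj₂ p) (inj₁ q) = inj₂ (Pos-ext (λ m → sym (ℚ.neg-distribˡ-* (s m) (t m))) (Pos-* p q))
  Apart-* {s} {t} (inj₂ p) (inj₂ q) = inj₁ (Pos-ext (λ m → solve 2 (λ x y → :- x :* :- y := x :* y) refl (s m) (t m)) (Pos-* p q))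

  Apart-neg : ∀ {s} → Apart s → Apart (λ m → - s m)
  Apart-neg (inj₁ p) = inj₂ (Pos-ext (λ m → solve 1 (λ x → x := :- (:- x)) refl _) p)
  Apart-neg (inj₂ p) = inj₁ p

  Pos-cancel : ∀ {s t} → IsCauchy t → Bounded s → Pos s → Pos (λ m → s m * t m) → Pos t
  Pos-cancel {s} {t} ct bs ps pst = [ (λ pt → pt)
    , (λ nt → contradiction (Pos-ext { λ m → s m * - t m } (λ m → sym (ℚ.neg-distribʳ-* (s m) (t m))) (Pos-* {s} { λ m → - t m } ps nt)) (Pos-asym { λ m → s m * t m } pst)) ]′
    (Apart-factor {t} {s} ct bs (inj₁ (Pos-ext { λ m → s m * t m } (λ m → *-comm (s m) (t m)) pst)))

  Pos-transport : ∀ {p q} → Null (λ m → p m - q m) → Pos p → Pos q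
  Pos-transport {p} {q} near pos = Pos-ext { λ m → p m + - (p m - q m) } (λ m → lemma (p m) (q m))
    (Pos-Null {p} { λ m → - (p m - q m) } (Null-neg { λ m → p m - q m } near) pos)
    where
    lemma : ∀ a b → a + - (a - b) ≡ b
    lemma = solve 2 (λ a b → a :+ :- (a :- b) := b) refl

  Apart-transport : ∀ {p q} → Null (λ m → p m - q m) → Apart p → Apart q
  Apart-transport {p} {q} near (inj₁ pos) = inj₁ (Pos-transport {p} {q} near pos)
  Apart-transport {p} {q} near (inj₂ pos) = inj₂ (Pos-transport { λ m → - p m } { λ m → - q m }
    (Null-ext { λ m → - (p m - q m) } (λ m → solve 2 (λ a b → :- (a :- b) := :- a :- (:- b)) refl (p m) (q m)) (Null-neg { λ m → p m - q m } near)) pos)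

  Pos-proportional : ∀ {a x b y} → Null (λ m → a m * x m - b m * y m) → Pos a → Pos b → Bounded b → IsCauchy y → Pos x → Pos y
  Pos-proportional {a} {x} {b} {y} near pa pb bb cy px = Pos-cancel {b} {y} cy bb pb
    (Pos-transport { λ m → a m * x m } { λ m → b m * y m } near (Pos-* {a} {x} pa px))

  Apart⇒¬zero : ∀ {s} → Apart s → ¬ (∀ m → s m ≡ 0ℚ)
  Apart⇒¬zero (inj₁ p) eq = Pos⇒¬Null p (Null-zero eq)
  Apart⇒¬zero (inj₂ p) eq = Pos⇒¬Null p (Null-zero λ m → cong -_ (eq m))

  Apart-∑ : ∀ {n} (s : Fin n → Seq) → (∀ i → IsCauchy (s i)) → Apart (λ m → ∑ (λ i → s i m)) → ∃ λ i → Apart (s i)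
  Apart-∑ {zero} s cs a = contradiction (λ _ → refl) (Apart⇒¬zero a)
  Apart-∑ {suc n} s cs a with Apart-split (cs zero) a
  ... | inj₁ a₀ = zero , a₀
  ... | inj₂ as = let i , ai = Apart-∑ (s ∘ suc) (cs ∘ suc) as in suc i , ai

  -ℝ_ : ℝ → ℝ
  -ℝ x = mkℝ (λ m → - seq x m) (neg-Cauchy {seq x} (isCauchy x))

  const : ℚ → ℝ
  const q = mkℝ (λ _ → q) λ ε 0<ε → 0 , λ _ _ _ _ → subst (λ z → ∣ z ∣ < ε) (sym (+-inverseʳ q)) 0<ε

  bounded : ∀ x → Bounded (seq x)
  bounded x = Cauchy⇒Bounded (isCauchy x)

  seq-sum : ∀ {n} (x : Fin n → ℝ) m → seq (ℝ.sum x) m ≡ ∑ (λ i → seq (x i) m)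
  seq-sum {zero} x m = refl
  seq-sum {suc n} x m = cong (seq (x zero) m +_) (seq-sum (x ∘ suc) m)

  <⇒Pos : ∀ {x y} → x ℝ.< y → Pos (λ m → seq y m - seq x m)
  <⇒Pos {x} {y} (ε , 0<ε , N , ev) = ε , 0<ε , N , λ m le → 0<-⇒< (subst (0ℚ <_)
    (solve 3 (λ y x e → y :- (x :+ e) := (y :- x) :- e) refl (seq y m) (seq x m) ε) (<⇒0<- (ev m le)))

  Pos⇒< : ∀ {x y} → Pos (λ m → seq y m - seq x m) → x ℝ.< y
  Pos⇒< {x} {y} (ε , 0<ε , N , ev) = ε , 0<ε , N , λ m le → 0<-⇒< (subst (0ℚ <_)
    (solve 3 (λ y x e → (y :- x) :- e := y :- (x :+ e)) refl (seq y m) (seq x m) ε) (<⇒0<- (ev m le)))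

  #0⇒Apart : ∀ {x} → x ℝ.# ℝ.0ℝ → Apart (seq x)
  #0⇒Apart {x} (inj₁ x<0) = inj₂ (Pos-ext (λ m → +-identityˡ (- seq x m)) (<⇒Pos {x} {ℝ.0ℝ} x<0))
  #0⇒Apart {x} (inj₂ 0<x) = inj₁ (Pos-ext (λ m → solve 1 (λ x → x :- con 0ℚ := x) refl (seq x m)) (<⇒Pos {ℝ.0ℝ} {x} 0<x))

  Apart⇒#0 : ∀ {x} → Apart (seq x) → x ℝ.# ℝ.0ℝ
  Apart⇒#0 {x} (inj₁ p) = inj₂ (Pos⇒< {ℝ.0ℝ} {x} (Pos-ext (λ m → solve 1 (λ x → x := x :- con 0ℚ) refl (seq x m)) p))
  Apart⇒#0 {x} (inj₂ p) = inj₁ (Pos⇒< {x} {ℝ.0ℝ} (Pos-ext (λ m → sym (+-identityˡ (- seq x m))) p))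

  const-apart : ∀ {q} → q ≢ 0ℚ → Apart (λ _ → q)
  const-apart {q} q≢0 = [ (λ q<0 → inj₂ (const-pos (<0⇒0<- q<0))) , (λ 0<q → inj₁ (const-pos 0<q)) ]′ (≢0⇒sign q≢0)
    where
    const-pos : ∀ {q} → 0ℚ < q → Pos (λ _ → q)
    const-pos {q} 0<q = ½ * q , half 0<q , 0 , λ _ _ → 0<-⇒< (subst (0ℚ <_) (solve 1 (λ q → con ½ :* q := q :- con ½ :* q) refl q) (half 0<q))

  -- Fraction-free elimination and spanning functionals.

  -- Division-free, so that elimination commutes with taking the m-th terms of Cauchy sequences.
  elim : ∀ {R} → Fin (suc R) → (u y : Fin (suc R) → ℚ) → Fin R → ℚ
  elim c u y j = u c * y (punchIn c j) - y c * u (punchIn c j)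

  -- The columns chosen in the successive elimination steps of a matrix with m rows and m + 1
  -- columns; one column is left over, which `last` selects.
  Pivots : ℕ → Set
  Pivots zero = ⊤
  Pivots (suc m) = Fin (suc (suc m)) × Pivots m

  -- A multiple of the generalised cross product of the rows: the solution of the eliminated system,
  -- with the entry at the pivot column restored from the first row.
  functional : ∀ {m} → Pivots m → (Fin m → Fin (suc m) → ℚ) → Fin (suc m) → ℚ
  functional {zero} _ v _ = 1ℚ
  functional {suc m} (c , π) v = Vector.insertAt (λ j → v zero c * g j) c (- ⟨ g , v zero ∘ punchIn c ⟩)
    where
    g : Fin (suc m) → ℚ
    g = functional π (λ i → elim c (v zero) (v (suc i)))

  -- The product of the pivots. Being apart from zero, it certifies that every pivot was admissible.
  scale : ∀ {m} → Pivots m → (Fin m → Fin (suc m) → ℚ) → ℚ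
  scale {zero} _ v = 1ℚ
  scale {suc m} (c , π) v = v zero c * scale π (λ i → elim c (v zero) (v (suc i)))

  last : ∀ {A : Set} {m} → Pivots m → (Fin (suc m) → A) → A
  last {m = zero} _ g = g zero
  last {m = suc m} (c , π) g = last π (g ∘ punchIn c)

  ⟨⟩-split : ∀ {R} (c : Fin (suc R)) (g y : Fin (suc R) → ℚ) → ⟨ g , y ⟩ ≡ g c * y c + ⟨ g ∘ punchIn c , y ∘ punchIn c ⟩
  ⟨⟩-split c g y = ∑-remove {i = c} (λ i → g i * y i)

  ⟨,elim⟩ : ∀ {R} c (g : Fin R → ℚ) (u y : Fin (suc R) → ℚ) →
    ⟨ g , elim c u y ⟩ ≡ u c * ⟨ g , y ∘ punchIn c ⟩ - y c * ⟨ g , u ∘ punchIn c ⟩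
  ⟨,elim⟩ c g u y = begin
    ⟨ g , elim c u y ⟩
      ≡⟨ ⟨⟩-congʳ g (λ j → solve 4 (λ a b x y → a :* x :- b :* y := a :* x :+ (:- b) :* y) refl (u c) (y c) (y (punchIn c j)) (u (punchIn c j))) ⟩
    ⟨ g , (λ j → u c * y (punchIn c j) + (- y c) * u (punchIn c j)) ⟩
      ≡⟨ ⟨⟩-combʳ (u c) (- y c) g (y ∘ punchIn c) (u ∘ punchIn c) ⟩
    u c * ⟨ g , y ∘ punchIn c ⟩ + (- y c) * ⟨ g , u ∘ punchIn c ⟩
      ≡⟨ solve 4 (λ a b x y → a :* x :+ (:- b) :* y := a :* x :- b :* y) refl (u c) (y c) ⟨ g , y ∘ punchIn c ⟩ ⟨ g , u ∘ punchIn c ⟩ ⟩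
    u c * ⟨ g , y ∘ punchIn c ⟩ - y c * ⟨ g , u ∘ punchIn c ⟩ ∎
    where open ≡-Reasoning

  ⟨punchIn,elim⟩ : ∀ {R} c (g u y : Fin (suc R) → ℚ) → ⟨ g ∘ punchIn c , elim c u y ⟩ ≡ u c * ⟨ g , y ⟩ - y c * ⟨ g , u ⟩
  ⟨punchIn,elim⟩ c g u y = trans (⟨,elim⟩ c (g ∘ punchIn c) u y) (trans
    (regroup (u c) (y c) (g c) ⟨ g ∘ punchIn c , y ∘ punchIn c ⟩ ⟨ g ∘ punchIn c , u ∘ punchIn c ⟩)
    (sym (cong₂ (λ a b → u c * a - y c * b) (⟨⟩-split c g y) (⟨⟩-split c g u))))
    where
    regroup : ∀ u y g a b → u * a - y * b ≡ u * (g * y + a) - y * (g * u + b)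
    regroup = solve 5 (λ u y g a b → u :* a :- y :* b := u :* (g :* y :+ a) :- y :* (g :* u :+ b)) refl

  functional-elim : ∀ {m} (c : Fin (suc (suc m))) (π : Pivots m) v y →
    ⟨ functional (c , π) v , y ⟩ ≡ ⟨ functional π (λ i → elim c (v zero) (v (suc i))) , elim c (v zero) y ⟩
  functional-elim {m} c π v y = begin
    ⟨ f , y ⟩
      ≡⟨ ⟨⟩-split c f y ⟩
    f c * y c + ⟨ f ∘ punchIn c , y ∘ punchIn c ⟩
      ≡⟨ cong₂ (λ a b → a * y c + b) (Vector.insertAt-lookup (λ j → v zero c * g j) c (- ⟨ g , v zero ∘ punchIn c ⟩))
           (trans (⟨⟩-congˡ (y ∘ punchIn c) (Vector.insertAt-punchIn (λ j → v zero c * g j) c (- ⟨ g , v zero ∘ punchIn c ⟩)))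
             (trans (∑-cong λ j → *-assoc (v zero c) (g j) (y (punchIn c j))) (sym (*-∑ (v zero c) (λ j → g j * y (punchIn c j)))))) ⟩
    - ⟨ g , v zero ∘ punchIn c ⟩ * y c + v zero c * ⟨ g , y ∘ punchIn c ⟩
      ≡⟨ solve 4 (λ a y u b → :- a :* y :+ u :* b := u :* b :- y :* a) refl ⟨ g , v zero ∘ punchIn c ⟩ (y c) (v zero c) ⟨ g , y ∘ punchIn c ⟩ ⟩
    v zero c * ⟨ g , y ∘ punchIn c ⟩ - y c * ⟨ g , v zero ∘ punchIn c ⟩
      ≡⟨ ⟨,elim⟩ c g (v zero) y ⟨
    ⟨ g , elim c (v zero) y ⟩ ∎
    where
    open ≡-Reasoning
    g : Fin (suc m) → ℚ
    g = functional π (λ i → elim c (v zero) (v (suc i)))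
    f : Fin (suc (suc m)) → ℚ
    f = functional (c , π) v

  functional-vanishes : ∀ {m} (π : Pivots m) v i → ⟨ functional π v , v i ⟩ ≡ 0ℚ
  functional-vanishes {suc m} (c , π) v zero = trans (functional-elim c π v (v zero))
    (∑-zero λ j → trans (cong (functional π (λ i → elim c (v zero) (v (suc i))) j *_) (+-inverseʳ (v zero c * v zero (punchIn c j)))) (*-zeroʳ (functional π (λ i → elim c (v zero) (v (suc i))) j)))
  functional-vanishes {suc m} (c , π) v (suc i) = trans (functional-elim c π v (v (suc i)))
    (functional-vanishes π (λ i → elim c (v zero) (v (suc i))) i)

  infix 9 _﹫_

  _﹫_ : ∀ {m R} → (Fin m → Fin R → ℝ) → ℕ → Fin m → Fin R → ℚ
  (v ﹫ t) i j = seq (v i j) t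

  elimℝ : ∀ {R} → Fin (suc R) → (u y : Fin (suc R) → ℝ) → Fin R → ℝ
  elimℝ c u y j = u c ℝ.* y (punchIn c j) ℝ.+ (-ℝ (y c ℝ.* u (punchIn c j)))

  functionalℝ : ∀ {m} → Pivots m → (Fin m → Fin (suc m) → ℝ) → Fin (suc m) → ℝ
  functionalℝ {zero} _ v _ = const 1ℚ
  functionalℝ {suc m} (c , π) v = Vector.insertAt (λ j → v zero c ℝ.* g j) c (-ℝ (ℝ.sum (λ j → g j ℝ.* v zero (punchIn c j))))
    where
    g : Fin (suc m) → ℝ
    g = functionalℝ π (λ i → elimℝ c (v zero) (v (suc i)))

  seq-insertAt : ∀ {n} (xs : Fin n → ℝ) c a t (ys : Fin n → ℚ) b → (∀ j → seq (xs j) t ≡ ys j) → seq a t ≡ b →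
    ∀ i → seq (Vector.insertAt xs c a i) t ≡ Vector.insertAt ys c b i
  seq-insertAt xs zero a t ys b eq eq′ zero = eq′
  seq-insertAt xs zero a t ys b eq eq′ (suc i) = eq i
  seq-insertAt {suc n} xs (suc c) a t ys b eq eq′ zero = eq zero
  seq-insertAt {suc n} xs (suc c) a t ys b eq eq′ (suc i) = seq-insertAt (xs ∘ suc) c a t (ys ∘ suc) b (eq ∘ suc) eq′ i

  seq-functional : ∀ {m} (π : Pivots m) v t i → seq (functionalℝ π v i) t ≡ functional π (v ﹫ t) i
  seq-functional {zero} _ v t i = refl
  seq-functional {suc m} (c , π) v t = seq-insertAt _ c _ t _ _
    (λ j → cong (seq (v zero c) t *_) (IH j))
    (cong -_ (trans (seq-sum (λ j → functionalℝ π (λ i → elimℝ c (v zero) (v (suc i))) j ℝ.* v zero (punchIn c j)) t)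
      (∑-cong λ j → cong (_* seq (v zero (punchIn c j)) t) (IH j))))
    where
    IH : ∀ j → seq (functionalℝ π (λ i → elimℝ c (v zero) (v (suc i))) j) t ≡ functional π (λ i → elim c ((v ﹫ t) zero) ((v ﹫ t) (suc i))) j
    IH = seq-functional π (λ i → elimℝ c (v zero) (v (suc i))) t

  scaleℝ : ∀ {m} → Pivots m → (Fin m → Fin (suc m) → ℝ) → ℝ
  scaleℝ {zero} _ v = const 1ℚ
  scaleℝ {suc m} (c , π) v = v zero c ℝ.* scaleℝ π (λ i → elimℝ c (v zero) (v (suc i)))

  seq-scale : ∀ {m} (π : Pivots m) v t → seq (scaleℝ π v) t ≡ scale π (v ﹫ t)
  seq-scale {zero} _ v t = refl
  seq-scale {suc m} (c , π) v t = cong (seq (v zero c) t *_) (seq-scale π (λ i → elimℝ c (v zero) (v (suc i))) t)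

  dot : ∀ {n} → (g y : Fin n → ℝ) → Seq
  dot g y t = ⟨ (λ i → seq (g i) t) , (λ i → seq (y i) t) ⟩

  -- A vector orthogonal to independent rows is unique up to a factor; both factors are kept
  -- explicit so that nothing is divided. Equality is up to null sequences because a real facet
  -- satisfies its equations only in the limit.
  proportional : ∀ {m} (π : Pivots m) (v : Fin m → Fin (suc m) → ℝ) (g : Fin (suc m) → ℝ) → (∀ i → Null (dot g (v i))) →
    ∀ i → Null (λ t → scale π (v ﹫ t) * seq (g i) t - seq (last π g) t * functional π (v ﹫ t) i)
  proportional {zero} _ v g null zero = Null-zero λ t → solve 1 (λ x → con 1ℚ :* x :- x :* con 1ℚ := con 0ℚ) refl (seq (g zero) t)
  proportional {suc m} (c , π) v g null i = by (c Fin.≟ i)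
    where
    v′ : Fin m → Fin (suc m) → ℝ
    v′ i = elimℝ c (v zero) (v (suc i))
    u : Seq
    u t = seq (v zero c) t
    μ ν : Seq
    μ t = scale π (v′ ﹫ t)
    ν t = seq (last π (g ∘ punchIn c)) t
    f′ : Fin (suc m) → Seq
    f′ j t = functional π (v′ ﹫ t) j
    null′ : ∀ i → Null (dot (g ∘ punchIn c) (v′ i))
    null′ i = Null-ext (λ t → trans (regroup (seq (v zero c) t) (seq (v (suc i) c) t) (dot g (v (suc i)) t) (dot g (v zero) t))
        (sym (⟨punchIn,elim⟩ c (λ j → seq (g j) t) ((v ﹫ t) zero) ((v ﹫ t) (suc i)))))
      (Null-+ (Null-* (bounded (v zero c)) (null (suc i))) (Null-* (bounded (-ℝ v (suc i) c)) (null zero)))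
      where
      regroup : ∀ u y a b → u * a + - y * b ≡ u * a - y * b
      regroup = solve 4 (λ u y a b → u :* a :+ (:- y) :* b := u :* a :- y :* b) refl
    IH : ∀ j → Null (λ t → μ t * seq (g (punchIn c j)) t - ν t * f′ j t)
    IH = proportional π v′ (g ∘ punchIn c) null′
    Goal : Fin (suc (suc m)) → Set
    Goal i = Null (λ t → (u t * μ t) * seq (g i) t - ν t * functional (c , π) (v ﹫ t) i)
    at-punchIn : ∀ j → Goal (punchIn c j)
    at-punchIn j = Null-ext (λ t → trans (regroup (u t) (μ t) (seq (g (punchIn c j)) t) (ν t) (f′ j t))
        (cong (λ z → (u t * μ t) * seq (g (punchIn c j)) t - ν t * z) (sym (Vector.insertAt-punchIn (λ j → u t * f′ j t) c (- ⟨ (λ j → f′ j t) , (v ﹫ t) zero ∘ punchIn c ⟩) j))))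
      (Null-* (bounded (v zero c)) (IH j))
      where
      regroup : ∀ u m g n f → u * (m * g - n * f) ≡ (u * m) * g - n * (u * f)
      regroup = solve 5 (λ u m g n f → u :* (m :* g :- n :* f) := (u :* m) :* g :- n :* (u :* f)) refl
    Null-∑ : ∀ {n} (s : Fin n → Seq) → (∀ j → Null (s j)) → Null (λ t → ∑ (λ j → s j t))
    Null-∑ {zero} s ns = Null-zero λ _ → refl
    Null-∑ {suc n} s ns = Null-+ (ns zero) (Null-∑ (s ∘ suc) (ns ∘ suc))
    -- The entry at the pivot column is determined by orthogonality to the first row, once the other
    -- entries are known.
    at-c : Goal c
    at-c = Null-ext eq (Null-+ (Null-* (Cauchy⇒Bounded′ (scaleℝ π v′) (seq-scale π v′)) (null zero))
        (Null-neg (Null-∑ (λ j t → seq (v zero (punchIn c j)) t * (μ t * seq (g (punchIn c j)) t - ν t * f′ j t)) (λ j → Null-* (bounded (v zero (punchIn c j))) (IH j)))))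
      where
      Cauchy⇒Bounded′ : ∀ {s} (x : ℝ) → (∀ t → seq x t ≡ s t) → Bounded s
      Cauchy⇒Bounded′ x eq = let b , 0<b , N , ev = bounded x in b , 0<b , N , λ m le → subst (λ z → ∣ z ∣ < b) (eq m) (ev m le)
      eq : ∀ t → μ t * dot g (v zero) t + - ∑ (λ j → seq (v zero (punchIn c j)) t * (μ t * seq (g (punchIn c j)) t - ν t * f′ j t))
        ≡ (u t * μ t) * seq (g c) t - ν t * functional (c , π) (v ﹫ t) c
      eq t = begin
        μ t * dot g (v zero) t + - ∑ (λ j → v₀ j * (μ t * g′ j - ν t * f′ j t))
          ≡⟨ cong₂ (λ a b → μ t * a + - b) (⟨⟩-split c (λ i → seq (g i) t) ((v ﹫ t) zero)) sum-eq ⟩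
        μ t * (seq (g c) t * u t + ⟨ g′ , v₀ ⟩) + - (μ t * ⟨ g′ , v₀ ⟩ + - ν t * ⟨ (λ j → f′ j t) , v₀ ⟩)
          ≡⟨ regroup (μ t) (seq (g c) t) (u t) ⟨ g′ , v₀ ⟩ (ν t) ⟨ (λ j → f′ j t) , v₀ ⟩ ⟩
        (u t * μ t) * seq (g c) t - ν t * - ⟨ (λ j → f′ j t) , v₀ ⟩
          ≡⟨ cong (λ z → (u t * μ t) * seq (g c) t - ν t * z) (Vector.insertAt-lookup (λ j → u t * f′ j t) c (- ⟨ (λ j → f′ j t) , v₀ ⟩)) ⟨
        (u t * μ t) * seq (g c) t - ν t * functional (c , π) (v ﹫ t) c ∎
        where
        open ≡-Reasoning
        v₀ g′ : Fin (suc m) → ℚ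
        v₀ j = seq (v zero (punchIn c j)) t
        g′ j = seq (g (punchIn c j)) t
        regroup : ∀ m g u a n b → m * (g * u + a) + - (m * a + - n * b) ≡ (u * m) * g - n * - b
        regroup = solve 6 (λ m g u a n b → m :* (g :* u :+ a) :+ :- (m :* a :+ (:- n) :* b) := (u :* m) :* g :- n :* (:- b)) refl
        sum-eq : ∑ (λ j → v₀ j * (μ t * g′ j - ν t * f′ j t)) ≡ μ t * ⟨ g′ , v₀ ⟩ + - ν t * ⟨ (λ j → f′ j t) , v₀ ⟩
        sum-eq = trans (∑-cong λ j → lemma (v₀ j) (μ t) (g′ j) (ν t) (f′ j t)) (⟨⟩-comb (μ t) (- ν t) g′ (λ j → f′ j t) v₀)
          where
          lemma : ∀ v m g n f → v * (m * g - n * f) ≡ (m * g + - n * f) * v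
          lemma = solve 5 (λ v m g n f → v :* (m :* g :- n :* f) := (m :* g :+ (:- n) :* f) :* v) refl
    by : Dec (c ≡ i) → Goal i
    by (yes refl) = at-c
    by (no c≢i) = subst Goal (Fin.punchIn-punchOut c≢i) (at-punchIn (Fin.punchOut c≢i))

  -- Linear independence of y together with the `v i`, in the positive form that matches
  -- `AffinelyIndependent`.
  Independent : ∀ {m R} → (Fin m → Fin R → ℝ) → (Fin R → ℝ) → Set
  Independent {m} {R} v y = ∀ (a : ℝ) (w : Fin m → ℝ) → Apart (seq a) ⊎ (∃ λ i → Apart (seq (w i))) →
    ∃ λ c → Apart (λ t → seq a t * seq (y c) t + ∑ (λ i → seq (w i) t * seq (v i c) t))

  -- A combination of eliminated rows is one of the original rows, with weights multiplied by the
  -- pivot and a weight for row zero that makes coordinate c vanish identically. The coordinate that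
  -- independence provides can therefore not be c.
  Independent-elim : ∀ {m R} (v : Fin (suc m) → Fin (suc R) → ℝ) y c → Apart (seq (v zero c)) → Independent v y →
    Independent (λ i → elimℝ c (v zero) (v (suc i))) (elimℝ c (v zero) y)
  Independent-elim {m} {R} v y c pivot ind a w ap = result (ind a′ w′ (apart′ ap))
    where
    z : Fin (suc R) → ℝ
    z j = a ℝ.* y j ℝ.+ ℝ.sum (λ i → w i ℝ.* v (suc i) j)
    a′ : ℝ
    a′ = v zero c ℝ.* a
    w′ : Fin (suc m) → ℝ
    w′ zero = -ℝ z c
    w′ (suc i) = v zero c ℝ.* w i
    apart′ : Apart (seq a) ⊎ (∃ λ i → Apart (seq (w i))) → Apart (seq a′) ⊎ (∃ λ i → Apart (seq (w′ i)))
    apart′ (inj₁ p) = inj₁ (Apart-* pivot p)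
    apart′ (inj₂ (i , p)) = inj₂ (suc i , Apart-* pivot p)
    u : Seq
    u t = seq (v zero c) t
    ζ : Fin (suc R) → Seq
    ζ j t = seq a t * seq (y j) t + ∑ (λ i → seq (w i) t * seq (v (suc i) j) t)
    combined : ∀ j t → seq a′ t * seq (y j) t + ∑ (λ i → seq (w′ i) t * seq (v i j) t) ≡ u t * ζ j t - ζ c t * seq (v zero j) t
    combined j t = trans
      (cong₂ (λ p q → (u t * seq a t) * seq (y j) t + (- (seq a t * seq (y c) t + p) * seq (v zero j) t + q))
        (seq-sum (λ i → w i ℝ.* v (suc i) c) t)
        (trans (∑-cong λ i → *-assoc (u t) (seq (w i) t) (seq (v (suc i) j) t)) (sym (*-∑ (u t) (λ i → seq (w i) t * seq (v (suc i) j) t)))))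
      (regroup (u t) (seq a t) (seq (y j) t) (ζ c t) (seq (v zero j) t) (∑ (λ i → seq (w i) t * seq (v (suc i) j) t)))
      where
      regroup : ∀ u a y z v s → (u * a) * y + (- z * v + u * s) ≡ u * (a * y + s) - z * v
      regroup = solve 6 (λ u a y z v s → (u :* a) :* y :+ (:- z :* v :+ u :* s) := u :* (a :* y :+ s) :- z :* v) refl
    Goal : Set
    Goal = ∃ λ j → Apart (λ t → seq a t * seq (elimℝ c (v zero) y j) t + ∑ (λ i → seq (w i) t * seq (elimℝ c (v zero) (v (suc i)) j) t))
    eliminated : ∀ j t → u t * ζ (punchIn c j) t - ζ c t * seq (v zero (punchIn c j)) t
      ≡ seq a t * seq (elimℝ c (v zero) y j) t + ∑ (λ i → seq (w i) t * seq (elimℝ c (v zero) (v (suc i)) j) t)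
    eliminated j t = sym (trans
      (cong (seq a t * (u t * Y - Yc * V) +_) (trans
        (∑-cong λ i → lemma (seq (w i) t) (u t) (seq (v (suc i) (punchIn c j)) t) (seq (v (suc i) c) t) V)
        (trans (∑-+ (λ i → u t * (seq (w i) t * seq (v (suc i) (punchIn c j)) t)) (λ i → - V * (seq (w i) t * seq (v (suc i) c) t)))
          (sym (cong₂ _+_ (*-∑ (u t) (λ i → seq (w i) t * seq (v (suc i) (punchIn c j)) t)) (*-∑ (- V) (λ i → seq (w i) t * seq (v (suc i) c) t)))))))
      (regroup (seq a t) (u t) Y Yc V (∑ (λ i → seq (w i) t * seq (v (suc i) (punchIn c j)) t)) (∑ (λ i → seq (w i) t * seq (v (suc i) c) t))))
      where
      Y = seq (y (punchIn c j)) t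
      Yc = seq (y c) t
      V = seq (v zero (punchIn c j)) t
      lemma : ∀ w u x xc V → w * (u * x - xc * V) ≡ u * (w * x) + - V * (w * xc)
      lemma = solve 5 (λ w u x xc V → w :* (u :* x :- xc :* V) := u :* (w :* x) :+ (:- V) :* (w :* xc)) refl
      regroup : ∀ a u Y Yc V s sc → a * (u * Y - Yc * V) + (u * s + - V * sc) ≡ u * (a * Y + s) - (a * Yc + sc) * V
      regroup = solve 7 (λ a u Y Yc V s sc → a :* (u :* Y :- Yc :* V) :+ (u :* s :+ (:- V) :* sc) := u :* (a :* Y :+ s) :- (a :* Yc :+ sc) :* V) refl
    result : (∃ λ j → Apart (λ t → seq a′ t * seq (y j) t + ∑ (λ i → seq (w′ i) t * seq (v i j) t))) → Goal
    result (j , ap) = by (c Fin.≟ j)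
      where
      by : Dec (c ≡ j) → Goal
      by (yes refl) = contradiction (λ t → trans (combined c t) (trans (cong (_- ζ c t * u t) (*-comm (u t) (ζ c t))) (+-inverseʳ (ζ c t * u t)))) (Apart⇒¬zero ap)
      by (no c≢j) = Fin.punchOut c≢j , Apart-ext (λ t → trans (combined j t)
        (trans (cong (λ k → u t * ζ k t - ζ c t * seq (v zero k) t) (sym (Fin.punchIn-punchOut c≢j))) (eliminated (Fin.punchOut c≢j) t))) ap

  -- Row zero with weight 1 is a nontrivial combination, so independence itself exhibits an entry
  -- apart from zero.
  pivots-exist : ∀ {m} (v : Fin m → Fin (suc m) → ℝ) y → Independent v y → ∃ λ π → Apart (seq (scaleℝ π v))
  pivots-exist {zero} v y ind = tt , inj₁ (½ , ℚ.positive⁻¹ ½ , 0 , λ _ _ → ½<1)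
    where
    ½<1 : ½ < 1ℚ
    ½<1 = 0<-⇒< (ℚ.positive⁻¹ (1ℚ - ½))
  pivots-exist {suc m} v y ind = step (ind (const 0ℚ) e₀ (inj₂ (zero , apart-one)))
    where
    e₀ : Fin (suc m) → ℝ
    e₀ zero = const 1ℚ
    e₀ (suc _) = const 0ℚ
    apart-one : Apart (λ _ → 1ℚ)
    apart-one = inj₁ (½ , ℚ.positive⁻¹ ½ , 0 , λ _ _ → 0<-⇒< (ℚ.positive⁻¹ (1ℚ - ½)))
    only-v₀ : ∀ c t → 0ℚ * seq (y c) t + ∑ (λ i → seq (e₀ i) t * seq (v i c) t) ≡ seq (v zero c) t
    only-v₀ c t = trans (cong (λ z → 0ℚ * seq (y c) t + (1ℚ * seq (v zero c) t + z)) (∑-zero λ i → *-zeroˡ (seq (v (suc i) c) t)))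
      (solve 2 (λ y v → con 0ℚ :* y :+ (con 1ℚ :* v :+ con 0ℚ) := v) refl (seq (y c) t) (seq (v zero c) t))
    step : (∃ λ c → Apart (λ t → 0ℚ * seq (y c) t + ∑ (λ i → seq (e₀ i) t * seq (v i c) t))) → ∃ λ π → Apart (seq (scaleℝ π v))
    step (c , ap) = let π , ap′ = pivots-exist (λ i → elimℝ c (v zero) (v (suc i))) (elimℝ c (v zero) y) (Independent-elim v y c pivot ind) in (c , π) , Apart-* pivot ap′
      where
      pivot : Apart (seq (v zero c))
      pivot = Apart-ext (only-v₀ c) ap

  -- After all eliminations the value at y is the single entry that y has left, and independence
  -- keeps it apart from zero.
  functional-apart : ∀ {m} (π : Pivots m) (v : Fin m → Fin (suc m) → ℝ) y → Apart (seq (scaleℝ π v)) → Independent v y →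
    Apart (λ t → ⟨ functional π (v ﹫ t) , (λ i → seq (y i) t) ⟩)
  functional-apart {zero} _ v y _ ind = step (ind (const 1ℚ) (λ ()) (inj₁ (inj₁ (½ , ℚ.positive⁻¹ ½ , 0 , λ _ _ → 0<-⇒< (ℚ.positive⁻¹ (1ℚ - ½))))))
    where
    step : (∃ λ c → Apart (λ t → 1ℚ * seq (y c) t + 0ℚ)) → Apart (λ t → 1ℚ * seq (y zero) t + 0ℚ)
    step (zero , ap) = ap
  functional-apart {suc m} (c , π) v y ap ind = Apart-ext (λ t → sym (functional-elim c π (v ﹫ t) (λ i → seq (y i) t)))
    (functional-apart π v′ (elimℝ c (v zero) y) rest (Independent-elim v y c pivot ind))
    where
    v′ : Fin m → Fin (suc m) → ℝ
    v′ i = elimℝ c (v zero) (v (suc i))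
    pivot : Apart (seq (v zero c))
    pivot = Apart-factor {seq (v zero c)} {seq (scaleℝ π v′)} (isCauchy (v zero c)) (bounded (scaleℝ π v′)) ap
    rest : Apart (seq (scaleℝ π v′))
    rest = Apart-factor {seq (scaleℝ π v′)} {seq (v zero c)} (isCauchy (scaleℝ π v′)) (bounded (v zero c))
      (Apart-ext { λ t → seq (v zero c) t * seq (scaleℝ π v′) t } (λ t → *-comm (seq (v zero c) t) (seq (scaleℝ π v′) t)) ap)

  -- General position as linear independence.

  enumerate : ∀ {n m} (σ : Fin n → Bool) → cnt σ ≡ m →
    ∃ λ (ι : Fin m → Fin n) → (∀ {i j} → ι i ≡ ι j → i ≡ j) × (∀ j → σ (ι j) ≡ true) × (∀ i → σ i ≡ true → ∃ λ j → ι j ≡ i)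
  enumerate {zero} σ refl = (λ ()) , (λ { {()} }) , (λ ()) , λ ()
  enumerate {suc n} σ eq with σ zero in σ₀
  enumerate {suc n} σ eq | false with enumerate (σ ∘ suc) eq
  ... | ι , inj , sound , complete = suc ∘ ι , inj ∘ Fin.suc-injective , sound
    , λ { zero h → contradiction (trans (sym σ₀) h) λ () ; (suc i) h → let j , e = complete i h in j , cong suc e }
  enumerate {suc n} {suc m} σ eq | true with enumerate (σ ∘ suc) (ℕ.suc-injective eq)
  ... | ι , inj , sound , complete = ι′ , inj′ , (λ { zero → σ₀ ; (suc j) → sound j })
    , λ { zero _ → zero , refl ; (suc i) h → let j , e = complete i h in suc j , cong suc e }
    where
    ι′ : Fin (suc m) → Fin (suc n)
    ι′ zero = zero
    ι′ (suc j) = suc (ι j)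
    inj′ : ∀ {i j} → ι′ i ≡ ι′ j → i ≡ j
    inj′ {zero} {zero} _ = refl
    inj′ {suc i} {suc j} e = cong suc (inj (Fin.suc-injective e))

  homogenize : ∀ {d} → Point d → Fin (suc d) → ℝ
  homogenize p zero = const 1ℚ
  homogenize p (suc c) = p c

  ≈-exact : ∀ {x y} → (∀ t → seq x t ≡ seq y t) → x ℝ.≈ y
  ≈-exact {x} {y} eq = Null-zero λ t → trans (cong (_- seq y t) (eq t)) (+-inverseʳ (seq y t))

  module _ {n d : ℕ} (S : PointSet n d) (gp : GeneralPosition S) where

    x̂ : Fin n → Fin (suc d) → ℝ
    x̂ i = homogenize (point S i)

    -- The weights need not add up to zero, so their `total` is taken off the weight of i. If
    -- `total` is apart from zero, the homogenising coordinate shows it. Otherwise general position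
    -- applies to the corrected weights, and the correction can spoil the coordinate found only if
    -- `total` was apart after all.
    general⇒independent : ∀ {m} → m ℕ.≤ d → (ι : Fin m → Fin n) → (∀ {i j} → ι i ≡ ι j → i ≡ j) →
      ∀ i → (∀ j → ι j ≢ i) → Independent (x̂ ∘ ι) (x̂ i)
    general⇒independent {m} m≤d ι inj i ∉ι a w ap = conclude (nonzero-or-total ap)
      where
      ι⁺ : Fin (suc m) → Fin n
      ι⁺ zero = i
      ι⁺ (suc j) = ι j
      inj⁺ : ∀ {j k} → ι⁺ j ≡ ι⁺ k → j ≡ k
      inj⁺ {zero} {zero} _ = refl
      inj⁺ {zero} {suc k} e = contradiction (sym e) (∉ι k)
      inj⁺ {suc j} {zero} e = contradiction e (∉ι j)
      inj⁺ {suc j} {suc k} e = cong suc (inj e)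
      total : ℝ
      total = a ℝ.+ ℝ.sum w
      w⁺ : Fin (suc m) → ℝ
      w⁺ zero = a ℝ.+ (-ℝ total)
      w⁺ (suc j) = w j
      balanced : ℝ.sum w⁺ ℝ.≈ ℝ.0ℝ
      balanced = ≈-exact {ℝ.sum w⁺} {ℝ.0ℝ} λ t → solve 2 (λ a s → (a :+ :- (a :+ s)) :+ s := con 0ℚ) refl (seq a t) (seq (ℝ.sum w) t)
      comb : Fin d → Seq
      comb c t = seq a t * seq (point S i c) t + ∑ (λ j → seq (w j) t * seq (point S (ι j) c) t)
      Goal : Set
      Goal = ∃ λ c → Apart (λ t → seq a t * seq (x̂ i c) t + ∑ (λ j → seq (w j) t * seq (x̂ (ι j) c) t))
      via-total : Apart (seq total) → Goal
      via-total p = zero , Apart-ext (λ t → cong₂ _+_ (sym (*-identityʳ (seq a t)))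
        (trans (seq-sum w t) (∑-cong λ j → sym (*-identityʳ (seq (w j) t))))) p
      nonzero-or-total : Apart (seq a) ⊎ (∃ λ j → Apart (seq (w j))) → (∃ λ j → Apart (seq (w⁺ j))) ⊎ Apart (seq total)
      nonzero-or-total (inj₂ (j , p)) = inj₁ (suc j , p)
      nonzero-or-total (inj₁ p) = Sum.map (λ q → zero , q) (λ q → q)
        (Apart-split {seq (w⁺ zero)} {seq total} (isCauchy (w⁺ zero))
          (Apart-ext (λ t → solve 2 (λ a s → a := (a :+ :- s) :+ s) refl (seq a t) (seq total t)) p))
      combination-seq : ∀ c t → seq (ℝ.combination w⁺ (point S ∘ ι⁺) c) t ≡ comb c t + seq (-ℝ total) t * seq (point S i c) t
      combination-seq c t = trans (cong ((seq a t + - seq total t) * seq (point S i c) t +_) (seq-sum (λ j → w j ℝ.* point S (ι j) c) t))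
        (solve 4 (λ a s x r → (a :+ :- s) :* x :+ r := (a :* x :+ r) :+ :- s :* x) refl (seq a t) (seq total t) (seq (point S i c) t) (∑ (λ j → seq (w j) t * seq (point S (ι j) c) t)))
      comb-Cauchy : ∀ c → ℝ
      comb-Cauchy c = a ℝ.* point S i c ℝ.+ ℝ.sum (λ j → w j ℝ.* point S (ι j) c)
      via-combination : (∃ λ c → ℝ.combination w⁺ (point S ∘ ι⁺) c ℝ.# ℝ.0ℝ) → Goal
      via-combination (c , ap) = [ (λ p → suc c , Apart-ext (λ t → cong (seq a t * seq (point S i c) t +_) (seq-sum (λ j → w j ℝ.* point S (ι j) c) t)) p)
        , (λ p → via-total (negated (Apart-factor {seq (-ℝ total)} {seq (point S i c)} (isCauchy (-ℝ total)) (bounded (point S i c)) p))) ]′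
        (Apart-split {seq (comb-Cauchy c)} {λ t → seq (-ℝ total) t * seq (point S i c) t} (isCauchy (comb-Cauchy c))
          (Apart-ext (λ t → trans (combination-seq c t) (cong (λ z → seq a t * seq (point S i c) t + z + seq (-ℝ total) t * seq (point S i c) t)
              (sym (seq-sum (λ j → w j ℝ.* point S (ι j) c) t))))
            (#0⇒Apart {ℝ.combination w⁺ (point S ∘ ι⁺) c} ap)))
        where
        negated : Apart (seq (-ℝ total)) → Apart (seq total)
        negated p = Apart-ext (λ t → solve 1 (λ x → :- (:- x) := x) refl (seq total t)) (Apart-neg {seq (-ℝ total)} p)
      conclude : (∃ λ j → Apart (seq (w⁺ j))) ⊎ Apart (seq total) → Goal
      conclude (inj₂ p) = via-total p
      conclude (inj₁ (j , p)) = via-combination (gp (ℕ.s≤s m≤d) ι⁺ inj⁺ w⁺ balanced (j , Apart⇒#0 {w⁺ j} p))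

    record Spanned (σ : Fin n → Bool) : Set where
      field
        ι        : Fin d → Fin n
        ι-inj    : ∀ {i j} → ι i ≡ ι j → i ≡ j
        sound    : ∀ j → σ (ι j) ≡ true
        complete : ∀ i → σ i ≡ true → ∃ λ j → ι j ≡ i
        pivots   : Pivots d
        apart    : Apart (seq (scaleℝ pivots (x̂ ∘ ι)))

      coefficients : Fin (suc d) → ℝ
      coefficients = functionalℝ pivots (x̂ ∘ ι)

      outside-apart : ∀ i → σ i ≡ false → Independent (x̂ ∘ ι) (x̂ i)
      outside-apart i i∉σ = general⇒independent ℕ.≤-refl ι ι-inj i λ j ιj≡i → contradiction (trans (sym (trans (cong σ (sym ιj≡i)) (sound j))) i∉σ) λ ()

    -- Pivots are found from independence of σ with one more point, so a point off σ must exist.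
    spanned : suc d ℕ.≤ n → ∀ σ → cnt σ ≡ d → Spanned σ
    spanned d<n σ size with enumerate σ size | cnt<⇒∃ {b = σ} {c = λ _ → true} (subst₂ ℕ._<_ (sym size) (sym (cnt-all {n} λ _ → refl)) d<n)
    ... | ι , inj , sound , complete | i , i∉σ , _ = record
      { ι = ι ; ι-inj = inj ; sound = sound ; complete = complete ; pivots = proj₁ P ; apart = proj₂ P }
      where
      P : ∃ λ π → Apart (seq (scaleℝ π (x̂ ∘ ι)))
      P = pivots-exist (x̂ ∘ ι) (x̂ i) (general⇒independent ℕ.≤-refl ι inj i λ j ιj≡i →
        contradiction (trans (sym (trans (cong σ (sym ιj≡i)) (sound j))) i∉σ) λ ())

  -- The rational configuration of a real point set.

  Eventually : (ℕ → Set) → Set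
  Eventually P = ∃ λ N → ∀ t → N ℕ.≤ t → P t

  eventually-× : ∀ {P Q} → Eventually P → Eventually Q → Eventually (λ t → P t × Q t)
  eventually-× (N , p) (M , q) = N ℕ.⊔ M , λ t le → p t (ℕ.m⊔n≤o⇒m≤o N M le) , q t (ℕ.m⊔n≤o⇒n≤o N M le)

  eventually-∀ : ∀ {n} {P : Fin n → ℕ → Set} → (∀ i → Eventually (P i)) → Eventually (λ t → ∀ i → P i t)
  eventually-∀ {zero} ev = 0 , λ _ _ ()
  eventually-∀ {suc n} ev = let N , p = eventually-× (ev zero) (eventually-∀ (ev ∘ suc))
    in N , λ { t le zero → proj₁ (p t le) ; t le (suc i) → proj₂ (p t le) i }

  eventually-∀ₛ : ∀ {n} {P : Subset n → ℕ → Set} → (∀ σ → Eventually (P σ)) → Eventually (λ t → ∀ σ → P σ t)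
  eventually-∀ₛ {zero} ev = let N , p = ev Vec.[] in N , λ { t le Vec.[] → p t le }
  eventually-∀ₛ {suc n} ev = let N , p = eventually-× (eventually-∀ₛ (ev ∘ (false Vec.∷_))) (eventually-∀ₛ (ev ∘ (true Vec.∷_)))
    in N , λ { t le (false Vec.∷ σ) → proj₁ (p t le) σ ; t le (true Vec.∷ σ) → proj₂ (p t le) σ }

  SignAt : Seq → ℕ → Set
  SignAt s t = (Pos s → 0ℚ < s t) × (Pos (λ m → - s m) → 0ℚ < - s t)

  eventually-sign : ∀ {s} → Apart s → Eventually (SignAt s)
  eventually-sign {s} (inj₁ p) = let N , ev = Pos-eventually p in N , λ t le → (λ _ → ev t le) , λ q → contradiction q (Pos-asym p)
  eventually-sign {s} (inj₂ p) = let N , ev = Pos-eventually p in N , λ t le → (λ q → contradiction p (Pos-asym q)) , λ _ → ev t le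

  Apart⇒≢0 : ∀ {s t} → Apart s → SignAt s t → s t ≢ 0ℚ
  Apart⇒≢0 (inj₁ p) (pos , _) = 0<⇒≢0 (pos p)
  Apart⇒≢0 (inj₂ p) (_ , neg) eq = 0<⇒≢0 (neg p) (cong -_ eq)

  last-const : ∀ {m} (π : Pivots m) (φ : Fin (suc m) → ℚ) t → seq (last π (const ∘ φ)) t ≡ last π φ
  last-const {zero} π φ t = refl
  last-const {suc m} (c , π) φ t = last-const π (φ ∘ punchIn c) t

  module Rational {n d : ℕ} (S : PointSet n d) (gp : GeneralPosition S) (d<n : suc d ℕ.≤ n) where

    spanning-data : ∀ σ → Dec (cnt (lookup σ) ≡ d) → Fin (suc d) → ℝ
    spanning-data σ (yes size) = Spanned.coefficients (spanned S gp d<n (lookup σ) size)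
    spanning-data σ (no _) = λ _ → const 0ℚ

    abstract
      coefficients : Subset n → Fin (suc d) → ℝ
      coefficients σ = spanning-data σ (cnt (lookup σ) ℕ.≟ d)

      coefficients-spanned : ∀ σ → cnt (lookup σ) ≡ d → ∃ λ (sp : Spanned S gp (lookup σ)) → coefficients σ ≡ Spanned.coefficients sp
      coefficients-spanned σ size = go (cnt (lookup σ) ℕ.≟ d)
        where
        go : (dec : Dec (cnt (lookup σ) ≡ d)) → ∃ λ (sp : Spanned S gp (lookup σ)) → spanning-data σ dec ≡ Spanned.coefficients sp
        go (yes size) = spanned S gp d<n (lookup σ) size , refl
        go (no ¬size) = contradiction size ¬size

    value : Subset n → Fin n → Seq
    value σ i = dot (coefficients σ) (x̂ S gp i)

    value-spanned : ∀ {σ} (sp : Spanned S gp (lookup σ)) → coefficients σ ≡ Spanned.coefficients sp → ∀ y t →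
      dot (coefficients σ) y t ≡ ⟨ functional (Spanned.pivots sp) ((x̂ S gp ∘ Spanned.ι sp) ﹫ t) , (λ c → seq (y c) t) ⟩
    value-spanned sp eq y t = ⟨⟩-congˡ (λ c → seq (y c) t) λ c →
      trans (cong (λ g → seq (g c) t) eq) (seq-functional (Spanned.pivots sp) (x̂ S gp ∘ Spanned.ι sp) t c)

    -- Exact at every t and not only in the limit, since `functional-vanishes` is a polynomial
    -- identity.
    value-on : ∀ {σ} → cnt (lookup σ) ≡ d → ∀ i → lookup σ i ≡ true → ∀ t → value σ i t ≡ 0ℚ
    value-on {σ} size i i∈σ t with coefficients-spanned σ size
    ... | sp , eq with Spanned.complete sp i i∈σ
    ... | j , refl = trans (value-spanned sp eq (x̂ S gp i) t) (functional-vanishes (Spanned.pivots sp) ((x̂ S gp ∘ Spanned.ι sp) ﹫ t) j)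

    value-off : ∀ {σ} → cnt (lookup σ) ≡ d → ∀ i → lookup σ i ≡ false → Apart (value σ i)
    value-off {σ} size i i∉σ with coefficients-spanned σ size
    ... | sp , eq = Apart-ext (λ t → sym (value-spanned sp eq (x̂ S gp i) t))
      (functional-apart (Spanned.pivots sp) (x̂ S gp ∘ Spanned.ι sp) (x̂ S gp i) (Spanned.apart sp) (Spanned.outside-apart sp i i∉σ))

    value-proportional : ∀ {σ} → cnt (lookup σ) ≡ d → (g : Fin (suc d) → ℝ) → (∀ i → lookup σ i ≡ true → Null (dot g (x̂ S gp i))) →
      ∃ λ M → ∃ λ N → Apart (seq M) × ∀ c → Null (λ t → seq M t * seq (g c) t - seq N t * seq (coefficients σ c) t)
    value-proportional {σ} size g vanish with coefficients-spanned σ size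
    ... | sp , eq = scaleℝ π v , last π g , Spanned.apart sp , λ c → Null-ext
        (λ t → cong₂ (λ x y → x * seq (g c) t - seq (last π g) t * y) (sym (seq-scale π v t))
          (sym (trans (cong (λ k → seq (k c) t) eq) (seq-functional π v t c))))
        (proportional π v g (λ k → vanish (Spanned.ι sp k) (Spanned.sound sp k)) c)
      where
      π = Spanned.pivots sp
      v = x̂ S gp ∘ Spanned.ι sp

    -- What the t-th approximation must inherit: nonzero pivots, so that σ still spans a hyperplane,
    -- and the side on which every other point lies.
    Faithful : Subset n → ℕ → Set
    Faithful σ t = ∀ (size : cnt (lookup σ) ≡ d) →
      (scale (Spanned.pivots (proj₁ (coefficients-spanned σ size))) ((x̂ S gp ∘ Spanned.ι (proj₁ (coefficients-spanned σ size))) ﹫ t) ≢ 0ℚ)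
      × (∀ i → lookup σ i ≡ false → SignAt (value σ i) t)

    eventually-faithful : ∀ σ → Eventually (Faithful σ)
    eventually-faithful σ = go (cnt (lookup σ) ℕ.≟ d)
      where
      go : Dec (cnt (lookup σ) ≡ d) → Eventually (Faithful σ)
      go (no ¬size) = 0 , λ _ _ size → contradiction size ¬size
      go (yes size) = let N , ev = eventually-× (eventually-sign (Spanned.apart sp)) (eventually-∀ signs)
        in N , λ t le size′ → subst (λ z → (scale (Spanned.pivots (proj₁ (coefficients-spanned σ z))) ((x̂ S gp ∘ Spanned.ι (proj₁ (coefficients-spanned σ z))) ﹫ t) ≢ 0ℚ)
               × (∀ i → lookup σ i ≡ false → SignAt (value σ i) t)) (ℕ.≡-irrelevant size size′)
             ((λ eq → Apart⇒≢0 (Spanned.apart sp) (proj₁ (ev t le)) (trans (seq-scale (Spanned.pivots sp) (x̂ S gp ∘ Spanned.ι sp) t) eq)) , proj₂ (ev t le))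
        where
        sp = proj₁ (coefficients-spanned σ size)
        signs : ∀ i → Eventually (λ t → lookup σ i ≡ false → SignAt (value σ i) t)
        signs i = by (lookup σ i) refl
          where
          by : ∀ z → lookup σ i ≡ z → Eventually (λ t → lookup σ i ≡ false → SignAt (value σ i) t)
          by true eq = 0 , λ _ _ eq′ → contradiction (trans (sym eq) eq′) λ ()
          by false eq = let N , ev = eventually-sign (value-off size i eq) in N , λ t le _ → ev t le

    abstract
      -- There are finitely many subsets, so one approximation is faithful for all of them.
      stage : ℕ
      stage = proj₁ (eventually-∀ₛ eventually-faithful)

      faithful : ∀ σ → Faithful σ stage
      faithful = proj₂ (eventually-∀ₛ eventually-faithful) stage ℕ.≤-refl

    q̂ : Fin n → Fin (suc d) → ℚ
    q̂ i c = seq (x̂ S gp i c) stage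

    -- Let σ be τ without a point p. As φ vanishes on σ it is a multiple of the functional of σ; it
    -- also vanishes at p, where that functional does not, so the multiple is zero.
    config-unique : ∀ {φ : Fin (suc d) → ℚ} τ → cnt τ ≡ suc d → (∀ i → τ i ≡ true → ⟨ φ , q̂ i ⟩ ≡ 0ℚ) → ∀ c → φ c ≡ 0ℚ
    config-unique {φ} τ size vanish c = with-point (cnt>0 (subst (0 ℕ.<_) (sym size) ℕ.z<s))
      where
      with-point : (∃ λ p → τ p ≡ true) → φ c ≡ 0ℚ
      with-point (p , p∈τ) = *-cancel-≡0 μ≢0 (trans (each c) (trans (cong (_* F c) ν≡0) (*-zeroˡ (F c))))
        where
        σ : Subset n
        σ = tabulate (τ ∖ p)
        at-σ : ∀ i → lookup σ i ≡ (τ ∖ p) i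
        at-σ = Vec.lookup∘tabulate (τ ∖ p)
        size-σ : cnt (lookup σ) ≡ d
        size-σ = trans (cnt-cong at-σ) (ℕ.suc-injective (trans (ℕ.+-comm 1 _) (trans (cong (λ z → cnt (τ ∖ p) ℕ.+ ⟦ z ⟧) (sym p∈τ)) (trans (cnt-∖ τ p) size))))
        sp = proj₁ (coefficients-spanned σ size-σ)
        π = Spanned.pivots sp
        v : Fin d → Fin (suc d) → ℚ
        v j = q̂ (Spanned.ι sp j)
        μ ν : ℚ
        μ = scale π v
        ν = last π φ
        F : Fin (suc d) → ℚ
        F = functional π v
        μ≢0 : μ ≢ 0ℚ
        μ≢0 = proj₁ (faithful σ size-σ)
        v-vanish : ∀ j → ⟨ φ , v j ⟩ ≡ 0ℚ
        v-vanish j = vanish (Spanned.ι sp j) (∖-⊆ τ p (Spanned.ι sp j) (trans (sym (at-σ (Spanned.ι sp j))) (Spanned.sound sp j)))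
        zero-1 : ∀ {a b} → a - b ≡ 0ℚ → a ≡ b
        zero-1 {a} {b} eq = trans (solve 2 (λ a b → a := (a :- b) :+ b) refl a b) (trans (cong (_+ b) eq) (+-identityˡ b))
        -- Applied to constant sequences, `proportional` becomes an identity between rationals.
        each : ∀ c → μ * φ c ≡ ν * F c
        each c = zero-1 (Null-const (Null-ext (λ t → cong (λ z → μ * φ c - z * F c) (last-const π φ t))
          (proportional π (λ j k → const (v j k)) (const ∘ φ) (λ j → Null-zero λ _ → v-vanish j) c)))
        F-p : ⟨ F , q̂ p ⟩ ≢ 0ℚ
        F-p eq = Apart⇒≢0 (value-off size-σ p p∉σ) (proj₂ (faithful σ size-σ) p p∉σ)
          (trans (value-spanned sp (proj₂ (coefficients-spanned σ size-σ)) (x̂ S gp p) stage) eq)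
          where
          p∉σ : lookup σ p ≡ false
          p∉σ = trans (at-σ p) (∖-self τ p)
        νF-p : ⟨ F , q̂ p ⟩ * ν ≡ 0ℚ
        νF-p = begin
          ⟨ F , q̂ p ⟩ * ν                      ≡⟨ *-comm ⟨ F , q̂ p ⟩ ν ⟩
          ν * ⟨ F , q̂ p ⟩                      ≡⟨ pull ν F ⟩
          ∑ (λ c → (ν * F c) * q̂ p c)          ≡⟨ ∑-cong (λ c → cong (_* q̂ p c) (each c)) ⟨
          ∑ (λ c → (μ * φ c) * q̂ p c)          ≡⟨ pull μ φ ⟨
          μ * ⟨ φ , q̂ p ⟩                      ≡⟨ cong (μ *_) (vanish p p∈τ) ⟩
          μ * 0ℚ                               ≡⟨ *-zeroʳ μ ⟩
          0ℚ                                   ∎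
          where
          open ≡-Reasoning
          pull : ∀ k (g : Fin (suc d) → ℚ) → k * ⟨ g , q̂ p ⟩ ≡ ∑ (λ c → (k * g c) * q̂ p c)
          pull k g = trans (*-∑ k (λ c → g c * q̂ p c)) (∑-cong λ c → sym (*-assoc k (g c) (q̂ p c)))
        ν≡0 : ν ≡ 0ℚ
        ν≡0 = *-cancel-≡0 F-p νF-p

    config : Config d n
    config = record
      { W = λ w → ∃ λ (φ : Fin (suc d) → ℚ) → ∀ i → w i ≡ ⟨ φ , q̂ i ⟩
      ; W-ext = λ eq (φ , w≡) → φ , λ i → trans (sym (eq i)) (w≡ i)
      ; W-comb = λ a b (φ , eq) (ψ , eq′) → (λ c → a * φ c + b * ψ c) , λ i →
          trans (cong₂ (λ x y → a * x + b * y) (eq i) (eq′ i)) (sym (⟨⟩-comb a b φ ψ (q̂ i)))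
      ; f = λ σ i → value σ i stage
      ; f∈W = λ {σ} _ → (λ c → seq (coefficients σ c) stage) , λ _ → refl
      ; f-on = λ size i i∈σ → value-on size i i∈σ stage
      ; f-off = λ {σ} size i i∉σ → Apart⇒≢0 (value-off size i i∉σ) (proj₂ (faithful σ size) i i∉σ)
      ; unique = λ (φ , eq) τ size vanish i → trans (eq i) (∑-zero λ c →
          trans (cong (_* q̂ i c) (config-unique {φ} τ size (λ j j∈ → trans (sym (eq j)) (vanish j j∈)) c)) (*-zeroˡ (q̂ i c)))
      ; h = λ _ → 1ℚ
      ; h∈W = unit zero , λ i → sym (⟨unit,⟩ zero (q̂ i))
      ; 0<h = λ _ → 0<1
      }

  -- Real facets as oriented subsets.

  record Enumeration {M} (P : Subset M → Bool) (c : ℕ) : Set where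
    field
      to        : Fin c → Subset M
      injective : ∀ {i j} → to i ≡ to j → i ≡ j
      sound     : ∀ i → P (to i) ≡ true
      complete  : ∀ σ → P σ ≡ true → ∃ λ i → to i ≡ σ

  enumeration : ∀ {M} (P : Subset M → Bool) → Enumeration P (∑ₛ (⟦_⟧ ∘ P))
  enumeration {zero} P = base (P Vec.[]) refl
    where
    base : ∀ b → P Vec.[] ≡ b → Enumeration P ⟦ b ⟧
    base true eq = record { to = λ _ → Vec.[] ; injective = λ { {zero} {zero} _ → refl } ; sound = λ _ → eq ; complete = λ { Vec.[] _ → zero , refl } }
    base false eq = record { to = λ () ; injective = λ { {()} } ; sound = λ () ; complete = λ { Vec.[] eq′ → contradiction (trans (sym eq) eq′) λ () } }
  enumeration {suc M} P = record { to = to ∘ Fin.splitAt a ; injective = λ {i} {j} eq → trans (sym (Fin.join-splitAt a b i))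
        (trans (cong (Fin.join a b) (inj (Fin.splitAt a i) (Fin.splitAt a j) eq)) (Fin.join-splitAt a b j))
      ; sound = sound ∘ Fin.splitAt a
      ; complete = λ { (false Vec.∷ σ) eq → let i , e = E₀.complete σ eq in i Fin.↑ˡ b , trans (cong to (Fin.splitAt-↑ˡ a i b)) (cong (false Vec.∷_) e)
                     ; (true Vec.∷ σ) eq → let i , e = E₁.complete σ eq in a Fin.↑ʳ i , trans (cong to (Fin.splitAt-↑ʳ a b i)) (cong (true Vec.∷_) e) } }
    where
    a = ∑ₛ (⟦_⟧ ∘ P ∘ (false Vec.∷_))
    b = ∑ₛ (⟦_⟧ ∘ P ∘ (true Vec.∷_))
    module E₀ = Enumeration (enumeration (P ∘ (false Vec.∷_)))
    module E₁ = Enumeration (enumeration (P ∘ (true Vec.∷_)))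
    to : Fin a ⊎ Fin b → Subset (suc M)
    to (inj₁ i) = false Vec.∷ E₀.to i
    to (inj₂ i) = true Vec.∷ E₁.to i
    sound : ∀ s → P (to s) ≡ true
    sound (inj₁ i) = E₀.sound i
    sound (inj₂ i) = E₁.sound i
    inj : ∀ s t → to s ≡ to t → s ≡ t
    inj (inj₁ i) (inj₁ j) eq = cong inj₁ (E₀.injective (cong Vec.tail eq))
    inj (inj₂ i) (inj₂ j) eq = cong inj₂ (E₁.injective (cong Vec.tail eq))
    inj (inj₁ i) (inj₂ j) eq = contradiction (cong Vec.head eq) λ ()
    inj (inj₂ i) (inj₁ j) eq = contradiction (cong Vec.head eq) λ ()

  signedℝ : Bool → ℝ → ℝ
  signedℝ true x = x
  signedℝ false x = -ℝ x

  seq-signed : ∀ b x t → seq (signedℝ b x) t ≡ signed b (seq x t)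
  seq-signed true x t = refl
  seq-signed false x t = refl

  signed-dot : ∀ b {n} (g y : Fin n → ℚ) → ⟨ signed b ∘ g , y ⟩ ≡ signed b ⟨ g , y ⟩
  signed-dot true g y = refl
  signed-dot false g y = trans (∑-cong λ i → solve 2 (λ g y → :- g :* y := :- (g :* y)) refl (g i) (y i)) (∑-neg (λ i → g i * y i))

  signed-* : ∀ b x y → signed b x * signed b y ≡ x * y
  signed-* true x y = refl
  signed-* false x y = solve 2 (λ x y → :- x :* :- y := x :* y) refl x y

  functionalOf : ∀ {d} → HalfSpace d → Fin (suc d) → ℝ
  functionalOf H zero = -ℝ (ℝ.offset H)
  functionalOf H (suc c) = ℝ.normal H c

  functionalOf-dot : ∀ {d} (H : HalfSpace d) (x : Point d) t →
    dot (functionalOf H) (homogenize x) t ≡ seq (ℝ.normal H ℝ.· x) t - seq (ℝ.offset H) t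
  functionalOf-dot H x t = trans (cong (- seq (ℝ.offset H) t * 1ℚ +_) (sym (seq-sum (λ c → ℝ.normal H c ℝ.* x c) t)))
    (solve 2 (λ o s → :- o :* con 1ℚ :+ s := s :- o) refl (seq (ℝ.offset H) t) (seq (ℝ.normal H ℝ.· x) t))

  ∈ₕ⇒Pos : ∀ {d} (H : HalfSpace d) x → x ∈ₕ H → Pos (dot (functionalOf H) (homogenize x))
  ∈ₕ⇒Pos H x x∈ = Pos-ext (λ t → sym (functionalOf-dot H x t)) (<⇒Pos {ℝ.offset H} {ℝ.normal H ℝ.· x} x∈)

  Pos⇒∈ₕ : ∀ {d} (H : HalfSpace d) x → Pos (dot (functionalOf H) (homogenize x)) → x ∈ₕ H
  Pos⇒∈ₕ H x p = Pos⇒< {ℝ.offset H} {ℝ.normal H ℝ.· x} (Pos-ext (functionalOf-dot H x) p)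

  dotℝ : ∀ {n} → (g y : Fin n → ℝ) → ℝ
  dotℝ g y = ℝ.sum (λ i → g i ℝ.* y i)

  seq-dot : ∀ {n} (g y : Fin n → ℝ) t → seq (dotℝ g y) t ≡ dot g y t
  seq-dot g y t = seq-sum (λ i → g i ℝ.* y i) t

  Null-dot : ∀ {n} (s : Fin n → Seq) (y : Fin n → ℝ) → (∀ i → Null (s i)) → Null (λ t → ∑ (λ i → s i t * seq (y i) t))
  Null-dot {zero} s y ns = Null-zero λ _ → refl
  Null-dot {suc n} s y ns = Null-+ (Null-ext (λ t → *-comm (seq (y zero) t) (s zero t)) (Null-* (bounded (y zero)) (ns zero))) (Null-dot (s ∘ suc) (y ∘ suc) (ns ∘ suc))

  Pos-signed : ∀ {s} → Apart s → ∃ λ b → Pos (λ t → signed b (s t))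
  Pos-signed (inj₁ p) = true , p
  Pos-signed (inj₂ p) = false , p

  Pos-square : ∀ {s} → Apart s → Pos (λ t → s t * s t)
  Pos-square (inj₁ p) = Pos-* p p
  Pos-square {s} (inj₂ p) = Pos-ext (λ t → solve 1 (λ x → :- x :* :- x := x :* x) refl (s t)) (Pos-* p p)

  -- In the limit M g = N f, where g is the functional of H. A nonzero normal makes N apart from
  -- zero, and multiplication by M gives M² g = (M N) f with a positive factor on the left; the sign
  -- of M N is the orientation b.
  module Proportional {d : ℕ} (H : HalfSpace d) (f : Fin (suc d) → ℝ) (M N : ℝ) (M-apart : Apart (seq M))
    (coordinate : ∀ c → Null (λ t → seq M t * seq (functionalOf H c) t - seq N t * seq (f c) t)) where

    private
      g : Fin (suc d) → ℝ
      g = functionalOf H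

    proportion : ∀ (y : Fin (suc d) → ℝ) → Null (λ t → seq M t * dot g y t - seq N t * dot f y t)
    proportion y = Null-ext (λ t → combine t) (Null-dot (λ c t → seq M t * seq (g c) t - seq N t * seq (f c) t) y coordinate)
      where
      combine : ∀ t → ∑ (λ c → (seq M t * seq (g c) t - seq N t * seq (f c) t) * seq (y c) t) ≡ seq M t * dot g y t - seq N t * dot f y t
      combine t = trans (⟨⟩-congˡ (λ c → seq (y c) t) (λ c → solve 4 (λ m g n f → m :* g :- n :* f := m :* g :+ (:- n) :* f) refl (seq M t) (seq (g c) t) (seq N t) (seq (f c) t)))
        (trans (⟨⟩-comb (seq M t) (- seq N t) (λ c → seq (g c) t) (λ c → seq (f c) t) (λ c → seq (y c) t))
          (solve 4 (λ m g n f → m :* g :+ (:- n) :* f := m :* g :- n :* f) refl (seq M t) (dot g y t) (seq N t) (dot f y t)))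
    N-apart : Apart (seq N)
    N-apart = Apart-factor {seq N} {seq (f (suc c))} (isCauchy N) (bounded (f (suc c)))
      (Apart-transport { λ t → seq M t * seq (ℝ.normal H c) t } { λ t → seq N t * seq (f (suc c)) t } (coordinate (suc c))
        (Apart-* {seq M} {seq (ℝ.normal H c)} M-apart (#0⇒Apart {ℝ.normal H c} (proj₂ (ℝ.nonzero H)))))
      where
      c = proj₁ (ℝ.nonzero H)
    K : ℝ
    K = M ℝ.* N
    sign : ∃ λ b → Pos (λ t → signed b (seq K t))
    sign = Pos-signed {seq K} (Apart-* {seq M} {seq N} M-apart N-apart)
    b = proj₁ sign
    K′ : ℝ
    K′ = signedℝ b K
    K-pos : Pos (seq K′)
    K-pos = Pos-ext { λ t → signed b (seq K t) } (λ t → sym (seq-signed b K t)) (proj₂ sign)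
    M² : Pos (seq (M ℝ.* M))
    M² = Pos-square {seq M} M-apart
    f-side : Point d → ℝ
    f-side x = signedℝ b (dotℝ f (homogenize x))
    seq-f-side : ∀ x t → seq (f-side x) t ≡ signed b (dot f (homogenize x) t)
    seq-f-side x t = trans (seq-signed b (dotℝ f (homogenize x)) t) (cong (signed b) (seq-dot f (homogenize x) t))
    g-side : Point d → ℝ
    g-side x = dotℝ g (homogenize x)
    relation : ∀ x t → seq M t * (seq M t * dot g (homogenize x) t - seq N t * dot f (homogenize x) t)
      ≡ seq (M ℝ.* M) t * seq (g-side x) t - seq K′ t * seq (f-side x) t
    relation x t = trans (lemma (seq M t) (dot g (homogenize x) t) (seq N t) (dot f (homogenize x) t))
      (cong₂ (λ y z → (seq M t * seq M t) * y - z) (sym (seq-dot g (homogenize x) t))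
        (sym (trans (cong₂ _*_ (seq-signed b K t) (seq-f-side x t)) (signed-* b (seq K t) (dot f (homogenize x) t)))))
      where
      lemma : ∀ m g n f → m * (m * g - n * f) ≡ (m * m) * g - (m * n) * f
      lemma = solve 4 (λ m g n f → m :* (m :* g :- n :* f) := (m :* m) :* g :- (m :* n) :* f) refl
    near : ∀ x → Null (λ t → seq (M ℝ.* M) t * seq (g-side x) t - seq K′ t * seq (f-side x) t)
    near x = Null-ext (relation x) (Null-* {seq M} (bounded M) (proportion (homogenize x)))
    near′ : ∀ x → Null (λ t → seq K′ t * seq (f-side x) t - seq (M ℝ.* M) t * seq (g-side x) t)
    near′ x = Null-ext (λ t → lemma (seq (M ℝ.* M) t * seq (g-side x) t) (seq K′ t * seq (f-side x) t)) (Null-neg (near x))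
      where
      lemma : ∀ a b → - (a - b) ≡ b - a
      lemma = solve 2 (λ a b → :- (a :- b) := b :- a) refl
    to : ∀ x → x ∈ₕ H → Pos (λ t → signed b (dot f (homogenize x) t))
    to x x∈ = Pos-ext {seq (f-side x)} (seq-f-side x)
      (Pos-proportional {seq (M ℝ.* M)} {seq (g-side x)} {seq K′} {seq (f-side x)} (near x) M² K-pos (bounded K′) (isCauchy (f-side x))
        (Pos-ext {dot g (homogenize x)} (λ t → sym (seq-dot g (homogenize x) t)) (∈ₕ⇒Pos H x x∈)))
    from : ∀ x → Pos (λ t → signed b (dot f (homogenize x) t)) → x ∈ₕ H
    from x p = Pos⇒∈ₕ H x (Pos-ext {seq (g-side x)} (seq-dot g (homogenize x))
      (Pos-proportional {seq K′} {seq (f-side x)} {seq (M ℝ.* M)} {seq (g-side x)} (near′ x) K-pos M² (bounded (M ℝ.* M)) (isCauchy (g-side x))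
        (Pos-ext { λ t → signed b (dot f (homogenize x) t) } (λ t → sym (seq-f-side x t)) p)))

  record Sides {d} (H : HalfSpace d) (f : Fin (suc d) → ℝ) : Set where
    field
      b     : Bool
      to    : ∀ x → x ∈ₕ H → Pos (λ t → signed b (dot f (homogenize x) t))
      from  : ∀ x → Pos (λ t → signed b (dot f (homogenize x) t)) → x ∈ₕ H

  abstract
    sides : ∀ {d} (H : HalfSpace d) (f : Fin (suc d) → ℝ) (M N : ℝ) → Apart (seq M) →
      (∀ c → Null (λ t → seq M t * seq (functionalOf H c) t - seq N t * seq (f c) t)) → Sides H f
    sides H f M N M-apart coordinate = record { b = b ; to = to ; from = from }
      where open Proportional H f M N M-apart coordinate

  module Facets {n d : ℕ} (S : PointSet n (suc d)) (gp : GeneralPosition S) (d<n : suc (suc d) ℕ.≤ n) where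
    open Rational S gp d<n

    private
      F : Subset n → Fin n → ℚ
      F = Config.f config

    oriented : Bool → Subset n → Fin (suc (suc d)) → ℝ
    oriented b σ c = signedℝ b (coefficients σ c)

    oriented-dot : ∀ b σ y t → dot (oriented b σ) y t ≡ signed b (dot (coefficients σ) y t)
    oriented-dot b σ y t = trans (⟨⟩-congˡ (λ c → seq (y c) t) λ c → seq-signed b (coefficients σ c) t)
      (signed-dot b (λ c → seq (coefficients σ c) t) (λ c → seq (y c) t))

    point-on point-off : ∀ {σ} → cnt (lookup σ) ≡ suc d → Fin n
    point-on {σ} size = proj₁ (cnt>0 {b = lookup σ} (subst (0 ℕ.<_) (sym size) ℕ.z<s))
    point-off {σ} size = proj₁ (cnt<⇒∃ {b = lookup σ} {c = λ _ → true} (subst₂ ℕ._<_ (sym size) (sym (cnt-all {n} λ _ → refl)) d<n))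

    point-off∉ : ∀ {σ} (size : cnt (lookup σ) ≡ suc d) → lookup σ (point-off {σ} size) ≡ false
    point-off∉ {σ} size = proj₁ (proj₂ (cnt<⇒∃ {b = lookup σ} {c = λ _ → true} (subst₂ ℕ._<_ (sym size) (sym (cnt-all {n} λ _ → refl)) d<n)))

    point-on∈ : ∀ {σ} (size : cnt (lookup σ) ≡ suc d) → lookup σ (point-on {σ} size) ≡ true
    point-on∈ {σ} size = proj₂ (cnt>0 {b = lookup σ} (subst (0 ℕ.<_) (sym size) ℕ.z<s))

    -- The functional is 0 at a point of σ and not at another one, so its linear part is nonzero.
    normal-apart : ∀ {σ} → cnt (lookup σ) ≡ suc d → ∃ λ c → Apart (seq (coefficients σ (suc c)))
    normal-apart {σ} size = c , Apart-factor {seq (coefficients σ (suc c))} {seq (point S i c ℝ.+ (-ℝ point S j c))}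
        (isCauchy (coefficients σ (suc c))) (bounded (point S i c ℝ.+ (-ℝ point S j c))) ap
      where
      i = point-off {σ} size
      j = point-on {σ} size
      term : Fin (suc d) → ℝ
      term c = coefficients σ (suc c) ℝ.* (point S i c ℝ.+ (-ℝ point S j c))
      difference : ∀ t → value σ i t ≡ ∑ (λ c → seq (term c) t)
      difference t = begin
        a * 1ℚ + ∑ (λ c → k c * p c)                                          ≡⟨ lemma (a * 1ℚ) (∑ (λ c → k c * p c)) (∑ (λ c → k c * q c)) ⟩
        (a * 1ℚ + ∑ (λ c → k c * q c)) + (∑ (λ c → k c * p c) + - ∑ (λ c → k c * q c))
          ≡⟨ cong₂ _+_ (value-on size j (point-on∈ {σ} size) t) (trans (cong (∑ (λ c → k c * p c) +_) (sym (∑-neg (λ c → k c * q c)))) (trans (sym (∑-+ (λ c → k c * p c) (λ c → - (k c * q c)))) (∑-cong λ c → distribute (k c) (p c) (q c)))) ⟩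
        0ℚ + ∑ (λ c → k c * (p c + - q c))                                    ≡⟨ +-identityˡ _ ⟩
        ∑ (λ c → k c * (p c + - q c))                                         ∎
        where
        open ≡-Reasoning
        a = seq (coefficients σ zero) t
        k p q : Fin (suc d) → ℚ
        k c = seq (coefficients σ (suc c)) t
        p c = seq (point S i c) t
        q c = seq (point S j c) t
        lemma : ∀ a x y → a + x ≡ (a + y) + (x + - y)
        lemma = solve 3 (λ a x y → a :+ x := (a :+ y) :+ (x :+ :- y)) refl
        distribute : ∀ k p q → k * p + - (k * q) ≡ k * (p + - q)
        distribute = solve 3 (λ k p q → k :* p :+ :- (k :* q) := k :* (p :+ :- q)) refl
      found : ∃ λ c → Apart (seq (term c))
      found = Apart-∑ (λ c → seq (term c)) (λ c → isCauchy (term c)) (Apart-ext difference (value-off size i (point-off∉ {σ} size)))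
      c = proj₁ found
      ap = proj₂ found

    halfSpace : ∀ b σ → cnt (lookup σ) ≡ suc d → HalfSpace (suc d)
    halfSpace b σ size = record
      { normal = oriented b σ ∘ suc
      ; offset = -ℝ (oriented b σ zero)
      ; nonzero = c , Apart⇒#0 {oriented b σ (suc c)} (Apart-ext (λ t → sym (seq-signed b (coefficients σ (suc c)) t)) (signed-apart b (proj₂ (normal-apart {σ} size))))
      }
      where
      c = proj₁ (normal-apart {σ} size)
      signed-apart : ∀ b {s : Seq} → Apart s → Apart (λ t → signed b (s t))
      signed-apart true p = p
      signed-apart false p = Apart-neg p

    halfSpace-dot : ∀ b σ size (y : Point (suc d)) t → dot (functionalOf (halfSpace b σ size)) (homogenize y) t ≡ signed b (dot (coefficients σ) (homogenize y) t)
    halfSpace-dot b σ size y t = trans (cong (_+ ∑ (λ c → seq (oriented b σ (suc c)) t * seq (y c) t))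
      (cong (_* 1ℚ) (solve 1 (λ x → :- (:- x) := x) refl (seq (oriented b σ zero) t)))) (oriented-dot b σ (homogenize y) t)

    Pos⇒∈ : ∀ {b σ size} y → Pos (λ t → signed b (dot (coefficients σ) (homogenize y) t)) → y ∈ₕ halfSpace b σ size
    Pos⇒∈ {b} {σ} {size} y p = Pos⇒∈ₕ (halfSpace b σ size) y (Pos-ext (λ t → sym (halfSpace-dot b σ size y t)) p)

    ∈⇒Pos : ∀ {b σ size} y → y ∈ₕ halfSpace b σ size → Pos (λ t → signed b (dot (coefficients σ) (homogenize y) t))
    ∈⇒Pos {b} {σ} {size} y y∈ = Pos-ext (halfSpace-dot b σ size y) (∈ₕ⇒Pos (halfSpace b σ size) y y∈)

    SignedPos : Bool → Subset n → Fin n → Set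
    SignedPos b σ i = Pos (λ t → signed b (value σ i t))

    zero-not-pos : ∀ b {s : Seq} → (∀ t → s t ≡ 0ℚ) → ¬ Pos (λ t → signed b (s t))
    zero-not-pos b eq p = Pos⇒¬Null p (Null-zero λ t → signed-zero b (eq t))

    side⇒Pos : ∀ {b σ} → cnt (lookup σ) ≡ suc d → ∀ i → side F (b Vec.∷ σ) i ≡ true → SignedPos b σ i
    side⇒Pos {b} {σ} size i eq = by (lookup σ i) refl
      where
      0<value : 0ℚ < signed b (value σ i stage)
      0<value = positive⇒0< eq
      by : ∀ z → lookup σ i ≡ z → SignedPos b σ i
      by true i∈σ = contradiction 0<value (<-irrefl (sym (signed-zero b (value-on {σ} size i i∈σ stage))))
      by false i∉σ = agree b {value σ i} 0<value (value-off {σ} size i i∉σ) (proj₂ (faithful σ size) i i∉σ)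
        where
        agree : ∀ b {s : Seq} → 0ℚ < signed b (s stage) → Apart s → SignAt s stage → Pos (λ t → signed b (s t))
        agree true lt (inj₁ p) _ = p
        agree true lt (inj₂ p) (_ , neg) = contradiction (<-trans lt (0<-⇒<0 (neg p))) (<-irrefl refl)
        agree false lt (inj₂ p) _ = p
        agree false lt (inj₁ p) (pos , _) = contradiction (<-trans (pos p) (0<-⇒<0 lt)) (<-irrefl refl)

    Pos⇒side : ∀ {b σ} → cnt (lookup σ) ≡ suc d → ∀ i → SignedPos b σ i → side F (b Vec.∷ σ) i ≡ true
    Pos⇒side {b} {σ} size i p = by (lookup σ i) refl
      where
      by : ∀ z → lookup σ i ≡ z → side F (b Vec.∷ σ) i ≡ true
      by true i∈σ = contradiction p (zero-not-pos b {value σ i} (value-on {σ} size i i∈σ))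
      by false i∉σ = 0<⇒positive (agree b {value σ i} p (proj₂ (faithful σ size) i i∉σ))
        where
        agree : ∀ b {s : Seq} → Pos (λ t → signed b (s t)) → SignAt s stage → 0ℚ < signed b (s stage)
        agree true p (pos , _) = pos p
        agree false p (_ , neg) = neg p

    module _ (j : ℕ) where
      P : Subset (suc n) → Bool
      P = isFacet (suc d) F j

      size-of : ∀ ι → P ι ≡ true → cnt (lookup (Vec.tail ι)) ≡ suc d
      size-of ι eq = ≡ᵇ⇒≡ (∧-trueˡ eq)

      facetOf : ∀ ι → P ι ≡ true → Facet S j
      facetOf (b Vec.∷ σ) eq = record
        { vertices = σ
        ; size = trans (∣∣≡cnt σ) size
        ; positiveSide = H
        ; spanning = λ i i∈σ → Null-ext (functionalOf-dot H (point S i)) (Null-zero λ t → trans (halfSpace-dot b σ size (point S i) t)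
            (signed-zero b (value-on size i (Vec.[]=⇒lookup i∈σ) t)))
        ; count = tabulate (side F (b Vec.∷ σ))
            , trans (∣∣≡cnt (tabulate (side F (b Vec.∷ σ)))) (trans (cnt-cong (Vec.lookup∘tabulate (side F (b Vec.∷ σ)))) (≡ᵇ⇒≡ (∧-trueʳ {cnt (lookup σ) ℕ.≡ᵇ suc d} eq)))
            , λ i → mk⇔
              (λ i∈ → Pos⇒∈ {b} {σ} {size} (point S i) (side⇒Pos {b} {σ} size i (trans (sym (Vec.lookup∘tabulate (side F (b Vec.∷ σ)) i)) (Vec.[]=⇒lookup i∈))))
              (λ i∈H → Vec.lookup⇒[]= i _ (trans (Vec.lookup∘tabulate (side F (b Vec.∷ σ)) i) (Pos⇒side {b} {σ} size i (∈⇒Pos {b} {σ} {size} (point S i) i∈H))))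
        }
        where
        size = size-of (b Vec.∷ σ) eq
        H = halfSpace b σ size

      -- The two orientations of σ have different positive sides, because a point off σ lies in
      -- exactly one of them.
      facetOf-injective : ∀ ι κ p q → ℝ.vertices (facetOf ι p) ≡ ℝ.vertices (facetOf κ q) → ℝ.positiveSide (facetOf ι p) ≐ ℝ.positiveSide (facetOf κ q) → ι ≡ κ
      facetOf-injective (b Vec.∷ σ) (b′ Vec.∷ .σ) p q refl same = cong (Vec._∷ σ) (by b b′ (proj₁ orientation) (proj₂ orientation))
        where
        size = size-of (b Vec.∷ σ) p
        i = point-off {σ} size
        sign : ∃ λ s → SignedPos s σ i
        sign = Pos-signed (value-off size i (point-off∉ {σ} size))
        there′ : SignedPos b σ i → SignedPos b′ σ i
        there′ pos = ∈⇒Pos {b′} {σ} {size-of (b′ Vec.∷ σ) q} (point S i) (Equivalence.to (same (point S i)) (Pos⇒∈ {b} {σ} {size} (point S i) pos))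
        back : SignedPos b′ σ i → SignedPos b σ i
        back pos = ∈⇒Pos {b} {σ} {size} (point S i) (Equivalence.from (same (point S i)) (Pos⇒∈ {b′} {σ} {size-of (b′ Vec.∷ σ) q} (point S i) pos))
        orientation : (SignedPos b σ i → SignedPos b′ σ i) × (SignedPos b′ σ i → SignedPos b σ i)
        orientation = there′ , back
        by : ∀ b b′ → (SignedPos b σ i → SignedPos b′ σ i) → (SignedPos b′ σ i → SignedPos b σ i) → b ≡ b′
        by true true _ _ = refl
        by false false _ _ = refl
        by true false f g = clash (proj₁ sign) (proj₂ sign)
          where
          clash : ∀ s → SignedPos s σ i → true ≡ false
          clash true p = contradiction (f p) (Pos-asym p)
          clash false p = contradiction p (Pos-asym (g p))
        by false true f g = clash (proj₁ sign) (proj₂ sign)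
          where
          clash : ∀ s → SignedPos s σ i → false ≡ true
          clash true p = contradiction (g p) (Pos-asym p)
          clash false p = contradiction p (Pos-asym (f p))

      -- Every facet arises from a candidate, since its functional is proportional to that of its vertices.
      orientation : ∀ (Φ : Facet S j) → Sides (ℝ.positiveSide Φ) (coefficients (ℝ.vertices Φ))
      orientation Φ = from-multiple (value-proportional {σ} size g on-facet)
        where
        σ = ℝ.vertices Φ
        H = ℝ.positiveSide Φ
        g : Fin (suc (suc d)) → ℝ
        g = functionalOf H
        size : cnt (lookup σ) ≡ suc d
        size = trans (sym (∣∣≡cnt σ)) (ℝ.size Φ)
        on-facet : ∀ i → lookup σ i ≡ true → Null (dot g (homogenize (point S i)))
        on-facet i i∈ = Null-ext { λ t → seq (ℝ.normal H ℝ.· point S i) t - seq (ℝ.offset H) t } {dot g (homogenize (point S i))}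
          (λ t → sym (functionalOf-dot H (point S i) t)) (ℝ.spanning Φ i (Vec.lookup⇒[]= i σ i∈))
        from-multiple : (∃ λ M → ∃ λ N → Apart (seq M) × ∀ c → Null (λ t → seq M t * seq (g c) t - seq N t * seq (coefficients σ c) t)) → Sides H (coefficients σ)
        from-multiple (M , N , M-apart , coordinate) = sides H (coefficients σ) M N M-apart coordinate

      module _ (Φ : Facet S j) where
        private
          open Sides (orientation Φ)
          σ = ℝ.vertices Φ
          τ = proj₁ (ℝ.count Φ)
          size : cnt (lookup σ) ≡ suc d
          size = trans (sym (∣∣≡cnt σ)) (ℝ.size Φ)

        candidate : Subset (suc n)
        candidate = b Vec.∷ σ

        candidate-facet : P candidate ≡ true
        candidate-facet = ∧-true (≡⇒≡ᵇ size) (≡⇒≡ᵇ (trans (cnt-cong agree) (trans (sym (∣∣≡cnt τ)) (proj₁ (proj₂ (ℝ.count Φ))))))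
          where
          membership : ∀ i → _
          membership = proj₂ (proj₂ (ℝ.count Φ))
          iff : ∀ {x y : Bool} → (x ≡ true → y ≡ true) → (y ≡ true → x ≡ true) → x ≡ y
          iff {true} {true} _ _ = refl
          iff {false} {false} _ _ = refl
          iff {true} {false} h _ = sym (h refl)
          iff {false} {true} _ h = h refl
          agree : ∀ i → side F candidate i ≡ lookup τ i
          agree i = iff
            (λ s → Vec.[]=⇒lookup (Equivalence.from (membership i) (from (point S i) (side⇒Pos {b} {σ} size i s))))
            (λ i∈τ → Pos⇒side {b} {σ} size i (to (point S i) (Equivalence.to (membership i) (Vec.lookup⇒[]= i τ i∈τ))))

        candidate-same : ∀ ι (p : P ι ≡ true) → ι ≡ candidate → ℝ.vertices (facetOf ι p) ≡ ℝ.vertices Φ × (ℝ.positiveSide (facetOf ι p) ≐ ℝ.positiveSide Φ)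
        candidate-same .candidate p refl = refl , λ x → mk⇔
          (λ x∈ → from x (∈⇒Pos {b} {σ} {size-of candidate p} x x∈))
          (λ x∈ → Pos⇒∈ {b} {σ} {size-of candidate p} x (to x x∈))

      cardinality : HasCardinality (facetSetoid S j) (facetCount (suc d) F j)
      cardinality = record
        { to = λ i → facetOf (E.to i) (E.sound i)
        ; cong = λ { {i} refl → refl , λ x → mk⇔ (λ h → h) (λ h → h) }
        ; bijective = (λ {i} {k} (vertices≡ , sides) → E.injective (facetOf-injective (E.to i) (E.to k) (E.sound i) (E.sound k) vertices≡ sides))
          , λ Φ → let i , e = E.complete (candidate Φ) (candidate-facet Φ)
                  in i , λ { {k} refl → candidate-same Φ (E.to i) (E.sound i) e }
        }
        where
        module E = Enumeration (enumeration P)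

  -- Boxes near the vertices of a simplex.

  8ℚ : ℚ
  8ℚ = ℤ.+ 8 / 1

  pow : ℕ → ℚ
  pow zero = 1ℚ
  pow (suc m) = 8ℚ * pow m

  0<pow : ∀ m → 0ℚ < pow m
  0<pow zero = 0<1
  0<pow (suc m) = 0<* (ℚ.positive⁻¹ 8ℚ) (0<pow m)

  private
    a≤8a : ∀ {a} → 0ℚ ≤ a → a ≤ 8ℚ * a
    a≤8a {a} 0≤a = 0≤-⇒≤ (subst (0ℚ ≤_) (solve 1 (λ a → con (8ℚ - 1ℚ) :* a := con 8ℚ :* a :- a) refl a) (0≤* (ℚ.nonNegative⁻¹ (8ℚ - 1ℚ)) 0≤a))

  pow-mono : ∀ {m m′} → m ℕ.≤ m′ → pow m ≤ pow m′
  pow-mono {m} le = go (ℕ.≤⇒≤′ le)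
    where
    go : ∀ {m′} → m ℕ.≤′ m′ → pow m ≤ pow m′
    go (ℕ.≤′-reflexive refl) = ≤-refl
    go (ℕ.≤′-step {m′} le) = ≤-trans (go le) (a≤8a (<⇒≤ (0<pow m′)))

  -- Barycentric coordinates with respect to the origin and the unit points.
  β : ∀ {d} → (Fin d → ℚ) → Fin (suc d) → ℚ
  β q zero = 1ℚ - ∑ q
  β q (suc c) = q c

  hom : ∀ {d} → (Fin d → ℚ) → Fin (suc d) → ℚ
  hom q zero = 1ℚ
  hom q (suc c) = q c

  -- The values of the affine functional φ at the vertices of the standard simplex, which are its
  -- coefficients in barycentric coordinates.
  vertexValues : ∀ {d} → (Fin (suc d) → ℚ) → Fin (suc d) → ℚ
  vertexValues φ zero = φ zero
  vertexValues φ (suc c) = φ zero + φ (suc c)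

  vertexValues-β : ∀ {d} (φ : Fin (suc d) → ℚ) q → ⟨ φ , hom q ⟩ ≡ ⟨ vertexValues φ , β q ⟩
  vertexValues-β φ q = sym (begin
    φ zero * (1ℚ - ∑ q) + ∑ (λ c → (φ zero + φ (suc c)) * q c)
      ≡⟨ cong (λ z → φ zero * (1ℚ - ∑ q) + z) (trans (∑-cong λ c → ℚ.*-distribʳ-+ (q c) (φ zero) (φ (suc c)))
           (trans (∑-+ (λ c → φ zero * q c) (λ c → φ (suc c) * q c)) (cong (_+ ∑ (λ c → φ (suc c) * q c)) (sym (*-∑ (φ zero) q))))) ⟩
    φ zero * (1ℚ - ∑ q) + (φ zero * ∑ q + ∑ (λ c → φ (suc c) * q c))
      ≡⟨ solve 3 (λ a s r → a :* (con 1ℚ :- s) :+ (a :* s :+ r) := a :* con 1ℚ :+ r) refl (φ zero) (∑ q) (∑ (λ c → φ (suc c) * q c)) ⟩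
    φ zero * 1ℚ + ∑ (λ c → φ (suc c) * q c) ∎)
    where open ≡-Reasoning

  module _ {d : ℕ} (s : ℚ) (K : ℚ) where
    private
      ∑-const-* : ∀ {d} a (q : Fin d → ℚ) → ⟨ q , (λ _ → a) ⟩ ≡ a * ∑ q
      ∑-const-* a q = trans (∑-cong λ c → *-comm (q c) a) (sym (*-∑ a q))

      Open-resp : ∀ {P Q : (Fin d → ℚ) → Set} → (∀ q → P q → Q q) → (∀ q → Q q → P q) → Open P → Open Q
      Open-resp to from P-open q Qq x = let ε₀ , 0<ε₀ , step = P-open q (from q Qq) x
        in ε₀ , 0<ε₀ , λ ε 0<ε ε≤ → to _ (step ε 0<ε ε≤)

      β-zero : ∀ (q : Fin d → ℚ) → (K + s) + ⟨ q , (λ _ → - s) ⟩ ≡ K + s * (1ℚ - ∑ q)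
      β-zero q = trans (cong (λ z → (K + s) + z) (∑-const-* (- s) q))
        (solve 3 (λ k s y → (k :+ s) :+ (:- s) :* y := k :+ s :* (con 1ℚ :- y)) refl K s (∑ q))

      β-suc : ∀ c (q : Fin d → ℚ) → K + ⟨ q , (λ i → s * unit c i) ⟩ ≡ K + s * q c
      β-suc c q = cong (K +_) (trans (∑-cong λ i → solve 3 (λ q s u → q :* (s :* u) := s :* (u :* q)) refl (q i) s (unit c i))
        (trans (sym (*-∑ s (λ i → unit c i * q i))) (cong (s *_) (⟨unit,⟩ c q))))

    β-open : ∀ (j : Fin (suc d)) → Open (λ q → 0ℚ < K + s * β q j)
    β-open zero = Open-resp (λ q → subst (0ℚ <_) (β-zero q)) (λ q → subst (0ℚ <_) (sym (β-zero q))) (Open-affine (K + s) (λ _ → - s))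
    β-open (suc c) = Open-resp (λ q → subst (0ℚ <_) (β-suc c q)) (λ q → subst (0ℚ <_) (sym (β-suc c q))) (Open-affine K (λ i → s * unit c i))

  -- In barycentric coordinates scaled by weight τ g, the box consists of the points
  -- B e_g + τ c with all coordinates of c between 1 and 2.
  module Boxes (d : ℕ) (B : ℚ) (0<B : 0ℚ < B) where

    r : ℕ
    r = suc d

    base : Fin r → Fin r → ℚ
    base g j = B * unit g j

    mid : ℚ → Fin r → Fin r → ℚ
    mid τ g j = base g j + (1ℚ + ½) * τ

    -- The total mass of the middle of the box; division by it gives barycentric coordinates with
    -- sum 1. A box with small τ is close to the vertex g, and growing τ moves it towards the
    -- barycentre.
    weight : ℚ → Fin r → ℚ
    weight τ g = ∑ (mid τ g)

    0≤base : ∀ g j → 0ℚ ≤ base g j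
    0≤base g j = 0≤* (<⇒≤ 0<B) (0≤unit g j)

    0<mid : ∀ {τ} g j → 0ℚ < τ → 0ℚ < mid τ g j
    0<mid g j 0<τ = +-mono-≤-< (0≤base g j) (0<* (ℚ.positive⁻¹ (1ℚ + ½)) 0<τ)

    0<weight : ∀ {τ} g → 0ℚ < τ → 0ℚ < weight τ g
    0<weight g 0<τ = ∑-pos (λ j → <⇒≤ (0<mid g j 0<τ)) zero (0<mid g zero 0<τ)

    InBox : ℚ → Fin r → (Fin d → ℚ) → Set
    InBox τ g q = ∀ j → j ∈ List.allFin r →
      (0ℚ < - (base g j + τ) + weight τ g * β q j) × (0ℚ < (base g j + (1ℚ + 1ℚ) * τ) + (- weight τ g) * β q j)

    InBox-open : ∀ τ g → Open (InBox τ g)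
    InBox-open τ g = Open-∀ (λ j → Open-× (β-open (weight τ g) (- (base g j + τ)) j) (β-open (- weight τ g) (base g j + (1ℚ + 1ℚ) * τ) j)) (List.allFin r)

    centre : ℚ → Fin r → Fin d → ℚ
    centre τ g c = inv (weight τ g) * mid τ g (suc c)

    centre-β : ∀ {τ} g → 0ℚ < τ → ∀ j → weight τ g * β (centre τ g) j ≡ mid τ g j
    centre-β {τ} g 0<τ (suc c) = trans (sym (*-assoc (weight τ g) (inv (weight τ g)) (mid τ g (suc c))))
      (trans (cong (_* mid τ g (suc c)) (inv-inverse (0<⇒≢0 (0<weight g 0<τ)))) (*-identityˡ (mid τ g (suc c))))
    centre-β {τ} g 0<τ zero = trans (cong (λ z → weight τ g * (1ℚ - z)) (sym (*-∑ (inv (weight τ g)) (mid τ g ∘ suc))))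
      (trans (solve 3 (λ w i m → w :* (con 1ℚ :- i :* m) := w :- (w :* i) :* m) refl (weight τ g) (inv (weight τ g)) (∑ (mid τ g ∘ suc)))
      (trans (cong (λ z → weight τ g - z * ∑ (mid τ g ∘ suc)) (inv-inverse (0<⇒≢0 (0<weight g 0<τ))))
        (solve 2 (λ a m → (a :+ m) :- con 1ℚ :* m := a) refl (mid τ g zero) (∑ (mid τ g ∘ suc)))))

    centre-in : ∀ {τ} g → 0ℚ < τ → InBox τ g (centre τ g)
    centre-in {τ} g 0<τ j _ = subst (λ z → 0ℚ < - (base g j + τ) + z) (sym (centre-β g 0<τ j)) (subst (0ℚ <_)
        (solve 2 (λ b t → con ½ :* t := :- (b :+ t) :+ (b :+ con (1ℚ + ½) :* t)) refl (base g j) τ) 0<half)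
      , subst (λ z → 0ℚ < (base g j + (1ℚ + 1ℚ) * τ) + z) (trans (cong -_ (sym (centre-β g 0<τ j))) (ℚ.neg-distribˡ-* (weight τ g) (β (centre τ g) j)))
          (subst (0ℚ <_) (solve 2 (λ b t → con ½ :* t := (b :+ con (1ℚ + 1ℚ) :* t) :+ :- (b :+ con (1ℚ + ½) :* t)) refl (base g j) τ) 0<half)
      where
      0<half : 0ℚ < ½ * τ
      0<half = 0<* (ℚ.positive⁻¹ ½) 0<τ

    module _ (φ : Fin r → ℚ) where
      ψ p m : Fin r → ℚ
      ψ = vertexValues φ
      p j = part (ψ j)
      m j = part (- ψ j)

      P N : ℚ
      P = ∑ p
      N = ∑ m

      excess : ℚ → Fin r → (Fin d → ℚ) → Fin r → ℚ
      excess τ g q j = weight τ g * β q j - base g j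

      E : ℚ → Fin r → (Fin d → ℚ) → ℚ
      E τ g q = ∑ (λ j → ψ j * excess τ g q j)

      scaled-value : ∀ τ g q → weight τ g * ⟨ φ , hom q ⟩ ≡ B * ψ g + E τ g q
      scaled-value τ g q = begin
        weight τ g * ⟨ φ , hom q ⟩                                  ≡⟨ cong (weight τ g *_) (vertexValues-β φ q) ⟩
        weight τ g * ⟨ ψ , β q ⟩                                    ≡⟨ *-∑ (weight τ g) (λ j → ψ j * β q j) ⟩
        ∑ (λ j → weight τ g * (ψ j * β q j))                        ≡⟨ ∑-cong (λ j → lemma (weight τ g) (ψ j) (β q j) B (unit g j)) ⟩
        ∑ (λ j → B * (unit g j * ψ j) + ψ j * excess τ g q j)       ≡⟨ ∑-+ (λ j → B * (unit g j * ψ j)) (λ j → ψ j * excess τ g q j) ⟩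
        ∑ (λ j → B * (unit g j * ψ j)) + E τ g q                    ≡⟨ cong (_+ E τ g q) (trans (sym (*-∑ B (λ j → unit g j * ψ j))) (cong (B *_) (⟨unit,⟩ g ψ))) ⟩
        B * ψ g + E τ g q                                           ∎
        where
        open ≡-Reasoning
        lemma : ∀ w y b k u → w * (y * b) ≡ k * (u * y) + y * (w * b - k * u)
        lemma = solve 5 (λ w y b k u → w :* (y :* b) := k :* (u :* y) :+ y :* (w :* b :- k :* u)) refl

      module _ {τ g q} (box : InBox τ g q) where
        private
          low : ∀ j → 0ℚ < excess τ g q j - τ
          low j = subst (0ℚ <_) (solve 3 (λ b t z → :- (b :+ t) :+ z := (z :- b) :- t) refl (base g j) τ (weight τ g * β q j)) (proj₁ (box j (List.∈-allFin j)))
          high : ∀ j → 0ℚ < (1ℚ + 1ℚ) * τ - excess τ g q j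
          high j = subst (0ℚ <_) (solve 4 (λ b t w z → (b :+ con (1ℚ + 1ℚ) :* t) :+ (:- w) :* z := con (1ℚ + 1ℚ) :* t :- (w :* z :- b)) refl (base g j) τ (weight τ g) (β q j)) (proj₂ (box j (List.∈-allFin j)))
          ψ-split : ∀ j → ψ j ≡ p j - m j
          ψ-split j = sym (part-difference (ψ j))

        -- Every excess lies between τ and 2 τ; positive coefficients are estimated at the lower end
        -- and negative ones at the upper.
        E-lower : 0ℚ ≤ E τ g q - (τ * P - (1ℚ + 1ℚ) * τ * N)
        E-lower = subst (0ℚ ≤_) eq (∑-nonneg λ j → +-mono-≤ (0≤* (0≤part (ψ j)) (<⇒≤ (low j))) (0≤* (0≤part (- ψ j)) (<⇒≤ (high j))))
          where
          x = excess τ g q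
          eq : ∑ (λ j → p j * (x j - τ) + m j * ((1ℚ + 1ℚ) * τ - x j)) ≡ E τ g q - (τ * P - (1ℚ + 1ℚ) * τ * N)
          eq = begin
            ∑ (λ j → p j * (x j - τ) + m j * ((1ℚ + 1ℚ) * τ - x j))
              ≡⟨ ∑-cong (λ j → trans (lemma (p j) (m j) (x j) τ) (cong (λ z → z * x j + ((- τ) * p j + ((1ℚ + 1ℚ) * τ) * m j)) (sym (ψ-split j)))) ⟩
            ∑ (λ j → ψ j * x j + ((- τ) * p j + ((1ℚ + 1ℚ) * τ) * m j))
              ≡⟨ trans (∑-+ (λ j → ψ j * x j) (λ j → (- τ) * p j + ((1ℚ + 1ℚ) * τ) * m j)) (cong (E τ g q +_)
                   (trans (∑-+ (λ j → (- τ) * p j) (λ j → ((1ℚ + 1ℚ) * τ) * m j)) (cong₂ _+_ (sym (*-∑ (- τ) p)) (sym (*-∑ ((1ℚ + 1ℚ) * τ) m))))) ⟩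
            E τ g q + ((- τ) * P + ((1ℚ + 1ℚ) * τ) * N)
              ≡⟨ solve 4 (λ e t p n → e :+ ((:- t) :* p :+ (con (1ℚ + 1ℚ) :* t) :* n) := e :- (t :* p :- con (1ℚ + 1ℚ) :* t :* n)) refl (E τ g q) τ P N ⟩
            E τ g q - (τ * P - (1ℚ + 1ℚ) * τ * N) ∎
            where
            open ≡-Reasoning
            lemma : ∀ p m x t → p * (x - t) + m * ((1ℚ + 1ℚ) * t - x) ≡ (p - m) * x + ((- t) * p + ((1ℚ + 1ℚ) * t) * m)
            lemma = solve 4 (λ p m x t → p :* (x :- t) :+ m :* (con (1ℚ + 1ℚ) :* t :- x) := (p :- m) :* x :+ ((:- t) :* p :+ (con (1ℚ + 1ℚ) :* t) :* m)) refl

        E-upper : 0ℚ ≤ ((1ℚ + 1ℚ) * τ * P - τ * N) - E τ g q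
        E-upper = subst (0ℚ ≤_) eq (∑-nonneg λ j → +-mono-≤ (0≤* (0≤part (ψ j)) (<⇒≤ (high j))) (0≤* (0≤part (- ψ j)) (<⇒≤ (low j))))
          where
          x = excess τ g q
          eq : ∑ (λ j → p j * ((1ℚ + 1ℚ) * τ - x j) + m j * (x j - τ)) ≡ ((1ℚ + 1ℚ) * τ * P - τ * N) - E τ g q
          eq = begin
            ∑ (λ j → p j * ((1ℚ + 1ℚ) * τ - x j) + m j * (x j - τ))
              ≡⟨ ∑-cong (λ j → trans (lemma (p j) (m j) (x j) τ) (cong (λ z → - (z * x j) + (((1ℚ + 1ℚ) * τ) * p j + (- τ) * m j)) (sym (ψ-split j)))) ⟩
            ∑ (λ j → - (ψ j * x j) + (((1ℚ + 1ℚ) * τ) * p j + (- τ) * m j))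
              ≡⟨ trans (∑-+ (λ j → - (ψ j * x j)) (λ j → ((1ℚ + 1ℚ) * τ) * p j + (- τ) * m j)) (cong₂ _+_ (∑-neg (λ j → ψ j * x j))
                   (trans (∑-+ (λ j → ((1ℚ + 1ℚ) * τ) * p j) (λ j → (- τ) * m j)) (cong₂ _+_ (sym (*-∑ ((1ℚ + 1ℚ) * τ) p)) (sym (*-∑ (- τ) m))))) ⟩
            - E τ g q + (((1ℚ + 1ℚ) * τ) * P + (- τ) * N)
              ≡⟨ solve 4 (λ e t p n → :- e :+ ((con (1ℚ + 1ℚ) :* t) :* p :+ (:- t) :* n) := (con (1ℚ + 1ℚ) :* t :* p :- t :* n) :- e) refl (E τ g q) τ P N ⟩
            ((1ℚ + 1ℚ) * τ * P - τ * N) - E τ g q ∎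
            where
            open ≡-Reasoning
            lemma : ∀ p m x t → p * ((1ℚ + 1ℚ) * t - x) + m * (x - t) ≡ - ((p - m) * x) + (((1ℚ + 1ℚ) * t) * p + (- t) * m)
            lemma = solve 4 (λ p m x t → p :* (con (1ℚ + 1ℚ) :* t :- x) :+ m :* (x :- t) := :- ((p :- m) :* x) :+ ((con (1ℚ + 1ℚ) :* t) :* p :+ (:- t) :* m)) refl

      -- The two factors 8 are chosen as follows. Nonpositivity at `y j` gives B ψ_j ≤ 2 t_j N;
      -- summed over the positive ψ_j this yields B P ≤ 2 ρ T N, and B = 8 ρ T turns it into 4 P ≤
      -- N. At a point of scale τ ≥ 8 t_j the scaled value is at most 2 t_j N + 2 τ P - τ N, hence
      -- at most -τ N / 4.
      module Inner (T : ℚ) (B-def : B ≡ 8ℚ * (∑ {r} (λ _ → 1ℚ) * T)) (0<T : 0ℚ < T)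
        (t : Fin r → ℚ) (y : Fin r → Fin d → ℚ) (0<t : ∀ j → 0ℚ < t j) (t≤T : ∀ j → t j ≤ T)
        (boxes : ∀ j → InBox (t j) j (y j)) (nonpos : ∀ j → ⟨ φ , hom (y j) ⟩ ≤ 0ℚ) where

        0≤P : 0ℚ ≤ P
        0≤P = ∑-nonneg (λ j → 0≤part (ψ j))

        0≤N : 0ℚ ≤ N
        0≤N = ∑-nonneg (λ j → 0≤part (- ψ j))

        ψ-bound : ∀ j → 0ℚ ≤ (1ℚ + 1ℚ) * (t j * N) - B * ψ j
        ψ-bound j = subst (0ℚ ≤_) (lemma (B * ψ j) (E (t j) j (y j)) (t j) P N)
          (+-mono-≤ (+-mono-≤ (ℚ.neg-antimono-≤ value≤0) (E-lower (boxes j))) (0≤* (<⇒≤ (0<t j)) 0≤P))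
          where
          value≤0 : B * ψ j + E (t j) j (y j) ≤ 0ℚ
          value≤0 = subst₂ _≤_ (scaled-value (t j) j (y j)) (*-zeroʳ (weight (t j) j))
            (ℚ.*-monoˡ-≤-nonNeg (weight (t j) j) {{ℚ.nonNegative (<⇒≤ (0<weight j (0<t j)))}} (nonpos j))
          lemma : ∀ b e t p n → - (b + e) + (e - (t * p - (1ℚ + 1ℚ) * t * n)) + t * p ≡ (1ℚ + 1ℚ) * (t * n) - b
          lemma = solve 5 (λ b e t p n → :- (b :+ e) :+ (e :- (t :* p :- con (1ℚ + 1ℚ) :* t :* n)) :+ t :* p := con (1ℚ + 1ℚ) :* (t :* n) :- b) refl

        p-bound : ∀ j → 0ℚ ≤ (1ℚ + 1ℚ) * (T * N) - B * p j
        p-bound j = by (0ℚ <? ψ j)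
          where
          0≤2 : 0ℚ ≤ 1ℚ + 1ℚ
          0≤2 = ℚ.nonNegative⁻¹ (1ℚ + 1ℚ)
          by : Dec (0ℚ < ψ j) → 0ℚ ≤ (1ℚ + 1ℚ) * (T * N) - B * p j
          by (no 0≮ψ) = subst (λ z → 0ℚ ≤ (1ℚ + 1ℚ) * (T * N) - B * z) (sym (part-neg (ℚ.≮⇒≥ 0≮ψ)))
            (subst (0ℚ ≤_) (solve 2 (λ a b → a := a :- b :* con 0ℚ) refl ((1ℚ + 1ℚ) * (T * N)) B) (0≤* 0≤2 (0≤* (<⇒≤ 0<T) 0≤N)))
          by (yes 0<ψ) = subst (λ z → 0ℚ ≤ (1ℚ + 1ℚ) * (T * N) - B * z) (sym (part-pos 0<ψ))
            (subst (0ℚ ≤_) (solve 4 (λ t u n b → con (1ℚ + 1ℚ) :* ((u :- t) :* n) :+ (con (1ℚ + 1ℚ) :* (t :* n) :- b) := con (1ℚ + 1ℚ) :* (u :* n) :- b) refl (t j) T N (B * ψ j))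
              (+-mono-≤ (0≤* 0≤2 (0≤* (≤⇒0≤- (t≤T j)) 0≤N)) (ψ-bound j)))

        ρ : ℚ
        ρ = ∑ {r} (λ _ → 1ℚ)

        0<ρT : 0ℚ < ρ * T
        0<ρT = 0<* (∑-pos {r} (λ _ → <⇒≤ 0<1) zero 0<1) 0<T

        P-small : 0ℚ ≤ N - (1ℚ + 1ℚ) * ((1ℚ + 1ℚ) * P)
        P-small = ℚ.*-cancelˡ-≤-pos ((1ℚ + 1ℚ) * (ρ * T)) {{ℚ.positive (0<* (ℚ.positive⁻¹ (1ℚ + 1ℚ)) 0<ρT)}}
          (subst₂ _≤_ (sym (*-zeroʳ ((1ℚ + 1ℚ) * (ρ * T)))) eq (∑-nonneg p-bound))
          where
          eq : ∑ (λ j → (1ℚ + 1ℚ) * (T * N) - B * p j) ≡ (1ℚ + 1ℚ) * (ρ * T) * (N - (1ℚ + 1ℚ) * ((1ℚ + 1ℚ) * P))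
          eq = begin
            ∑ (λ j → (1ℚ + 1ℚ) * (T * N) - B * p j)
              ≡⟨ ∑-cong (λ j → solve 3 (λ a b p → a :- b :* p := a :* con 1ℚ :+ (:- b) :* p) refl ((1ℚ + 1ℚ) * (T * N)) B (p j)) ⟩
            ∑ (λ j → (1ℚ + 1ℚ) * (T * N) * 1ℚ + (- B) * p j)
              ≡⟨ trans (∑-+ (λ j → (1ℚ + 1ℚ) * (T * N) * 1ℚ) (λ j → (- B) * p j)) (cong₂ _+_ (sym (*-∑ {r} ((1ℚ + 1ℚ) * (T * N)) (λ _ → 1ℚ))) (sym (*-∑ (- B) p))) ⟩
            (1ℚ + 1ℚ) * (T * N) * ρ + (- B) * P
              ≡⟨ cong (λ z → (1ℚ + 1ℚ) * (T * N) * ρ + (- z) * P) B-def ⟩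
            (1ℚ + 1ℚ) * (T * N) * ρ + (- (8ℚ * (ρ * T))) * P
              ≡⟨ solve 4 (λ t n r p → con (1ℚ + 1ℚ) :* (t :* n) :* r :+ (:- (con 8ℚ :* (r :* t))) :* p := con (1ℚ + 1ℚ) :* (r :* t) :* (n :- con (1ℚ + 1ℚ) :* (con (1ℚ + 1ℚ) :* p))) refl T N ρ P ⟩
            (1ℚ + 1ℚ) * (ρ * T) * (N - (1ℚ + 1ℚ) * ((1ℚ + 1ℚ) * P)) ∎
            where open ≡-Reasoning

        N-zero⇒vanishes : N ≡ 0ℚ → ∀ q → ⟨ φ , hom q ⟩ ≡ 0ℚ
        N-zero⇒vanishes N≡0 q = trans (vertexValues-β φ q) (∑-zero λ j → trans (cong (_* β q j) (ψ≡0 j)) (*-zeroˡ (β q j)))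
          where
          each-zero : ∀ {k} {u : Fin k → ℚ} → (∀ j → 0ℚ ≤ u j) → ∑ u ≤ 0ℚ → ∀ j → u j ≡ 0ℚ
          each-zero {u = u} 0≤u ∑≤0 j = ℚ.≤-antisym (ℚ.≮⇒≥ λ 0<u → <-irrefl refl (<-≤-trans (∑-pos 0≤u j 0<u) ∑≤0)) (0≤u j)
          P≤0 : P ≤ 0ℚ
          P≤0 = ℚ.≮⇒≥ λ 0<P → <-irrefl refl (<-≤-trans (0<* (ℚ.positive⁻¹ (1ℚ + 1ℚ)) (0<* (ℚ.positive⁻¹ (1ℚ + 1ℚ)) 0<P))
            (subst ((1ℚ + 1ℚ) * ((1ℚ + 1ℚ) * P) ≤_) N≡0 (0≤-⇒≤ P-small)))
          ψ≡0 : ∀ j → ψ j ≡ 0ℚ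
          ψ≡0 j = trans (sym (part-difference (ψ j))) (cong₂ _-_ (each-zero (λ j → 0≤part (ψ j)) P≤0 j) (each-zero (λ j → 0≤part (- ψ j)) (≤-reflexive N≡0) j))

        inner : ∀ {τ j q z} → InBox τ j q → 8ℚ * t j ≤ τ → ⟨ φ , hom z ⟩ ≢ 0ℚ → ⟨ φ , hom q ⟩ < 0ℚ
        inner {τ} {j} {q} {z} box 8t≤τ nonzero = ℚ.*-cancelˡ-<-nonNeg (weight τ j) {{ℚ.nonNegative (<⇒≤ (0<weight j 0<τ))}}
          (subst₂ _<_ (sym (scaled-value τ j q)) (sym (*-zeroʳ (weight τ j))) (0<-⇒<0 is-negative))
          where
          0<τ : 0ℚ < τ
          0<τ = <-≤-trans (0<* (ℚ.positive⁻¹ 8ℚ) (0<t j)) 8t≤τ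
          0<N : 0ℚ < N
          0<N = ℚ.≰⇒> λ N≤0 → nonzero (N-zero⇒vanishes (ℚ.≤-antisym N≤0 0≤N) z)
          -- An identity: the negated value is τ N / 4 plus the slacks of `E-upper` and `ψ-bound`, a
          -- quarter of (τ - 8 t) N and half of τ (N - 4 P).
          is-negative : 0ℚ < - (B * ψ j + E τ j q)
          is-negative = subst (0ℚ <_) (lemma (B * ψ j) (E τ j q) τ (t j) P N)
            (+-mono-<-≤ (0<* (0<* (ℚ.positive⁻¹ (½ * ½)) 0<τ) 0<N)
              (+-mono-≤ (+-mono-≤ (E-upper box) (ψ-bound j))
                (+-mono-≤ (0≤* (ℚ.nonNegative⁻¹ (½ * ½)) (0≤* (≤⇒0≤- 8t≤τ) 0≤N)) (0≤* (ℚ.nonNegative⁻¹ ½) (0≤* (<⇒≤ 0<τ) P-small)))))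
            where
            lemma : ∀ b e τ t p n → ((½ * ½) * τ) * n + (((((1ℚ + 1ℚ) * τ * p - τ * n) - e) + ((1ℚ + 1ℚ) * (t * n) - b))
                + ((½ * ½) * ((τ - 8ℚ * t) * n) + ½ * (τ * (n - (1ℚ + 1ℚ) * ((1ℚ + 1ℚ) * p))))) ≡ - (b + e)
            lemma = solve 6 (λ b e τ t p n → (con (½ * ½) :* τ) :* n :+ ((((con (1ℚ + 1ℚ) :* τ :* p :- τ :* n) :- e) :+ (con (1ℚ + 1ℚ) :* (t :* n) :- b))
                :+ (con (½ * ½) :* ((τ :- con 8ℚ :* t) :* n) :+ con ½ :* (τ :* (n :- con (1ℚ + 1ℚ) :* (con (1ℚ + 1ℚ) :* p))))) := :- (b :+ e)) refl

  -- Rational points in general position.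

  Dual : ∀ {n d} → (Fin n → Fin d → ℚ) → Set
  Dual {n} {d} q = ∀ (τ : Fin n → Bool) → cnt τ ℕ.≤ suc d → ∀ t → τ t ≡ true →
    ∃ λ (g : Fin (suc d) → ℚ) → ⟨ g , hom (q t) ⟩ ≢ 0ℚ × ∀ i → τ i ≡ true → i ≢ t → ⟨ g , hom (q i) ⟩ ≡ 0ℚ

  hom-value : ∀ {d} (φ : Fin (suc d) → ℚ) x → φ zero + ⟨ x , φ ∘ suc ⟩ ≡ ⟨ φ , hom x ⟩
  hom-value φ x = cong₂ _+_ (sym (*-identityʳ (φ zero))) (⟨⟩-comm x (φ ∘ suc))

  Vanishing : ∀ {n d} → (Fin n → Fin d → ℚ) → (Fin n → Bool) → Set
  Vanishing {n} {d} q τ = ∃ λ (φ : Fin (suc d) → ℚ) → (∃ λ j → φ j ≢ 0ℚ) × ∀ i → τ i ≡ true → ⟨ φ , hom (q i) ⟩ ≡ 0ℚ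

  abstract
    vanishing : ∀ {n d} (q : Fin n → Fin d → ℚ) τ → cnt τ ℕ.≤ d → Vanishing q τ
    vanishing q τ le = let φ , nz , sol = kernel τ (hom ∘ q) (ℕ.s≤s le)
      in φ , nz , λ i i∈ → trans (⟨⟩-comm φ (hom (q i))) (sol i i∈)

  module _ {n d : ℕ} (q : Fin n → Fin d → ℚ) where

    -- A functional with zero linear part is constant, so it cannot vanish at c unless it is zero.
    nowhere-zero : ∀ (φ : Fin (suc d) → ℚ) → (∃ λ j → φ j ≢ 0ℚ) → ∀ c → φ zero + ⟨ c , φ ∘ suc ⟩ ≡ 0ℚ → ∃ λ x → φ (suc x) ≢ 0ℚ
    nowhere-zero φ (suc x , nz) c eq = x , nz
    nowhere-zero φ (zero , nz) c eq = by (Fin.any? (λ x → ¬? (φ (suc x) ≟ 0ℚ)))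
      where
      by : Dec (∃ λ x → φ (suc x) ≢ 0ℚ) → ∃ λ x → φ (suc x) ≢ 0ℚ
      by (yes found) = found
      by (no none) = contradiction (trans (sym (trans (cong (φ zero +_) (∑-zero λ x → trans (cong (c x *_) (all-zero x)) (*-zeroʳ (c x)))) (+-identityʳ (φ zero)))) eq) nz
        where
        all-zero : ∀ x → φ (suc x) ≡ 0ℚ
        all-zero x with φ (suc x) ≟ 0ℚ
        ... | yes p = p
        ... | no p = contradiction (x , p) none

    chosen : (s : Subset n) → Dec (cnt (lookup s) ℕ.≤ d) → ∃ λ (φ : Fin (suc d) → ℚ) → ∃ λ j → φ j ≢ 0ℚ
    chosen s (yes le) = let φ , nz , _ = vanishing q (lookup s) le in φ , nz
    -- For a larger set the constant functional 1, which every point avoids.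
    chosen s (no _) = unit zero , zero , λ eq → ℚ.1≢0 (trans (sym (unit-self {suc d} zero)) eq)

    -- One vanishing functional is fixed in advance for each set of at most d points, so x has only
    -- finitely many hyperplanes to avoid.
    avoiding : ∀ {P : (Fin d → ℚ) → Set} → Open P → ∀ c → P c →
      ∃ λ x → P x × ∀ τ → cnt τ ℕ.≤ d → ∃ λ (φ : Fin (suc d) → ℚ) → ⟨ φ , hom x ⟩ ≢ 0ℚ × ∀ i → τ i ≡ true → ⟨ φ , hom (q i) ⟩ ≡ 0ℚ
    avoiding P-open c p = finish (perturb P-open (λ s → φ s zero) (λ s → φ s ∘ suc) (λ s → nowhere-zero (φ s) (proj₂ (chosen s (dec s)))) (subsets n) c p)
      where
      dec : ∀ (s : Subset n) → Dec (cnt (lookup s) ℕ.≤ d)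
      dec s = cnt (lookup s) ℕ.≤? d
      φ : Subset n → Fin (suc d) → ℚ
      φ s = proj₁ (chosen s (dec s))
      vanishes : ∀ s (D : Dec (cnt (lookup s) ℕ.≤ d)) → cnt (lookup s) ℕ.≤ d → ∀ i → lookup s i ≡ true → ⟨ proj₁ (chosen s D) , hom (q i) ⟩ ≡ 0ℚ
      vanishes s (yes le) _ = proj₂ (proj₂ (vanishing q (lookup s) le))
      vanishes s (no ¬le) le = contradiction le ¬le
      finish : (∃ λ x → _ × ∀ s → s ∈ subsets n → φ s zero + ⟨ x , φ s ∘ suc ⟩ ≢ 0ℚ) → _
      finish (x , px , nz) = x , px , λ τ le → φ (tabulate τ)
        , (λ eq → nz (tabulate τ) (∈-subsets (tabulate τ)) (trans (hom-value (φ (tabulate τ)) x) eq))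
        , λ i i∈ → vanishes (tabulate τ) (dec (tabulate τ)) (subst (ℕ._≤ d) (sym (cnt-cong (Vec.lookup∘tabulate τ))) le) i (trans (Vec.lookup∘tabulate τ i) i∈)

  infixr 5 _◂_

  _◂_ : ∀ {n} {A : Set} → A → (Fin n → A) → Fin (suc n) → A
  (x ◂ q) zero = x
  (x ◂ q) (suc i) = q i

  -- An old functional g is made to vanish at x as ⟨φ, x⟩ g - ⟨g, x⟩ φ. Since φ vanishes at all old
  -- points of τ, the zeros of g among them remain and its value at t is only scaled by ⟨φ, x⟩.
  Dual-◂ : ∀ {n d} {x : Fin d → ℚ} {q : Fin n → Fin d → ℚ} → Dual q →
    (∀ τ → cnt τ ℕ.≤ d → ∃ λ (φ : Fin (suc d) → ℚ) → ⟨ φ , hom x ⟩ ≢ 0ℚ × ∀ i → τ i ≡ true → ⟨ φ , hom (q i) ⟩ ≡ 0ℚ) → Dual (x ◂ q)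
  Dual-◂ {n} {d} {x} {q} dual avoid τ le t t∈ = by (τ zero) refl t t∈
    where
    tail≤ : τ zero ≡ true → cnt (τ ∘ suc) ℕ.≤ d
    tail≤ eq = ℕ.≤-pred (subst (λ z → ⟦ z ⟧ ℕ.+ cnt (τ ∘ suc) ℕ.≤ suc d) eq le)
    by : ∀ z → τ zero ≡ z → ∀ t → τ t ≡ true →
      ∃ λ (g : Fin (suc d) → ℚ) → ⟨ g , hom ((x ◂ q) t) ⟩ ≢ 0ℚ × ∀ i → τ i ≡ true → i ≢ t → ⟨ g , hom ((x ◂ q) i) ⟩ ≡ 0ℚ
    by z eq zero t∈ = let φ , nz , van = avoid (τ ∘ suc) (tail≤ t∈)
      in φ , nz , λ { zero _ i≢t → contradiction refl i≢t ; (suc i) i∈ _ → van i i∈ }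
    by false eq (suc t) t∈ = let g , nz , van = dual (τ ∘ suc) (ℕ.≤-trans (ℕ.m≤n+m (cnt (τ ∘ suc)) ⟦ τ zero ⟧) le) t t∈
      in g , nz , λ { zero i∈ _ → contradiction (trans (sym eq) i∈) λ () ; (suc i) i∈ i≢t → van i i∈ (i≢t ∘ cong suc) }
    by true eq (suc t) t∈ = combine (dual (τ ∘ suc) (ℕ.≤-trans (tail≤ eq) (ℕ.n≤1+n d)) t t∈) (avoid (τ ∘ suc) (tail≤ eq))
      where
      combine : (∃ λ (g : Fin (suc d) → ℚ) → ⟨ g , hom (q t) ⟩ ≢ 0ℚ × ∀ i → τ (suc i) ≡ true → i ≢ t → ⟨ g , hom (q i) ⟩ ≡ 0ℚ) →
        (∃ λ (φ : Fin (suc d) → ℚ) → ⟨ φ , hom x ⟩ ≢ 0ℚ × ∀ i → τ (suc i) ≡ true → ⟨ φ , hom (q i) ⟩ ≡ 0ℚ) →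
        ∃ λ (g : Fin (suc d) → ℚ) → ⟨ g , hom (q t) ⟩ ≢ 0ℚ × ∀ i → τ i ≡ true → i ≢ suc t → ⟨ g , hom ((x ◂ q) i) ⟩ ≡ 0ℚ
      combine (g , nz , van) (φ , nz′ , van′) = g′
        , subst (_≢ 0ℚ) (sym (trans (⟨⟩-comb a b g φ (hom (q t))) (trans (cong (λ z → a * ⟨ g , hom (q t) ⟩ + b * z) (van′ t t∈))
            (trans (cong (a * ⟨ g , hom (q t) ⟩ +_) (*-zeroʳ b)) (+-identityʳ (a * ⟨ g , hom (q t) ⟩)))))) (*≢0 nz′ nz)
        , λ { zero _ _ → trans (⟨⟩-comb a b g φ (hom x)) (solve 2 (λ a b → a :* b :+ (:- b) :* a := con 0ℚ) refl ⟨ φ , hom x ⟩ ⟨ g , hom x ⟩)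
            ; (suc i) i∈ i≢t → trans (⟨⟩-comb a b g φ (hom (q i))) (trans (cong₂ (λ y z → a * y + b * z) (van i i∈ (i≢t ∘ cong suc)) (van′ i i∈))
                (solve 2 (λ a b → a :* con 0ℚ :+ b :* con 0ℚ := con 0ℚ) refl a b)) }
        where
        a b : ℚ
        a = ⟨ φ , hom x ⟩
        b = - ⟨ g , hom x ⟩
        g′ : Fin (suc d) → ℚ
        g′ c = a * g c + b * φ c

  general-points : ∀ {d} n (P : Fin n → (Fin d → ℚ) → Set) → (∀ i → Open (P i)) → (∀ i → ∃ (P i)) →
    ∃ λ (q : Fin n → Fin d → ℚ) → (∀ i → P i (q i)) × Dual q
  general-points zero P P-open start = (λ ()) , (λ ()) , λ _ _ ()
  general-points (suc n) P P-open start =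
    let q , Pq , dual = general-points n (P ∘ suc) (P-open ∘ suc) (start ∘ suc)
        c , p = start zero
        x , px , avoid = avoiding q (P-open zero) c p
    in (x ◂ q) , (λ { zero → px ; (suc i) → Pq i }) , Dual-◂ dual avoid

  image : ∀ {m n} → (Fin m → Fin n) → Fin n → Bool
  image ι i = does (Fin.any? (λ j → i Fin.≟ ι j))

  image-∈ : ∀ {m n} (ι : Fin m → Fin n) j → image ι (ι j) ≡ true
  image-∈ ι j = dec-true (Fin.any? (λ k → ι j Fin.≟ ι k)) (j , refl)

  cnt-image : ∀ {m n} (ι : Fin m → Fin n) → cnt (image ι) ℕ.≤ m
  cnt-image {m} {n} ι = begin
    cnt (image ι)                                              ≤⟨ sum-mono-≤ each ⟩
    sum (λ i → sum (λ j → ⟦ does (i Fin.≟ ι j) ⟧))             ≡⟨ ∑-comm (λ i j → ⟦ does (i Fin.≟ ι j) ⟧) ⟩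
    sum (λ j → sum (λ i → ⟦ does (i Fin.≟ ι j) ⟧))             ≡⟨ sum-one (λ j → cnt-≟ (ι j)) ⟩
    m                                                          ∎
    where
    open ℕ.≤-Reasoning
    at-least : ∀ {k} (b : Fin k → Bool) j → b j ≡ true → 1 ℕ.≤ sum (λ j → ⟦ b j ⟧)
    at-least b zero eq = subst (λ z → 1 ℕ.≤ ⟦ z ⟧ ℕ.+ cnt (b ∘ suc)) (sym eq) (ℕ.s≤s ℕ.z≤n)
    at-least b (suc j) eq = ℕ.≤-trans (at-least (b ∘ suc) j eq) (ℕ.m≤n+m (cnt (b ∘ suc)) ⟦ b zero ⟧)
    each : ∀ i → ⟦ image ι i ⟧ ℕ.≤ sum (λ j → ⟦ does (i Fin.≟ ι j) ⟧)
    each i = go (Fin.any? (λ j → i Fin.≟ ι j))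
      where
      go : (D : Dec (∃ λ j → i ≡ ι j)) → ⟦ does D ⟧ ℕ.≤ sum (λ j → ⟦ does (i Fin.≟ ι j) ⟧)
      go (no _) = ℕ.z≤n
      go (yes (j , eq)) = at-least (λ j → does (i Fin.≟ ι j)) j (dec-true (i Fin.≟ ι j) eq)

  module _ {n d : ℕ} (q : Fin n → Fin d → ℚ) (dual : Dual q) where

    realPoint : Fin n → Point d
    realPoint i c = const (q i c)

    -- Paired with the combination, the functional g for `ι j₀` sees only the weight of j₀. Its
    -- constant part meets the total weight, which is null, so its linear part must meet a
    -- coordinate apart from zero.
    dual⇒independent : ∀ {m} → m ℕ.≤ suc d → (ι : Fin m → Fin n) → (∀ {i j} → ι i ≡ ι j → i ≡ j) → AffinelyIndependent (realPoint ∘ ι)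
    dual⇒independent {m} m≤ ι inj w total (j₀ , w#0) = separated (dual (image ι) (ℕ.≤-trans (cnt-image ι) m≤) (ι j₀) (image-∈ ι j₀))
      where
      W : Fin m → Seq
      W j = seq (w j)
      comb : Fin d → ℝ
      comb c = ℝ.combination w (realPoint ∘ ι) c
      comb-seq : ∀ c t → seq (comb c) t ≡ ∑ (λ j → W j t * q (ι j) c)
      comb-seq c t = seq-sum (λ j → w j ℝ.* const (q (ι j) c)) t
      separated : (∃ λ (g : Fin (suc d) → ℚ) → ⟨ g , hom (q (ι j₀)) ⟩ ≢ 0ℚ × ∀ i → image ι i ≡ true → i ≢ ι j₀ → ⟨ g , hom (q i) ⟩ ≡ 0ℚ) →
        comb ℝ.#ₚ ℝ.origin
      separated (g , nz , van) = c , Apart⇒#0 {comb c} (Apart-factor {seq (comb c)} {λ _ → g (suc c)} (isCauchy (comb c)) (bounded (const (g (suc c)))) (proj₂ found))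
        where
        G : ℚ
        G = ⟨ g , hom (q (ι j₀)) ⟩
        terms : Seq
        terms t = ∑ (λ c → seq (comb c) t * g (suc c))
        pairing : ∀ t → W j₀ t * G ≡ g zero * ∑ (λ j → W j t) + terms t
        pairing t = begin
          W j₀ t * G
            ≡⟨ ∑-single j₀ (λ j j≢j₀ → trans (cong (W j t *_) (van (ι j) (image-∈ ι j) (j≢j₀ ∘ inj))) (*-zeroʳ (W j t))) ⟨
          ∑ (λ j → W j t * ⟨ g , hom (q (ι j)) ⟩)
            ≡⟨ ∑-cong (λ j → expand (W j t) (ι j)) ⟩
          ∑ (λ j → g zero * W j t + ∑ (λ c → W j t * q (ι j) c * g (suc c)))
            ≡⟨ ∑-+ (λ j → g zero * W j t) (λ j → ∑ (λ c → W j t * q (ι j) c * g (suc c))) ⟩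
          ∑ (λ j → g zero * W j t) + ∑ (λ j → ∑ (λ c → W j t * q (ι j) c * g (suc c)))
            ≡⟨ cong₂ _+_ (sym (*-∑ (g zero) (λ j → W j t))) (trans (∑-swap (λ j c → W j t * q (ι j) c * g (suc c)))
                 (∑-cong λ c → trans (sym (∑-* (g (suc c)) (λ j → W j t * q (ι j) c))) (cong (_* g (suc c)) (sym (comb-seq c t))))) ⟩
          g zero * ∑ (λ j → W j t) + terms t ∎
          where
          open ≡-Reasoning
          expand : ∀ w i → w * ⟨ g , hom (q i) ⟩ ≡ g zero * w + ∑ (λ c → w * q i c * g (suc c))
          expand w i = trans (solve 3 (λ w a r → w :* (a :* con 1ℚ :+ r) := a :* w :+ w :* r) refl w (g zero) (∑ (λ c → g (suc c) * q i c)))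
            (cong (g zero * w +_) (trans (*-∑ w (λ c → g (suc c) * q i c)) (∑-cong λ c → solve 3 (λ w a b → w :* (a :* b) := w :* b :* a) refl w (g (suc c)) (q i c))))
        near : Null (λ t → W j₀ t * G - terms t)
        near = Null-ext (λ t → sym (trans (cong (_- terms t) (pairing t))
            (trans (solve 2 (λ a b → (a :+ b) :- b := a) refl (g zero * ∑ (λ j → W j t)) (terms t)) (cong (g zero *_) (sym (trans (solve 1 (λ x → x :- con 0ℚ := x) refl (seq (ℝ.sum w) t)) (seq-sum w t)))))))
          (Null-* { λ _ → g zero } { λ t → seq (ℝ.sum w) t - 0ℚ } (bounded (const (g zero))) total)
        termℝ : Fin d → ℝ
        termℝ c = comb c ℝ.* const (g (suc c))
        found : ∃ λ c → Apart (seq (termℝ c))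
        found = Apart-∑ (λ c → seq (termℝ c)) (λ c → isCauchy (termℝ c))
          (Apart-transport { λ t → W j₀ t * G } {terms} near (Apart-* {W j₀} { λ _ → G } (#0⇒Apart {w j₀} w#0) (const-apart nz)))
        c = proj₁ found

  module _ {n d : ℕ} (q : Fin n → Fin (suc d) → ℚ) (dual : Dual q) where

    realPoints : PointSet n (suc d)
    realPoints = record
      { point = realPoint q dual
      ; distinct = λ {i} {j} i≢j → distinct i≢j
      }
      where
      module _ {i j : Fin n} (i≢j : i ≢ j) where
        ι : Fin 2 → Fin n
        ι zero = i
        ι (suc zero) = j
        ι-inj : ∀ {a b} → ι a ≡ ι b → a ≡ b
        ι-inj {zero} {zero} _ = refl
        ι-inj {zero} {suc zero} eq = contradiction eq i≢j
        ι-inj {suc zero} {zero} eq = contradiction (sym eq) i≢j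
        ι-inj {suc zero} {suc zero} _ = refl
        -- With weights 1 and -1 affine independence of two points says that they are apart.
        w : Fin 2 → ℝ
        w zero = const 1ℚ
        w (suc zero) = const (- 1ℚ)
        total : ℝ.sum w ℝ.≈ ℝ.0ℝ
        total = Null-zero λ _ → refl
        distinct : realPoint q dual i ℝ.#ₚ realPoint q dual j
        distinct = conclude (dual⇒independent q dual (ℕ.s≤s (ℕ.s≤s ℕ.z≤n)) ι ι-inj w total (zero , Apart⇒#0 {const 1ℚ} (const-apart ℚ.1≢0)))
          where
          conclude : ℝ.combination w (realPoint q dual ∘ ι) ℝ.#ₚ ℝ.origin → realPoint q dual i ℝ.#ₚ realPoint q dual j
          conclude (c , ap) = c , difference (#0⇒Apart {ℝ.combination w (realPoint q dual ∘ ι) c} ap)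
            where
            eq : ∀ (t : ℕ) → 1ℚ * q i c + (- 1ℚ * q j c + 0ℚ) ≡ q i c - q j c
            eq _ = solve 2 (λ x y → con 1ℚ :* x :+ (con (- 1ℚ) :* y :+ con 0ℚ) := x :- y) refl (q i c) (q j c)
            difference : Apart (λ _ → 1ℚ * q i c + (- 1ℚ * q j c + 0ℚ)) → const (q i c) ℝ.# const (q j c)
            difference (inj₁ p) = inj₂ (Pos⇒< {const (q j c)} {const (q i c)} (Pos-ext eq p))
            difference (inj₂ p) = inj₁ (Pos⇒< {const (q i c)} {const (q j c)} (Pos-ext (λ t → trans (cong -_ (eq t)) (solve 2 (λ x y → :- (x :- y) := y :- x) refl (q i c) (q j c))) p))

    realPoints-general : GeneralPosition realPoints
    realPoints-general m≤ ι inj = dual⇒independent q dual m≤ ι inj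

  -- The tight example.

  least : ∀ {n} (b : Fin n → Bool) → (∃ λ i → b i ≡ true) → ∃ λ i → b i ≡ true × ∀ j → j Fin.< i → b j ≡ false
  least {suc n} b (i , bi) = by (b zero) refl
    where
    shift : ∀ i → b i ≡ true → b zero ≡ false → ∃ λ i → b (suc i) ≡ true
    shift zero bi b₀ = contradiction (trans (sym bi) b₀) λ ()
    shift (suc i) bi _ = i , bi
    by : ∀ z → b zero ≡ z → ∃ λ i → b i ≡ true × ∀ j → j Fin.< i → b j ≡ false
    by true b₀ = zero , b₀ , λ _ ()
    by false b₀ = let m , bm , below = least (b ∘ suc) (shift i bi b₀)
      in suc m , bm , λ { zero _ → b₀ ; (suc j) (ℕ.s≤s lt) → below j lt }

  module Tight (d n k : ℕ) (large : suc k ℕ.* suc (suc d) ℕ.≤ n) where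

    r : ℕ
    r = suc (suc d)

    -- The points are dealt to the r vertices in turn, and `member j t` is the t-th point of group
    -- j; since n is at least (k + 1) r, every group has k + 1 members.
    group : Fin n → Fin r
    group i = Fin.fromℕ< (m%n<n (Fin.toℕ i) r)

    member : Fin r → Fin (suc k) → Fin n
    member j t = Fin.fromℕ< {Fin.toℕ j ℕ.+ Fin.toℕ t ℕ.* r} (ℕ.≤-trans (ℕ.+-monoˡ-≤ (Fin.toℕ t ℕ.* r) (Fin.toℕ<n j))
      (ℕ.≤-trans (ℕ.*-monoˡ-≤ r (Fin.toℕ<n t)) large))

    toℕ-member : ∀ j t → Fin.toℕ (member j t) ≡ Fin.toℕ j ℕ.+ Fin.toℕ t ℕ.* r
    toℕ-member j t = Fin.toℕ-fromℕ< (ℕ.≤-trans (ℕ.+-monoˡ-≤ (Fin.toℕ t ℕ.* r) (Fin.toℕ<n j))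
      (ℕ.≤-trans (ℕ.*-monoˡ-≤ r (Fin.toℕ<n t)) large))

    group-member : ∀ j t → group (member j t) ≡ j
    group-member j t = Fin.toℕ-injective (begin
      Fin.toℕ (group (member j t))               ≡⟨ Fin.toℕ-fromℕ< (m%n<n (Fin.toℕ (member j t)) r) ⟩
      Fin.toℕ (member j t) % r                   ≡⟨ cong (_% r) (toℕ-member j t) ⟩
      (Fin.toℕ j ℕ.+ Fin.toℕ t ℕ.* r) % r        ≡⟨ [m+kn]%n≡m%n (Fin.toℕ j) (Fin.toℕ t) r ⟩
      Fin.toℕ j % r                              ≡⟨ m<n⇒m%n≡m (Fin.toℕ<n j) ⟩
      Fin.toℕ j                                  ∎)
      where open ≡-Reasoning

    member-injective : ∀ j {s t} → member j s ≡ member j t → s ≡ t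
    member-injective j {s} {t} eq = Fin.toℕ-injective (ℕ.*-cancelʳ-≡ _ _ r (ℕ.+-cancelˡ-≡ (Fin.toℕ j) _ _
      (trans (sym (toℕ-member j s)) (trans (cong Fin.toℕ eq) (toℕ-member j t)))))

    -- At most k points are missing from R, too few for all of the k + 1 listed members of a group.
    group-hit : ∀ R → n ℕ.≤ cnt R ℕ.+ k → ∀ j → ∃ λ i → R i ≡ true × group i ≡ j
    group-hit R many j = by (Fin.any? (λ t → R (member j t) Bool.≟ true))
      where
      by : Dec (∃ λ t → R (member j t) ≡ true) → ∃ λ i → R i ≡ true × group i ≡ j
      by (yes (t , hit)) = member j t , hit , group-member j t
      by (no none) = collide (enumerate (not ∘ R) refl)
        where
        few : cnt (not ∘ R) ℕ.< suc k
        few = ℕ.s≤s (ℕ.+-cancelʳ-≤ (cnt R) _ _ (subst (ℕ._≤ k ℕ.+ cnt R) (sym (cnt-not R)) (subst (n ℕ.≤_) (ℕ.+-comm (cnt R) k) many)))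
        collide : _ → ∃ λ i → R i ≡ true × group i ≡ j
        collide (ι , _ , _ , complete) = contradiction (Fin.pigeonhole few place) λ (s , t , s<t , eq) →
          Fin.<⇒≢ s<t (member-injective j (trans (sym (proj₂ (found s))) (trans (cong ι eq) (proj₂ (found t)))))
          where
          found : ∀ t → ∃ λ i → ι i ≡ member j t
          found t = complete (member j t) (cong not (Bool.¬-not λ hit → none (t , hit)))
          place : Fin (suc k) → Fin (cnt (not ∘ R))
          place t = proj₁ (found t)

    top ρ B : ℚ
    top = pow n
    ρ = ∑ {r} (λ _ → 1ℚ)
    B = 8ℚ * (ρ * top)

    0<B : 0ℚ < B
    0<B = 0<* (ℚ.positive⁻¹ 8ℚ) (0<* (∑-pos {r} (λ _ → <⇒≤ 0<1) zero 0<1) (0<pow n))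

    open Boxes (suc d) B 0<B using (InBox; InBox-open; centre; centre-in; module Inner)

    -- A smaller index is farther out in its group, and the scale of every later point is at least 8
    -- times as large, the gap that `Inner` asks for.
    τ : Fin n → ℚ
    τ i = pow (Fin.toℕ i)

    abstract
      points : ∃ λ (q : Fin n → Fin (suc d) → ℚ) → (∀ i → InBox (τ i) (group i) (q i)) × Dual q
      points = general-points n (λ i → InBox (τ i) (group i)) (λ i → InBox-open (τ i) (group i))
        (λ i → centre (τ i) (group i) , centre-in (group i) (0<pow (Fin.toℕ i)))

    q : Fin n → Fin (suc d) → ℚ
    q = proj₁ points

    q-box : ∀ i → InBox (τ i) (group i) (q i)
    q-box = proj₁ (proj₂ points)

    S : PointSet n (suc d)
    S = realPoints q (proj₂ (proj₂ points))

    S-general : GeneralPosition S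
    S-general = realPoints-general q (proj₂ (proj₂ points))

    r≤n : r ℕ.≤ n
    r≤n = ℕ.≤-trans (ℕ.m≤m+n r (k ℕ.* r)) large

    C : Config (suc d) n
    C = Rational.config S S-general r≤n

    open ConfigProperties C

    as-functional : ∀ {w} → W w → ∃ λ (φ : Fin r → ℚ) → ∀ i → w i ≡ ⟨ φ , hom (q i) ⟩
    as-functional (φ , eq) = φ , λ i → trans (eq i) (⟨⟩-congʳ φ (q̂≡ i))
      where
      q̂≡ : ∀ i c → Rational.q̂ S S-general r≤n i c ≡ hom (q i) c
      q̂≡ i zero = refl
      q̂≡ i (suc c) = refl

    signed-functional : ∀ b {σ} → cnt (lookup σ) ≡ suc d → ∃ λ (φ : Fin r → ℚ) → ∀ i → signed b (f σ i) ≡ ⟨ φ , hom (q i) ⟩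
    signed-functional b {σ} size = let φ , eq = as-functional (f∈W {σ} size)
      in signed b ∘ φ , λ i → trans (cong (signed b) (eq i)) (sym (signed-dot b φ (hom (q i))))

    signed-≢0 : ∀ b {x} → x ≢ 0ℚ → signed b x ≢ 0ℚ
    signed-≢0 true x≢0 = x≢0
    signed-≢0 false {x} x≢0 eq = x≢0 (trans (solve 1 (λ x → x := :- (:- x)) refl x) (cong -_ eq))

    module Within (R : Fin n → Bool) (many : n ℕ.≤ cnt R ℕ.+ k) where

      outermost : ∀ j → ∃ λ i → R i ∧ does (group i Fin.≟ j) ≡ true × ∀ i′ → i′ Fin.< i → R i′ ∧ does (group i′ Fin.≟ j) ≡ false
      outermost j = least (λ i → R i ∧ does (group i Fin.≟ j)) (let i , Ri , gi = group-hit R many j in i , ∧-true Ri (dec-true (group i Fin.≟ j) gi))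

      y : Fin r → Fin n
      y j = proj₁ (outermost j)

      y∈R : ∀ j → R (y j) ≡ true
      y∈R j = ∧-trueˡ (proj₁ (proj₂ (outermost j)))

      group-y : ∀ j → group (y j) ≡ j
      group-y j = does-true (group (y j) Fin.≟ j) (∧-trueʳ {R (y j)} (proj₁ (proj₂ (outermost j))))

      Y : Fin n → Bool
      Y i = does (y (group i) Fin.≟ i)

      y∈Y : ∀ j → Y (y j) ≡ true
      y∈Y j = dec-true (y (group (y j)) Fin.≟ y j) (cong y (group-y j))

      Y⇒y : ∀ i → Y i ≡ true → y (group i) ≡ i
      Y⇒y i = does-true (y (group i) Fin.≟ i)

      y-injective : ∀ {j j′} → y j ≡ y j′ → j ≡ j′
      y-injective {j} {j′} eq = trans (sym (group-y j)) (trans (cong group eq) (group-y j′))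

      size-Y : cnt Y ≡ r
      size-Y = begin
        cnt Y                                                 ≡⟨ sum-cong-≗ each ⟩
        sum (λ i → sum (λ j → ⟦ does (i Fin.≟ y j) ⟧))        ≡⟨ ∑-comm (λ i j → ⟦ does (i Fin.≟ y j) ⟧) ⟩
        sum (λ j → sum (λ i → ⟦ does (i Fin.≟ y j) ⟧))        ≡⟨ sum-one (λ j → cnt-≟ (y j)) ⟩
        r                                                     ∎
        where
        open ≡-Reasoning
        each : ∀ i → ⟦ Y i ⟧ ≡ sum (λ j → ⟦ does (i Fin.≟ y j) ⟧)
        each i = by (y (group i) Fin.≟ i)
          where
          by : (D : Dec (y (group i) ≡ i)) → ⟦ does D ⟧ ≡ sum (λ j → ⟦ does (i Fin.≟ y j) ⟧)
          by (yes eq) = sym (trans (cnt-cong same) (cnt-≟ (group i)))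
            where
            same : ∀ j → does (i Fin.≟ y j) ≡ does (j Fin.≟ group i)
            same j = go (j Fin.≟ group i)
              where
              go : (D : Dec (j ≡ group i)) → does (i Fin.≟ y j) ≡ does D
              go (yes refl) = dec-true (i Fin.≟ y (group i)) (sym eq)
              go (no j≢) = dec-false (i Fin.≟ y j) λ i≡yj → j≢ (trans (sym (group-y j)) (cong group (sym i≡yj)))
          by (no ¬eq) = sym (cnt-none λ j → dec-false (i Fin.≟ y j) λ i≡yj → ¬eq (trans (cong y (trans (cong group i≡yj) (group-y j))) (sym i≡yj)))

      -- The points of Y are the vertices of the convex hull of R, which is a simplex.
      inside : ∀ (φ : Fin r → ℚ) → (∀ j → ⟨ φ , hom (q (y j)) ⟩ ≤ 0ℚ) → (∃ λ i → ⟨ φ , hom (q i) ⟩ ≢ 0ℚ) →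
        ∀ i → R i ≡ true → Y i ≡ false → ⟨ φ , hom (q i) ⟩ < 0ℚ
      inside φ nonpos (z , nz) i i∈R i∉Y = I.inner {τ i} {group i} {q i} {q z} (q-box i) (pow-mono later) nz
        where
        module I = Inner φ top refl (0<pow n) (τ ∘ y) (q ∘ y) (λ j → 0<pow (Fin.toℕ (y j))) (λ j → pow-mono (ℕ.<⇒≤ (Fin.toℕ<n (y j))))
          (λ j → subst (λ g → InBox (τ (y j)) g (q (y j))) (group-y j) (q-box (y j))) nonpos
        later : suc (Fin.toℕ (y (group i))) ℕ.≤ Fin.toℕ i
        later = ℕ.≤∧≢⇒< (ℕ.≮⇒≥ λ i<y → contradiction (trans (sym (∧-true i∈R (dec-true (group i Fin.≟ group i) refl))) (proj₂ (proj₂ (outermost (group i))) i i<y)) λ ())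
          λ eq → contradiction (trans (sym (dec-true (y (group i) Fin.≟ i) (Fin.toℕ-injective eq))) i∉Y) λ ()

      simplexFace : Fin r → Subset n
      simplexFace j = tabulate (Y ∖ y j)

      lookup-face : ∀ j i → lookup (simplexFace j) i ≡ (Y ∖ y j) i
      lookup-face j = Vec.lookup∘tabulate (Y ∖ y j)

      size-simplexFace : ∀ j → cnt (lookup (simplexFace j)) ≡ suc d
      size-simplexFace j = trans (cnt-cong (lookup-face j)) (ℕ.suc-injective (trans (ℕ.+-comm 1 _)
        (trans (cong (λ z → cnt (Y ∖ y j) ℕ.+ ⟦ z ⟧) (sym (y∈Y j))) (trans (cnt-∖ Y (y j)) size-Y))))

      y∉simplexFace : ∀ j → lookup (simplexFace j) (y j) ≡ false
      y∉simplexFace j = trans (lookup-face j (y j)) (∖-self Y (y j))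

      outward : Fin r → Bool
      outward j = not (positive? (f (simplexFace j) (y j)))

      hullFacet : Fin r → Subset (suc n)
      hullFacet j = outward j Vec.∷ simplexFace j

      hullFacet-injective : ∀ {j j′} → hullFacet j ≡ hullFacet j′ → j ≡ j′
      hullFacet-injective {j} {j′} eq = by (j Fin.≟ j′)
        where
        by : Dec (j ≡ j′) → j ≡ j′
        by (yes e) = e
        by (no j≢j′) = contradiction
          (trans (sym (trans (lookup-face j′ (y j)) (trans (∖-other Y (y j′) (y j) (j≢j′ ∘ y-injective)) (y∈Y j))))
            (trans (cong (λ v → lookup (Vec.tail v) (y j)) (sym eq)) (y∉simplexFace j))) λ ()

      outward-negative : ∀ {x} → x ≢ 0ℚ → signed (not (positive? x)) x < 0ℚ
      outward-negative {x} x≢0 with ≢0⇒sign x≢0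
      ... | inj₁ x<0 = subst (λ z → signed (not z) x < 0ℚ) (sym (≤0⇒nonpositive (<⇒≤ x<0))) x<0
      ... | inj₂ 0<x = subst (λ z → signed (not z) x < 0ℚ) (sym (0<⇒positive 0<x)) (ℚ.neg-antimono-< 0<x)

      -- The functional is zero at all `y j′` except `y j`, where the orientation makes it negative;
      -- `inside` carries the sign over to the rest of R.
      hullFacet-nonpositive : ∀ j i → R i ≡ true → side f (hullFacet j) i ≡ false
      hullFacet-nonpositive j i i∈R = ≤0⇒nonpositive (subst (_≤ 0ℚ) (sym (eq i)) (by (Y i) refl))
        where
        σ = simplexFace j
        b = outward j
        φ = proj₁ (signed-functional b {σ} (size-simplexFace j))
        eq = proj₂ (signed-functional b {σ} (size-simplexFace j))
        y-value : f σ (y j) ≢ 0ℚ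
        y-value = f-off (size-simplexFace j) (y j) (y∉simplexFace j)
        on-y : ∀ j′ → ⟨ φ , hom (q (y j′)) ⟩ ≤ 0ℚ
        on-y j′ = subst (_≤ 0ℚ) (eq (y j′)) (at (j′ Fin.≟ j))
          where
          at : Dec (j′ ≡ j) → signed b (f σ (y j′)) ≤ 0ℚ
          at (yes e) = subst (λ z → signed b (f σ (y z)) ≤ 0ℚ) (sym e) (<⇒≤ (outward-negative y-value))
          at (no j′≢j) = ≤-reflexive (signed-zero b (f-on (size-simplexFace j) (y j′)
            (trans (lookup-face j (y j′)) (trans (∖-other Y (y j) (y j′) (j′≢j ∘ y-injective)) (y∈Y j′)))))
        by : ∀ z → Y i ≡ z → ⟨ φ , hom (q i) ⟩ ≤ 0ℚ
        by true i∈Y = subst (λ z → ⟨ φ , hom (q z) ⟩ ≤ 0ℚ) (Y⇒y i i∈Y) (on-y (group i))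
        by false i∉Y = <⇒≤ (inside φ on-y (y j , λ e → signed-≢0 b y-value (trans (eq (y j)) e)) i i∈R i∉Y)

      -- A functional that is nonpositive on R is strictly negative at the points off Y, so σ lies
      -- in Y. It misses a single element t of Y, and the sign at t fixes the orientation.
      hullFacet-complete : ∀ b σ → cnt (lookup σ) ≡ suc d → (∀ i → lookup σ i ≡ true → R i ≡ true) →
        (∀ i → R i ≡ true → side f (b Vec.∷ σ) i ≡ false) → ∃ λ j → b Vec.∷ σ ≡ hullFacet j
      hullFacet-complete b σ size σ⊆R nonpos = group t , cong₂ Vec._∷_ b≡ σ≡
        where
        φ = proj₁ (signed-functional b {σ} size)
        eq = proj₂ (signed-functional b {σ} size)
        on-R : ∀ i → R i ≡ true → signed b (f σ i) ≤ 0ℚ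
        on-R i i∈R = nonpositive⇒≤0 (nonpos i i∈R)
        t-exists : ∃ λ i → lookup σ i ≡ false × Y i ≡ true
        t-exists = cnt<⇒∃ {b = lookup σ} {c = Y} (ℕ.≤-reflexive (trans (cong suc size) (sym size-Y)))
        t = proj₁ t-exists
        t∉σ = proj₁ (proj₂ t-exists)
        t∈Y = proj₂ (proj₂ t-exists)
        y-t : y (group t) ≡ t
        y-t = Y⇒y t t∈Y
        t-value : f σ t ≢ 0ℚ
        t-value = f-off size t t∉σ
        σ⊆Y : ∀ i → lookup σ i ≡ true → Y i ≡ true
        σ⊆Y i i∈σ = Bool.¬-not λ i∉Y → <-irrefl (trans (sym (eq i)) (signed-zero b (f-on size i i∈σ)))
          (inside φ (λ j → subst (_≤ 0ℚ) (eq (y j)) (on-R (y j) (y∈R j))) (t , λ e → signed-≢0 b t-value (trans (eq t) e)) i (σ⊆R i i∈σ) i∉Y)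
        σ≡ : σ ≡ simplexFace (group t)
        σ≡ = lookup-injective λ i → trans (cnt-⊆-≡ {b = lookup σ} {c = Y ∖ y (group t)} sub
            (trans size (trans (sym (size-simplexFace (group t))) (cnt-cong (lookup-face (group t))))) i) (sym (lookup-face (group t) i))
          where
          sub : ∀ i → lookup σ i ≡ true → (Y ∖ y (group t)) i ≡ true
          sub i i∈σ = trans (∖-other Y (y (group t)) i λ i≡ → contradiction (trans (sym i∈σ) (trans (cong (lookup σ) (trans i≡ y-t)) t∉σ)) λ ()) (σ⊆Y i i∈σ)
        t∈R : R t ≡ true
        t∈R = trans (cong R (sym y-t)) (y∈R (group t))
        b≡ : b ≡ outward (group t)
        b≡ = trans (by b (on-R t t∈R)) (cong not (cong positive? (cong₂ f σ≡ (sym y-t))))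
          where
          by : ∀ b → signed b (f σ t) ≤ 0ℚ → b ≡ not (positive? (f σ t))
          by true le = cong not (sym (≤0⇒nonpositive le))
          by false le = cong not (sym (0<⇒positive (≮0∧≢0⇒0< (λ lt → <-irrefl refl (<-≤-trans (<0⇒0<- lt) le)) t-value)))

    sized : Subset (suc n) → Bool
    sized ι = cnt (lookup (Vec.tail ι)) ℕ.≡ᵇ suc d

    side-disjoint : ∀ ι → sized ι ≡ true → ∀ i → lookup (Vec.tail ι) i ≡ true → side f ι i ≡ false
    side-disjoint (b Vec.∷ σ) size i i∈σ = ≤0⇒nonpositive (≤-reflexive (signed-zero b (f-on {σ} (≡ᵇ⇒≡ size) i i∈σ)))

    open Thinning {suc n} {n} d sized (λ ι → lookup (Vec.tail ι)) (side f) (λ ι → ≡ᵇ⇒≡) side-disjoint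

    simplex-hull : ∀ R → n ℕ.≤ cnt R ℕ.+ k → level R 0 ≡ r
    simplex-hull R many = ∑ₛ-enum (at R 0) hullFacet hullFacet-injective sound complete
      where
      open Within R many
      sound : ∀ j → at R 0 (hullFacet j) ≡ true
      sound j = ∧-true (≡⇒≡ᵇ (size-simplexFace j)) (∧-true
        (≡⇒≡ᵇ (cnt-none λ i → Bool.¬-not λ eq → contradiction
          (trans (sym (in-R i (trans (sym (lookup-face j i)) (∧-trueˡ eq)))) (not-true (∧-trueʳ {lookup (simplexFace j) i} eq))) λ ()))
        (≡⇒≡ᵇ (cnt-none λ i → Bool.¬-not λ eq → contradiction
          (trans (sym (∧-trueˡ eq)) (hullFacet-nonpositive j i (∧-trueʳ {side f (hullFacet j) i} eq))) λ ())))
        where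
        not-true : ∀ {b} → not b ≡ true → b ≡ false
        not-true {false} _ = refl
        in-R : ∀ i → (Y ∖ y j) i ≡ true → R i ≡ true
        in-R i i∈ = trans (cong R (sym (Y⇒y i (∖-⊆ Y (y j) i i∈)))) (y∈R (group i))
      complete : ∀ ι → at R 0 ι ≡ true → ∃ λ j → ι ≡ hullFacet j
      complete (b Vec.∷ σ) eq = hullFacet-complete b σ (≡ᵇ⇒≡ (∧-trueˡ eq))
        (λ i i∈σ → Bool.¬-not λ i∉R → contradiction (trans (sym (cnt≡0 miss i)) (cong₂ (λ x y → x ∧ not y) i∈σ i∉R)) λ ())
        (λ i i∈R → Bool.¬-not λ up → contradiction (trans (sym (cnt≡0 viol i)) (cong₂ _∧_ up i∈R)) λ ())
        where
        ι = b Vec.∷ σ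
        miss : missing R ι ≡ 0
        miss = ≡ᵇ⇒≡ (∧-trueˡ {missing R ι ℕ.≡ᵇ 0} (∧-trueʳ {sized ι} eq))
        viol : violated R ι ≡ 0
        viol = ≡ᵇ⇒≡ (∧-trueʳ {missing R ι ℕ.≡ᵇ 0} (∧-trueʳ {sized ι} eq))

    facetCount-tight : ∀ j → j ℕ.≤ k → facetCount (suc d) f j ≡ r ℕ.* binom j d
    facetCount-tight j j≤k = trans (∑ₛ-cong each) (level-value r k simplex-hull j full (subst (λ z → n ℕ.+ j ℕ.≤ z ℕ.+ k) (sym (cnt-all {n} λ _ → refl)) (ℕ.+-monoʳ-≤ n j≤k)))
      where
      full : Fin n → Bool
      full _ = true
      each : ∀ ι → ⟦ isFacet (suc d) f j ι ⟧ ≡ ⟦ at full j ι ⟧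
      each ι = cong₂ (λ x y → ⟦ sized ι ∧ (x ∧ (y ℕ.≡ᵇ j)) ⟧)
        (sym (≡⇒≡ᵇ (cnt-none λ i → Bool.∧-zeroʳ (lookup (Vec.tail ι) i)))) (cnt-cong λ i → sym (Bool.∧-identityʳ (side f ι i)))

    -- The hockey-stick identity, one step of Pascal's rule at a time.
    cumulative-tight : ∀ j → j ℕ.≤ k → cumulative (facetCount (suc d) f) j ≡ r ℕ.* binom j (suc d)
    cumulative-tight zero _ = facetCount-tight 0 ℕ.z≤n
    cumulative-tight (suc j) j<k = trans (cong₂ ℕ._+_ (cumulative-tight j (ℕ.<⇒≤ j<k)) (facetCount-tight (suc j) j<k))
      (trans (ℕ.+-comm (r ℕ.* binom j (suc d)) _) (sym (ℕ.*-distribˡ-+ r (binom (suc j) d) (binom j (suc d)))))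

  -- Assembly.

  sum-applyUpTo : ∀ e k → ListAction.sum (List.applyUpTo e (suc k)) ≡ cumulative e k
  sum-applyUpTo e zero = ℕ.+-identityʳ (e 0)
  sum-applyUpTo e (suc k) = trans (cong (e 0 ℕ.+_) (sum-applyUpTo (e ∘ suc) k)) (head-first e k)
    where
    head-first : ∀ e k → e 0 ℕ.+ cumulative (e ∘ suc) k ≡ cumulative e (suc k)
    head-first e zero = refl
    head-first e (suc k) = trans (sym (ℕ.+-assoc (e 0) (cumulative (e ∘ suc) k) (e (suc (suc k))))) (cong (ℕ._+ e (suc (suc k))) (head-first e k))

  ≤facetTotal : ∀ {n d} (S : PointSet n (suc d)) → GeneralPosition S → suc (suc d) ℕ.≤ n → ℕ → ℕ
  ≤facetTotal {d = d} S gp d<n = cumulative (facetCount (suc d) (Config.f (Rational.config S gp d<n)))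

  count-facets : ∀ {n d} (S : PointSet n (suc d)) (gp : GeneralPosition S) (d<n : suc (suc d) ℕ.≤ n) k →
    NumberOf≤Facets S k (≤facetTotal S gp d<n k)
  count-facets {d = d} S gp d<n k = e , (λ j _ → Facets.cardinality S gp d<n j) , sym (sum-applyUpTo e k)
    where
    e : ℕ → ℕ
    e = facetCount (suc d) (Config.f (Rational.config S gp d<n))

open Counting using (binom≡C)
open Geometry using (lower-bound; ≤facetTotal; count-facets; module Rational; module Tight)
open import Defs using (PointSet; GeneralPosition; NumberOf≤Facets)
open import Data.Nat.Combinatorics using (_C_)
open import Data.Nat using (_+_; _*_; _/_; _≤_; _<_)

theorem11 : (d n k : ℕ) → 1 ≤ d → suc d ≤ n → k < n / suc d →
    ((S : PointSet n d) → GeneralPosition S →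
    ∃ λ N → NumberOf≤Facets S k N × suc d * ((k + d) C d) ≤ N)
    × (Σ (PointSet n d) λ S → GeneralPosition S × NumberOf≤Facets S k (suc d * ((k + d) C d)))
theorem11 (suc d) n k _ d<n k<n/r = lower , tight
  where
  large : suc k * suc (suc d) ≤ n
  large = ℕ.≤-trans (ℕ.*-monoˡ-≤ (suc (suc d)) k<n/r) (m/n*n≤m n (suc (suc d)))
  lower : (S : PointSet n (suc d)) → GeneralPosition S →
    ∃ λ N → NumberOf≤Facets S k N × suc (suc d) * ((k + suc d) C suc d) ≤ N
  lower S gp = ≤facetTotal S gp d<n k , count-facets S gp d<n k ,
    subst (λ z → suc (suc d) * z ≤ ≤facetTotal S gp d<n k) (sym (binom≡C k (suc d))) (lower-bound (suc d) n k (Rational.config S gp d<n) large)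
  tight : Σ (PointSet n (suc d)) λ S → GeneralPosition S × NumberOf≤Facets S k (suc (suc d) * ((k + suc d) C suc d))
  tight = S , S-general , subst (NumberOf≤Facets S k)
    (trans (cumulative-tight k ℕ.≤-refl) (cong (suc (suc d) *_) (sym (binom≡C k (suc d))))) (count-facets S S-general r≤n k)
    where open Tight d n k large using (S; S-general; r≤n; cumulative-tight)
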